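{- There exists a number $n_0$ such that every oriented graph $G$ on $n \ge n_0$ vertices with minimum semi-degree $\delta^0(G) \ge \left\lceil \frac{3n-4}{8} \right\rceil$ contains a (directed) Hamilton cycle.
   Context: An oriented graph is a directed graph obtained from a simple undirected graph by orienting each of its edges (so there are no loops, no multiple edges and no pair of opposite edges $xy, yx$). The minimum semi-degree $\delta^0(G)$ is the minimum of the minimum outdegree $\delta^+(G)$ and the minimum indegree $\delta^-(G)$. A Hamilton cycle is a directed cycle containing every vertex of $G$. -}

module Defs where

open import Data.Nat using (ℕ; suc; _+_; _*_; _∸_; _/_; _≤_)
open import Data.Fin using (Fin)
open import Data.Fin.Subset using (Subset; ∣_∣)
open import Data.Fin.Properties using (any?)
open import Data.Vec using (tabulate)
open import Data.Bool using (Bool)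
open import Data.List using (List; []; _∷_; length)
open import Data.List.Relation.Unary.Unique.Propositional using (Unique)
open import Data.Product using (Σ; _×_; ∃)
open import Data.Unit.Polymorphic using (⊤)
open import Relation.Nullary using (¬_; Dec; does)
open import Relation.Binary.PropositionalEquality using (_≡_)
open import Level using (0ℓ)

record OrientedGraph (n : ℕ) : Set₁ where
  field
    Arc      : Fin n → Fin n → Set
    arc?     : ∀ x y → Dec (Arc x y)
    irrefl   : ∀ x → ¬ Arc x x
    asym     : ∀ x y → Arc x y → ¬ Arc y x

  outNbhd : Fin n → Subset n
  outNbhd x = tabulate (λ y → does (arc? x y))

  inNbhd : Fin n → Subset n
  inNbhd x = tabulate (λ y → does (arc? y x))

  outdeg : Fin n → ℕ
  outdeg x = ∣ outNbhd x ∣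

  indeg : Fin n → ℕ
  indeg x = ∣ inNbhd x ∣

open OrientedGraph public

minSemiDegree≥ : ∀ {n} → OrientedGraph n → ℕ → Set
minSemiDegree≥ {n} G d = (x : Fin n) → (d ≤ outdeg G x) × (d ≤ indeg G x)

data ClosedWalkFrom {n : ℕ} (G : OrientedGraph n) (start : Fin n) : Fin n → List (Fin n) → Set where
  close : ∀ {x} → Arc G x start → ClosedWalkFrom G start x []
  step  : ∀ {x y ys} → Arc G x y → ClosedWalkFrom G start y ys → ClosedWalkFrom G start x (y ∷ ys)

-- A Hamilton cycle: a list of distinct vertices x₀ x₁ … x_{n-1} containing
-- all n vertices (distinct + length n), with arcs xᵢ → xᵢ₊₁ and x_{n-1} → x₀.
HamiltonCycle : ∀ {n} → OrientedGraph n → Set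
HamiltonCycle {n} G =
  Σ (List (Fin n)) λ cyc →
    Unique cyc × length cyc ≡ n ×
    (Σ (Fin n) λ x₀ → Σ (List (Fin n)) λ rest →
       cyc ≡ x₀ ∷ rest × ClosedWalkFrom G x₀ x₀ rest)

-- ⌈(3n-4)/8⌉ (for n ≥ 2, where 3n-4 ≥ 0; truncated subtraction otherwise)
ceil[3n-4]/8 : ℕ → ℕ
ceil[3n-4]/8 n = ((3 * n ∸ 4) + 7) / 8

{-# OPTIONS --safe #-}

-- A vertex is a robust in-neighbour of a set T if it sends many arcs to T. Suppose that every set T that is not
-- tiny has clearly more than |T| robust in-neighbours, or almost all vertices. Regard a permutation of the
-- vertices as a collection of arcs. Removing an arc u → t that is not in G opens a path from t to u; expansion
-- shows that boundedly many rotations, each giving one vertex y a new predecessor, turn the end of this path into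
-- an in-neighbour of t, and the path is closed again with fewer non-arcs. The same procedure removes short cycles,
-- so there is a 1-factor consisting of boundedly many long cycles. These are merged by a path set aside beforehand,
-- a chain of gadgets: a gadget for (b , a) is a path that can also be covered by two paths, one ending at a and one
-- starting at b, hence swallows any cycle with an arc from v to v′ such that v → b and a → v′. By averaging,
-- boundedly many rounds of few gadgets serve all pairs (v , v′) that can occur.
--
-- If a set T fails to expand, counting arcs shows that G is close to the extremal graph: four parts A, B, C, D of
-- about n/4 vertices with almost all arcs A → B → C → D → A and density one half inside A, inside C and between B
-- and D. Let X be D ∪ A and Y be A ∪ B, up to few exceptional vertices. The arcs from X to Y and from the complement
-- of X to the complement of Y form two disjoint bipartite relations between tails and heads, each of them robustly
-- expanding, so the argument above applies if |X| = |Y|. Otherwise, say, |X| = |Y| + e with e > 0, and contracting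
-- e disjoint arcs from X to the complement of Y restores the balance. These arcs exist since the degree bound
-- (3n - 4)/8 forces at least e n / 40 such arcs while every vertex is incident with few of them.
module Submission where

-- Expansion is used relative to a permutation: the layers of `good` alternate a robust step
-- backwards with a passage along the permutation, and each step has so many choices that it can
-- avoid everything used before. The layers are computed once and stay valid during the rotations
-- because no head is moved twice. The obstacle in merging is that the cycles are unknown when the
-- gadgets are placed. So every block has to serve all of about n² pairs, while all blocks together
-- may occupy only a small linear number of vertices. One gadget serves a constant fraction of the
-- pairs still open, so logarithmically many would do; a cubed Bernoulli inequality gives enough
-- without logarithms. In the extremal case a vertex has a tail class and a head class that need not
-- agree, and a Hamilton cycle inside the two relations requires equally many tails and heads in
-- each. The estimates tolerate small linear errors except for the count of crossing arcs, where
-- even the missing loops are counted: there the additive constant of the degree bound is decisive.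

open import Defs
import Algebra.Solver.CommutativeMonoid as CMSolver
import Data.Bool.Base as Bool
open import Data.Bool.Base using (Bool; true; false; if_then_else_; _∧_; not; _∨_; _xor_)
import Data.Bool.Properties as Boolₚ
open import Data.Empty using (⊥; ⊥-elim)
import Data.Fin.Base as Fin
open import Data.Fin.Base using (Fin)
import Data.Fin.Properties as Finₚ
open import Data.Fin.Subset using (∣_∣)
open import Data.Fin.Subset.Properties using (anySubset?)
open import Data.List.Base using (List; []; _∷_; _++_; map; length; concatMap; take; drop; allFin; filterᵇ; cartesianProduct)
import Data.List.Membership.DecPropositional as DecMem
open import Data.List.Membership.Propositional using (_∈_; _∉_)
open import Data.List.Membership.Propositional.Properties using (∈-++⁺ˡ; ∈-++⁺ʳ; ∈-++⁻; ∈-map⁺; ∈-map⁻; ∈-allFin; ∈-∃++; ∈-concat⁺′; ∈-insert; ∈-cartesianProduct⁺; ∈-cartesianProduct⁻)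
import Data.List.Properties as Listₚ
import Data.List.Relation.Binary.Permutation.Propositional as ↭
open import Data.List.Relation.Binary.Permutation.Propositional using (_↭_; ↭-refl; ↭-sym; ↭-trans; ↭-prep; ↭-reflexive; prep; swap)
import Data.List.Relation.Binary.Permutation.Propositional.Properties as ↭ₚ
import Data.List.Relation.Unary.All as All
open import Data.List.Relation.Unary.All using ([]; _∷_)
import Data.List.Relation.Unary.All.Properties as Allₚ
open import Data.List.Relation.Unary.AllPairs using ([]; _∷_)
open import Data.List.Relation.Unary.Any using (here; there)
open import Data.List.Relation.Unary.Unique.Propositional using (Unique)
import Data.List.Relation.Unary.Unique.Propositional.Properties as Uniqueₚ
import Data.Nat.Base as ℕ
open import Data.Nat.Base using (ℕ; zero; suc; _+_; _*_; _≤_; _<_; z≤n; s≤s; _∸_; _≥_; s≤s⁻¹; _^_)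
open import Data.Nat.DivMod using (m≡m%n+[m/n]*n; m%n<n)
import Data.Nat.Properties as ℕₚ
open import Data.Nat.Solver using (module +-*-Solver)
open import Data.Product.Base using (Σ; ∃; _×_; _,_; proj₁; proj₂; ∃₂)
open import Data.Sum.Base using (_⊎_; inj₁; inj₂; [_,_]′)
open import Data.Unit.Base using (⊤; tt)
open import Data.Vec.Base using ([]; _∷_; lookup; tabulate)
open import Data.Vec.Properties using (lookup∘tabulate)
open import Function.Base using (_∘_; id; const)
open import Relation.Binary.PropositionalEquality using (_≡_; _≢_; refl; sym; trans; cong; cong₂; subst; module ≡-Reasoning; subst₂)
open import Relation.Nullary using (¬_; yes; no; Dec; does)
open import Relation.Nullary.Decidable using (dec-true; dec-false; _×-dec_)

-- Certificates for inequalities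

-- Multiplication by a numeral, opaque so that conversion checking never unfolds a large numeral.
infixl 7 _·_
opaque
  _·_ : ℕ → ℕ → ℕ
  k · x = k * x

  ·-def : ∀ k x → k · x ≡ k * x
  ·-def k x = refl

infixl 6 _⊕_
infixl 7 _⊗_ _⊙_
-- Products of variables are allowed: each distinct monomial behaves like a further unknown, so a
-- certificate can combine hypotheses that were multiplied by an unknown beforehand.
data Ex : Set where
  #   : ℕ → Ex
  ξ   : ℕ → Ex
  _⊕_ _⊗_ : Ex → Ex → Ex
  _⊙_ : ℕ → Ex → Ex

look : List ℕ → ℕ → ℕ
look []       _       = 0
look (x ∷ xs) zero    = x
look (x ∷ xs) (suc i) = look xs i

eval : List ℕ → Ex → ℕ
eval ρ (# k)   = k
eval ρ (ξ i)   = look ρ i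
eval ρ (a ⊕ b) = eval ρ a + eval ρ b
eval ρ (a ⊗ b) = eval ρ a * eval ρ b
eval ρ (k ⊙ a) = k · eval ρ a

-- A monomial is the ordered list of its variables, repeated according to their exponents; a
-- polynomial lists coefficients with monomials. A certificate is then checked by `refl` between two
-- normal forms.
Mono Poly : Set
Mono = List ℕ
Poly = List (ℕ × Mono)

-- The order only decides whether two sums arrive at the same normal form; soundness of `addTerm`
-- holds for either answer.
leMono : Mono → Mono → Bool
leMono []       _        = true
leMono (_ ∷ _)  []       = false
leMono (x ∷ xs) (y ∷ ys) = if x ℕ.<ᵇ y then true else (if x ℕ.≡ᵇ y then leMono xs ys else false)

insVar : ℕ → Mono → Mono
insVar x []       = x ∷ []
insVar x (y ∷ ys) = if x ℕ.≤ᵇ y then x ∷ y ∷ ys else y ∷ insVar x ys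

mulMono : Mono → Mono → Mono
mulMono []       m = m
mulMono (x ∷ xs) m = insVar x (mulMono xs m)

addTerm : ℕ → Mono → Poly → Poly
addTerm c m [] = (c , m) ∷ []
addTerm c m ((d , m′) ∷ p) with Listₚ.≡-dec ℕₚ._≟_ m m′
... | yes _ = (c + d , m) ∷ p
... | no  _ = if leMono m m′ then (c , m) ∷ (d , m′) ∷ p else (d , m′) ∷ addTerm c m p

addPoly : Poly → Poly → Poly
addPoly []            q = q
addPoly ((c , m) ∷ p) q = addTerm c m (addPoly p q)

mulTerm : ℕ → Mono → Poly → Poly
mulTerm c m []            = []
mulTerm c m ((d , k) ∷ p) = addTerm (c * d) (mulMono m k) (mulTerm c m p)

mulPoly : Poly → Poly → Poly
mulPoly []            q = []
mulPoly ((c , m) ∷ p) q = addPoly (mulTerm c m q) (mulPoly p q)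

norm : Ex → Poly
norm (# zero)    = []
norm (# (suc k)) = (suc k , []) ∷ []
norm (ξ i)       = (1 , i ∷ []) ∷ []
norm (a ⊕ b)     = addPoly (norm a) (norm b)
norm (a ⊗ b)     = mulPoly (norm a) (norm b)
norm (k ⊙ a)     = mulTerm k [] (norm a)

module _ (ρ : List ℕ) where
  ⟦_⟧ₘ : Mono → ℕ
  ⟦ [] ⟧ₘ     = 1
  ⟦ x ∷ m ⟧ₘ = look ρ x * ⟦ m ⟧ₘ

  ⟦_⟧ₚ : Poly → ℕ
  ⟦ [] ⟧ₚ          = 0
  ⟦ (c , m) ∷ p ⟧ₚ = c * ⟦ m ⟧ₘ + ⟦ p ⟧ₚ

  open +-*-Solver

  insVar-sound : ∀ x m → ⟦ insVar x m ⟧ₘ ≡ look ρ x * ⟦ m ⟧ₘ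
  insVar-sound x []       = refl
  insVar-sound x (y ∷ ys) with x ℕ.≤ᵇ y
  ... | true  = refl
  ... | false = trans (cong (look ρ y *_) (insVar-sound x ys))
                  (solve 3 (λ a b c → a :* (b :* c) := b :* (a :* c)) refl (look ρ y) (look ρ x) ⟦ ys ⟧ₘ)

  mulMono-sound : ∀ m k → ⟦ mulMono m k ⟧ₘ ≡ ⟦ m ⟧ₘ * ⟦ k ⟧ₘ
  mulMono-sound []      k = sym (ℕₚ.+-identityʳ _)
  mulMono-sound (x ∷ m) k = trans (insVar-sound x (mulMono m k))
    (trans (cong (look ρ x *_) (mulMono-sound m k)) (sym (ℕₚ.*-assoc (look ρ x) ⟦ m ⟧ₘ ⟦ k ⟧ₘ)))

  addTerm-sound : ∀ c m p → ⟦ addTerm c m p ⟧ₚ ≡ c * ⟦ m ⟧ₘ + ⟦ p ⟧ₚ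
  addTerm-sound c m [] = refl
  addTerm-sound c m ((d , m′) ∷ p) with Listₚ.≡-dec ℕₚ._≟_ m m′
  ... | yes refl = solve 4 (λ c d m p → (c :+ d) :* m :+ p := c :* m :+ (d :* m :+ p)) refl c d ⟦ m ⟧ₘ ⟦ p ⟧ₚ
  ... | no _ with leMono m m′
  ...   | true  = refl
  ...   | false = trans (cong (d * ⟦ m′ ⟧ₘ +_) (addTerm-sound c m p))
                    (solve 3 (λ a b c → a :+ (b :+ c) := b :+ (a :+ c)) refl (d * ⟦ m′ ⟧ₘ) (c * ⟦ m ⟧ₘ) ⟦ p ⟧ₚ)

  addPoly-sound : ∀ p q → ⟦ addPoly p q ⟧ₚ ≡ ⟦ p ⟧ₚ + ⟦ q ⟧ₚ
  addPoly-sound []            q = refl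
  addPoly-sound ((c , m) ∷ p) q = trans (addTerm-sound c m (addPoly p q))
    (trans (cong (c * ⟦ m ⟧ₘ +_) (addPoly-sound p q)) (sym (ℕₚ.+-assoc (c * ⟦ m ⟧ₘ) ⟦ p ⟧ₚ ⟦ q ⟧ₚ)))

  mulTerm-sound : ∀ c m p → ⟦ mulTerm c m p ⟧ₚ ≡ c * ⟦ m ⟧ₘ * ⟦ p ⟧ₚ
  mulTerm-sound c m []            = sym (ℕₚ.*-zeroʳ (c * ⟦ m ⟧ₘ))
  mulTerm-sound c m ((d , k) ∷ p) = trans (addTerm-sound (c * d) (mulMono m k) (mulTerm c m p))
    (trans (cong₂ (λ s t → c * d * s + t) (mulMono-sound m k) (mulTerm-sound c m p))
      (solve 5 (λ c d m k p → c :* d :* (m :* k) :+ c :* m :* p := c :* m :* (d :* k :+ p)) refl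
        c d ⟦ m ⟧ₘ ⟦ k ⟧ₘ ⟦ p ⟧ₚ))

  mulPoly-sound : ∀ p q → ⟦ mulPoly p q ⟧ₚ ≡ ⟦ p ⟧ₚ * ⟦ q ⟧ₚ
  mulPoly-sound []            q = refl
  mulPoly-sound ((c , m) ∷ p) q = trans (addPoly-sound (mulTerm c m q) (mulPoly p q))
    (trans (cong₂ _+_ (mulTerm-sound c m q) (mulPoly-sound p q))
      (sym (ℕₚ.*-distribʳ-+ ⟦ q ⟧ₚ (c * ⟦ m ⟧ₘ) ⟦ p ⟧ₚ)))

  norm-sound : ∀ e → ⟦ norm e ⟧ₚ ≡ eval ρ e
  norm-sound (# zero)    = refl
  norm-sound (# (suc k)) = solve 1 (λ k → k :* con 1 :+ con 0 := k) refl (suc k)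
  norm-sound (ξ i)       = solve 1 (λ x → con 1 :* (x :* con 1) :+ con 0 := x) refl (look ρ i)
  norm-sound (a ⊕ b)     = trans (addPoly-sound (norm a) (norm b)) (cong₂ _+_ (norm-sound a) (norm-sound b))
  norm-sound (a ⊗ b)     = trans (mulPoly-sound (norm a) (norm b)) (cong₂ _*_ (norm-sound a) (norm-sound b))
  norm-sound (k ⊙ a)     = trans (mulTerm-sound k [] (norm a))
    (trans (cong₂ _*_ (ℕₚ.*-identityʳ k) (norm-sound a)) (sym (·-def k (eval ρ a))))

  norm-≡ : ∀ a b → norm a ≡ norm b → eval ρ a ≡ eval ρ b
  norm-≡ a b eq = trans (sym (norm-sound a)) (trans (cong ⟦_⟧ₚ eq) (norm-sound b))

  Hyps : List (Ex × Ex) → Set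
  Hyps []             = ⊤
  Hyps ((l , r) ∷ hs) = eval ρ l ≤ eval ρ r × Hyps hs

  combine : (Ex × Ex → Ex) → List ℕ → List (Ex × Ex) → Ex
  combine side (c ∷ cs) (h ∷ hs) = c ⊙ side h ⊕ combine side cs hs
  combine side _        _        = # 0

  combine-≤ : ∀ cs hs → Hyps hs → eval ρ (combine proj₁ cs hs) ≤ eval ρ (combine proj₂ cs hs)
  combine-≤ []       hs             p        = z≤n
  combine-≤ (c ∷ cs) []             p        = z≤n
  combine-≤ (c ∷ cs) ((l , r) ∷ hs) (p , ps) = ℕₚ.+-mono-≤
    (ℕₚ.≤-trans (ℕₚ.≤-reflexive (·-def c _))
      (ℕₚ.≤-trans (ℕₚ.*-monoʳ-≤ c p) (ℕₚ.≤-reflexive (sym (·-def c _)))))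
    (combine-≤ cs hs ps)

  -- Farkas-style certificates: the hypotheses l ≤ r with multipliers cs add up to an absurd inequality with slack
  -- e + 1; in lin-≤ the first multiplier belongs to the negated goal.
  lin-⊥′ : ∀ hs (cs : List ℕ) (e : Ex) →
    norm (combine proj₂ cs hs ⊕ (e ⊕ # 1)) ≡ norm (combine proj₁ cs hs) → Hyps hs → ⊥
  lin-⊥′ hs cs e eq p = ℕₚ.<-irrefl refl (begin-strict
    R                 <⟨ ℕₚ.n<1+n R ⟩
    suc R             ≤⟨ s≤s (ℕₚ.m≤m+n R (eval ρ e)) ⟩
    suc (R + eval ρ e) ≡⟨ sym (trans (cong (R +_) (ℕₚ.+-comm (eval ρ e) 1)) (ℕₚ.+-suc R (eval ρ e))) ⟩
    R + (eval ρ e + 1) ≡⟨ norm-≡ (combine proj₂ cs hs ⊕ (e ⊕ # 1)) (combine proj₁ cs hs) eq ⟩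
    eval ρ (combine proj₁ cs hs) ≤⟨ combine-≤ cs hs p ⟩
    R ∎)
    where
    open ℕₚ.≤-Reasoning
    R = eval ρ (combine proj₂ cs hs)

  opaque
    lin-⊥ : ∀ hs (cs : List ℕ) (e : Ex) →
      norm (combine proj₂ cs hs ⊕ (e ⊕ # 1)) ≡ norm (combine proj₁ cs hs) → Hyps hs → ⊥
    lin-⊥ = lin-⊥′

    lin-≤ : ∀ hs l r (cs : List ℕ) (e : Ex) →
      norm (combine proj₂ cs ((# 1 ⊕ r , l) ∷ hs) ⊕ (e ⊕ # 1)) ≡ norm (combine proj₁ cs ((# 1 ⊕ r , l) ∷ hs)) →
      Hyps hs → eval ρ l ≤ eval ρ r
    lin-≤ hs l r cs e eq p = ℕₚ.≮⇒≥ λ r<l → lin-⊥′ ((# 1 ⊕ r , l) ∷ hs) cs e eq (r<l , p)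

-- Counting

b2n : Bool → ℕ
b2n true  = 1
b2n false = 0

b2n≤1 : ∀ b → b2n b ≤ 1
b2n≤1 true  = s≤s z≤n
b2n≤1 false = z≤n

∧-split : ∀ {a b} → a ∧ b ≡ true → a ≡ true × b ≡ true
∧-split {true} {true} _ = refl , refl

∧-join : ∀ {a b} → a ≡ true → b ≡ true → a ∧ b ≡ true
∧-join refl refl = refl

b2n-split : ∀ a b → b2n a ≡ b2n (a ∧ b) + b2n (a ∧ not b)
b2n-split true  true  = refl
b2n-split true  false = refl
b2n-split false b     = refl

b2n-⇒ : ∀ {a b} → (a ≡ true → b ≡ true) → b2n a ≤ b2n b
b2n-⇒ {true}  h rewrite h refl = ℕₚ.≤-refl
b2n-⇒ {false} h = z≤n

b2n-⇒+ : ∀ {a b c} → (a ≡ true → b ≡ true ⊎ c ≡ true) → b2n a ≤ b2n b + b2n c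
b2n-⇒+ {true} {b} {c} h with h refl
... | inj₁ refl = s≤s z≤n
... | inj₂ refl = ℕₚ.m≤n+m 1 (b2n b)
b2n-⇒+ {false} h = z≤n

false≢true : ∀ {b} → b ≡ false → ¬ (b ≡ true)
false≢true refl ()

¬true⇒false : ∀ {b} → ¬ (b ≡ true) → b ≡ false
¬true⇒false {true}  h = ⊥-elim (h refl)
¬true⇒false {false} h = refl

not-true : ∀ {b} → not b ≡ true → b ≡ false
not-true {false} _ = refl

true-or-false : ∀ b → b ≡ true ⊎ b ≡ false
true-or-false true  = inj₁ refl
true-or-false false = inj₂ refl

<ᵇ-true : ∀ {m n} → m < n → (m ℕ.<ᵇ n) ≡ true
<ᵇ-true {m} {n} h with m ℕ.<ᵇ n | ℕₚ.<⇒<ᵇ h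
... | true | _ = refl

<ᵇ-< : ∀ {m n} → (m ℕ.<ᵇ n) ≡ true → m < n
<ᵇ-< {m} {n} h = ℕₚ.<ᵇ⇒< m n (subst Bool.T (sym h) tt)

<ᵇ-false : ∀ {m n} → (m ℕ.<ᵇ n) ≡ false → n ≤ m
<ᵇ-false {m} {n} h = ℕₚ.≮⇒≥ λ m<n → false≢true h (<ᵇ-true m<n)

module _ {A : Set} where
  sumOf : (A → ℕ) → List A → ℕ
  sumOf f []       = 0
  sumOf f (x ∷ xs) = f x + sumOf f xs

  cnt : (A → Bool) → List A → ℕ
  cnt P = sumOf (λ x → b2n (P x))

  sumOf-mono : ∀ {f g : A → ℕ} xs → (∀ {x} → x ∈ xs → f x ≤ g x) → sumOf f xs ≤ sumOf g xs
  sumOf-mono []       h = z≤n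
  sumOf-mono (x ∷ xs) h = ℕₚ.+-mono-≤ (h (here refl)) (sumOf-mono xs (λ p → h (there p)))

  sumOf-cong : ∀ {f g : A → ℕ} xs → (∀ {x} → x ∈ xs → f x ≡ g x) → sumOf f xs ≡ sumOf g xs
  sumOf-cong []       h = refl
  sumOf-cong (x ∷ xs) h = cong₂ _+_ (h (here refl)) (sumOf-cong xs (λ p → h (there p)))

  sumOf-+ : ∀ (f g : A → ℕ) xs → sumOf (λ x → f x + g x) xs ≡ sumOf f xs + sumOf g xs
  sumOf-+ f g []       = refl
  sumOf-+ f g (x ∷ xs) rewrite sumOf-+ f g xs = (norm-≡ (f x ∷ g x ∷ sumOf f xs ∷ sumOf g xs ∷ [])
      ((ξ 0 ⊕ ξ 1) ⊕ (ξ 2 ⊕ ξ 3)) ((ξ 0 ⊕ ξ 2) ⊕ (ξ 1 ⊕ ξ 3)) refl)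

  sumOf-* : ∀ k (f : A → ℕ) xs → sumOf (λ x → k * f x) xs ≡ k * sumOf f xs
  sumOf-* k f []       = sym (ℕₚ.*-zeroʳ k)
  sumOf-* k f (x ∷ xs) rewrite sumOf-* k f xs = sym (ℕₚ.*-distribˡ-+ k (f x) (sumOf f xs))

  sumOf-const : ∀ k (xs : List A) → sumOf (λ _ → k) xs ≡ length xs * k
  sumOf-const k []       = refl
  sumOf-const k (x ∷ xs) = cong (k +_) (sumOf-const k xs)

  sumOf-++ : ∀ (f : A → ℕ) xs ys → sumOf f (xs ++ ys) ≡ sumOf f xs + sumOf f ys
  sumOf-++ f []       ys = refl
  sumOf-++ f (x ∷ xs) ys = trans (cong (f x +_) (sumOf-++ f xs ys)) (sym (ℕₚ.+-assoc (f x) _ _))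

  sumOf-↭ : ∀ (f : A → ℕ) {xs ys} → xs ↭ ys → sumOf f xs ≡ sumOf f ys
  sumOf-↭ f ↭.refl          = refl
  sumOf-↭ f (prep x p)      = cong (f x +_) (sumOf-↭ f p)
  sumOf-↭ f (swap {xs} {ys} x y p) rewrite sumOf-↭ f p = (norm-≡ (f x ∷ f y ∷ sumOf f ys ∷ [])
      (ξ 0 ⊕ (ξ 1 ⊕ ξ 2)) (ξ 1 ⊕ (ξ 0 ⊕ ξ 2)) refl)
  sumOf-↭ f (↭.trans p q)   = trans (sumOf-↭ f p) (sumOf-↭ f q)

  ∃-sumOf-< : ∀ {f g : A → ℕ} xs → sumOf f xs < sumOf g xs → ∃ λ x → x ∈ xs × f x < g x
  ∃-sumOf-< {f} {g} (x ∷ xs) h with f x ℕₚ.<? g x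
  ... | yes q = x , here refl , q
  ... | no q with ∃-sumOf-< {f} {g} xs (ℕₚ.+-cancelˡ-< (g x) _ _ (ℕₚ.≤-<-trans (ℕₚ.+-monoˡ-≤ _ (ℕₚ.≮⇒≥ q)) h))
  ...   | y , y∈ , r = y , there y∈ , r

  ∃-sumOf-≤ : ∀ {f g : A → ℕ} xs → 0 < length xs → sumOf f xs ≤ sumOf g xs → ∃ λ x → x ∈ xs × f x ≤ g x
  ∃-sumOf-≤ {f} {g} xs 0<l h with ∃-sumOf-< {f} {λ x → 1 + g x} xs
    (ℕₚ.≤-<-trans h (ℕₚ.<-≤-trans (ℕₚ.m<n+m (sumOf g xs) 0<l)
      (ℕₚ.≤-reflexive (sym (trans (sumOf-+ (λ _ → 1) g xs)
        (cong (_+ sumOf g xs) (trans (sumOf-const 1 xs) (ℕₚ.*-identityʳ _))))))))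
  ... | x , x∈ , q = x , x∈ , s≤s⁻¹ q

  cnt-mono : ∀ {P Q : A → Bool} xs → (∀ {x} → x ∈ xs → P x ≡ true → Q x ≡ true) → cnt P xs ≤ cnt Q xs
  cnt-mono xs h = sumOf-mono xs (λ p → b2n-⇒ (h p))

  cnt-cong : ∀ {P Q : A → Bool} xs → (∀ {x} → x ∈ xs → P x ≡ Q x) → cnt P xs ≡ cnt Q xs
  cnt-cong xs h = sumOf-cong xs (λ p → cong b2n (h p))

  cnt-cover : ∀ {P Q R : A → Bool} xs → (∀ {x} → x ∈ xs → P x ≡ true → Q x ≡ true ⊎ R x ≡ true) →
    cnt P xs ≤ cnt Q xs + cnt R xs
  cnt-cover xs h = ℕₚ.≤-trans (sumOf-mono xs (λ p → b2n-⇒+ (h p))) (ℕₚ.≤-reflexive (sumOf-+ _ _ xs))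

  cnt-split : ∀ (P Q : A → Bool) xs → cnt P xs ≡ cnt (λ x → P x ∧ Q x) xs + cnt (λ x → P x ∧ not (Q x)) xs
  cnt-split P Q xs = trans (sumOf-cong xs (λ {x} _ → b2n-split (P x) (Q x))) (sumOf-+ _ _ xs)

  cnt-true : ∀ (xs : List A) → cnt (λ _ → true) xs ≡ length xs
  cnt-true xs = trans (sumOf-const 1 xs) (ℕₚ.*-identityʳ _)

  cnt≤length : ∀ (P : A → Bool) xs → cnt P xs ≤ length xs
  cnt≤length P xs = ℕₚ.≤-trans (cnt-mono xs (λ _ _ → refl)) (ℕₚ.≤-reflexive (cnt-true xs))

  cnt-not : ∀ (P : A → Bool) xs → cnt P xs + cnt (λ x → not (P x)) xs ≡ length xs
  cnt-not P xs = trans (sym (cnt-split (λ _ → true) P xs)) (cnt-true xs)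

  cnt-∃ : ∀ {P : A → Bool} xs → 0 < cnt P xs → ∃ λ x → x ∈ xs × P x ≡ true
  cnt-∃ {P} (x ∷ xs) h with P x in eq
  ... | true  = x , here refl , eq
  ... | false with cnt-∃ xs h
  ...   | y , y∈ , q = y , there y∈ , q

  cnt-pos : ∀ {P : A → Bool} {x} xs → x ∈ xs → P x ≡ true → 0 < cnt P xs
  cnt-pos (x ∷ xs) (here refl) q rewrite q = s≤s z≤n
  cnt-pos {P} (y ∷ xs) (there p) q = ℕₚ.<-≤-trans (cnt-pos xs p q) (ℕₚ.m≤n+m _ (b2n (P y)))

  cnt-zero : ∀ {P : A → Bool} xs → (∀ {x} → x ∈ xs → P x ≡ false) → cnt P xs ≡ 0
  cnt-zero []       h = refl
  cnt-zero (x ∷ xs) h rewrite h (here refl) = cnt-zero xs (λ p → h (there p))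

  cnt-↭ : ∀ (P : A → Bool) {xs ys} → xs ↭ ys → cnt P xs ≡ cnt P ys
  cnt-↭ P = sumOf-↭ (λ x → b2n (P x))

  cnt-filter : ∀ (P Q : A → Bool) xs → cnt Q (filterᵇ P xs) ≡ cnt (λ x → P x ∧ Q x) xs
  cnt-filter P Q []       = refl
  cnt-filter P Q (x ∷ xs) with P x
  ... | true  = cong (b2n (Q x) +_) (cnt-filter P Q xs)
  ... | false = cnt-filter P Q xs

  length-filter : ∀ (P : A → Bool) xs → length (filterᵇ P xs) ≡ cnt P xs
  length-filter P []       = refl
  length-filter P (x ∷ xs) with P x
  ... | true  = cong suc (length-filter P xs)
  ... | false = length-filter P xs

  Unique-↭ : ∀ {xs ys : List A} → xs ↭ ys → Unique xs → Unique ys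
  Unique-↭ ↭.refl u = u
  Unique-↭ (prep x p) (x∉ ∷ u) = ↭ₚ.All-resp-↭ p x∉ ∷ Unique-↭ p u
  Unique-↭ (swap x y p) ((x≢y ∷ x∉) ∷ y∉ ∷ u) =
    ((x≢y ∘ sym) ∷ ↭ₚ.All-resp-↭ p y∉) ∷ ↭ₚ.All-resp-↭ p x∉ ∷ Unique-↭ p u
  Unique-↭ (↭.trans p q) u = Unique-↭ q (Unique-↭ p u)

  Unique-++⁻ˡ : ∀ (xs : List A) {ys} → Unique (xs ++ ys) → Unique xs
  Unique-++⁻ˡ []       u = []
  Unique-++⁻ˡ (x ∷ xs) (x∉ ∷ u) = Allₚ.++⁻ˡ xs x∉ ∷ Unique-++⁻ˡ xs u

  Unique-disjoint : ∀ (xs : List A) {ys x} → Unique (xs ++ ys) → x ∈ xs → x ∈ ys → ⊥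
  Unique-disjoint (x ∷ xs) (x∉ ∷ u) (here refl) q = All.lookup (Allₚ.++⁻ʳ xs x∉) q refl
  Unique-disjoint (x ∷ xs) (x∉ ∷ u) (there p) q = Unique-disjoint xs u p q

  Unique-∷ : ∀ {x : A} {xs} → x ∉ xs → Unique xs → Unique (x ∷ xs)
  Unique-∷ {x} x∉ u = All.tabulate (λ {y} y∈ x≡y → x∉ (subst (_∈ _) (sym x≡y) y∈)) ∷ u

module _ {A B : Set} where
  sumOf-map : ∀ (f : B → ℕ) (g : A → B) xs → sumOf f (map g xs) ≡ sumOf (λ x → f (g x)) xs
  sumOf-map f g []       = refl
  sumOf-map f g (x ∷ xs) = cong (f (g x) +_) (sumOf-map f g xs)

  sumOf-swap : ∀ (f : A → B → ℕ) xs ys →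
    sumOf (λ x → sumOf (f x) ys) xs ≡ sumOf (λ y → sumOf (λ x → f x y) xs) ys
  sumOf-swap f []       ys = sym (trans (sumOf-const 0 ys) (ℕₚ.*-zeroʳ (length ys)))
  sumOf-swap f (x ∷ xs) ys = trans (cong (sumOf (f x) ys +_) (sumOf-swap f xs ys))
    (sym (sumOf-+ (f x) (λ y → sumOf (λ x → f x y) xs) ys))

module _ {n : ℕ} where
  private V = Fin n

  infix 4 _==_
  _==_ : V → V → Bool
  x == y = does (x Finₚ.≟ y)

  ==-refl : ∀ x → (x == x) ≡ true
  ==-refl x = dec-true (x Finₚ.≟ x) refl

  ==-≡ : ∀ {x y} → (x == y) ≡ true → x ≡ y
  ==-≡ {x} {y} h with x Finₚ.≟ y
  ... | yes p = p

  ==-≢ : ∀ {x y} → x ≢ y → (x == y) ≡ false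
  ==-≢ {x} {y} h = dec-false (x Finₚ.≟ y) h

  mem : V → List V → Bool
  mem x []       = false
  mem x (y ∷ ys) = (x == y) ∨ mem x ys

  ∈⇒mem : ∀ {x xs} → x ∈ xs → mem x xs ≡ true
  ∈⇒mem {x} (here refl) rewrite ==-refl x = refl
  ∈⇒mem {x} {y ∷ _} (there p) rewrite ∈⇒mem p = Boolₚ.∨-zeroʳ (x == y)

  mem⇒∈ : ∀ {x} xs → mem x xs ≡ true → x ∈ xs
  mem⇒∈ {x} (y ∷ ys) h with x Finₚ.≟ y
  ... | yes refl = here refl
  ... | no _     = there (mem⇒∈ ys h)

  ∉⇒mem : ∀ {x xs} → x ∉ xs → mem x xs ≡ false
  ∉⇒mem {x} {xs} h = ¬true⇒false (λ q → h (mem⇒∈ xs q))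

  mem⇒∉ : ∀ {x xs} → mem x xs ≡ false → x ∉ xs
  mem⇒∉ h p = false≢true h (∈⇒mem p)

  _∈?_ : ∀ (x : V) xs → Dec (x ∈ xs)
  x ∈? xs = DecMem._∈?_ Finₚ._≟_ x xs

  cnt-== : ∀ x (vs : List V) → Unique vs → cnt (_== x) vs ≤ 1
  cnt-== x []       u = z≤n
  cnt-== x (y ∷ vs) (y∉ ∷ u) with y Finₚ.≟ x
  ... | no _     = cnt-== x vs u
  ... | yes refl = s≤s (ℕₚ.≤-reflexive (cnt-zero vs (λ p → ==-≢ (λ q → All.lookup y∉ p (sym q)))))

  cnt-mem : ∀ F (vs : List V) → Unique vs → cnt (λ x → mem x F) vs ≤ length F
  cnt-mem []      vs u = ℕₚ.≤-reflexive (cnt-zero vs (λ _ → refl))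
  cnt-mem (y ∷ F) vs u = ℕₚ.≤-trans
    (cnt-cover {Q = _== y} {R = λ x → mem x F} vs λ {x} _ h → ∨-case (x == y) h)
    (ℕₚ.+-mono-≤ (cnt-== y vs u) (cnt-mem F vs u))
    where
    ∨-case : ∀ a {b} → a ∨ b ≡ true → a ≡ true ⊎ b ≡ true
    ∨-case true  h = inj₁ refl
    ∨-case false h = inj₂ h

  cnt-avoid : ∀ (P : V → Bool) F (vs : List V) → Unique vs →
    cnt P vs ≤ cnt (λ x → P x ∧ not (mem x F)) vs + length F
  cnt-avoid P F vs u = ℕₚ.≤-trans (ℕₚ.≤-reflexive (cnt-split P (λ x → not (mem x F)) vs))
    (ℕₚ.+-monoʳ-≤ _ (ℕₚ.≤-trans (cnt-mono vs (λ {x} _ h → trans (sym (Boolₚ.not-involutive (mem x F))) (proj₂ (∧-split {P x} h)))) (cnt-mem F vs u)))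

  opaque
    -- The common form of the greedy choices below: more candidates than forbidden vertices.
    pick : ∀ (P : V → Bool) F (vs : List V) → Unique vs → length F < cnt P vs →
      ∃ λ x → x ∈ vs × P x ≡ true × x ∉ F
    pick P F vs u h with cnt-∃ {P = λ x → P x ∧ not (mem x F)} vs
        (ℕₚ.+-cancelʳ-< (length F) 0 _ (ℕₚ.<-≤-trans h (cnt-avoid P F vs u)))
    ... | x , x∈ , q with ∧-split {P x} q
    ...   | p , r = x , x∈ , p , mem⇒∉ (not-true r)

-- Paths and cycles as lists

module ↭-Solver {A : Set} where
  open CMSolver (↭ₚ.++-commutativeMonoid {A = A}) public using (solve; _⊜_) renaming (_⊕_ to _⊞_)

-- A cycle is a nonempty list. A single vertex counts as a cycle whose only arc is a loop, so that a
-- family of disjoint cycles is the same as a permutation.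
Cyc : Set → Set
Cyc A = A × List A

module _ {A : Set} where
  lastOf : A → List A → A
  lastOf t []       = t
  lastOf t (x ∷ xs) = lastOf x xs

  pairs : A → List A → List (A × A)
  pairs t []       = []
  pairs t (x ∷ xs) = (t , x) ∷ pairs x xs

  cycArcs : Cyc A → List (A × A)
  cycArcs (x , xs) = (lastOf x xs , x) ∷ pairs x xs

  verts : Cyc A → List A
  verts (x , xs) = x ∷ xs

  lastOf-++ : ∀ t xs y ys → lastOf t (xs ++ y ∷ ys) ≡ lastOf y ys
  lastOf-++ t []       y ys = refl
  lastOf-++ t (x ∷ xs) y ys = lastOf-++ x xs y ys

  pairs-++ : ∀ t xs y ys → pairs t (xs ++ y ∷ ys) ≡ pairs t xs ++ (lastOf t xs , y) ∷ pairs y ys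
  pairs-++ t []       y ys = refl
  pairs-++ t (x ∷ xs) y ys = cong ((t , x) ∷_) (pairs-++ x xs y ys)

  lastOf-∈ : ∀ t (xs : List A) → lastOf t xs ∈ t ∷ xs
  lastOf-∈ t []       = here refl
  lastOf-∈ t (x ∷ xs) = there (lastOf-∈ x xs)

  rotate-arcs : ∀ x as y bs → cycArcs (x , as ++ y ∷ bs) ↭ cycArcs (y , bs ++ x ∷ as)
  rotate-arcs x as y bs
    rewrite lastOf-++ x as y bs | lastOf-++ y bs x as | pairs-++ x as y bs | pairs-++ y bs x as =
    solve 4 (λ p a q b → (p ⊞ (a ⊞ (q ⊞ b))) ⊜ (q ⊞ (b ⊞ (p ⊞ a)))) ↭-refl
      ((lastOf y bs , x) ∷ []) (pairs x as) ((lastOf x as , y) ∷ []) (pairs y bs)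
    where open ↭-Solver

  pairs-fst : ∀ t xs → map proj₁ (pairs t xs) ++ lastOf t xs ∷ [] ≡ t ∷ xs
  pairs-fst t []       = refl
  pairs-fst t (x ∷ xs) = cong (t ∷_) (pairs-fst x xs)

  pairs-snd : ∀ t xs → map proj₂ (pairs t xs) ≡ xs
  pairs-snd t []       = refl
  pairs-snd t (x ∷ xs) = cong (x ∷_) (pairs-snd x xs)

  allVerts : List (Cyc A) → List A
  allVerts = concatMap verts

  allArcs : List (Cyc A) → List (A × A)
  allArcs = concatMap cycArcs

  cycArcs-fst : ∀ c → map proj₁ (cycArcs c) ↭ verts c
  cycArcs-fst (x , xs) = ↭-trans (↭ₚ.∷↭∷ʳ _ _) (↭-reflexive (pairs-fst x xs))

  cycArcs-snd : ∀ c → map proj₂ (cycArcs c) ≡ verts c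
  cycArcs-snd (x , xs) = cong (x ∷_) (pairs-snd x xs)

  allArcs-fst : ∀ cs → map proj₁ (allArcs cs) ↭ allVerts cs
  allArcs-fst []       = ↭-refl
  allArcs-fst (c ∷ cs) = ↭-trans (↭-reflexive (Listₚ.map-++ proj₁ (cycArcs c) (allArcs cs)))
    (↭ₚ.++⁺ (cycArcs-fst c) (allArcs-fst cs))

  allArcs-snd : ∀ cs → map proj₂ (allArcs cs) ≡ allVerts cs
  allArcs-snd []       = refl
  allArcs-snd (c ∷ cs) = trans (Listₚ.map-++ proj₂ (cycArcs c) (allArcs cs))
    (cong₂ _++_ (cycArcs-snd c) (allArcs-snd cs))

module _ {A B : Set} where
  concatMap-mid : ∀ (f : A → List B) xs x ys → concatMap f (xs ++ x ∷ ys) ↭ f x ++ concatMap f (xs ++ ys)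
  concatMap-mid f xs x ys rewrite Listₚ.concatMap-++ f xs (x ∷ ys) | Listₚ.concatMap-++ f xs ys =
    ↭ₚ.shifts (concatMap f xs) (f x)

module _ {A : Set} where
  -- A permutation with one arc taken out, namely the one from `lastOf t ps` to `t`: what remains is
  -- a path and a family of cycles.
  openArcs : A → List A → List (Cyc A) → List (A × A)
  openArcs t ps cs = pairs t ps ++ allArcs cs

  openVerts : A → List A → List (Cyc A) → List A
  openVerts t ps cs = (t ∷ ps) ++ allVerts cs

  shortᵇ : ℕ → Cyc A → Bool
  shortᵇ L (x , xs) = length xs ℕ.<ᵇ L

  -- The path is counted as if it were already closed, so opening and closing a cycle leave the
  -- number unchanged.
  shorts : ℕ → A → List A → List (Cyc A) → ℕ
  shorts L t ps cs = b2n (shortᵇ L (t , ps)) + cnt (shortᵇ L) cs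

  take-∉ : ∀ L (xs : List A) y ys → y ∉ take L (xs ++ y ∷ ys) → L ≤ length xs
  take-∉ zero    xs       y ys h = z≤n
  take-∉ (suc L) []       y ys h = ⊥-elim (h (here refl))
  take-∉ (suc L) (x ∷ xs) y ys h = s≤s (take-∉ L xs y ys (h ∘ there))

  drop-∉ : ∀ m (xs : List A) y ys → y ∉ drop m (xs ++ y ∷ ys) → length xs < m
  drop-∉ zero    xs       y ys h = ⊥-elim (h (∈-insert xs))
  drop-∉ (suc m) []       y ys h = s≤s z≤n
  drop-∉ (suc m) (x ∷ xs) y ys h = s≤s (drop-∉ m xs y ys h)

  -- The first and last L entries: a rotation that avoids them splits off only long pieces.
  ends : ℕ → List A → List A
  ends L ps = take L ps ++ drop (length ps ∸ L) ps

  length-ends : ∀ L ps → length (ends L ps) ≤ L + L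
  length-ends L ps rewrite Listₚ.length-++ (take L ps) {drop (length ps ∸ L) ps}
                         | Listₚ.length-take L ps | Listₚ.length-drop (length ps ∸ L) ps =
    ℕₚ.+-mono-≤ (ℕₚ.m⊓n≤m L (length ps)) (ℕₚ.m≤n+o⇒m∸n≤o (length ps) (length ps ∸ L)
      (ℕₚ.≤-trans (ℕₚ.m≤n+m∸n (length ps) L) (ℕₚ.≤-reflexive (ℕₚ.+-comm L _))))

  ends-long : ∀ L (xs : List A) y ys → y ∉ ends L (xs ++ y ∷ ys) → L ≤ length xs × L ≤ length ys
  ends-long L xs y ys h = take-∉ L xs y ys (h ∘ ∈-++⁺ˡ) , ℕₚ.≮⇒≥ λ p →
    ℕₚ.<⇒≱ (drop-∉ _ xs y ys (h ∘ ∈-++⁺ʳ (take L (xs ++ y ∷ ys))))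
      (ℕₚ.m≤n+o⇒m∸n≤o _ L
        (ℕₚ.≤-trans (ℕₚ.≤-reflexive (trans (Listₚ.length-++ xs) (trans (ℕₚ.+-suc _ _) (ℕₚ.+-comm (suc (length xs)) (length ys)))))
          (ℕₚ.≤-trans (ℕₚ.≤-reflexive (ℕₚ.+-suc (length ys) (length xs))) (ℕₚ.+-monoˡ-≤ (length xs) p))))

  -- One rotation step: the path t ∷ ps is continued at y, which is taken away from its predecessor w.
  record Move (t : A) (ps : List A) (cs : List (Cyc A)) (y : A) : Set where
    field
      ps′    : List A
      cs′    : List (Cyc A)
      rest   : List (A × A)
      verts≈ : openVerts t ps′ cs′ ↭ openVerts t ps cs
      old≈   : openArcs t ps cs ↭ (lastOf t ps′ , y) ∷ rest
      new≈   : openArcs t ps′ cs′ ↭ (lastOf t ps , y) ∷ rest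
      short≤ : ∀ L → y ∉ ends L ps → shorts L t ps′ cs′ ≤ shorts L t ps cs
      short< : ∀ L → y ∉ ends L ps → length ps < L → shorts L t ps′ cs′ < shorts L t ps cs

  private
    <ᵇ-long : ∀ {m L} → L ≤ m → (m ℕ.<ᵇ L) ≡ false
    <ᵇ-long {m} {L} h = ¬true⇒false λ q → ℕₚ.<⇒≱ (<ᵇ-< {m} {L} q) h

    ifS : ℕ → ℕ → ℕ
    ifS L m = b2n (m ℕ.<ᵇ L)

    ifS-mono : ∀ L {m k} → k ≤ m → ifS L m ≤ ifS L k
    ifS-mono L {m} {k} h = b2n-⇒ {m ℕ.<ᵇ L} λ q → <ᵇ-true {k} {L} (ℕₚ.≤-<-trans h (<ᵇ-< {m} {L} q))

  -- If `y` lies on the path, the part from `y` on closes up through the new arc into a cycle of its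
  -- own, and the path now ends at the predecessor of `y`.
  move-path : ∀ t xs y ys cs → Move t (xs ++ y ∷ ys) cs y
  move-path t xs y ys cs = record
    { ps′ = xs
    ; cs′ = (y , ys) ∷ cs
    ; rest = pairs t xs ++ pairs y ys ++ allArcs cs
    ; verts≈ = ↭-reflexive (cong (t ∷_) (sym (Listₚ.++-assoc xs (y ∷ ys) (allVerts cs))))
    ; old≈ = ↭-trans (↭-reflexive (cong (_++ allArcs cs) (pairs-++ t xs y ys)))
        (solve 4 (λ a w b c → ((a ⊞ (w ⊞ b)) ⊞ c) ⊜ (w ⊞ (a ⊞ (b ⊞ c)))) ↭-refl
          (pairs t xs) ((lastOf t xs , y) ∷ []) (pairs y ys) (allArcs cs))
    ; new≈ = ↭-trans (↭-reflexive (cong (λ u → pairs t xs ++ (u , y) ∷ pairs y ys ++ allArcs cs) (sym (lastOf-++ t xs y ys))))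
        (solve 4 (λ a w b c → (a ⊞ (w ⊞ (b ⊞ c))) ⊜ (w ⊞ (a ⊞ (b ⊞ c)))) ↭-refl
          (pairs t xs) ((lastOf t (xs ++ y ∷ ys) , y) ∷ []) (pairs y ys) (allArcs cs))
    ; short≤ = λ L h → let (p , q) = ends-long L xs y ys h in
        ℕₚ.≤-trans (ℕₚ.≤-reflexive (cong₂ (λ a b → b2n a + (b2n b + cnt (shortᵇ L) cs))
          (<ᵇ-long {length xs} {L} p) (<ᵇ-long {length ys} {L} q)))
          (ℕₚ.m≤n+m _ _)
    -- A path with fewer than `L` vertices after `t` is contained in its own `ends`, so `y` cannot
    -- lie on it.
    ; short< = λ L h l → let (p , q) = ends-long L xs y ys h in
        ⊥-elim (ℕₚ.<⇒≱ l (ℕₚ.≤-trans p (ℕₚ.≤-trans (ℕₚ.m≤m+n _ _) (ℕₚ.≤-reflexive (sym (Listₚ.length-++ xs))))))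
    }
    where open ↭-Solver

  -- If `y` lies on a cycle, the path is continued once around it and stops at the predecessor of
  -- `y`; the hypotheses present the cycle with `y` as its first vertex.
  move-cyc : ∀ t ps as c bs y ys → cycArcs c ↭ cycArcs (y , ys) → verts c ↭ y ∷ ys →
    length (proj₂ c) ≡ length ys → Move t ps (as ++ c ∷ bs) y
  move-cyc t ps as c bs y ys ae ve le = record
    { ps′ = ps ++ y ∷ ys
    ; cs′ = as ++ bs
    ; rest = pairs t ps ++ pairs y ys ++ allArcs (as ++ bs)
    ; verts≈ = ↭-prep t (↭-trans (↭-reflexive (Listₚ.++-assoc ps (y ∷ ys) _))
        (↭ₚ.++⁺ˡ ps (↭-trans (↭ₚ.++⁺ʳ _ (↭-sym ve)) (↭-sym (concatMap-mid verts as c bs)))))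
    ; old≈ = ↭-trans (↭ₚ.++⁺ˡ (pairs t ps) (↭-trans (concatMap-mid cycArcs as c bs) (↭ₚ.++⁺ʳ _ ae)))
        (↭-trans (solve 4 (λ a w b c → (a ⊞ ((w ⊞ b) ⊞ c)) ⊜ (w ⊞ (a ⊞ (b ⊞ c)))) ↭-refl
          (pairs t ps) ((lastOf y ys , y) ∷ []) (pairs y ys) (allArcs (as ++ bs)))
          (↭-reflexive (cong (λ u → (u , y) ∷ pairs t ps ++ pairs y ys ++ allArcs (as ++ bs)) (sym (lastOf-++ t ps y ys)))))
    ; new≈ = ↭-trans (↭-reflexive (cong (_++ allArcs (as ++ bs)) (pairs-++ t ps y ys)))
        (solve 4 (λ a w b c → ((a ⊞ (w ⊞ b)) ⊞ c) ⊜ (w ⊞ (a ⊞ (b ⊞ c)))) ↭-refl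
          (pairs t ps) ((lastOf t ps , y) ∷ []) (pairs y ys) (allArcs (as ++ bs)))
    ; short≤ = λ L _ → ℕₚ.≤-trans (bound L) (ℕₚ.m≤n+m _ (ifS L (length ps)))
    ; short< = λ L _ l → ℕₚ.≤-trans (s≤s (bound L)) (ℕₚ.≤-reflexive (cong (λ b → b2n b + cnt (shortᵇ L) (as ++ c ∷ bs)) (sym (<ᵇ-true l))))
    }
    where
    open ↭-Solver
    bound : ∀ L → shorts L t (ps ++ y ∷ ys) (as ++ bs) ≤ cnt (shortᵇ L) (as ++ c ∷ bs)
    bound L = ℕₚ.≤-trans (ℕₚ.+-monoˡ-≤ _ (ifS-mono L {length (ps ++ y ∷ ys)} {length (proj₂ c)}
        (ℕₚ.≤-trans (ℕₚ.≤-reflexive le) (ℕₚ.≤-trans (ℕₚ.n≤1+n _)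
          (ℕₚ.≤-trans (ℕₚ.m≤n+m _ (length ps)) (ℕₚ.≤-reflexive (sym (Listₚ.length-++ ps))))))))
      (ℕₚ.≤-reflexive (sym (cnt-↭ (shortᵇ L) (↭ₚ.shift c as bs))))

  ∈-concatMap⁻ : ∀ {y : A} (cs : List (Cyc A)) → y ∈ allVerts cs → ∃ λ (c : Cyc A) → c ∈ cs × y ∈ verts c
  ∈-concatMap⁻ (c ∷ cs) p with ∈-++⁻ (verts c) p
  ... | inj₁ q = c , here refl , q
  ... | inj₂ q with ∈-concatMap⁻ cs q
  ...   | d , d∈ , r = d , there d∈ , r

  move′ : ∀ t ps cs y → y ∈ openVerts t ps cs → y ≢ t → Move t ps cs y
  move′ t ps cs y (here y≡t) y≢t = ⊥-elim (y≢t y≡t)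
  move′ t ps cs y (there p) y≢t with ∈-++⁻ ps p
  ... | inj₁ q with ∈-∃++ q
  ...   | xs , ys , refl = move-path t xs y ys cs
  move′ t ps cs y (there p) y≢t | inj₂ q with ∈-concatMap⁻ cs q
  ... | c , c∈ , y∈ with ∈-∃++ c∈
  ...   | as , bs , refl with c | y∈
  ...     | (x , xs) | here refl = move-cyc t ps as (x , xs) bs x xs ↭-refl ↭-refl refl
  ...     | (x , xs) | there r with ∈-∃++ r
  ...       | xs₁ , xs₂ , refl = move-cyc t ps as (x , xs₁ ++ y ∷ xs₂) bs y (xs₂ ++ x ∷ xs₁)
              (rotate-arcs x xs₁ y xs₂)
              (solve 4 (λ x a y b → (x ⊞ (a ⊞ (y ⊞ b))) ⊜ (y ⊞ (b ⊞ (x ⊞ a)))) ↭-refl (x ∷ []) xs₁ (y ∷ []) xs₂)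
              (trans (Listₚ.length-++ xs₁) (trans (ℕₚ.+-suc _ _) (trans (cong suc (ℕₚ.+-comm (length xs₁) _))
                (trans (sym (ℕₚ.+-suc _ _)) (sym (Listₚ.length-++ xs₂))))))
            where open ↭-Solver

  opaque
    move : ∀ t ps cs y → y ∈ openVerts t ps cs → y ≢ t → Move t ps cs y
    move = move′

-- Robust expansion

inC : Bool → Bool → Bool
inC true  b = b
inC false b = not b

inC-≡ : ∀ c {b} → inC c b ≡ true → b ≡ c
inC-≡ true  h = h
inC-≡ false h = not-true h

inC-refl : ∀ c → inC c c ≡ true
inC-refl true  = refl
inC-refl false = refl

module _ {n : ℕ} where
  private V = Fin n

  -- Vertices carry an out-class ko and an in-class ki, and arcs join equal classes, so the relation is
  -- a union of two bipartite graphs between out-copies and in-copies.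
  record Robust (vs : List V) (E : V → V → Bool) (ko ki : V → Bool) (d f h g : ℕ) : Set where
    field
      uniq    : Unique vs
      pure    : ∀ {x y} → E x y ≡ true → ko x ≡ ki y
      bal     : cnt ko vs ≡ cnt ki vs
      deg-in  : ∀ {t} → t ∈ vs → d ≤ cnt (λ w → E w t) vs
      deg-out : ∀ {u} → u ∈ vs → d ≤ cnt (E u) vs
      -- Here `f` is the number of arcs that makes an in-neighbour robust and `h` the guaranteed
      -- gain. The number `g` serves twice: smaller sets are exempt, and fewer than `g` vertices of
      -- the class may stay unreached.
      expand  : ∀ c (T : V → Bool) → (∀ {y} → T y ≡ true → ki y ≡ c) → g ≤ cnt T vs →
        let N = cnt (λ w → f ℕ.<ᵇ cnt (λ y → E w y ∧ T y) vs) vs in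
        cnt T vs + h ≤ N ⊎ cnt (λ w → inC c (ko w)) vs < N + g

    bal-class : ∀ c → cnt (λ w → inC c (ko w)) vs ≡ cnt (λ w → inC c (ki w)) vs
    bal-class true  = bal
    bal-class false = ℕₚ.+-cancelˡ-≡ (cnt ko vs) _ _ (trans (cnt-not ko vs)
      (trans (sym (cnt-not ki vs)) (cong (_+ cnt (λ w → not (ki w)) vs) (sym bal))))

  -- When `as` is a permutation, this is the image of `P` under its successor map.
  pr : List (V × V) → (V → Bool) → V → Bool
  pr []             P y = false
  pr ((w , z) ∷ as) P y = ((y == z) ∧ P w) ∨ pr as P y

  pr-∃ : ∀ as {P y} → pr as P y ≡ true → ∃ λ w → (w , y) ∈ as × P w ≡ true
  pr-∃ ((w , z) ∷ as) {P} {y} h with (y == z) ∧ P w in eq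
  ... | true with ∧-split {y == z} eq
  ...   | p , q with ==-≡ {x = y} p
  ...     | refl = w , here refl , q
  pr-∃ ((w , z) ∷ as) {P} {y} h | false with pr-∃ as h
  ... | w′ , p , q = w′ , there p , q

  pr-intro : ∀ {as P w y} → (w , y) ∈ as → P w ≡ true → pr as P y ≡ true
  pr-intro {_} {P} {w} {y} (here refl) q rewrite ==-refl y | q = refl
  pr-intro {(w′ , z) ∷ as} {P} {w} {y} (there p) q rewrite pr-intro {as} {P} p q = Boolₚ.∨-zeroʳ _

  cnt-pr : ∀ as {vs : List V} P → map proj₁ as ↭ vs → map proj₂ as ↭ vs → cnt P vs ≤ cnt (pr as P) vs
  cnt-pr as {vs} P p q = begin
    cnt P vs                    ≡⟨ cnt-↭ P (↭-sym p) ⟩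
    cnt P (map proj₁ as)        ≡⟨ sumOf-map _ proj₁ as ⟩
    cnt (P ∘ proj₁) as          ≤⟨ cnt-mono as (λ m → pr-intro m) ⟩
    cnt (pr as P ∘ proj₂) as    ≡⟨ sumOf-map _ proj₂ as ⟨
    cnt (pr as P) (map proj₂ as) ≡⟨ cnt-↭ (pr as P) q ⟩
    cnt (pr as P) vs            ∎
    where open ℕₚ.≤-Reasoning

  record Factor (vs : List V) (ko ki : V → Bool) (as : List (V × V)) : Set where
    field
      fsts : map proj₁ as ↭ vs
      snds : map proj₂ as ↭ vs
      apure : ∀ {w y} → (w , y) ∈ as → ko w ≡ ki y

    fst-∈ : ∀ {w y} → (w , y) ∈ as → w ∈ vs
    fst-∈ p = ↭ₚ.∈-resp-↭ fsts (∈-map⁺ proj₁ p)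

    snd-∈ : ∀ {w y} → (w , y) ∈ as → y ∈ vs
    snd-∈ p = ↭ₚ.∈-resp-↭ snds (∈-map⁺ proj₂ p)

  module Layers {vs : List V} {E : V → V → Bool} {ko ki : V → Bool} {d f h g : ℕ}
                (R : Robust vs E ko ki d f h g) {as : List (V × V)} (F : Factor vs ko ki as)
                (0<g : 0 < g) (gf<d : g + f < d) where
    open Robust R
    open Factor F

    -- From w, the in-vertex t is reached by j robust steps w → y, w := predecessor of y, and an arc w → t.
    good : V → ℕ → V → Bool
    good t zero    w = E w t
    good t (suc j) w = f ℕ.<ᵇ cnt (λ y → E w y ∧ pr as (good t j) y) vs

    good-class : ∀ t j {w} → good t j w ≡ true → ko w ≡ ki t
    pr-class : ∀ t j {y} → pr as (good t j) y ≡ true → ki y ≡ ki t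
    good-class t zero    p = pure p
    good-class t (suc j) {w} p with cnt-∃ {P = λ y → E w y ∧ pr as (good t j) y} vs (ℕₚ.≤-<-trans z≤n (<ᵇ-< {f} p))
    ... | y , _ , q with ∧-split {E w y} q
    ...   | e , r = trans (pure e) (pr-class t j r)
    pr-class t j p with pr-∃ as p
    ... | w , m , q = trans (sym (apure m)) (good-class t j q)

    -- The more than `g + f` out-neighbours of `u` lie in the right class by purity, and fewer than
    -- `g` vertices of that class are missed by the successor image of layer `j`; more than `f`
    -- remain.
    saturated : ∀ t j → t ∈ vs → cnt (λ w → inC (ki t) (ko w)) vs < cnt (good t j) vs + g →
      ∀ {u} → u ∈ vs → ko u ≡ ki t → good t (suc j) u ≡ true
    saturated t j t∈ s {u} u∈ ku = <ᵇ-true {f} {cnt (λ y → E u y ∧ pr as (good t j) y) vs} (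
        lin-≤ (d ∷ cnt (E u) vs ∷ cnt (λ y → E u y ∧ T y) vs ∷ cnt (λ y → E u y ∧ not (T y)) vs ∷
          cnt (λ y → I y ∧ not (T y)) vs ∷ cnt I vs ∷ cnt (λ y → I y ∧ T y) vs ∷ cnt T vs ∷ cnt (good t j) vs ∷
          cnt (λ w → inC (ki t) (ko w)) vs ∷ g ∷ f ∷ [])
          ((ξ 0 , ξ 1) ∷ (ξ 1 , ξ 2 ⊕ ξ 3) ∷ (ξ 3 , ξ 4) ∷ (ξ 6 ⊕ ξ 4 , ξ 5) ∷ (ξ 7 , ξ 6) ∷ (ξ 8 , ξ 7) ∷
           (# 1 ⊕ ξ 9 , ξ 8 ⊕ ξ 10) ∷ (ξ 5 , ξ 9) ∷ (# 1 ⊕ (ξ 10 ⊕ ξ 11) , ξ 0) ∷ [])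
          (# 1 ⊕ ξ 11) (ξ 2) (1 ∷ 1 ∷ 1 ∷ 1 ∷ 1 ∷ 1 ∷ 1 ∷ 1 ∷ 1 ∷ 1 ∷ []) (# 1) refl
          (deg-out u∈ , ℕₚ.≤-reflexive e1 , e2 , ℕₚ.≤-reflexive (sym e3) , e4 , e5 , s ,
           ℕₚ.≤-reflexive (sym (bal-class (ki t))) , gf<d , tt))
      where
      T = pr as (good t j)
      I = λ w → inC (ki t) (ki w)
      T⊂I : ∀ {y} → T y ≡ true → I y ≡ true
      T⊂I p rewrite pr-class t j p = inC-refl (ki t)
      e1 : cnt (E u) vs ≡ cnt (λ y → E u y ∧ T y) vs + cnt (λ y → E u y ∧ not (T y)) vs
      e1 = cnt-split (E u) T vs
      e2 : cnt (λ y → E u y ∧ not (T y)) vs ≤ cnt (λ y → I y ∧ not (T y)) vs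
      e2 = cnt-mono vs λ {y} _ p → let (a , b) = ∧-split {E u y} p in
        ∧-join (subst (λ z → inC (ki t) z ≡ true) (trans (sym ku) (pure a)) (inC-refl (ki t))) b
      e3 : cnt I vs ≡ cnt (λ y → I y ∧ T y) vs + cnt (λ y → I y ∧ not (T y)) vs
      e3 = cnt-split I T vs
      e4 : cnt T vs ≤ cnt (λ y → I y ∧ T y) vs
      e4 = cnt-mono vs λ _ p → ∧-join (T⊂I p) p
      e5 : cnt (good t j) vs ≤ cnt T vs
      e5 = cnt-pr as (good t j) fsts snds

    -- The successor map does not shrink a layer, so `expand` adds `h` at every step until the layer
    -- nearly fills its class; from then on `saturated` keeps it full.
    growth : ∀ t j → t ∈ vs → g + j * h ≤ cnt (good t j) vs ⊎ cnt (λ w → inC (ki t) (ko w)) vs < cnt (good t j) vs + g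
    growth t zero t∈ = inj₁ (lin-≤ (d ∷ cnt (λ w → E w t) vs ∷ g ∷ f ∷ h ∷ [])
          ((ξ 0 , ξ 1) ∷ (# 1 ⊕ (ξ 2 ⊕ ξ 3) , ξ 0) ∷ [])
          (ξ 2 ⊕ (# 0 ⊗ ξ 4)) (ξ 1) (1 ∷ 1 ∷ 1 ∷ []) (ξ 3 ⊕ # 1) refl (deg-in t∈ , gf<d , tt))
    growth t (suc j) t∈ with growth t j t∈
    ... | inj₂ s = inj₂ (ℕₚ.≤-<-trans (cnt-mono vs (λ u∈ p → saturated t j t∈ s u∈ (inC-≡ (ki t) p))) (ℕₚ.m<m+n _ 0<g))
    ... | inj₁ s with expand (ki t) (pr as (good t j)) (pr-class t j)
                    (ℕₚ.≤-trans (ℕₚ.m≤m+n g (j * h)) (ℕₚ.≤-trans s (cnt-pr as (good t j) fsts snds)))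
    ...   | inj₂ q = inj₂ q
    ...   | inj₁ q = inj₁ (lin-≤ (g ∷ j ∷ h ∷ sumOf (λ x → b2n (good t j x)) vs ∷ cnt (pr as (good t j)) vs ∷
          sumOf (λ x → b2n (f ℕ.<ᵇ sumOf (λ x₁ → b2n (E x x₁ ∧ pr as (good t j) x₁)) vs)) vs ∷ [])
          ((ξ 0 ⊕ (ξ 1 ⊗ ξ 2) , ξ 3) ∷ (ξ 3 , ξ 4) ∷ (ξ 4 ⊕ ξ 2 , ξ 5) ∷ [])
          (ξ 0 ⊕ (ξ 2 ⊕ (ξ 1 ⊗ ξ 2))) (ξ 5) (1 ∷ 1 ∷ 1 ∷ 1 ∷ []) (# 0) refl
          (s , cnt-pr as (good t j) fsts snds , q , tt))

    -- A layer has at most `length vs` elements, so the growth has stopped by step `J`, and one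
    -- further step takes in the whole class. Having this for all later steps too leaves the parity
    -- of their number free.
    layers′ : ∀ {J} → length vs < g + J * h → ∀ {t} → t ∈ vs → ∀ j {u} → J ≤ j → u ∈ vs → ko u ≡ ki t → good t (suc j) u ≡ true
    layers′ {J} b {t} t∈ j J≤j with growth t j t∈
    ... | inj₂ s = saturated t j t∈ s
    ... | inj₁ s = λ _ _ → ⊥-elim (lin-⊥ (length vs ∷ g ∷ J ∷ h ∷ j ∷ sumOf (λ x → b2n (good t j x)) vs ∷ [])
          ((# 1 ⊕ ξ 0 , ξ 1 ⊕ (ξ 2 ⊗ ξ 3)) ∷ (ξ 1 ⊕ (ξ 4 ⊗ ξ 3) , ξ 5) ∷ (ξ 5 , ξ 0) ∷ (ξ 2 ⊗ ξ 3 , ξ 4 ⊗ ξ 3) ∷ [])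
          (1 ∷ 1 ∷ 1 ∷ 1 ∷ []) (# 0) refl (b , s , cnt≤length (good t j) vs , ℕₚ.*-mono-≤ J≤j (ℕₚ.≤-refl {h}) , tt))

    opaque
      layers : ∀ {J} → length vs < g + J * h → ∀ {t} → t ∈ vs → ∀ j {u} → J ≤ j → u ∈ vs → ko u ≡ ki t → good t (suc j) u ≡ true
      layers = layers′

    step-good′ : ∀ {t j u} (X : List V) → length X ≤ f → good t (suc j) u ≡ true →
      ∃₂ λ y w → y ∈ vs × y ∉ X × E u y ≡ true × (w , y) ∈ as × good t j w ≡ true
    step-good′ {t} {j} {u} X l p with pick (λ y → E u y ∧ pr as (good t j) y) X vs uniq (ℕₚ.≤-<-trans l (<ᵇ-< {f} p))
    ... | y , y∈ , q , y∉ with ∧-split {E u y} q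
    ...   | e , r with pr-∃ as r
    ...     | w , m , s = y , w , y∈ , y∉ , e , m , s

    opaque
      step-good : ∀ {t j u} (X : List V) → length X ≤ f → good t (suc j) u ≡ true →
        ∃₂ λ y w → y ∈ vs × y ∉ X × E u y ≡ true × (w , y) ∈ as × good t j w ≡ true
      step-good {t} {j} {u} = step-good′ {t} {j} {u}

-- Opening a permutation at an arc

module _ {A : Set} where
  ∈-pairs : ∀ {u t : A} x xs → (u , t) ∈ pairs x xs → ∃₂ λ as bs → xs ≡ as ++ t ∷ bs × u ≡ lastOf x as
  ∈-pairs x (y ∷ ys) (here refl) = [] , ys , refl , refl
  ∈-pairs x (y ∷ ys) (there p) with ∈-pairs y ys p
  ... | as , bs , refl , refl = y ∷ as , bs , refl , refl

  record Opening (s : List (Cyc A)) (u t : A) : Set where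
    field
      ps     : List A
      cs     : List (Cyc A)
      last≡  : lastOf t ps ≡ u
      verts≈ : openVerts t ps cs ↭ allVerts s
      arcs≈  : allArcs s ↭ (u , t) ∷ openArcs t ps cs
      short≡ : ∀ L → shorts L t ps cs ≡ cnt (shortᵇ L) s
      sub    : ∀ {c} → c ∈ cs → c ∈ s

  ∈-allArcs : ∀ {a} (s : List (Cyc A)) → a ∈ allArcs s → ∃ λ (c : Cyc A) → c ∈ s × a ∈ cycArcs c
  ∈-allArcs (c ∷ cs) p with ∈-++⁻ (cycArcs c) p
  ... | inj₁ q = c , here refl , q
  ... | inj₂ q with ∈-allArcs cs q
  ...   | d , d∈ , r = d , there d∈ , r

  ∈-skip : ∀ {B : Set} {c d : B} as {bs} → c ∈ as ++ bs → c ∈ as ++ d ∷ bs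
  ∈-skip []       p         = there p
  ∈-skip (a ∷ as) (here e)  = here e
  ∈-skip (a ∷ as) (there p) = there (∈-skip as p)

  open-at-head : ∀ as t ps bs → Opening (as ++ (t , ps) ∷ bs) (lastOf t ps) t
  open-at-head as t ps bs = record
    { ps = ps ; cs = as ++ bs ; last≡ = refl
    ; verts≈ = ↭-sym (concatMap-mid verts as (t , ps) bs)
    ; arcs≈ = concatMap-mid cycArcs as (t , ps) bs
    ; short≡ = λ L → sym (cnt-↭ (shortᵇ L) (↭ₚ.shift (t , ps) as bs))
    ; sub = ∈-skip as }

  open-at′ : ∀ (s : List (Cyc A)) {u t} → (u , t) ∈ allArcs s → Opening s u t
  open-at′ s p with ∈-allArcs s p
  ... | (x , xs) , c∈ , q with ∈-∃++ c∈
  open-at′ s p | (x , xs) , c∈ , here refl | as , bs , refl = open-at-head as x xs bs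
  open-at′ s {u} {t} p | (x , xs) , c∈ , there q | as , bs , refl with ∈-pairs x xs q
  ... | xs₁ , xs₂ , refl , refl = record
    { ps = xs₂ ++ x ∷ xs₁ ; cs = as ++ bs ; last≡ = lastOf-++ t xs₂ x xs₁
    ; verts≈ = ↭-trans (↭ₚ.++⁺ʳ _ (solve 4 (λ x a y b → (y ⊞ (b ⊞ (x ⊞ a))) ⊜ (x ⊞ (a ⊞ (y ⊞ b)))) ↭-refl (x ∷ []) xs₁ (t ∷ []) xs₂))
        (↭-sym (concatMap-mid verts as (x , xs₁ ++ t ∷ xs₂) bs))
    ; arcs≈ = ↭-trans (concatMap-mid cycArcs as (x , xs₁ ++ t ∷ xs₂) bs)
        (↭ₚ.++⁺ʳ (allArcs (as ++ bs)) (↭-trans (rotate-arcs x xs₁ t xs₂)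
          (↭-reflexive (cong (λ z → (z , t) ∷ pairs t (xs₂ ++ x ∷ xs₁)) (lastOf-++ t xs₂ x xs₁)))))
    ; short≡ = λ L → trans (cong (λ k → b2n (k ℕ.<ᵇ L) + cnt (shortᵇ L) (as ++ bs)) len)
        (sym (cnt-↭ (shortᵇ L) (↭ₚ.shift (x , xs₁ ++ t ∷ xs₂) as bs)))
    ; sub = ∈-skip as }
    where
    open ↭-Solver
    len : length (xs₂ ++ x ∷ xs₁) ≡ length (xs₁ ++ t ∷ xs₂)
    len = trans (Listₚ.length-++ xs₂) (trans (ℕₚ.+-suc _ _) (trans (cong suc (ℕₚ.+-comm (length xs₂) _))
      (trans (sym (ℕₚ.+-suc _ _)) (sym (Listₚ.length-++ xs₁)))))

  opaque
    open-at : ∀ (s : List (Cyc A)) {u t} → (u , t) ∈ allArcs s → Opening s u t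
    open-at = open-at′

  openArcs-snd : ∀ t ps (cs : List (Cyc A)) → t ∷ map proj₂ (openArcs t ps cs) ≡ openVerts t ps cs
  openArcs-snd t ps cs = allArcs-snd ((t , ps) ∷ cs)

  fst-unique : ∀ {w w′ y : A} as → Unique (map proj₂ as) → (w , y) ∈ as → (w′ , y) ∈ as → w ≡ w′
  fst-unique (_ ∷ as) u (here refl) (here refl) = refl
  fst-unique (_ ∷ as) (y∉ ∷ u) (here refl) (there q) = ⊥-elim (All.lookup y∉ (∈-map⁺ proj₂ q) refl)
  fst-unique (_ ∷ as) (y∉ ∷ u) (there p) (here refl) = ⊥-elim (All.lookup y∉ (∈-map⁺ proj₂ p) refl)
  fst-unique (_ ∷ as) (_ ∷ u) (there p) (there q) = fst-unique as u p q

-- Rotations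

module LongCycles {n : ℕ} {vs : List (Fin n)} {E : Fin n → Fin n → Bool} {ko ki : Fin n → Bool} {d f h g : ℕ}
                  (R : Robust vs E ko ki d f h g) (0<g : 0 < g) (gf<d : g + f < d)
                  (J : ℕ) (big : length vs < g + J * h) (L : ℕ) (room : 2 + J + (L + L) ≤ f) where
  private V = Fin n
  open Robust R

  bad : V × V → Bool
  bad (x , y) = not (E x y)

  PureArcs : List (V × V) → Set
  PureArcs as = ∀ {x y} → (x , y) ∈ as → ko x ≡ ki y

  PureArcs-↭ : ∀ {as bs} → as ↭ bs → PureArcs as → PureArcs bs
  PureArcs-↭ p h q = h (↭ₚ.∈-resp-↭ (↭-sym p) q)

  PureArcs-∷ : ∀ {x y as} → ko x ≡ ki y → PureArcs as → PureArcs ((x , y) ∷ as)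
  PureArcs-∷ e h (here refl) = e
  PureArcs-∷ e h (there q) = h q

  factor : ∀ s → allVerts s ↭ vs → PureArcs (allArcs s) → Factor vs ko ki (allArcs s)
  factor s v p = record { fsts = ↭-trans (allArcs-fst s) v ; snds = ↭-trans (↭-reflexive (allArcs-snd s)) v ; apure = p }

  module _ {as : List (V × V)} (F : Factor vs ko ki as) where
    open Layers R F 0<g gf<d

    -- The flag `strict` tells that at least one rotation took place: the first rotation is what
    -- removes a short path.
    record Closing (t : V) (ps : List V) (cs : List (Cyc V)) (strict : Bool) : Set where
      field
        ps′    : List V
        cs′    : List (Cyc V)
        verts≈ : openVerts t ps′ cs′ ↭ openVerts t ps cs
        arc    : E (lastOf t ps′) t ≡ true
        bad≤   : cnt bad (openArcs t ps′ cs′) ≤ cnt bad (openArcs t ps cs)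
        pure′  : PureArcs (openArcs t ps′ cs′)
        short≤ : shorts L t ps′ cs′ ≤ shorts L t ps cs
        short< : strict ≡ true → length ps < L → shorts L t ps′ cs′ < shorts L t ps cs

    nonzero : ℕ → Bool
    nonzero zero    = false
    nonzero (suc _) = true

    -- The layers refer to the permutation `as` from before the rotations. The heads moved so far
    -- are kept in `X` and avoided; every other arc of `as`, except the one into `t`, is still
    -- present, so the current predecessor of the chosen `y` is the one that the layer speaks of.
    walk′ : ∀ j t ps cs (X : List V) → good t j (lastOf t ps) ≡ true → openVerts t ps cs ↭ vs →
      PureArcs (openArcs t ps cs) →
      (∀ {w y} → (w , y) ∈ as → y ≢ t → y ∉ X → (w , y) ∈ openArcs t ps cs) →
      length X + (j + (1 + (L + L))) ≤ f → Closing t ps cs (nonzero j)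
    walk′ zero t ps cs X p v pu inv len = record
      { ps′ = ps ; cs′ = cs ; verts≈ = ↭-refl ; arc = p ; bad≤ = ℕₚ.≤-refl ; pure′ = pu ; short≤ = ℕₚ.≤-refl
      ; short< = λ () }
    walk′ (suc j) t ps cs X p v pu inv len with step-good {t} {j} {lastOf t ps} (t ∷ X ++ ends L ps)
        (lin-≤ (length X ∷ j ∷ L ∷ f ∷ length (X ++ ends L ps) ∷ length (ends L ps) ∷ [])
              ((ξ 0 ⊕ ((# 1 ⊕ ξ 1) ⊕ (# 1 ⊕ (ξ 2 ⊕ ξ 2))) , ξ 3) ∷ (ξ 4 , ξ 0 ⊕ ξ 5) ∷ (ξ 5 , ξ 2 ⊕ ξ 2) ∷ [])
              (# 1 ⊕ ξ 4) (ξ 3) (1 ∷ 1 ∷ 1 ∷ 1 ∷ []) (ξ 1 ⊕ # 1) refl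
              (len , ℕₚ.≤-reflexive (Listₚ.length-++ X {ends L ps}) , length-ends L ps , tt)) p
    ... | y , w , y∈ , y∉ , e , m , q with move t ps cs y (↭ₚ.∈-resp-↭ (↭-sym v) y∈) (λ y≡t → y∉ (here y≡t))
    ...   | M = record
      { ps′ = W.ps′ ; cs′ = W.cs′ ; verts≈ = ↭-trans W.verts≈ (Move.verts≈ M) ; arc = W.arc
      ; bad≤ = ℕₚ.≤-trans W.bad≤ bad-step
      ; pure′ = W.pure′
      ; short≤ = ℕₚ.≤-trans W.short≤ (Move.short≤ M L y∉ends)
      ; short< = λ _ l → ℕₚ.≤-<-trans W.short≤ (Move.short< M L y∉ends l) }
      where
      ps₁ = Move.ps′ M
      cs₁ = Move.cs′ M
      rest = Move.rest M
      y≢t : y ≢ t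
      y≢t y≡t = y∉ (here y≡t)
      y∉X : y ∉ X
      y∉X r = y∉ (there (∈-++⁺ˡ r))
      y∉ends : y ∉ ends L ps
      y∉ends r = y∉ (there (∈-++⁺ʳ X r))
      uniq-snd : Unique (map proj₂ (openArcs t ps cs))
      uniq-snd with subst Unique (sym (openArcs-snd t ps cs)) (Unique-↭ (↭-sym v) uniq)
      ... | _ ∷ u = u
      w≡ : w ≡ lastOf t ps₁
      w≡ = fst-unique _ uniq-snd (inv m y≢t y∉X) (↭ₚ.∈-resp-↭ (↭-sym (Move.old≈ M)) (here refl))
      pu-rest : PureArcs rest
      pu-rest r = pu (↭ₚ.∈-resp-↭ (↭-sym (Move.old≈ M)) (there r))
      bad-step : cnt bad (openArcs t ps₁ cs₁) ≤ cnt bad (openArcs t ps cs)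
      bad-step rewrite cnt-↭ bad (Move.new≈ M) | cnt-↭ bad (Move.old≈ M) | e = ℕₚ.m≤n+m _ _
      inv₁ : ∀ {w′ y′} → (w′ , y′) ∈ as → y′ ≢ t → y′ ∉ y ∷ X → (w′ , y′) ∈ openArcs t ps₁ cs₁
      inv₁ r y′≢t y′∉ with ↭ₚ.∈-resp-↭ (Move.old≈ M) (inv r y′≢t (y′∉ ∘ there))
      ... | here refl = ⊥-elim (y′∉ (here refl))
      ... | there r′  = ↭ₚ.∈-resp-↭ (↭-sym (Move.new≈ M)) (there r′)
      module W = Closing (walk′ j t ps₁ cs₁ (y ∷ X) (subst (λ z → good t j z ≡ true) w≡ q)
        (↭-trans (Move.verts≈ M) v) (PureArcs-↭ (↭-sym (Move.new≈ M)) (PureArcs-∷ (pure e) pu-rest)) inv₁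
        (lin-≤ (length X ∷ j ∷ L ∷ f ∷ [])
              ((ξ 0 ⊕ (# 1 ⊕ (ξ 1 ⊕ (# 1 ⊕ (ξ 2 ⊕ ξ 2)))) , ξ 3) ∷ [])
              ((# 1 ⊕ ξ 0) ⊕ (ξ 1 ⊕ (# 1 ⊕ (ξ 2 ⊕ ξ 2)))) (ξ 3) (1 ∷ 1 ∷ []) (# 0) refl (len , tt)))

    opaque
      walk : ∀ j t ps cs (X : List V) → good t j (lastOf t ps) ≡ true → openVerts t ps cs ↭ vs →
        PureArcs (openArcs t ps cs) →
        (∀ {w y} → (w , y) ∈ as → y ≢ t → y ∉ X → (w , y) ∈ openArcs t ps cs) →
        length X + (j + (1 + (L + L))) ≤ f → Closing t ps cs (nonzero j)
      walk = walk′

  State : Set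
  State = List (Cyc V)

  -- Non-arcs and short cycles are counted together, since curing one must not produce the other:
  -- rotations insert only arcs of `E`, and the avoidance of `ends` keeps all pieces that are split
  -- off long.
  μ : State → ℕ
  μ s = cnt bad (allArcs s) + cnt (shortᵇ L) s

  -- A removed non-arc never returns. A short cycle, once opened, lies inside the vertices to be
  -- avoided, so the first rotation continues into another cycle and merges the two.
  reclose : ∀ s {u t} → allVerts s ↭ vs → PureArcs (allArcs s) → (O : Opening s u t) →
    (E u t ≡ false ⊎ length (Opening.ps O) < L) →
    ∃ λ s′ → allVerts s′ ↭ vs × PureArcs (allArcs s′) × μ s′ < μ s
  reclose s {u} {t} v pu O reason = (t , C.ps′) ∷ C.cs′ , ↭-trans C.verts≈ v₀ , PureArcs-∷ (pure C.arc) C.pure′ , μ<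
    where
    open Opening O
    F = factor s v pu
    v₀ : openVerts t ps cs ↭ vs
    v₀ = ↭-trans verts≈ v
    t∈ : t ∈ vs
    t∈ = ↭ₚ.∈-resp-↭ v₀ (here refl)
    pu₀ : PureArcs ((u , t) ∷ openArcs t ps cs)
    pu₀ = PureArcs-↭ arcs≈ pu
    u∈ : u ∈ vs
    u∈ = Factor.fst-∈ F (↭ₚ.∈-resp-↭ (↭-sym arcs≈) (here refl))
    inv : ∀ {w y} → (w , y) ∈ allArcs s → y ≢ t → y ∉ [] → (w , y) ∈ openArcs t ps cs
    inv r y≢t _ with ↭ₚ.∈-resp-↭ arcs≈ r
    ... | here refl = ⊥-elim (y≢t refl)
    ... | there r′  = r′
    module C = Closing (walk F (suc J) t ps cs []
      (subst (λ z → Layers.good R F 0<g gf<d t (suc J) z ≡ true) (sym last≡)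
        (Layers.layers R F 0<g gf<d big t∈ J ℕₚ.≤-refl u∈ (pu₀ (here refl))))
      v₀ (pu₀ ∘ there) inv (lin-≤ (J ∷ L ∷ f ∷ [])
            (((# 2 ⊕ ξ 0) ⊕ (ξ 1 ⊕ ξ 1) , ξ 2) ∷ [])
            (# 0 ⊕ ((# 1 ⊕ ξ 0) ⊕ (# 1 ⊕ (ξ 1 ⊕ ξ 1)))) (ξ 2) (1 ∷ 1 ∷ []) (# 0) refl (room , tt)))
    eq-bad : cnt bad (allArcs s) ≡ b2n (bad (u , t)) + cnt bad (openArcs t ps cs)
    eq-bad = cnt-↭ bad arcs≈
    arc0 : b2n (bad (lastOf t C.ps′ , t)) ≡ 0
    arc0 rewrite C.arc = refl
    μ< : μ ((t , C.ps′) ∷ C.cs′) < μ s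
    closed≡ : cnt bad (allArcs ((t , C.ps′) ∷ C.cs′)) ≡ cnt bad (openArcs t C.ps′ C.cs′)
    closed≡ = cong (_+ cnt bad (openArcs t C.ps′ C.cs′)) arc0
    open≤ : cnt bad (openArcs t ps cs) ≤ cnt bad (allArcs s)
    open≤ = ℕₚ.≤-trans (ℕₚ.m≤n+m _ (b2n (bad (u , t)))) (ℕₚ.≤-reflexive (sym eq-bad))
    open< : E u t ≡ false → cnt bad (openArcs t ps cs) < cnt bad (allArcs s)
    open< r = ℕₚ.≤-reflexive (trans (cong (λ b → b2n (not b) + cnt bad (openArcs t ps cs)) (sym r)) (sym eq-bad))
    μ< = go reason
      where
      go : E u t ≡ false ⊎ length ps < L → μ ((t , C.ps′) ∷ C.cs′) < μ s
      go (inj₁ r) = ℕₚ.+-mono-<-≤ (ℕₚ.≤-<-trans (ℕₚ.≤-trans (ℕₚ.≤-reflexive closed≡) C.bad≤) (open< r))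
        (ℕₚ.≤-trans C.short≤ (ℕₚ.≤-reflexive (short≡ L)))
      go (inj₂ r) = ℕₚ.+-mono-≤-< (ℕₚ.≤-trans (ℕₚ.≤-trans (ℕₚ.≤-reflexive closed≡) C.bad≤) open≤)
        (ℕₚ.<-≤-trans (C.short< refl r) (ℕₚ.≤-reflexive (short≡ L)))

  repair : ∀ m s → μ s ≤ m → allVerts s ↭ vs → PureArcs (allArcs s) →
    ∃ λ s′ → allVerts s′ ↭ vs × (∀ {a} → a ∈ allArcs s′ → bad a ≡ false) × (∀ {c} → c ∈ s′ → shortᵇ L c ≡ false)
  repair m s le v pu with cnt bad (allArcs s) in eb | cnt (shortᵇ L) s in es
  ... | zero | zero = s , v
      , (λ p → ¬true⇒false λ q → ℕₚ.<-irrefl (sym eb) (cnt-pos {P = bad} _ p q))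
      , (λ p → ¬true⇒false λ q → ℕₚ.<-irrefl (sym es) (cnt-pos {P = shortᵇ L} _ p q))
  repair zero s () v pu | suc _ | _
  repair zero s () v pu | zero | suc _
  repair (suc m) s le v pu | suc b | k with cnt-∃ {P = bad} (allArcs s) (subst (0 <_) (sym eb) (s≤s z≤n))
  ... | (u , t) , p , q with reclose s v pu (open-at s p) (inj₁ (not-true q))
  ...   | s′ , v′ , pu′ , lt = repair m s′ (s≤s⁻¹ (ℕₚ.<-≤-trans lt (ℕₚ.≤-trans (ℕₚ.≤-reflexive (cong₂ _+_ eb es)) le))) v′ pu′
  repair (suc m) s le v pu | zero | suc k with cnt-∃ {P = shortᵇ L} s (subst (0 <_) (sym es) (s≤s z≤n))
  ... | (t , ps) , c∈ , q with ∈-∃++ c∈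
  ...   | as , bs , refl with reclose s v pu (open-at-head as t ps bs) (inj₂ (<ᵇ-< {length ps} {L} q))
  ...     | s′ , v′ , pu′ , lt = repair m s′ (s≤s⁻¹ (ℕₚ.<-≤-trans lt (ℕₚ.≤-trans (ℕₚ.≤-reflexive (cong₂ _+_ eb es)) le))) v′ pu′

  impure : V × V → Bool
  impure (x , y) = not (does (ko x Boolₚ.≟ ki y))

  impure-false : ∀ {x y} → impure (x , y) ≡ false → ko x ≡ ki y
  impure-false {x} {y} h with ko x | ki y
  ... | true  | true  = refl
  ... | false | false = refl

  pure-impure : ∀ {x y} → ko x ≡ ki y → impure (x , y) ≡ false
  pure-impure {x} {y} h with ko x | ki y | h
  ... | true  | true  | _ = refl
  ... | false | false | _ = refl

  -- Since the class counts agree, an impure arc is matched by one of the opposite kind, and exchanging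
  -- their heads makes both pure.
  exchange : ∀ s {u t} → allVerts s ↭ vs → (u , t) ∈ allArcs s → ko u ≢ ki t →
    ∃ λ s′ → allVerts s′ ↭ vs × cnt impure (allArcs s′) < cnt impure (allArcs s)
  exchange s {u} {t} v p ne with open-at s p
  ... | O = (t , M.ps′) ∷ M.cs′ , ↭-trans M.verts≈ (↭-trans verts≈ v) , fewer
    where
    open Opening O
    opp : ∃ λ a → a ∈ openArcs t ps cs × ko (proj₁ a) ≡ ki t × ki (proj₂ a) ≡ ko u
    opp = go (ko u) (ki t) refl refl
      where
      tot : b2n (ko u) + cnt (ko ∘ proj₁) (openArcs t ps cs) ≡ b2n (ki t) + cnt (ki ∘ proj₂) (openArcs t ps cs)
      tot = trans (sym (cnt-↭ (ko ∘ proj₁) arcs≈)) (trans (sym (sumOf-map _ proj₁ (allArcs s)))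
        (trans (cnt-↭ ko (↭-trans (allArcs-fst s) v)) (trans bal (trans (sym (cnt-↭ ki v))
        (trans (cong (cnt ki) (sym (allArcs-snd s))) (trans (sumOf-map _ proj₂ (allArcs s)) (cnt-↭ (ki ∘ proj₂) arcs≈)))))))
      go : ∀ a b → ko u ≡ a → ki t ≡ b → ∃ λ a′ → a′ ∈ openArcs t ps cs × ko (proj₁ a′) ≡ ki t × ki (proj₂ a′) ≡ ko u
      go true  true  e₁ e₂ = ⊥-elim (ne (trans e₁ (sym e₂)))
      go false false e₁ e₂ = ⊥-elim (ne (trans e₁ (sym e₂)))
      go true false e₁ e₂ with ∃-sumOf-< {f = b2n ∘ ko ∘ proj₁} {g = b2n ∘ ki ∘ proj₂} (openArcs t ps cs)
          (ℕₚ.≤-reflexive (subst₂ (λ x y → b2n x + cnt (ko ∘ proj₁) (openArcs t ps cs) ≡ b2n y + cnt (ki ∘ proj₂) (openArcs t ps cs)) e₁ e₂ tot))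
      ... | (w , y) , m , lt with ko w in f₁ | ki y in f₂ | lt
      ...   | false | true | _ = (w , y) , m , trans f₁ (sym e₂) , trans f₂ (sym e₁)
      ...   | false | false | ()
      ...   | true | true | s≤s ()
      go false true e₁ e₂ with ∃-sumOf-< {f = b2n ∘ ki ∘ proj₂} {g = b2n ∘ ko ∘ proj₁} (openArcs t ps cs)
          (ℕₚ.≤-reflexive (sym (subst₂ (λ x y → b2n x + cnt (ko ∘ proj₁) (openArcs t ps cs) ≡ b2n y + cnt (ki ∘ proj₂) (openArcs t ps cs)) e₁ e₂ tot)))
      ... | (w , y) , m , lt with ko w in f₁ | ki y in f₂ | lt
      ...   | true | false | _ = (w , y) , m , trans f₁ (sym e₂) , trans f₂ (sym e₁)
      ...   | false | false | ()
      ...   | true | true | s≤s ()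
    w = proj₁ (proj₁ opp)
    y = proj₂ (proj₁ opp)
    m = proj₁ (proj₂ opp)
    y∈ : y ∈ openVerts t ps cs
    y∈ = subst (y ∈_) (openArcs-snd t ps cs) (there (∈-map⁺ proj₂ m))
    y≢t : y ≢ t
    y≢t e = ne (trans (sym (proj₂ (proj₂ (proj₂ opp)))) (cong ki e))
    module M = Move (move t ps cs y y∈ y≢t)
    uniq-snd : Unique (map proj₂ (openArcs t ps cs))
    uniq-snd with subst Unique (sym (openArcs-snd t ps cs)) (Unique-↭ (↭-sym (↭-trans verts≈ v)) uniq)
    ... | _ ∷ u = u
    w≡ : w ≡ lastOf t M.ps′
    w≡ = fst-unique _ uniq-snd m (↭ₚ.∈-resp-↭ (↭-sym M.old≈) (here refl))
    z₁ : impure (lastOf t M.ps′ , t) ≡ false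
    z₁ = pure-impure (trans (cong ko (sym w≡)) (proj₁ (proj₂ (proj₂ opp))))
    z₂ : impure (lastOf t ps , y) ≡ false
    z₂ = pure-impure (trans (cong ko last≡) (sym (proj₂ (proj₂ (proj₂ opp)))))
    o₁ : impure (u , t) ≡ true
    o₁ with true-or-false (impure (u , t))
    ... | inj₁ q = q
    ... | inj₂ q = ⊥-elim (ne (impure-false q))
    fewer : cnt impure (allArcs ((t , M.ps′) ∷ M.cs′)) < cnt impure (allArcs s)
    fewer = ℕₚ.≤-<-trans (ℕₚ.≤-reflexive (cong₂ _+_ (cong b2n z₁) (trans (cnt-↭ impure M.new≈) (cong (λ b → b2n b + cnt impure M.rest) z₂))))
      (ℕₚ.≤-<-trans (ℕₚ.≤-trans (ℕₚ.m≤n+m _ (b2n (impure (lastOf t M.ps′ , y)))) (ℕₚ.≤-reflexive (sym (cnt-↭ impure M.old≈))))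
        (ℕₚ.≤-reflexive (sym (trans (cnt-↭ impure arcs≈) (cong (λ b → b2n b + cnt impure (openArcs t ps cs)) o₁)))))

  purify : ∀ m s → cnt impure (allArcs s) ≤ m → allVerts s ↭ vs →
    ∃ λ s′ → allVerts s′ ↭ vs × PureArcs (allArcs s′)
  purify m s le v with cnt impure (allArcs s) in ei
  ... | zero = s , v , λ p → impure-false (¬true⇒false λ q → ℕₚ.<-irrefl (sym ei) (cnt-pos {P = impure} _ p q))
  purify zero s () v | suc _
  purify (suc m) s le v | suc k with cnt-∃ {P = impure} (allArcs s) (subst (0 <_) (sym ei) (s≤s z≤n))
  ... | (u , t) , p , q with exchange s v p (λ e → false≢true (pure-impure e) q)
  ...   | s′ , v′ , lt = purify m s′ (s≤s⁻¹ (ℕₚ.<-≤-trans lt (ℕₚ.≤-trans (ℕₚ.≤-reflexive ei) le))) v′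

  long-cycles : ∀ {v₀ vs₀} → vs ≡ v₀ ∷ vs₀ →
    ∃ λ s → allVerts s ↭ vs × (∀ {x y} → (x , y) ∈ allArcs s → E x y ≡ true) × (∀ {c} → c ∈ s → L ≤ length (proj₂ c))
  -- The enumeration of the vertices, read as one cycle, serves as the initial permutation.
  long-cycles {v₀} {vs₀} refl with purify _ ((v₀ , vs₀) ∷ []) ℕₚ.≤-refl (↭-reflexive (Listₚ.++-identityʳ _))
  ... | s , v , pu with repair _ s ℕₚ.≤-refl v pu
  ...   | s′ , v′ , e , l = s′ , v′ , (λ {x} {y} p → trans (sym (Boolₚ.not-involutive (E x y))) (cong not (e p)))
          , λ {c} p → <ᵇ-false {length (proj₂ c)} {L} (l p)

-- Absorbing gadgets

module _ {A : Set} where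
  lastOf-append : ∀ (t : A) xs ys → lastOf t (xs ++ ys) ≡ lastOf (lastOf t xs) ys
  lastOf-append t []       ys = refl
  lastOf-append t (x ∷ xs) ys = lastOf-append x xs ys

  pairs-append : ∀ (t : A) xs ys → pairs t (xs ++ ys) ≡ pairs t xs ++ pairs (lastOf t xs) ys
  pairs-append t []       ys = refl
  pairs-append t (x ∷ xs) ys = cong ((t , x) ∷_) (pairs-append x xs ys)

module _ {n : ℕ} where
  private V = Fin n

  Chain : (V → V → Bool) → V → List V → Set
  Chain E t xs = ∀ {x y} → (x , y) ∈ pairs t xs → E x y ≡ true

  module _ {E : V → V → Bool} where
    chain-append : ∀ t xs ys → Chain E t xs → Chain E (lastOf t xs) ys → Chain E t (xs ++ ys)
    chain-append t xs ys p q {x} {y} m with ∈-++⁻ (pairs t xs) (subst ((x , y) ∈_) (pairs-append t xs ys) m)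
    ... | inj₁ r = p r
    ... | inj₂ r = q r

    chain-++⁻ʳ : ∀ t xs ys → Chain E t (xs ++ ys) → Chain E (lastOf t xs) ys
    chain-++⁻ʳ t xs ys p {x} {y} m = p (subst ((x , y) ∈_) (sym (pairs-append t xs ys)) (∈-++⁺ʳ (pairs t xs) m))

    chain-∷ : ∀ {t x xs} → E t x ≡ true → Chain E x xs → Chain E t (x ∷ xs)
    chain-∷ e c (here refl) = e
    chain-∷ e c (there m) = c m

    chain-1 : ∀ {t x} → E t x ≡ true → Chain E t (x ∷ [])
    chain-1 e = chain-∷ e λ ()

  -- Only the inner vertices are kept out of `X`. They may even meet `u` or `t`, so the endpoints
  -- are put into `X` wherever a genuine path is needed.
  Connects : List V → (V → V → Bool) → ℕ → ℕ → Set
  Connects vs E f r = ∀ {u t} → u ∈ vs → t ∈ vs → (X : List V) → length X ≤ f →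
    ∃ λ xs → Chain E u (xs ++ t ∷ []) × Unique xs × (∀ {x} → x ∈ xs → x ∈ vs × x ∉ X) × length xs ≤ r

  -- A path from t whose vertices can also be covered by a path from t to a and a path from b to the old end,
  -- so that a cycle entered from a and left towards b can be spliced in.
  record Splits (E : V → V → Bool) (t : V) (ps : List V) (b a : V) : Set where
    field
      as bs : List V
      perm  : t ∷ ps ↭ (t ∷ as) ++ (b ∷ bs)
      lasta : lastOf t as ≡ a
      lastb : lastOf b bs ≡ lastOf t ps
      chaina : Chain E t as
      chainb : Chain E b bs

  succs : List (V × V) → List V → List V
  succs as U = map proj₂ (filterᵇ (λ a → mem (proj₁ a) U) as)

  succs-∈ : ∀ as U {w y} → (w , y) ∈ as → w ∈ U → y ∈ succs as U
  succs-∈ ((w , y) ∷ as) U (here refl) q rewrite ∈⇒mem q = here refl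
  succs-∈ ((w′ , z) ∷ as) U (there p) q with mem w′ U
  ... | true  = there (succs-∈ as U p q)
  ... | false = succs-∈ as U p q

  length-succs : ∀ as U {vs} → map proj₁ as ↭ vs → Unique vs → length (succs as U) ≤ length U
  length-succs as U {vs} p u = begin
    length (succs as U)                             ≡⟨ Listₚ.length-map proj₂ (filterᵇ (λ a → mem (proj₁ a) U) as) ⟩
    length (filterᵇ (λ a → mem (proj₁ a) U) as)     ≡⟨ length-filter _ as ⟩
    cnt (λ a → mem (proj₁ a) U) as                  ≡⟨ sumOf-map _ proj₁ as ⟨
    cnt (λ x → mem x U) (map proj₁ as)              ≡⟨ cnt-↭ (λ x → mem x U) p ⟩
    cnt (λ x → mem x U) vs                          ≤⟨ cnt-mem U vs u ⟩
    length U                                        ∎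
    where open ℕₚ.≤-Reasoning

module Gadgets {n : ℕ} {vs : List (Fin n)} {E : Fin n → Fin n → Bool} {ko ki : Fin n → Bool} {d f h g : ℕ}
               (R : Robust vs E ko ki d f h g) (0<g : 0 < g) (gf<d : g + f < d)
               (irr : ∀ x → E x x ≡ false)
               {as : List (Fin n × Fin n)} (F : Factor vs ko ki as) (real : ∀ {x y} → (x , y) ∈ as → E x y ≡ true)
               (r : ℕ) (connects : Connects vs E f r) where
  private V = Fin n
  open Robust R
  open Layers R F 0<g gf<d
  open Factor F

  -- A path from `e` with a cover of its vertices by two disjoint paths. The one from `hx` stops
  -- where the whole path stops; the end of the one from `hy` is free and is steered towards the
  -- target.
  record Strand (X : List V) (e hx hy : V) : Set where
    field
      ps xs ys : List V
      chain  : Chain E e ps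
      chainx : Chain E hx xs
      chainy : Chain E hy ys
      lastx  : lastOf hx xs ≡ lastOf e ps
      perm   : e ∷ ps ↭ (hx ∷ xs) ++ (hy ∷ ys)
      unique : Unique (e ∷ ps)
      inside : ∀ {x} → x ∈ e ∷ ps → x ∈ vs × x ∉ X

  -- The main strand is extended by a connecting path, w and y; the x-strand follows it up to w, while the
  -- y-strand jumps directly to y. Then the strands change roles.
  extend′ : ∀ {X e hx hy} (S : Strand X e hx hy) {w y} → E w y ≡ true → E (lastOf hy (Strand.ys S)) y ≡ true →
    w ∈ vs → y ∈ vs → w ∉ e ∷ Strand.ps S → y ∉ e ∷ Strand.ps S → w ∉ X → y ∉ X →
    length X + (3 + length (Strand.ps S)) ≤ f →
    Σ (Strand X e hy hx) λ S′ → lastOf hx (Strand.ys S′) ≡ w × lastOf hy (Strand.xs S′) ≡ y ×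
      length (Strand.ps S′) ≤ 2 + r + length (Strand.ps S)
  extend′ {X} {e} {hx} {hy} S {w} {y} wy jy w∈ y∈ w∉ y∉ w∉X y∉X len
    with connects {lastOf e (Strand.ps S)} {w} (proj₁ (Strand.inside S (lastOf-∈ e (Strand.ps S)))) w∈ (w ∷ y ∷ X ++ e ∷ Strand.ps S)
      (ℕₚ.≤-trans (ℕₚ.≤-reflexive (cong (2 +_) (Listₚ.length-++ X))) (lin-≤ (length X ∷ length (Strand.ps S) ∷ f ∷ [])
            ((ξ 0 ⊕ (# 3 ⊕ ξ 1) , ξ 2) ∷ []) (# 2 ⊕ (ξ 0 ⊕ (# 1 ⊕ ξ 1))) (ξ 2) (1 ∷ 1 ∷ []) (# 0) refl (len , tt)))
  ... | cs , cch , cu , cin , clen = record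
      { ps = ps ++ qs ++ y ∷ [] ; xs = ys ++ y ∷ [] ; ys = xs ++ qs
      ; chain = chain-append e ps (qs ++ y ∷ []) chain
          (chain-append (lastOf e ps) qs (y ∷ []) cch (chain-1 (subst (λ z → E z y ≡ true) (sym lastq) wy)))
      ; chainx = chain-append hy ys (y ∷ []) chainy (chain-1 jy)
      ; chainy = chain-append hx xs qs chainx (subst (λ z → Chain E z qs) (sym lastx) cch)
      ; lastx = trans (lastOf-++ hy ys y []) (sym lastp)
      ; perm = ↭-trans (↭ₚ.++⁺ʳ (qs ++ y ∷ []) perm)
          (solve 6 (λ a b c d e f → ((a ⊞ b) ⊞ (c ⊞ d)) ⊞ (e ⊞ f) ⊜ ((c ⊞ (d ⊞ f)) ⊞ (a ⊞ (b ⊞ e)))) ↭-refl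
            (hx ∷ []) xs (hy ∷ []) ys qs (y ∷ []))
      ; unique = Uniqueₚ.++⁺ unique uq (λ (p , q) → disj q p)
      ; inside = λ p → ins (∈-++⁻ (e ∷ ps) p)
      } , trans (lastOf-append hx xs qs) (trans (cong (λ z → lastOf z qs) lastx) lastq) , lastOf-++ hy ys y []
        , ℕₚ.≤-trans (ℕₚ.≤-reflexive lenq) (lin-≤ (length cs ∷ r ∷ length (Strand.ps S) ∷ [])
              ((ξ 0 , ξ 1) ∷ [])
              (ξ 2 ⊕ ((ξ 0 ⊕ # 1) ⊕ # 1)) (# 1 ⊕ (# 1 ⊕ (ξ 1 ⊕ ξ 2))) (1 ∷ 1 ∷ []) (# 0) refl (clen , tt))
    where
    open Strand S
    open ↭-Solver
    qs = cs ++ w ∷ []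
    lastq : lastOf (lastOf e ps) qs ≡ w
    lastq = lastOf-++ (lastOf e ps) cs w []
    lastp : lastOf e (ps ++ qs ++ y ∷ []) ≡ y
    lastp = trans (lastOf-append e ps (qs ++ y ∷ [])) (lastOf-++ (lastOf e ps) qs y [])
    lenq : length (ps ++ (cs ++ w ∷ []) ++ y ∷ []) ≡ length ps + ((length cs + 1) + 1)
    lenq = trans (Listₚ.length-++ ps) (cong (length ps +_) (trans (Listₚ.length-++ (cs ++ w ∷ [])) (cong (_+ 1) (Listₚ.length-++ cs))))
    w≢y : w ≢ y
    w≢y refl = false≢true (irr w) wy
    inc : ∀ {x} → x ∈ qs ++ y ∷ [] → x ∈ cs ⊎ x ≡ w ⊎ x ≡ y
    inc p with ∈-++⁻ qs p
    ... | inj₂ (here refl) = inj₂ (inj₂ refl)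
    ... | inj₁ q with ∈-++⁻ cs q
    ...   | inj₁ s = inj₁ s
    ...   | inj₂ (here refl) = inj₂ (inj₁ refl)
    uq : Unique (qs ++ y ∷ [])
    uq = Uniqueₚ.++⁺ (Uniqueₚ.++⁺ cu ([] ∷ []) λ { (p , here refl) → proj₂ (cin p) (here refl) }) ([] ∷ [])
      λ { (p , here refl) → case (∈-++⁻ cs p) }
      where
      case : y ∈ cs ⊎ y ∈ w ∷ [] → ⊥
      case (inj₁ q) = proj₂ (cin q) (there (here refl))
      case (inj₂ (here q)) = w≢y (sym q)
    disj : ∀ {x} → x ∈ qs ++ y ∷ [] → x ∈ e ∷ ps → ⊥
    disj p q with inc p
    ... | inj₁ s = proj₂ (cin s) (there (there (∈-++⁺ʳ X q)))
    ... | inj₂ (inj₁ refl) = w∉ q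
    ... | inj₂ (inj₂ refl) = y∉ q
    ins : ∀ {x} → x ∈ e ∷ ps ⊎ x ∈ qs ++ y ∷ [] → x ∈ vs × x ∉ X
    ins (inj₁ p) = inside p
    ins (inj₂ p) with inc p
    ... | inj₁ s = proj₁ (cin s) , λ q → proj₂ (cin s) (there (there (∈-++⁺ˡ q)))
    ... | inj₂ (inj₁ refl) = w∈ , w∉X
    ... | inj₂ (inj₂ refl) = y∈ , y∉X

  opaque
    extend : ∀ {X e hx hy} (S : Strand X e hx hy) {w y} → E w y ≡ true → E (lastOf hy (Strand.ys S)) y ≡ true →
      w ∈ vs → y ∈ vs → w ∉ e ∷ Strand.ps S → y ∉ e ∷ Strand.ps S → w ∉ X → y ∉ X →
      length X + (3 + length (Strand.ps S)) ≤ f →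
      Σ (Strand X e hy hx) λ S′ → lastOf hx (Strand.ys S′) ≡ w × lastOf hy (Strand.xs S′) ≡ y ×
        length (Strand.ps S′) ≤ 2 + r + length (Strand.ps S)
    extend = extend′

  swapped : ℕ → V → V → V
  swapped zero    x y = x
  swapped (suc j) x y = swapped j y x

  -- The free end descends through the layers. It jumps to some `y` whose predecessor `w` in the
  -- factor is one layer lower, and after the exchange of roles `w` is the new free end. In layer
  -- zero the jump goes to `t`, whose predecessor is `a`.
  braid′ : ∀ {X e t a} (a→t : (a , t) ∈ as) → a ∉ X → t ∉ X → ∀ j {hx hy} (S : Strand (a ∷ t ∷ X) e hx hy) →
    good t j (lastOf hy (Strand.ys S)) ≡ true →
    2 · (length X + (6 + length (Strand.ps S) + j * (2 + r))) ≤ f →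
    Σ (Strand X e (swapped j hy hx) (swapped j hx hy)) λ S′ →
      lastOf (swapped j hx hy) (Strand.ys S′) ≡ a × length (Strand.ps S′) ≤ (1 + j) * (2 + r) + length (Strand.ps S)
  braid′ {X} {e} {t} {a} a→t a∉X t∉X zero {hx} {hy} S p len
    with extend {X} S₀ (real a→t) p (fst-∈ a→t) (snd-∈ a→t)
      (λ q → proj₂ (Strand.inside S q) (here refl)) (λ q → proj₂ (Strand.inside S q) (there (here refl))) a∉X t∉X (
          lin-≤ (length X ∷ length (Strand.ps S) ∷ r ∷ f ∷ [])
            ((2 ⊙ (ξ 0 ⊕ ((# 6 ⊕ ξ 1) ⊕ (# 0 ⊗ (# 2 ⊕ ξ 2)))) , ξ 3) ∷ [])
            (ξ 0 ⊕ (# 3 ⊕ ξ 1)) (ξ 3) (1 ∷ 1 ∷ []) (ξ 0 ⊕ ξ 1 ⊕ # 9) refl (len , tt))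
    where
    S₀ : Strand X e hx hy
    S₀ = record { ps = Strand.ps S ; xs = Strand.xs S ; ys = Strand.ys S ; chain = Strand.chain S ; chainx = Strand.chainx S
                ; chainy = Strand.chainy S ; lastx = Strand.lastx S ; perm = Strand.perm S ; unique = Strand.unique S
                ; inside = λ q → proj₁ (Strand.inside S q) , λ r → proj₂ (Strand.inside S q) (there (there r)) }
  ... | S′ , l , _ , b = S′ , l , (lin-≤ (length (Strand.ps S′) ∷ r ∷ length (Strand.ps S) ∷ [])
        ((ξ 0 , # 1 ⊕ (# 1 ⊕ (ξ 1 ⊕ ξ 2))) ∷ [])
        (ξ 0) (# 1 ⊕ (# 1 ⊕ ((ξ 1 ⊕ # 0) ⊕ ξ 2))) (1 ∷ 1 ∷ []) (# 0) refl (b , tt))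
  braid′ {X} {e} {t} {a} a→t a∉X t∉X (suc j) {hx} {hy} S p len
    -- Avoiding the successors of `U` as well keeps the predecessor of the chosen head out of `U`.
    -- This doubles the forbidden set, whence the factor 2 in the space required.
    with step-good {t} {j} (U ++ succs as U) (ℕₚ.≤-trans (ℕₚ.≤-reflexive (Listₚ.length-++ U)) (
        lin-≤ (length (succs as U) ∷ length (X ++ e ∷ Strand.ps S) ∷ length X ∷ length (Strand.ps S) ∷ j ∷ r ∷ f ∷ [])
          ((ξ 0 , # 1 ⊕ (# 1 ⊕ ξ 1)) ∷ (# 1 ⊕ (# 1 ⊕ ξ 1) , (ξ 2 ⊕ # 3) ⊕ ξ 3) ∷
           (2 ⊙ (ξ 2 ⊕ ((# 6 ⊕ ξ 3) ⊕ ((# 1 ⊕ ξ 4) ⊗ (# 2 ⊕ ξ 5)))) , ξ 6) ∷ [])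
          ((# 1 ⊕ (# 1 ⊕ ξ 1)) ⊕ ξ 0) (ξ 6) (1 ∷ 1 ∷ 2 ∷ 1 ∷ []) (2 ⊙ (ξ 4 ⊗ ξ 5) ⊕ 4 ⊙ ξ 4 ⊕ 2 ⊙ ξ 5 ⊕ # 10) refl
          (length-succs as U fsts uniq , ℕₚ.≤-reflexive lenU , len , tt))) p
    where
    U = (a ∷ t ∷ X) ++ e ∷ Strand.ps S
    lenU : length U ≡ length X + 3 + length (Strand.ps S)
    lenU = trans (cong (2 +_) (Listₚ.length-++ X)) (norm-≡ (length X ∷ length (Strand.ps S) ∷ [])
        (# 2 ⊕ (ξ 0 ⊕ (# 1 ⊕ ξ 1))) ((ξ 0 ⊕ # 3) ⊕ ξ 1) refl)
  ... | y , w , y∈ , y∉ , ey , m , q with extend S (real m) ey (fst-∈ m) y∈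
        (λ z → y∉ (∈-++⁺ʳ U (succs-∈ as U m (∈-++⁺ʳ (a ∷ t ∷ X) z)))) (λ z → y∉ (∈-++⁺ˡ (∈-++⁺ʳ (a ∷ t ∷ X) z)))
        (λ z → y∉ (∈-++⁺ʳ U (succs-∈ as U m (∈-++⁺ˡ z)))) (λ z → y∉ (∈-++⁺ˡ (∈-++⁺ˡ z))) (
            lin-≤ (length X ∷ length (Strand.ps S) ∷ r ∷ j ∷ f ∷ [])
              ((2 ⊙ (ξ 0 ⊕ (# 1 ⊕ (# 1 ⊕ (# 1 ⊕ (# 1 ⊕ (# 1 ⊕ (# 1 ⊕ (ξ 1 ⊕ (# 1 ⊕ (# 1 ⊕ (ξ 2 ⊕ (ξ 3 ⊗ (# 1 ⊕ (# 1 ⊕ ξ 2)))))))))))))) , ξ 4) ∷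
               [])
              ((# 1 ⊕ (# 1 ⊕ ξ 0)) ⊕ (# 3 ⊕ ξ 1)) (ξ 4) (1 ∷ 1 ∷ [])
               (2 ⊙ (ξ 2 ⊗ ξ 3) ⊕ ξ 0 ⊕ ξ 1 ⊕ 2 ⊙ ξ 2 ⊕ 4 ⊙ ξ 3 ⊕ # 11) refl
              (len , tt))
    where
    U = (a ∷ t ∷ X) ++ e ∷ Strand.ps S
  ...   | S₁ , l₁ , _ , b₁ with braid′ a→t a∉X t∉X j S₁ (subst (λ z → good t j z ≡ true) (sym l₁) q) (
      lin-≤ (length X ∷ length (Strand.ps S) ∷ r ∷ j ∷ f ∷ length (Strand.ps S₁) ∷ [])
        ((2 ⊙ (ξ 0 ⊕ (# 1 ⊕ (# 1 ⊕ (# 1 ⊕ (# 1 ⊕ (# 1 ⊕ (# 1 ⊕ (ξ 1 ⊕ (# 1 ⊕ (# 1 ⊕ (ξ 2 ⊕ (ξ 3 ⊗ (# 1 ⊕ (# 1 ⊕ ξ 2)))))))))))))) , ξ 4) ∷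
         (ξ 5 , # 1 ⊕ (# 1 ⊕ (ξ 2 ⊕ ξ 1))) ∷ [])
        (2 ⊙ (ξ 0 ⊕ ((# 6 ⊕ ξ 5) ⊕ (ξ 3 ⊗ (# 2 ⊕ ξ 2))))) (ξ 4) (1 ∷ 1 ∷ 2 ∷ []) (# 0) refl (len , b₁ , tt))
  ...     | S₂ , l₂ , b₂ = S₂ , l₂ ,
      (lin-≤ (length (Strand.ps S₁) ∷ r ∷ length (Strand.ps S) ∷ length (Strand.ps S₂) ∷ j ∷ [])
        ((ξ 0 , # 1 ⊕ (# 1 ⊕ (ξ 1 ⊕ ξ 2))) ∷ (ξ 3 , # 1 ⊕ (# 1 ⊕ ((ξ 1 ⊕ (ξ 4 ⊗ (# 1 ⊕ (# 1 ⊕ ξ 1)))) ⊕ ξ 0))) ∷ [])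
        (ξ 3) (# 1 ⊕ (# 1 ⊕ ((ξ 1 ⊕ (# 1 ⊕ (# 1 ⊕ (ξ 1 ⊕ (ξ 4 ⊗ (# 1 ⊕ (# 1 ⊕ ξ 1))))))) ⊕ ξ 2))) (1 ∷ 1 ∷ 1 ∷ [])
         (# 0) refl
        (b₁ , b₂ , tt))

  opaque
    braid : ∀ {X e t a} (a→t : (a , t) ∈ as) → a ∉ X → t ∉ X → ∀ j {hx hy} (S : Strand (a ∷ t ∷ X) e hx hy) →
      good t j (lastOf hy (Strand.ys S)) ≡ true →
      2 · (length X + (6 + length (Strand.ps S) + j * (2 + r))) ≤ f →
      Σ (Strand X e (swapped j hy hx) (swapped j hx hy)) λ S′ →
        lastOf (swapped j hx hy) (Strand.ys S′) ≡ a × length (Strand.ps S′) ≤ (1 + j) * (2 + r) + length (Strand.ps S)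
    braid = braid′

module _ {A : Set} {n : ℕ} where
  private V = Fin n

  -- Double counting of the related pairs whose second entry avoids `F`: some `y` reaches the
  -- average. Such a `y` is not in `F`, because its count would then be zero while the average is
  -- positive.
  averaging′ : ∀ (xs : List A) (vs : List V) (rel : A → V → Bool) (F : List V) (m f : ℕ) → Unique vs →
    0 < length xs → 0 < m → length F ≤ f → (∀ {x} → x ∈ xs → m + f ≤ cnt (rel x) vs) →
    ∃ λ y → y ∈ vs × y ∉ F × length xs * m ≤ length vs * cnt (λ x → rel x y) xs
  averaging′ xs vs rel F m f u 0<l 0<m lF h with ∃-sumOf-≤ {f = λ _ → length xs * m} {g = λ y → length vs * c y} vs 0<N sums
    where
    c : V → ℕ
    c y = cnt (λ x → rel x y ∧ not (mem y F)) xs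
    0<N : 0 < length vs
    0<N = go xs 0<l h
      where
      go : ∀ xs → 0 < length xs → (∀ {x} → x ∈ xs → m + f ≤ cnt (rel x) vs) → 0 < length vs
      go (x ∷ _) _ h′ = ℕₚ.<-≤-trans 0<m (ℕₚ.≤-trans (ℕₚ.m≤m+n m f) (ℕₚ.≤-trans (h′ (here refl)) (cnt≤length (rel x) vs)))
    each : ∀ {x} → x ∈ xs → m ≤ cnt (λ y → rel x y ∧ not (mem y F)) vs
    each {x} x∈ = ℕₚ.+-cancelʳ-≤ f m _ (ℕₚ.≤-trans (h x∈) (ℕₚ.≤-trans (cnt-avoid (rel x) F vs u) (ℕₚ.+-monoʳ-≤ _ lF)))
    total : length xs * m ≤ sumOf c vs
    total = ℕₚ.≤-trans (ℕₚ.≤-reflexive (sym (sumOf-const m xs)))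
      (ℕₚ.≤-trans (sumOf-mono xs each) (ℕₚ.≤-reflexive (sumOf-swap (λ x y → b2n (rel x y ∧ not (mem y F))) xs vs)))
    sums : sumOf (λ _ → length xs * m) vs ≤ sumOf (λ y → length vs * c y) vs
    sums = ℕₚ.≤-trans (ℕₚ.≤-reflexive (sumOf-const (length xs * m) vs))
      (ℕₚ.≤-trans (ℕₚ.*-monoʳ-≤ (length vs) total) (ℕₚ.≤-reflexive (sym (sumOf-* (length vs) c vs))))
  ... | y , y∈ , q with mem y F in eq
  ...   | false = y , y∈ , mem⇒∉ eq , ℕₚ.≤-trans q (ℕₚ.*-monoʳ-≤ (length vs) (cnt-mono xs λ {x} _ p → proj₁ (∧-split {rel x y} p)))
  ...   | true = ⊥-elim (ℕₚ.<⇒≱ (ℕₚ.*-mono-< 0<l 0<m) (ℕₚ.≤-trans q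
            (ℕₚ.≤-reflexive (trans (cong (length vs *_) (cnt-zero xs λ {x} _ → Boolₚ.∧-zeroʳ (rel x y))) (ℕₚ.*-zeroʳ (length vs))))))

  opaque
    averaging : ∀ (xs : List A) (vs : List V) (rel : A → V → Bool) (F : List V) (m f : ℕ) → Unique vs →
      0 < length xs → 0 < m → length F ≤ f → (∀ {x} → x ∈ xs → m + f ≤ cnt (rel x) vs) →
      ∃ λ y → y ∈ vs × y ∉ F × length xs * m ≤ length vs * cnt (λ x → rel x y) xs
    averaging = averaging′

module _ {n : ℕ} where
  private V = Fin n

  -- A cycle with an arc from `v` to `v′` is cut there and spliced in as e ... a → v′ ... v → b ...
  -- end.
  Serves : (V → V → Bool) → V → List V → V → V → Set
  Serves E e ps v v′ = ∃₂ λ b a → Splits E e ps b a × E v b ≡ true × E a v′ ≡ true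

  module _ {E : V → V → Bool} where
    open ↭-Solver

    serves-after : ∀ {e ps v v′} e₀ qs → Chain E e₀ (qs ++ e ∷ []) → Serves E e ps v v′ → Serves E e₀ (qs ++ e ∷ ps) v v′
    serves-after {e} {ps} e₀ qs ch (b , a , S , p , q) = b , a , record
      { as = qs ++ e ∷ as ; bs = bs
      ; perm = ↭-trans (↭ₚ.++⁺ˡ (e₀ ∷ qs) perm)
          (solve 4 (λ a b c d → (a ⊞ ((b ⊞ c) ⊞ d)) ⊜ ((a ⊞ (b ⊞ c)) ⊞ d)) ↭-refl (e₀ ∷ qs) (e ∷ []) as (b ∷ bs))
      ; lasta = trans (lastOf-++ e₀ qs e as) lasta
      ; lastb = trans lastb (sym (lastOf-++ e₀ qs e ps))
      ; chaina = subst (Chain E e₀) (Listₚ.++-assoc qs (e ∷ []) as)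
          (chain-append e₀ (qs ++ e ∷ []) as ch (subst (λ z → Chain E z as) (sym (lastOf-++ e₀ qs e [])) chaina))
      ; chainb = chainb } , p , q
      where open Splits S

    serves-before : ∀ {e ps v v′} rs → Chain E (lastOf e ps) rs → Serves E e ps v v′ → Serves E e (ps ++ rs) v v′
    serves-before {e} {ps} rs ch (b , a , S , p , q) = b , a , record
      { as = as ; bs = bs ++ rs
      ; perm = ↭-trans (↭ₚ.++⁺ʳ rs perm) (↭-reflexive (Listₚ.++-assoc (e ∷ as) (b ∷ bs) rs))
      ; lasta = lasta
      ; lastb = trans (lastOf-append b bs rs) (trans (cong (λ z → lastOf z rs) lastb) (sym (lastOf-append e ps rs)))
      ; chaina = chaina
      ; chainb = chain-append b bs rs chainb (subst (λ z → Chain E z rs) (sym lastb) ch) } , p , q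
      where open Splits S

    absorb-one : ∀ {e ps} v′ us → Chain E v′ us → Serves E e ps (lastOf v′ us) v′ →
      ∃ λ ps′ → Chain E e ps′ × lastOf e ps′ ≡ lastOf e ps × e ∷ ps′ ↭ (e ∷ ps) ++ v′ ∷ us
    absorb-one {e} {ps} v′ us ch (b , a , S , p , q) = as ++ (v′ ∷ us) ++ b ∷ bs
      , chain-append e as _ chaina (chain-∷ (subst (λ z → E z v′ ≡ true) (sym lasta) q)
          (chain-append v′ us (b ∷ bs) ch (chain-∷ p chainb)))
      , trans (lastOf-append e as ((v′ ∷ us) ++ b ∷ bs)) (trans (lastOf-++ (lastOf e as) (v′ ∷ us) b bs) lastb)
      , ↭-trans (solve 3 (λ a b c → (a ⊞ (b ⊞ c)) ⊜ ((a ⊞ c) ⊞ b)) ↭-refl (e ∷ as) (v′ ∷ us) (b ∷ bs)) (↭ₚ.++⁺ʳ (v′ ∷ us) (↭-sym perm))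
      where open Splits S

    -- A block that has swallowed a cycle is spent, so the index `K` of blocks bounds the number of
    -- cycles that can be absorbed. Each block serves every pair of `S`, hence any cycle may be
    -- given to any block.
    data Absorber (S : V → V → Set) : ℕ → V → List V → Set where
      base : ∀ {e ps} → Chain E e ps → Absorber S 0 e ps
      more : ∀ {K e ps cs e′ ps′} → Absorber S K e ps → Chain E (lastOf e ps) (cs ++ e′ ∷ []) → Chain E e′ ps′ →
        (∀ {v v′} → S v v′ → Serves E e′ ps′ v v′) → Absorber S (suc K) e (ps ++ cs ++ e′ ∷ ps′)

    absorber-chain : ∀ {S K e ps} → Absorber S K e ps → Chain E e ps
    absorber-chain (base c) = c
    absorber-chain (more {e = e} {ps} {cs} {e′} {ps′} A c c′ s) = chain-append e ps _ (absorber-chain A)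
      (subst (Chain E _) (Listₚ.++-assoc cs (e′ ∷ []) ps′)
        (chain-append _ (cs ++ e′ ∷ []) ps′ c (subst (λ z → Chain E z ps′) (sym (lastOf-++ _ cs e′ [])) c′)))

    absorb-all : ∀ {S K e ps} → Absorber S K e ps → (cs : List (Cyc V)) → length cs ≤ K →
      (∀ {x xs} → (x , xs) ∈ cs → Chain E x xs × S (lastOf x xs) x) →
      ∃ λ ps′ → Chain E e ps′ × lastOf e ps′ ≡ lastOf e ps × e ∷ ps′ ↭ (e ∷ ps) ++ allVerts cs
    absorb-all A [] le h = _ , absorber-chain A , refl , ↭-sym (↭ₚ.++-identityʳ _)
    absorb-all (more {e = e} {ps} {mid} {e′} {ps′} A c c′ s) ((x , xs) ∷ cs) (s≤s le) h
      with absorb-all A cs le (h ∘ there) | absorb-one {e′} {ps′} x xs (proj₁ (h (here refl))) (s (proj₂ (h (here refl))))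
    ... | ps₁ , ch₁ , l₁ , p₁ | ps₂ , ch₂ , l₂ , p₂ = ps₁ ++ mid ++ e′ ∷ ps₂
      , chain-append e ps₁ _ ch₁ (subst (λ z → Chain E z (mid ++ e′ ∷ ps₂)) (sym l₁)
          (subst (Chain E (lastOf e ps)) (Listₚ.++-assoc mid (e′ ∷ []) ps₂)
            (chain-append _ (mid ++ e′ ∷ []) ps₂ c (subst (λ z → Chain E z ps₂) (sym (lastOf-++ _ mid e′ [])) ch₂))))
      , trans (lastOf-append e ps₁ (mid ++ e′ ∷ ps₂)) (trans (lastOf-++ (lastOf e ps₁) mid e′ ps₂)
          (trans l₂ (sym (trans (lastOf-append e ps (mid ++ e′ ∷ ps′)) (lastOf-++ (lastOf e ps) mid e′ ps′)))))
      , ↭-trans (↭ₚ.++⁺ p₁ (↭ₚ.++⁺ˡ mid p₂))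
          (solve 5 (λ a b c d e → ((a ⊞ b) ⊞ (c ⊞ (d ⊞ e))) ⊜ ((a ⊞ (c ⊞ d)) ⊞ (e ⊞ b))) ↭-refl
            (e ∷ ps) (allVerts cs) mid (e′ ∷ ps′) (x ∷ xs))

  preds : List (V × V) → List V → List V
  preds as U = map proj₁ (filterᵇ (λ a → mem (proj₂ a) U) as)

  preds-∈ : ∀ as U {w y} → (w , y) ∈ as → y ∈ U → w ∈ preds as U
  preds-∈ ((w , y) ∷ as) U (here refl) q rewrite ∈⇒mem q = here refl
  preds-∈ ((w′ , z) ∷ as) U (there p) q with mem z U
  ... | true  = there (preds-∈ as U p q)
  ... | false = preds-∈ as U p q

  length-preds : ∀ as U {vs} → map proj₂ as ↭ vs → Unique vs → length (preds as U) ≤ length U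
  length-preds as U {vs} p u = begin
    length (preds as U)                             ≡⟨ Listₚ.length-map proj₁ (filterᵇ (λ a → mem (proj₂ a) U) as) ⟩
    length (filterᵇ (λ a → mem (proj₂ a) U) as)     ≡⟨ length-filter _ as ⟩
    cnt (λ a → mem (proj₂ a) U) as                  ≡⟨ sumOf-map _ proj₂ as ⟨
    cnt (λ x → mem x U) (map proj₂ as)              ≡⟨ cnt-↭ (λ x → mem x U) p ⟩
    cnt (λ x → mem x U) vs                          ≤⟨ cnt-mem U vs u ⟩
    length U                                        ∎
    where open ℕₚ.≤-Reasoning

-- Blocks of gadgets that serve all pairs

module Rounds {n : ℕ} {vs : List (Fin n)} {E : Fin n → Fin n → Bool} {ko ki : Fin n → Bool} {d f h g : ℕ}
              (R : Robust vs E ko ki d f h g) (0<g : 0 < g) (gf<d : g + f < d)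
              (irr : ∀ x → E x x ≡ false)
              {as : List (Fin n × Fin n)} (F : Factor vs ko ki as) (real : ∀ {x y} → (x , y) ∈ as → E x y ≡ true)
              (r : ℕ) (connects : Connects vs E f r)
              (J : ℕ) (big : length vs < g + J * h)
              (p m : ℕ) (0<m : 0 < m) (mf≤d : m + f ≤ d) (dense : length vs * length vs ≤ (1 + p) * (m * m)) where
  private V = Fin n
  open Robust R
  open Factor F
  open Gadgets R 0<g gf<d irr F real r connects

  -- Braiding extends the strands `2 + (J + J)` times by at most `2 + r` vertices each; the starting
  -- arc and the path that links the gadget to its predecessor fit into the remaining `10 + r`.
  σ : ℕ
  σ = 10 + r + (2 + (J + J)) * (2 + r)

  swapped-even : ∀ k {x y : V} → swapped (k + k) x y ≡ x
  swapped-even zero = refl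
  swapped-even (suc k) {x} {y} = subst (λ j → swapped (suc j) x y ≡ x) (sym (ℕₚ.+-suc k k)) (swapped-even k)

  record Gadget (X : List V) (b a : V) : Set where
    field
      e      : V
      ps     : List V
      chain  : Chain E e ps
      unique : Unique (e ∷ ps)
      inside : ∀ {x} → x ∈ e ∷ ps → x ∈ vs × x ∉ X
      splits : Splits E e ps b a
      small  : suc (length ps) + r ≤ σ

  opaque
    gadget : ∀ {X b a w t} → (w , b) ∈ as → (a , t) ∈ as → ki b ≡ ko a → w ∉ a ∷ t ∷ X → b ∉ a ∷ t ∷ X → a ∉ X → t ∉ X →
      2 · (length X + σ) ≤ f → Gadget X b a
    gadget {X} {b} {a} {w} {t} wb at cl w∉ b∉ a∉ t∉ room with
      -- With the final extension the strands change roles an even number of times in all. So the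
      -- strand that ends at `a` begins at `w`, the first vertex of the gadget, as `Splits` demands.
      braid at a∉ t∉ (suc (J + J)) S₀ (Layers.layers R F 0<g gf<d big (snd-∈ at) (J + J) (ℕₚ.m≤m+n J J) (fst-∈ wb)
        (trans (apure wb) (trans cl (apure at)))) (lin-≤ (length X ∷ r ∷ J ∷ f ∷ [])
              ((2 ⊙ (ξ 0 ⊕ ((# 10 ⊕ ξ 1) ⊕ ((# 2 ⊕ (ξ 2 ⊕ ξ 2)) ⊗ (# 2 ⊕ ξ 1)))) , ξ 3) ∷ [])
              (2 ⊙ (ξ 0 ⊕ ((# 6 ⊕ # 1) ⊕ ((# 1 ⊕ (ξ 2 ⊕ ξ 2)) ⊗ (# 2 ⊕ ξ 1))))) (ξ 3) (1 ∷ 1 ∷ []) (4 ⊙ ξ 1 ⊕ # 10)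
               refl
              (room , tt))
      where
      S₀ : Strand (a ∷ t ∷ X) w b w
      S₀ = record { ps = b ∷ [] ; xs = [] ; ys = [] ; chain = chain-1 (real wb) ; chainx = λ () ; chainy = λ ()
        ; lastx = refl ; perm = swap w b ↭-refl
        ; unique = ((λ { refl → false≢true (irr w) (real wb) }) ∷ []) ∷ ([] ∷ [])
        ; inside = λ { (here refl) → fst-∈ wb , w∉ ; (there (here refl)) → snd-∈ wb , b∉ } }
    ... | S , l , len = record
      { e = w ; ps = Strand.ps S ; chain = Strand.chain S ; unique = Strand.unique S ; inside = Strand.inside S
      ; splits = record
        { as = Strand.ys S ; bs = Strand.xs S
        ; perm = ↭-trans (Strand.perm S) (↭-trans (↭ₚ.++-comm (swapped (J + J) b w ∷ Strand.xs S) (swapped (J + J) w b ∷ Strand.ys S))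
            (↭-reflexive (cong₂ (λ x y → (x ∷ Strand.ys S) ++ y ∷ Strand.xs S) ew eb)))
        ; lasta = subst (λ z → lastOf z (Strand.ys S) ≡ a) ew l
        ; lastb = subst (λ z → lastOf z (Strand.xs S) ≡ lastOf w (Strand.ps S)) eb (Strand.lastx S)
        ; chaina = subst (λ z → Chain E z (Strand.ys S)) ew (Strand.chainy S)
        ; chainb = subst (λ z → Chain E z (Strand.xs S)) eb (Strand.chainx S) }
      ; small = (lin-≤ (length (Gadgets.Strand.ps S) ∷ r ∷ J ∷ [])
            ((ξ 0 , # 1 ⊕ (# 1 ⊕ ((ξ 1 ⊕ (# 1 ⊕ (# 1 ⊕ (ξ 1 ⊕ ((ξ 2 ⊕ ξ 2) ⊗ (# 1 ⊕ (# 1 ⊕ ξ 1))))))) ⊕ # 1))) ∷ [])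
            ((# 1 ⊕ ξ 0) ⊕ ξ 1) ((# 10 ⊕ ξ 1) ⊕ ((# 2 ⊕ (ξ 2 ⊕ ξ 2)) ⊗ (# 2 ⊕ ξ 1))) (1 ∷ 1 ∷ []) (# 8) refl
            (len , tt)) }
      where
      ew : swapped (J + J) w b ≡ w
      ew = swapped-even J
      eb : swapped (J + J) b w ≡ b
      eb = swapped-even J

  pred-of : ∀ {y} → y ∈ vs → ∃ λ w → (w , y) ∈ as
  pred-of y∈ with ∈-map⁻ proj₂ (↭ₚ.∈-resp-↭ (↭-sym snds) y∈)
  ... | (w , _) , q , refl = w , q

  succ-of : ∀ {w} → w ∈ vs → ∃ λ y → (w , y) ∈ as
  succ-of w∈ with ∈-map⁻ proj₁ (↭ₚ.∈-resp-↭ (↭-sym fsts) w∈)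
  ... | (_ , y) , q , refl = y , q

  PairsOK : List (V × V) → Set
  PairsOK U = ∀ {v v′} → (v , v′) ∈ U → v ∈ vs × v′ ∈ vs × ko v ≡ ki v′

  servedBy : V → V → V × V → Bool
  servedBy b a (v , v′) = E v b ∧ E a v′

  filter-⊆ : ∀ {A : Set} (P : A → Bool) {x} xs → x ∈ filterᵇ P xs → x ∈ xs × P x ≡ true
  filter-⊆ P (y ∷ ys) q with P y in eq
  filter-⊆ P (y ∷ ys) (here refl) | true = here refl , eq
  filter-⊆ P (y ∷ ys) (there q) | true = let (a , b) = filter-⊆ P ys q in there a , b
  filter-⊆ P (y ∷ ys) q | false = let (a , b) = filter-⊆ P ys q in there a , b

  ∈-filterᵇ : ∀ {A : Set} (P : A → Bool) {x} xs → x ∈ xs → P x ≡ true → x ∈ filterᵇ P xs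
  ∈-filterᵇ P (y ∷ ys) (here refl) e rewrite e = here refl
  ∈-filterᵇ P (y ∷ ys) (there q) e with P y
  ... | true  = there (∈-filterᵇ P ys q e)
  ... | false = ∈-filterᵇ P ys q e

  -- First `b` is chosen by averaging over all pairs, then `a` over the pairs with `v → b`. Each
  -- choice keeps a fraction of at least `m / length vs`, and `dense` turns the product of the two
  -- into `1 / (1 + p)`.
  serve′ : ∀ X U → PairsOK U → 0 < length U → 2 · (length X + σ) ≤ f →
    ∃₂ λ b a → Gadget X b a × (1 + p) * cnt (not ∘ servedBy b a) U ≤ p * length U
  serve′ X U ok 0<U room
    with averaging U vs (λ (v , v′) b → E v b) (X ++ succs as X) m f uniq 0<U 0<m
      (ℕₚ.≤-trans (ℕₚ.≤-reflexive (Listₚ.length-++ X)) (lin-≤ (length (succs as X) ∷ length X ∷ r ∷ J ∷ f ∷ [])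
            ((ξ 0 , ξ 1) ∷ (2 ⊙ (ξ 1 ⊕ ((# 10 ⊕ ξ 2) ⊕ ((# 2 ⊕ (ξ 3 ⊕ ξ 3)) ⊗ (# 2 ⊕ ξ 2)))) , ξ 4) ∷ [])
            (ξ 1 ⊕ ξ 0) (ξ 4) (1 ∷ 1 ∷ 1 ∷ []) (4 ⊙ (ξ 2 ⊗ ξ 3) ⊕ 6 ⊙ ξ 2 ⊕ 8 ⊙ ξ 3 ⊕ # 28) refl
            (length-succs as X fsts uniq , room , tt)))
      (λ q → ℕₚ.≤-trans mf≤d (deg-out (proj₁ (ok q))))
  ... | b , b∈ , b∉ , avb with pred-of b∈
  ...   | w , wb with averaging U₁ vs (λ (v , v′) a → E a v′) (X₁ ++ preds as X₁) m f uniq 0<U₁ 0<m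
          (ℕₚ.≤-trans (ℕₚ.≤-reflexive (Listₚ.length-++ X₁)) (lin-≤ (length (preds as X₁) ∷ length X ∷ r ∷ J ∷ f ∷ [])
                ((ξ 0 , # 1 ⊕ (# 1 ⊕ ξ 1)) ∷
                 (2 ⊙ (ξ 1 ⊕ (# 1 ⊕ (# 1 ⊕ (# 1 ⊕ (# 1 ⊕ (# 1 ⊕ (# 1 ⊕ (# 1 ⊕ (# 1 ⊕ (# 1 ⊕ (# 1 ⊕ (ξ 2 ⊕ (# 1 ⊕ (# 1 ⊕ (ξ 2 ⊕ (# 1 ⊕ (# 1 ⊕ (ξ 2 ⊕ ((ξ 3 ⊕ ξ 3) ⊗ (# 1 ⊕ (# 1 ⊕ ξ 2))))))))))))))))))))) , ξ 4) ∷
                 [])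
                ((# 1 ⊕ (# 1 ⊕ ξ 1)) ⊕ ξ 0) (ξ 4) (1 ∷ 1 ∷ 1 ∷ []) (4 ⊙ (ξ 2 ⊗ ξ 3) ⊕ 6 ⊙ ξ 2 ⊕ 8 ⊙ ξ 3 ⊕ # 24) refl
                (length-preds as X₁ snds uniq , room , tt)))
          (λ {x} q → ℕₚ.≤-trans mf≤d (deg-in (proj₁ (proj₂ (ok (proj₁ (filter-⊆ (λ (v , v′) → E v b) {x} U q)))))))
    where
    X₁ = b ∷ w ∷ X
    U₁ = filterᵇ (λ (v , v′) → E v b) U
    0<U₁ : 0 < length U₁
    0<U₁ rewrite length-filter (λ (v , v′) → E v b) U = ℕₚ.n≢0⇒n>0 λ e →
      ℕₚ.<⇒≱ (ℕₚ.*-mono-< 0<U 0<m) (ℕₚ.≤-trans avb (ℕₚ.≤-reflexive (trans (cong (length vs *_) e) (ℕₚ.*-zeroʳ (length vs)))))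
  ...     | a , a∈ , a∉ , ava with succ-of a∈
  ...       | t , at = b , a , gadget wb at cl w∉ b∉′ (λ q → a∉ (∈-++⁺ˡ (there (there q)))) (λ q → a∉ (∈-++⁺ʳ X₁ (preds-∈ as X₁ at (there (there q))))) room , bound
    where
    X₁ = b ∷ w ∷ X
    U₁ = filterᵇ (λ (v , v′) → E v b) U
    c = cnt (servedBy b a) U
    k : ℕ
    k = length U₁
    k₂ : ℕ
    k₂ = cnt (λ (v , v′) → E a v′) U₁
    k₂≡ : k₂ ≡ c
    k₂≡ = cnt-filter (λ (v , v′) → E v b) (λ (v , v′) → E a v′) U
    k≡ : k ≡ cnt (λ (v , v′) → E v b) U
    k≡ = length-filter (λ (v , v′) → E v b) U
    N = length vs
    key : length U * (m * m) ≤ (N * N) * c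
    key = begin
      length U * (m * m)  ≡⟨ ℕₚ.*-assoc (length U) m m ⟨
      (length U * m) * m  ≤⟨ ℕₚ.*-monoˡ-≤ m avb ⟩
      (N * cnt (λ (v , v′) → E v b) U) * m ≡⟨ cong (λ z → (N * z) * m) (sym k≡) ⟩
      (N * k) * m         ≡⟨ ℕₚ.*-assoc N k m ⟩
      N * (k * m)         ≤⟨ ℕₚ.*-monoʳ-≤ N ava ⟩
      N * (N * k₂)        ≡⟨ cong (λ z → N * (N * z)) k₂≡ ⟩
      N * (N * c)         ≡⟨ ℕₚ.*-assoc N N c ⟨
      (N * N) * c         ∎
      where open ℕₚ.≤-Reasoning
    U≤ : length U ≤ (1 + p) * c
    U≤ = ℕₚ.*-cancelʳ-≤ (length U) ((1 + p) * c) (m * m) {{ℕₚ.m*n≢0 m m {{ℕ.>-nonZero 0<m}} {{ℕ.>-nonZero 0<m}}}}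
      (ℕₚ.≤-trans key (ℕₚ.≤-trans (ℕₚ.*-monoˡ-≤ c dense) (ℕₚ.≤-reflexive (norm-≡ (m ∷ p ∷ c ∷ [])
          (((ξ 0 ⊗ ξ 0) ⊕ (ξ 1 ⊗ (ξ 0 ⊗ ξ 0))) ⊗ ξ 2) (((# 1 ⊕ ξ 1) ⊗ ξ 2) ⊗ (ξ 0 ⊗ ξ 0)) refl))))
    bound : (1 + p) * cnt (not ∘ servedBy b a) U ≤ p * length U
    bound = lin-≤ (length U ∷ p ∷ c ∷ cnt (λ x → not (servedBy b a x)) U ∷ [])
          ((ξ 0 , (# 1 ⊕ ξ 1) ⊗ ξ 2) ∷ ((# 1 ⊕ ξ 1) ⊗ (ξ 2 ⊕ ξ 3) , (# 1 ⊕ ξ 1) ⊗ ξ 0) ∷ [])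
          ((# 1 ⊕ ξ 1) ⊗ ξ 3) (ξ 1 ⊗ ξ 0) (1 ∷ 1 ∷ 1 ∷ []) (# 0) refl
          (U≤ , ℕₚ.≤-reflexive (cong ((1 + p) *_) (cnt-not (servedBy b a) U)) , tt)
    0<c : 0 < c
    0<c = ℕₚ.n≢0⇒n>0 λ e → ℕₚ.<⇒≱ 0<U (ℕₚ.≤-trans U≤ (ℕₚ.≤-reflexive (trans (cong ((1 + p) *_) e) (ℕₚ.*-zeroʳ (1 + p)))))
    -- At least one pair is served; purity of `v → b` and `a → v′` carries its compatibility over to
    -- `b` and `a`.
    cl : ki b ≡ ko a
    cl with cnt-∃ {P = servedBy b a} U 0<c
    ... | (v , v′) , q , z with ∧-split {E v b} z
    ...   | z₁ , z₂ = trans (sym (pure z₁)) (trans (proj₂ (proj₂ (ok q))) (sym (pure z₂)))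
    w∉ : w ∉ a ∷ t ∷ X
    w∉ (here refl) = a∉ (∈-++⁺ˡ {xs = X₁} (there (here refl)))
    w∉ (there (here refl)) = a∉ (∈-++⁺ʳ X₁ (preds-∈ as X₁ at (there (here refl))))
    w∉ (there (there q)) = b∉ (∈-++⁺ʳ X (succs-∈ as X wb q))
    b∉′ : b ∉ a ∷ t ∷ X
    b∉′ (here refl) = a∉ (∈-++⁺ˡ {xs = X₁} (here refl))
    b∉′ (there (here refl)) = a∉ (∈-++⁺ʳ X₁ (preds-∈ as X₁ at (here refl)))
    b∉′ (there (there q)) = b∉ (∈-++⁺ˡ q)

  opaque
    serve : ∀ X U → PairsOK U → 0 < length U → 2 · (length X + σ) ≤ f →
      ∃₂ λ b a → Gadget X b a × (1 + p) * cnt (not ∘ servedBy b a) U ≤ p * length U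
    serve = serve′

  record Piece (X : List V) : Set where
    field
      e      : V
      ps     : List V
      chain  : Chain E e ps
      unique : Unique (e ∷ ps)
      inside : ∀ {x} → x ∈ e ∷ ps → x ∈ vs × x ∉ X

  record Linked {X} (P Q : Piece X) : Set where
    private
      module P = Piece P
      module Q = Piece Q
    field
      mid    : List V
      link   : Chain E (lastOf P.e P.ps) (mid ++ Q.e ∷ [])
      chain  : Chain E P.e (P.ps ++ mid ++ Q.e ∷ Q.ps)
      unique : Unique (P.e ∷ P.ps ++ mid ++ Q.e ∷ Q.ps)
      inside : ∀ {x} → x ∈ P.e ∷ P.ps ++ mid ++ Q.e ∷ Q.ps → x ∈ vs × x ∉ X
      small  : length mid ≤ r

  piece-of : ∀ {X} {P Q : Piece X} → Linked P Q → Piece X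
  piece-of {_} {P} {Q} K = record { e = Piece.e P ; ps = Piece.ps P ++ mid ++ Piece.e Q ∷ Piece.ps Q
    ; chain = chain ; unique = unique ; inside = inside }
    where open Linked K

  opaque
    link-up : ∀ {X} (P Q : Piece X) → (∀ {x} → x ∈ Piece.e P ∷ Piece.ps P → x ∉ Piece.e Q ∷ Piece.ps Q) →
      length X + (2 + length (Piece.ps P) + length (Piece.ps Q)) ≤ f → Linked P Q
    link-up {X} P Q dis len with connects {lastOf (Piece.e P) (Piece.ps P)} {Piece.e Q}
        (proj₁ (Piece.inside P (lastOf-∈ (Piece.e P) (Piece.ps P)))) (proj₁ (Piece.inside Q (here refl)))
        (X ++ (Piece.e P ∷ Piece.ps P) ++ Piece.e Q ∷ Piece.ps Q)
        (ℕₚ.≤-trans (ℕₚ.≤-reflexive (trans (Listₚ.length-++ X) (cong (λ z → length X + suc z) (Listₚ.length-++ (Piece.ps P))))) (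
            lin-≤ (length X ∷ length (Piece.ps P) ∷ length (Piece.ps Q) ∷ f ∷ [])
              ((ξ 0 ⊕ ((# 2 ⊕ ξ 1) ⊕ ξ 2) , ξ 3) ∷ [])
              (ξ 0 ⊕ (# 1 ⊕ (ξ 1 ⊕ (# 1 ⊕ ξ 2)))) (ξ 3) (1 ∷ 1 ∷ []) (# 0) refl (len , tt)))
    ... | mid , ch , u , ins , le = record
      { mid = mid ; link = ch ; small = le
      ; chain = chain-append P.e P.ps _ P.chain (subst (Chain E _) (Listₚ.++-assoc mid (Q.e ∷ []) Q.ps)
          (chain-append _ (mid ++ Q.e ∷ []) Q.ps ch (subst (λ z → Chain E z Q.ps) (sym (lastOf-++ _ mid Q.e [])) Q.chain)))
      ; unique = Uniqueₚ.++⁺ P.unique (Uniqueₚ.++⁺ u Q.unique λ (a , b) → proj₂ (ins a) (∈-++⁺ʳ X (∈-++⁺ʳ (P.e ∷ P.ps) b)))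
          λ (a , b) → d₂ a (∈-++⁻ mid b)
      ; inside = λ q → in₃ (∈-++⁻ (P.e ∷ P.ps) q) }
      where
      module P = Piece P
      module Q = Piece Q
      d₂ : ∀ {x} → x ∈ P.e ∷ P.ps → x ∈ mid ⊎ x ∈ Q.e ∷ Q.ps → ⊥
      d₂ a (inj₁ b) = proj₂ (ins b) (∈-++⁺ʳ X (∈-++⁺ˡ a))
      d₂ a (inj₂ b) = dis a b
      in₂ : ∀ {x} → x ∈ mid ⊎ x ∈ Q.e ∷ Q.ps → x ∈ vs × x ∉ X
      in₂ (inj₁ b) = proj₁ (ins b) , λ q → proj₂ (ins b) (∈-++⁺ˡ q)
      in₂ (inj₂ b) = Q.inside b
      in₃ : ∀ {x} → x ∈ P.e ∷ P.ps ⊎ x ∈ mid ++ Q.e ∷ Q.ps → x ∈ vs × x ∉ X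
      in₃ (inj₁ a) = P.inside a
      in₃ (inj₂ b) = in₂ (∈-++⁻ mid b)

  size : ∀ {X} → Piece X → ℕ
  size P = length (Piece.ps P)

  size-linked : ∀ {X} {P Q : Piece X} (K : Linked P Q) → size (piece-of K) ≤ size P + (r + (1 + size Q))
  size-linked {_} {P} {Q} K = ℕₚ.≤-trans (ℕₚ.≤-reflexive (trans (Listₚ.length-++ (Piece.ps P)) (cong (size P +_) (Listₚ.length-++ (Linked.mid K)))))
    (ℕₚ.+-monoʳ-≤ (size P) (ℕₚ.+-monoˡ-≤ _ (Linked.small K)))

  record Extension {X : List V} (P : Piece X) (U : List (V × V)) : Set where
    field
      P₁     : Piece X
      b a    : V
      size₁  : size P₁ ≤ size P + σ
      fewer  : (1 + p) * cnt (not ∘ servedBy b a) U ≤ p * length U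
      keeps  : ∀ {v v′} → Serves E (Piece.e P) (Piece.ps P) v v′ → Serves E (Piece.e P₁) (Piece.ps P₁) v v′
      serves : ∀ {v v′} → servedBy b a (v , v′) ≡ true → Serves E (Piece.e P₁) (Piece.ps P₁) v v′

  opaque
    extension : ∀ {X} (P : Piece X) U → PairsOK U → 0 < length U → 2 · (length X + (1 + size P) + σ) ≤ f → Extension P U
    extension {X} P U ok 0<U room = go (serve (X ++ Piece.e P ∷ Piece.ps P) U ok 0<U
        (ℕₚ.≤-trans (ℕₚ.≤-reflexive (cong (λ z → 2 · (z + σ)) (Listₚ.length-++ X))) room))
      where
      go : (∃₂ λ b a → Gadget (X ++ Piece.e P ∷ Piece.ps P) b a × (1 + p) * cnt (not ∘ servedBy b a) U ≤ p * length U) → Extension P U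
      go (b , a , G , bd) = finish (link-up P Q (λ p q → proj₂ (Gadget.inside G q) (∈-++⁺ʳ X p)) (
          lin-≤ (length X ∷ size P ∷ r ∷ J ∷ f ∷ length (Gadget.ps G) ∷ [])
            ((2 ⊙ ((ξ 0 ⊕ (# 1 ⊕ ξ 1)) ⊕ ((# 10 ⊕ ξ 2) ⊕ ((# 2 ⊕ (ξ 3 ⊕ ξ 3)) ⊗ (# 2 ⊕ ξ 2)))) , ξ 4) ∷
             ((# 1 ⊕ ξ 5) ⊕ ξ 2 , (# 10 ⊕ ξ 2) ⊕ ((# 2 ⊕ (ξ 3 ⊕ ξ 3)) ⊗ (# 2 ⊕ ξ 2))) ∷ [])
            (ξ 0 ⊕ ((# 2 ⊕ ξ 1) ⊕ ξ 5)) (ξ 4) (1 ∷ 1 ∷ 1 ∷ [])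
             (2 ⊙ (ξ 2 ⊗ ξ 3) ⊕ ξ 0 ⊕ ξ 1 ⊕ 4 ⊙ ξ 2 ⊕ 4 ⊙ ξ 3 ⊕ # 15) refl
            (room , Gadget.small G , tt)))
       where
       module P = Piece P
       Q : Piece X
       Q = record { e = Gadget.e G ; ps = Gadget.ps G ; chain = Gadget.chain G ; unique = Gadget.unique G
         ; inside = λ q → proj₁ (Gadget.inside G q) , λ z → proj₂ (Gadget.inside G q) (∈-++⁺ˡ z) }
       finish : Linked P Q → Extension P U
       finish K = record
         { P₁ = piece-of K ; b = b ; a = a ; size₁ = (lin-≤ (size (piece-of K) ∷ size P ∷ r ∷ size Q ∷ J ∷ [])
               ((ξ 0 , ξ 1 ⊕ (ξ 2 ⊕ (# 1 ⊕ ξ 3))) ∷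
                ((# 1 ⊕ ξ 3) ⊕ ξ 2 , (# 10 ⊕ ξ 2) ⊕ ((# 2 ⊕ (ξ 4 ⊕ ξ 4)) ⊗ (# 2 ⊕ ξ 2))) ∷ [])
               (ξ 0) (ξ 1 ⊕ ((# 10 ⊕ ξ 2) ⊕ ((# 2 ⊕ (ξ 4 ⊕ ξ 4)) ⊗ (# 2 ⊕ ξ 2)))) (1 ∷ 1 ∷ 1 ∷ []) (# 0) refl
               (size-linked K , Gadget.small G , tt)) ; fewer = bd
         ; keeps = serves-before {e = P.e} {P.ps} (Linked.mid K ++ Gadget.e G ∷ Gadget.ps G) (chain-++⁻ʳ P.e P.ps _ (Linked.chain K))
         ; serves = λ {v} {v′} eq → let (z₁ , z₂) = ∧-split {E v b} eq in
             subst (λ z → Serves E P.e z v v′) (Listₚ.++-assoc P.ps (Linked.mid K) _)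
               (serves-after P.e (P.ps ++ Linked.mid K)
                 (subst (Chain E P.e) (sym (Listₚ.++-assoc P.ps (Linked.mid K) _)) (chain-append P.e P.ps _ P.chain (Linked.link K)))
                 (b , a , Gadget.splits G , z₁ , z₂)) }

  record Round {X : List V} (P : Piece X) (U : List (V × V)) (M : ℕ) : Set where
    field
      P′     : Piece X
      size′  : size P′ ≤ size P + M * σ
      keeps  : ∀ {v v′} → Serves E (Piece.e P) (Piece.ps P) v v′ → Serves E (Piece.e P′) (Piece.ps P′) v v′
      serves : ∀ {v v′} → (v , v′) ∈ U → Serves E (Piece.e P′) (Piece.ps P′) v v′

  -- The invariant is that `u` times the `M`-th power of `p / (1 + p)` stays below 1: a gadget
  -- shrinks `u` by this ratio and uses up one power. At `M = 0` no pair is left.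
  decay : ∀ M u c → (1 + p) * c ≤ p * u → u * p ^ suc M < (1 + p) ^ suc M → c * p ^ M < (1 + p) ^ M
  decay M u c le lt = ℕₚ.*-cancelˡ-< (1 + p) _ _ (begin-strict
    (1 + p) * (c * p ^ M) ≡⟨ ℕₚ.*-assoc (1 + p) c (p ^ M) ⟨
    ((1 + p) * c) * p ^ M ≤⟨ ℕₚ.*-monoˡ-≤ (p ^ M) le ⟩
    (p * u) * p ^ M       ≡⟨ trans (cong (_* p ^ M) (ℕₚ.*-comm p u)) (ℕₚ.*-assoc u p (p ^ M)) ⟩
    u * p ^ suc M         <⟨ lt ⟩
    (1 + p) * (1 + p) ^ M ∎)
    where open ℕₚ.≤-Reasoning

  round : ∀ M X U → PairsOK U → (P : Piece X) → 2 · (length X + (1 + size P) + M * σ) ≤ f →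
    length U * p ^ M < (1 + p) ^ M → Round P U M
  round M X [] ok P room pot = record { P′ = P ; size′ = ℕₚ.m≤m+n _ _ ; keeps = id ; serves = λ () }
  round zero X (x ∷ U) ok P room (s≤s ())
  round (suc M) X (u ∷ us) ok P room pot = combine-rounds (extension P (u ∷ us) ok (s≤s z≤n) (
      lin-≤ (length X ∷ size P ∷ M ∷ r ∷ J ∷ f ∷ [])
        ((2 ⊙ ((ξ 0 ⊕ (# 1 ⊕ ξ 1)) ⊕ ((# 1 ⊕ ξ 2) ⊗ ((# 10 ⊕ ξ 3) ⊕ ((# 2 ⊕ (ξ 4 ⊕ ξ 4)) ⊗ (# 2 ⊕ ξ 3))))) , ξ 5) ∷
         [])
        (2 ⊙ ((ξ 0 ⊕ (# 1 ⊕ ξ 1)) ⊕ ((# 10 ⊕ ξ 3) ⊕ ((# 2 ⊕ (ξ 4 ⊕ ξ 4)) ⊗ (# 2 ⊕ ξ 3))))) (ξ 5) (1 ∷ 1 ∷ [])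
         (4 ⊙ (ξ 2 ⊗ ξ 3 ⊗ ξ 4) ⊕ 6 ⊙ (ξ 2 ⊗ ξ 3) ⊕ 8 ⊙ (ξ 2 ⊗ ξ 4) ⊕ 28 ⊙ ξ 2) refl
        (room , tt)))
    where
    U = u ∷ us
    combine-rounds : Extension P U → Round P U (suc M)
    combine-rounds K = conclude (round M X rem (λ {v} {v′} q → ok (proj₁ (filter-⊆ (not ∘ servedBy K.b K.a) {v , v′} U q))) K.P₁
        (lin-≤ (length X ∷ size P ∷ M ∷ r ∷ J ∷ f ∷ size (Extension.P₁ K) ∷ [])
              ((2 ⊙ ((ξ 0 ⊕ (# 1 ⊕ ξ 1)) ⊕ ((# 1 ⊕ ξ 2) ⊗ ((# 10 ⊕ ξ 3) ⊕ ((# 2 ⊕ (ξ 4 ⊕ ξ 4)) ⊗ (# 2 ⊕ ξ 3))))) , ξ 5) ∷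
               (ξ 6 , ξ 1 ⊕ ((# 10 ⊕ ξ 3) ⊕ ((# 2 ⊕ (ξ 4 ⊕ ξ 4)) ⊗ (# 2 ⊕ ξ 3)))) ∷ [])
              (2 ⊙ ((ξ 0 ⊕ (# 1 ⊕ ξ 6)) ⊕ (ξ 2 ⊗ ((# 10 ⊕ ξ 3) ⊕ ((# 2 ⊕ (ξ 4 ⊕ ξ 4)) ⊗ (# 2 ⊕ ξ 3)))))) (ξ 5)
               (1 ∷ 1 ∷ 2 ∷ []) (# 0) refl
              (room , K.size₁ , tt))
        (subst (λ z → z * p ^ M < (1 + p) ^ M) (sym (length-filter (not ∘ servedBy K.b K.a) U)) (decay M (length U) _ K.fewer pot)))
      where
      module K = Extension K
      rem : List (V × V)
      rem = filterᵇ (not ∘ servedBy K.b K.a) U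
      conclude : Round K.P₁ rem M → Round P U (suc M)
      conclude R′ = record
        { P′ = R′.P′ ; size′ = (lin-≤ (size (Round.P′ R′) ∷ size (Extension.P₁ K) ∷ M ∷ r ∷ J ∷ size P ∷ [])
              ((ξ 0 , ξ 1 ⊕ (ξ 2 ⊗ ((# 10 ⊕ ξ 3) ⊕ ((# 2 ⊕ (ξ 4 ⊕ ξ 4)) ⊗ (# 2 ⊕ ξ 3))))) ∷
               (ξ 1 , ξ 5 ⊕ ((# 10 ⊕ ξ 3) ⊕ ((# 2 ⊕ (ξ 4 ⊕ ξ 4)) ⊗ (# 2 ⊕ ξ 3)))) ∷ [])
              (ξ 0) (ξ 5 ⊕ ((# 1 ⊕ ξ 2) ⊗ ((# 10 ⊕ ξ 3) ⊕ ((# 2 ⊕ (ξ 4 ⊕ ξ 4)) ⊗ (# 2 ⊕ ξ 3))))) (1 ∷ 1 ∷ 1 ∷ [])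
               (# 0) refl
              (R′.size′ , K.size₁ , tt)) ; keeps = λ s → R′.keeps (K.keeps s) ; serves = λ {v} {v′} q → all v v′ q }
        where
        module R′ = Round R′
        all : ∀ v v′ → (v , v′) ∈ U → Serves E (Piece.e R′.P′) (Piece.ps R′.P′) v v′
        all v v′ q = [ (λ e → R′.keeps (K.serves e)) , (λ e → R′.serves (∈-filterᵇ (not ∘ servedBy K.b K.a) U q (cong not e))) ]′
          (true-or-false (servedBy K.b K.a (v , v′)))

  Compatible : V → V → Set
  Compatible v v′ = v ∈ vs × v′ ∈ vs × ko v ≡ ki v′

  compatible-pairs : List (V × V)
  compatible-pairs = filterᵇ (λ (v , v′) → does (ko v Boolₚ.≟ ki v′)) (cartesianProduct vs vs)

  pairs-ok : PairsOK compatible-pairs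
  pairs-ok {v} {v′} q with filter-⊆ (λ (v , v′) → does (ko v Boolₚ.≟ ki v′)) (cartesianProduct vs vs) q
  ... | q₁ , q₂ with ∈-cartesianProduct⁻ vs vs q₁
  ...   | a , b = a , b , eq (ko v) (ki v′) q₂
    where
    eq : ∀ x y → does (x Boolₚ.≟ y) ≡ true → x ≡ y
    eq true  true  _ = refl
    eq false false _ = refl

  pairs-all : ∀ {v v′} → Compatible v v′ → (v , v′) ∈ compatible-pairs
  pairs-all {v} {v′} (a , b , e) = ∈-filterᵇ _ (cartesianProduct vs vs) (∈-cartesianProduct⁺ a b) (dec-true (ko v Boolₚ.≟ ki v′) e)

  length-product : ∀ (xs ys : List V) → length (cartesianProduct xs ys) ≡ length xs * length ys
  length-product []       ys = refl
  length-product (x ∷ xs) ys = trans (Listₚ.length-++ (map (x ,_) ys)) (cong₂ _+_ (Listₚ.length-map (x ,_) ys) (length-product xs ys))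

  length-pairs : length compatible-pairs ≤ length vs * length vs
  length-pairs = ℕₚ.≤-trans (ℕₚ.≤-reflexive (length-filter _ (cartesianProduct vs vs)))
    (ℕₚ.≤-trans (cnt≤length _ (cartesianProduct vs vs)) (ℕₚ.≤-reflexive (length-product vs vs)))

  Rope : ℕ → ℕ → Set
  Rope K M = Σ (Piece []) λ P → size P ≤ K * (2 + r + M * σ) × Absorber {E = E} Compatible K (Piece.e P) (Piece.ps P)

  -- A new block starts at a fresh vertex and grows until it serves all compatible pairs; only then
  -- is it joined to the earlier blocks, by a path outside all of them.
  rounds : ∀ K M {v₀} → v₀ ∈ vs → 2 · (4 + (K * (2 + r + M * σ))) ≤ f → length vs * length vs * p ^ M < (1 + p) ^ M →
    f < length vs → Rope K M
  rounds zero M {v₀} v₀∈ room pot fl = record { e = v₀ ; ps = [] ; chain = λ () ; unique = [] ∷ [] ; inside = λ { (here refl) → v₀∈ , λ () } } , z≤n , base (λ ())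
  rounds (suc K) M {v₀} v₀∈ room pot fl = grow (rounds K M v₀∈ (lin-≤ (K ∷ r ∷ M ∷ J ∷ f ∷ [])
        ((2 ⊙ (# 4 ⊕ ((# 1 ⊕ ξ 0) ⊗ ((# 2 ⊕ ξ 1) ⊕ (ξ 2 ⊗ ((# 10 ⊕ ξ 1) ⊕ ((# 2 ⊕ (ξ 3 ⊕ ξ 3)) ⊗ (# 2 ⊕ ξ 1))))))) , ξ 4) ∷
         [])
        (2 ⊙ (# 4 ⊕ (ξ 0 ⊗ ((# 2 ⊕ ξ 1) ⊕ (ξ 2 ⊗ ((# 10 ⊕ ξ 1) ⊕ ((# 2 ⊕ (ξ 3 ⊕ ξ 3)) ⊗ (# 2 ⊕ ξ 1)))))))) (ξ 4)
         (1 ∷ 1 ∷ []) (4 ⊙ (ξ 1 ⊗ ξ 2 ⊗ ξ 3) ⊕ 6 ⊙ (ξ 1 ⊗ ξ 2) ⊕ 8 ⊙ (ξ 2 ⊗ ξ 3) ⊕ 2 ⊙ ξ 1 ⊕ 28 ⊙ ξ 2 ⊕ # 4) refl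
        (room , tt)) pot fl)
    where
    grow : Rope K M → Rope (suc K) M
    grow (P , sz , A) = from (pick (λ _ → true) (Piece.e P ∷ Piece.ps P) vs uniq
        (ℕₚ.<-≤-trans {1 + size P} {length vs} (lin-≤ (size P ∷ K ∷ r ∷ M ∷ J ∷ f ∷ length vs ∷ [])
              ((ξ 0 , ξ 1 ⊗ ((# 2 ⊕ ξ 2) ⊕ (ξ 3 ⊗ ((# 10 ⊕ ξ 2) ⊕ ((# 2 ⊕ (ξ 4 ⊕ ξ 4)) ⊗ (# 2 ⊕ ξ 2)))))) ∷
               (2 ⊙ (# 4 ⊕ ((# 1 ⊕ ξ 1) ⊗ ((# 2 ⊕ ξ 2) ⊕ (ξ 3 ⊗ ((# 10 ⊕ ξ 2) ⊕ ((# 2 ⊕ (ξ 4 ⊕ ξ 4)) ⊗ (# 2 ⊕ ξ 2))))))) , ξ 5) ∷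
               (# 1 ⊕ ξ 5 , ξ 6) ∷ [])
              (# 1 ⊕ (# 1 ⊕ ξ 0)) (ξ 6) (1 ∷ 1 ∷ 1 ∷ 1 ∷ [])
               (2 ⊙ (ξ 1 ⊗ ξ 2 ⊗ ξ 3 ⊗ ξ 4) ⊕ 3 ⊙ (ξ 1 ⊗ ξ 2 ⊗ ξ 3) ⊕ 4 ⊙ (ξ 1 ⊗ ξ 3 ⊗ ξ 4) ⊕ 4 ⊙ (ξ 2 ⊗ ξ 3 ⊗ ξ 4) ⊕ (ξ 1 ⊗ ξ 2) ⊕ 14 ⊙ (ξ 1 ⊗ ξ 3) ⊕ 6 ⊙ (ξ 2 ⊗ ξ 3) ⊕ 8 ⊙ (ξ 3 ⊗ ξ 4) ⊕ 2 ⊙ ξ 1 ⊕ 2 ⊙ ξ 2 ⊕ 28 ⊙ ξ 3 ⊕ # 11)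
               refl
              (sz , room , fl , tt)) (ℕₚ.≤-reflexive (sym (cnt-true vs)))))
      where
      from : (∃ λ x → x ∈ vs × true ≡ true × x ∉ Piece.e P ∷ Piece.ps P) → Rope (suc K) M
      from (v₁ , v₁∈ , _ , v₁∉) = conclude (round M (Piece.e P ∷ Piece.ps P) compatible-pairs pairs-ok start
            (lin-≤ (size P ∷ K ∷ r ∷ M ∷ J ∷ f ∷ [])
                  ((ξ 0 , ξ 1 ⊗ ((# 2 ⊕ ξ 2) ⊕ (ξ 3 ⊗ ((# 10 ⊕ ξ 2) ⊕ ((# 2 ⊕ (ξ 4 ⊕ ξ 4)) ⊗ (# 2 ⊕ ξ 2)))))) ∷
                   (2 ⊙ (# 4 ⊕ ((# 1 ⊕ ξ 1) ⊗ ((# 2 ⊕ ξ 2) ⊕ (ξ 3 ⊗ ((# 10 ⊕ ξ 2) ⊕ ((# 2 ⊕ (ξ 4 ⊕ ξ 4)) ⊗ (# 2 ⊕ ξ 2))))))) , ξ 5) ∷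
                   [])
                  (2 ⊙ (((# 1 ⊕ ξ 0) ⊕ (# 1 ⊕ # 0)) ⊕ (ξ 3 ⊗ ((# 10 ⊕ ξ 2) ⊕ ((# 2 ⊕ (ξ 4 ⊕ ξ 4)) ⊗ (# 2 ⊕ ξ 2))))))
                   (ξ 5) (1 ∷ 2 ∷ 1 ∷ []) (2 ⊙ ξ 2 ⊕ # 8) refl
                  (sz , room , tt)) (ℕₚ.≤-<-trans (ℕₚ.*-monoˡ-≤ (p ^ M) length-pairs) pot))
       where
       start : Piece (Piece.e P ∷ Piece.ps P)
       start = record { e = v₁ ; ps = [] ; chain = λ () ; unique = [] ∷ [] ; inside = λ { (here refl) → v₁∈ , v₁∉ } }
       conclude : Round start compatible-pairs M → Rope (suc K) M
       conclude record { P′ = Q ; size′ = szQ ; serves = srv } = finish (link-up P Q₀ (λ a b → proj₂ (Piece.inside Q b) a) (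
           lin-≤ (size P ∷ K ∷ r ∷ M ∷ J ∷ size Q ∷ f ∷ [])
             ((ξ 0 , ξ 1 ⊗ ((# 2 ⊕ ξ 2) ⊕ (ξ 3 ⊗ ((# 10 ⊕ ξ 2) ⊕ ((# 2 ⊕ (ξ 4 ⊕ ξ 4)) ⊗ (# 2 ⊕ ξ 2)))))) ∷
              (ξ 5 , # 0 ⊕ (ξ 3 ⊗ ((# 10 ⊕ ξ 2) ⊕ ((# 2 ⊕ (ξ 4 ⊕ ξ 4)) ⊗ (# 2 ⊕ ξ 2))))) ∷
              (2 ⊙ (# 4 ⊕ ((# 1 ⊕ ξ 1) ⊗ ((# 2 ⊕ ξ 2) ⊕ (ξ 3 ⊗ ((# 10 ⊕ ξ 2) ⊕ ((# 2 ⊕ (ξ 4 ⊕ ξ 4)) ⊗ (# 2 ⊕ ξ 2))))))) , ξ 6) ∷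
              [])
             (# 0 ⊕ ((# 2 ⊕ ξ 0) ⊕ ξ 5)) (ξ 6) (1 ∷ 1 ∷ 1 ∷ 1 ∷ [])
              (2 ⊙ (ξ 1 ⊗ ξ 2 ⊗ ξ 3 ⊗ ξ 4) ⊕ 3 ⊙ (ξ 1 ⊗ ξ 2 ⊗ ξ 3) ⊕ 4 ⊙ (ξ 1 ⊗ ξ 3 ⊗ ξ 4) ⊕ 2 ⊙ (ξ 2 ⊗ ξ 3 ⊗ ξ 4) ⊕ (ξ 1 ⊗ ξ 2) ⊕ 14 ⊙ (ξ 1 ⊗ ξ 3) ⊕ 3 ⊙ (ξ 2 ⊗ ξ 3) ⊕ 4 ⊙ (ξ 3 ⊗ ξ 4) ⊕ 2 ⊙ ξ 1 ⊕ 2 ⊙ ξ 2 ⊕ 14 ⊙ ξ 3 ⊕ # 10)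
              refl
             (sz , szQ , room , tt)))
         where
         Q₀ : Piece []
         Q₀ = record { e = Piece.e Q ; ps = Piece.ps Q ; chain = Piece.chain Q ; unique = Piece.unique Q
           ; inside = λ q → proj₁ (Piece.inside Q q) , λ () }
         finish : Linked P Q₀ → Rope (suc K) M
         finish L = piece-of L , (lin-≤ (size (piece-of L) ∷ size P ∷ r ∷ size Q₀ ∷ K ∷ M ∷ J ∷ [])
               ((ξ 0 , ξ 1 ⊕ (ξ 2 ⊕ (# 1 ⊕ ξ 3))) ∷
                (ξ 1 , ξ 4 ⊗ ((# 2 ⊕ ξ 2) ⊕ (ξ 5 ⊗ ((# 10 ⊕ ξ 2) ⊕ ((# 2 ⊕ (ξ 6 ⊕ ξ 6)) ⊗ (# 2 ⊕ ξ 2)))))) ∷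
                (ξ 3 , # 0 ⊕ (ξ 5 ⊗ ((# 10 ⊕ ξ 2) ⊕ ((# 2 ⊕ (ξ 6 ⊕ ξ 6)) ⊗ (# 2 ⊕ ξ 2))))) ∷ [])
               (ξ 0) ((# 1 ⊕ ξ 4) ⊗ ((# 2 ⊕ ξ 2) ⊕ (ξ 5 ⊗ ((# 10 ⊕ ξ 2) ⊕ ((# 2 ⊕ (ξ 6 ⊕ ξ 6)) ⊗ (# 2 ⊕ ξ 2))))))
                (1 ∷ 1 ∷ 1 ∷ 1 ∷ []) (# 1) refl
               (size-linked L , sz , szQ , tt)) , more A (Linked.link L) (Piece.chain Q) (λ c → srv (pairs-all c))

-- The number of gadgets

-- Bernoulli's inequality (1 + 1/p)^s ≥ 1 + s/p without denominators.
bernoulli : ∀ p s → (p + s) * p ^ s ≤ p * (1 + p) ^ s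
bernoulli p zero    = ℕₚ.≤-reflexive (cong (_* 1) (ℕₚ.+-identityʳ p))
bernoulli p (suc s) = begin
  (p + suc s) * (p * p ^ s)         ≤⟨ (lin-≤ (p ∷ s ∷ (p ^ s) ∷ [])
        [] ((ξ 0 ⊕ (# 1 ⊕ ξ 1)) ⊗ (ξ 0 ⊗ ξ 2)) ((# 1 ⊕ ξ 0) ⊗ ((ξ 0 ⊕ ξ 1) ⊗ ξ 2)) (1 ∷ []) ((ξ 1 ⊗ ξ 2)) refl tt) ⟩
  (1 + p) * ((p + s) * p ^ s)       ≤⟨ ℕₚ.*-monoʳ-≤ (1 + p) (bernoulli p s) ⟩
  (1 + p) * (p * (1 + p) ^ s)       ≡⟨ (norm-≡ (p ∷ ((1 + p) ^ s) ∷ [])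
      ((# 1 ⊕ ξ 0) ⊗ (ξ 0 ⊗ ξ 1)) (ξ 0 ⊗ ((# 1 ⊕ ξ 0) ⊗ ξ 1)) refl) ⟩
  p * ((1 + p) * (1 + p) ^ s)       ∎
  where open ℕₚ.≤-Reasoning

^-3* : ∀ x s → x ^ (s + (s + s)) ≡ x ^ s * (x ^ s * x ^ s)
^-3* x s = trans (ℕₚ.^-distribˡ-+-* x s (s + s)) (cong (x ^ s *_) (ℕₚ.^-distribˡ-+-* x s s))

-- Bernoulli's inequality is cubed because the number `X` of pairs grows like the square of `s`, and
-- a cube of a linear bound eventually exceeds it.
exp-beats : ∀ p s X → 0 < p → X * (p * (p * p)) < (p + s) * ((p + s) * (p + s)) → X * p ^ (s + (s + s)) < (1 + p) ^ (s + (s + s))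
exp-beats p s X 0<p h = ℕₚ.*-cancelˡ-< (p * (p * p)) _ _ (begin-strict
  p * (p * p) * (X * p ^ (s + (s + s)))        ≡⟨ cong (λ z → p * (p * p) * (X * z)) (^-3* p s) ⟩
  p * (p * p) * (X * (u * (u * u)))            ≡⟨ (norm-≡ (p ∷ X ∷ u ∷ [])
      ((ξ 0 ⊗ (ξ 0 ⊗ ξ 0)) ⊗ (ξ 1 ⊗ (ξ 2 ⊗ (ξ 2 ⊗ ξ 2)))) ((ξ 1 ⊗ (ξ 0 ⊗ (ξ 0 ⊗ ξ 0))) ⊗ (ξ 2 ⊗ (ξ 2 ⊗ ξ 2))) refl) ⟩
  X * (p * (p * p)) * (u * (u * u))            <⟨ ℕₚ.*-monoˡ-< (u * (u * u)) {{ℕ.>-nonZero 0<u³}} h ⟩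
  (p + s) * ((p + s) * (p + s)) * (u * (u * u)) ≡⟨ (norm-≡ (p ∷ s ∷ u ∷ [])
      (((ξ 0 ⊕ ξ 1) ⊗ ((ξ 0 ⊕ ξ 1) ⊗ (ξ 0 ⊕ ξ 1))) ⊗ (ξ 2 ⊗ (ξ 2 ⊗ ξ 2))) (((ξ 0 ⊕ ξ 1) ⊗ ξ 2) ⊗ (((ξ 0 ⊕ ξ 1) ⊗ ξ 2) ⊗ ((ξ 0 ⊕ ξ 1) ⊗ ξ 2))) refl) ⟩
  ((p + s) * u) * (((p + s) * u) * ((p + s) * u)) ≤⟨ ℕₚ.*-mono-≤ b (ℕₚ.*-mono-≤ b b) ⟩
  (p * w) * ((p * w) * (p * w))                ≡⟨ (norm-≡ (p ∷ w ∷ [])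
      ((ξ 0 ⊗ ξ 1) ⊗ ((ξ 0 ⊗ ξ 1) ⊗ (ξ 0 ⊗ ξ 1))) ((ξ 0 ⊗ (ξ 0 ⊗ ξ 0)) ⊗ (ξ 1 ⊗ (ξ 1 ⊗ ξ 1))) refl) ⟩
  p * (p * p) * (w * (w * w))                  ≡⟨ cong (p * (p * p) *_) (^-3* (1 + p) s) ⟨
  p * (p * p) * (1 + p) ^ (s + (s + s))        ∎)
  where
  open ℕₚ.≤-Reasoning
  u = p ^ s
  w = (1 + p) ^ s
  b : (p + s) * u ≤ p * w
  b = bernoulli p s
  0<u : 0 < u
  0<u = ℕₚ.≤-trans (ℕₚ.≤-reflexive (sym (ℕₚ.^-zeroˡ s))) (ℕₚ.^-monoˡ-≤ s 0<p)
  0<u³ : 0 < u * (u * u)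
  0<u³ = ℕₚ.*-mono-< 0<u (ℕₚ.*-mono-< 0<u 0<u)

-- For k ≥ threshold C r σ there is room for M gadgets of size σ in each of C rounds, where M is large enough for
-- M steps of decay to exhaust (C k)² pairs.
threshold : ℕ → ℕ → ℕ → ℕ
threshold C r σ = D * (1 + p * (p * p) * (C * C) * (D * D))
  where
  p = C * C
  -- Space consumed per unit of `s` when each of the `C` blocks contains `M = 3 s` gadgets of size
  -- `σ`.
  D = 4 + C * (2 + r + (σ + (σ + σ)))

module Count (C k p D s : ℕ) (0<C : 0 < C) (0<p : 0 < p) (k<  : k < (1 + s) * D) (s≥ : 1 + p * (p * p) * (C * C) * (D * D) ≤ s) where
  open ℕₚ.≤-Reasoning
  kb : C * k ≤ C * ((1 + s) * D)
  kb = ℕₚ.*-monoʳ-≤ C (ℕₚ.<⇒≤ k<)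

  regroup : ∀ a d p C → (C * (a * d)) * (C * (a * d)) * (p * (p * p)) ≡ a * a * (p * (p * p) * (C * C) * (d * d))
  regroup a d p C = (norm-≡ (C ∷ a ∷ d ∷ p ∷ [])
      (((ξ 0 ⊗ (ξ 1 ⊗ ξ 2)) ⊗ (ξ 0 ⊗ (ξ 1 ⊗ ξ 2))) ⊗ (ξ 3 ⊗ (ξ 3 ⊗ ξ 3))) ((ξ 1 ⊗ ξ 1) ⊗ (((ξ 3 ⊗ (ξ 3 ⊗ ξ 3)) ⊗ (ξ 0 ⊗ ξ 0)) ⊗ (ξ 2 ⊗ ξ 2))) refl)

  pot : (C * k) * (C * k) * (p * (p * p)) < (p + s) * ((p + s) * (p + s))
  pot = begin-strict
    (C * k) * (C * k) * (p * (p * p)) ≤⟨ ℕₚ.*-monoˡ-≤ (p * (p * p)) (ℕₚ.*-mono-≤ kb kb) ⟩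
    (C * ((1 + s) * D)) * (C * ((1 + s) * D)) * (p * (p * p)) ≡⟨ regroup (1 + s) D p C ⟩
    (1 + s) * (1 + s) * (p * (p * p) * (C * C) * (D * D)) <⟨ ℕₚ.*-monoʳ-< ((1 + s) * (1 + s)) s≥ ⟩
    (1 + s) * (1 + s) * s ≤⟨ ℕₚ.*-mono-≤ (ℕₚ.*-mono-≤ (ℕₚ.+-monoˡ-≤ s 0<p) (ℕₚ.+-monoˡ-≤ s 0<p)) (ℕₚ.m≤n+m s p) ⟩
    (p + s) * (p + s) * (p + s) ≡⟨ ℕₚ.*-assoc (p + s) (p + s) (p + s) ⟩
    (p + s) * ((p + s) * (p + s)) ∎

room-for : ∀ C r σ s D k → D ≡ 4 + C * (2 + r + (σ + (σ + σ))) → 0 < s → s * D ≤ k → 4 + C * (2 + r + (s + (s + s)) * σ) ≤ k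
room-for C r σ s D k refl 0<s le = ℕₚ.≤-trans {j = s * (4 + C * (2 + r + (σ + (σ + σ))))} (lin-≤ (C ∷ r ∷ s ∷ σ ∷ [])
      (((# 1 ⊕ # 0) ⊗ (# 4 ⊕ (ξ 0 ⊗ (# 2 ⊕ ξ 1))) , ξ 2 ⊗ (# 4 ⊕ (ξ 0 ⊗ (# 2 ⊕ ξ 1)))) ∷ [])
      (# 4 ⊕ (ξ 0 ⊗ ((# 2 ⊕ ξ 1) ⊕ ((ξ 2 ⊕ (ξ 2 ⊕ ξ 2)) ⊗ ξ 3))))
       (ξ 2 ⊗ (# 4 ⊕ (ξ 0 ⊗ ((# 2 ⊕ ξ 1) ⊕ (ξ 3 ⊕ (ξ 3 ⊕ ξ 3)))))) (1 ∷ 1 ∷ []) (# 0) refl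
      (ℕₚ.*-mono-≤ 0<s (ℕₚ.≤-refl {4 + C * (2 + r)}) , tt)) le

quotient-large : ∀ k D s x Q → k ≡ x + s * D → x < D → D * (1 + Q) ≤ k → 1 + Q ≤ s
quotient-large k D s x Q k≡ x< le = ℕₚ.≮⇒≥ λ s<1+Q → (lin-⊥ (k ∷ x ∷ s ∷ D ∷ Q ∷ [])
      ((ξ 0 , ξ 1 ⊕ (ξ 2 ⊗ ξ 3)) ∷ (# 1 ⊕ ξ 1 , ξ 3) ∷ (ξ 2 ⊗ ξ 3 , ξ 4 ⊗ ξ 3) ∷ (ξ 3 ⊗ (# 1 ⊕ ξ 4) , ξ 0) ∷ [])
      (1 ∷ 1 ∷ 1 ∷ 1 ∷ []) (# 0) refl (ℕₚ.≤-reflexive k≡ , x< , ℕₚ.*-monoˡ-≤ D (s≤s⁻¹ s<1+Q) , le , tt))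

below-next : ∀ k D s x → k ≡ x + s * D → x < D → k < (1 + s) * D
below-next k D s x k≡ x< = lin-≤ (k ∷ x ∷ s ∷ D ∷ [])
      ((ξ 0 , ξ 1 ⊕ (ξ 2 ⊗ ξ 3)) ∷ (# 1 ⊕ ξ 1 , ξ 3) ∷ [])
      (# 1 ⊕ ξ 0) ((# 1 ⊕ ξ 2) ⊗ ξ 3) (1 ∷ 1 ∷ 1 ∷ []) (# 0) refl (ℕₚ.≤-reflexive k≡ , x< , tt)

split-by : ∀ k D → 0 < D → ∃₂ λ s x → k ≡ x + s * D × x < D
split-by k D@(suc _) _ = k ℕ./ D , k ℕ.% D , m≡m%n+[m/n]*n k D , m%n<n k D

opaque
  gadget-count : ∀ C r σ → 0 < C → ∀ k → threshold C r σ ≤ k →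
    ∃ λ M → 4 + C * (2 + r + M * σ) ≤ k × (C * k) * (C * k) * (C * C) ^ M < (1 + C * C) ^ M
  gadget-count C r σ 0<C k le with split-by k (4 + C * (2 + r + (σ + (σ + σ)))) (s≤s z≤n)
  ... | s , x , k≡ , x< = s + (s + s) , room-for C r σ s _ k refl (ℕₚ.≤-trans (s≤s z≤n) s≥) (ℕₚ.≤-trans (ℕₚ.m≤n+m _ x) (ℕₚ.≤-reflexive (sym k≡)))
      , exp-beats (C * C) s ((C * k) * (C * k)) 0<p (Count.pot C k (C * C) _ s 0<C 0<p (below-next k _ s x k≡ x<) s≥)
    where
    0<p : 0 < C * C
    0<p = ℕₚ.*-mono-< 0<C 0<C
    s≥ : 1 + (C * C) * ((C * C) * (C * C)) * (C * C) * ((4 + C * (2 + r + (σ + (σ + σ)))) * (4 + C * (2 + r + (σ + (σ + σ))))) ≤ s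
    s≥ = quotient-large k _ s x _ k≡ x< le

-- Contraction of paths

module _ {A : Set} where
  complement : ∀ (xs vs : List A) → Unique xs → (∀ {x} → x ∈ xs → x ∈ vs) → ∃ λ rest → vs ↭ xs ++ rest
  complement []       vs u h = vs , ↭-refl
  complement (x ∷ xs) vs (x∉ ∷ u) h with ∈-∃++ (h (here refl))
  ... | as , bs , refl with complement xs (as ++ bs) u (λ {y} y∈ → drop-x (All.lookup x∉ y∈) (h (there y∈)))
    where
    drop-x : ∀ {y} → x ≢ y → y ∈ as ++ x ∷ bs → y ∈ as ++ bs
    drop-x x≢y p with ∈-++⁻ as p
    ... | inj₁ q         = ∈-++⁺ˡ q
    ... | inj₂ (here e)  = ⊥-elim (x≢y (sym e))
    ... | inj₂ (there q) = ∈-++⁺ʳ as q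
  ...   | rest , p = rest , ↭-trans (↭ₚ.shift x as bs) (↭-prep x p)

  cnt-sub : ∀ {vs xs rest : List A} (P : A → Bool) → vs ↭ xs ++ rest → cnt P vs ≡ cnt P xs + cnt P rest
  cnt-sub {vs} {xs} P p = trans (cnt-↭ P p) (sumOf-++ _ xs _)

module _ {n : ℕ} where
  private V = Fin n

  -- Robust without the balance of the classes, which is restored by contracting suitable paths.
  record PreRobust (vs : List V) (E : V → V → Bool) (ko ki : V → Bool) (d f h g : ℕ) : Set where
    field
      uniq    : Unique vs
      pure    : ∀ {x y} → E x y ≡ true → ko x ≡ ki y
      deg-in  : ∀ {t} → t ∈ vs → d ≤ cnt (λ w → E w t) vs
      deg-out : ∀ {u} → u ∈ vs → d ≤ cnt (E u) vs
      expand  : ∀ c (T : V → Bool) → (∀ {y} → T y ≡ true → ki y ≡ c) → g ≤ cnt T vs →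
        let N = cnt (λ w → f ℕ.<ᵇ cnt (λ y → E w y ∧ T y) vs) vs in
        cnt T vs + h ≤ N ⊎ cnt (λ w → inC c (ko w)) vs < N + g

  unbalanced : ∀ {vs E ko ki d f h g} → Robust vs E ko ki d f h g → PreRobust vs E ko ki d f h g
  unbalanced R = record { uniq = R.uniq ; pure = R.pure ; deg-in = R.deg-in ; deg-out = R.deg-out ; expand = R.expand }
    where module R = Robust R

  -- Contracting disjoint paths to their first vertices: out x is the last vertex of the path of x.
  contract : ∀ {vs vs′ del dou : List V} {E ko ki d f h g} (out : V → V) q → PreRobust vs E ko ki d f h g →
    vs ↭ vs′ ++ del → vs ↭ map out vs′ ++ dou → length del ≤ q → length dou ≤ q →
    cnt (λ x → ko (out x)) vs′ ≡ cnt ki vs′ →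
    ∀ {d′ h′} → d′ + q ≤ d → h′ + q ≤ h → Robust vs′ (λ x → E (out x)) (λ x → ko (out x)) ki d′ f h′ (g + q)
  contract {vs} {vs′} {del} {dou} {E} {ko} {ki} {d} {f} {h} {g} out q R pv pw lv lw bl {d′} {h′} dq hq = record
    { uniq = Unique-++⁻ˡ vs′ (Unique-↭ pv uniq)
    ; pure = pure
    ; bal = bl
    ; deg-in = λ {t} t∈ → (lin-≤ (d ∷ cnt (λ w → E w t) vs ∷ cnt (λ w → E w t) ws ∷ cnt (λ w → E w t) dou ∷ q ∷
          sumOf (λ x → b2n (E (out x) t)) vs′ ∷ d′ ∷ [])
          ((ξ 0 , ξ 1) ∷ (ξ 1 , ξ 2 ⊕ ξ 3) ∷ (ξ 3 , ξ 4) ∷ (ξ 2 , ξ 5) ∷ (ξ 6 ⊕ ξ 4 , ξ 0) ∷ [])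
          (ξ 6) (ξ 5) (1 ∷ 1 ∷ 1 ∷ 1 ∷ 1 ∷ 1 ∷ []) (# 0) refl
          (deg-in (sub t∈) , ℕₚ.≤-reflexive (cnt-sub {xs = ws} {dou} (λ w → E w t) pw) ,
           ℕₚ.≤-trans (cnt≤length (λ w → E w t) dou) lw , ℕₚ.≤-reflexive (sumOf-map (λ w → b2n (E w t)) out vs′) ,
           dq , tt))
    ; deg-out = λ {u} u∈ → (lin-≤ (d ∷ cnt (E (out u)) vs ∷ cnt (E (out u)) vs′ ∷ cnt (E (out u)) del ∷ q ∷ d′ ∷ [])
          ((ξ 0 , ξ 1) ∷ (ξ 1 , ξ 2 ⊕ ξ 3) ∷ (ξ 3 , ξ 4) ∷ (ξ 5 ⊕ ξ 4 , ξ 0) ∷ [])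
          (ξ 5) (ξ 2) (1 ∷ 1 ∷ 1 ∷ 1 ∷ 1 ∷ []) (# 0) refl
          (deg-out (subʷ u∈) , ℕₚ.≤-reflexive (cnt-sub {xs = vs′} {del} (E (out u)) pv) ,
           ℕₚ.≤-trans (cnt≤length (E (out u)) del) lv , dq , tt))
    ; expand = ex }
    where
    open PreRobust R
    ws : List V
    ws = map out vs′
    sub : ∀ {x} → x ∈ vs′ → x ∈ vs
    sub p = ↭ₚ.∈-resp-↭ (↭-sym pv) (∈-++⁺ˡ p)
    subʷ : ∀ {x} → x ∈ vs′ → out x ∈ vs
    subʷ p = ↭ₚ.∈-resp-↭ (↭-sym pw) (∈-++⁺ˡ (∈-map⁺ out p))
    del∉ : ∀ {x} → x ∈ del → x ∉ vs′
    del∉ p r = Unique-disjoint vs′ (Unique-↭ pv uniq) r p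
    module _ (c : Bool) (T : V → Bool) (T⊂ : ∀ {y} → T y ≡ true → ki y ≡ c) (big : g + q ≤ cnt T vs′) where
      -- Without the deleted heads, the size of the set and the degrees into it are the same in `vs`
      -- and in `vs′`. Only the deleted tails, at most `q` of them, disturb the comparison.
      T′ : V → Bool
      T′ y = T y ∧ mem y vs′
      restrict : ∀ (P : V → Bool) → cnt (λ y → P y ∧ T′ y) vs ≡ cnt (λ y → P y ∧ T y) vs′
      restrict P = trans (cnt-sub {xs = vs′} {del} (λ y → P y ∧ T′ y) pv) (trans (cong₂ _+_
        (cnt-cong vs′ λ {y} p → cong (P y ∧_) (trans (cong (T y ∧_) (∈⇒mem p)) (Boolₚ.∧-identityʳ (T y))))
        (cnt-zero del λ {y} p → trans (cong (λ z → P y ∧ (T y ∧ z)) (∉⇒mem (del∉ p)))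
          (trans (cong (P y ∧_) (Boolₚ.∧-zeroʳ (T y))) (Boolₚ.∧-zeroʳ (P y))))) (ℕₚ.+-identityʳ _))
      T≡ : cnt T′ vs ≡ cnt T vs′
      T≡ = restrict (λ _ → true)
      nb nb′ : V → Bool
      nb w = f ℕ.<ᵇ cnt (λ y → E w y ∧ T′ y) vs
      nb′ w = f ℕ.<ᵇ cnt (λ y → E w y ∧ T y) vs′
      nb≡ : ∀ xs → cnt nb xs ≡ cnt nb′ xs
      nb≡ xs = cnt-cong xs λ {w} _ → cong (f ℕ.<ᵇ_) (restrict (E w))
      N : ℕ
      N = cnt (nb′ ∘ out) vs′
      N≡ : N ≡ cnt nb′ ws
      N≡ = sym (sumOf-map (λ w → b2n (nb′ w)) out vs′)
      nb≤ : cnt nb vs ≤ N + q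
      nb≤ = ℕₚ.≤-trans (ℕₚ.≤-reflexive (trans (cnt-sub {xs = ws} {dou} nb pw) (cong (_+ cnt nb dou) (trans (nb≡ ws) (sym N≡)))))
        (ℕₚ.+-monoʳ-≤ N (ℕₚ.≤-trans (cnt≤length nb dou) lw))
      O≤ : cnt (λ w → inC c (ko (out w))) vs′ ≤ cnt (λ w → inC c (ko w)) vs
      O≤ = ℕₚ.≤-trans (ℕₚ.≤-reflexive (sym (sumOf-map (λ w → b2n (inC c (ko w))) out vs′)))
        (ℕₚ.≤-trans (ℕₚ.m≤m+n _ _) (ℕₚ.≤-reflexive (sym (cnt-sub {xs = ws} {dou} (λ w → inC c (ko w)) pw))))
      ex : cnt T vs′ + h′ ≤ N ⊎ cnt (λ w → inC c (ko (out w))) vs′ < N + (g + q)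
      ex with expand c T′ (λ p → T⊂ (proj₁ (∧-split p))) (ℕₚ.≤-trans (ℕₚ.m≤m+n g q) (ℕₚ.≤-trans big (ℕₚ.≤-reflexive (sym T≡))))
      ... | inj₁ a = inj₁ (ℕₚ.+-cancelʳ-≤ q _ _ (begin
          cnt T vs′ + h′ + q   ≡⟨ ℕₚ.+-assoc (cnt T vs′) h′ q ⟩
          cnt T vs′ + (h′ + q) ≤⟨ ℕₚ.+-mono-≤ (ℕₚ.≤-reflexive (sym T≡)) hq ⟩
          cnt T′ vs + h        ≤⟨ a ⟩
          cnt nb vs            ≤⟨ nb≤ ⟩
          N + q                ∎))
        where open ℕₚ.≤-Reasoning
      ... | inj₂ b = inj₂ (begin-strict
          cnt (λ w → inC c (ko (out w))) vs′ ≤⟨ O≤ ⟩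
          cnt (λ w → inC c (ko w)) vs        <⟨ b ⟩
          cnt nb vs + g                      ≤⟨ ℕₚ.+-monoˡ-≤ g nb≤ ⟩
          N + q + g                          ≡⟨ trans (ℕₚ.+-assoc N q g) (cong (N +_) (ℕₚ.+-comm q g)) ⟩
          N + (g + q)                        ∎)
        where open ℕₚ.≤-Reasoning

  HamCycle : List V → (V → V → Bool) → Set
  HamCycle vs E = ∃₂ λ t ps → t ∷ ps ↭ vs × Chain E t ps × E (lastOf t ps) t ≡ true

module _ {n : ℕ} where
  private V = Fin n

  -- The contraction of a path to its first vertex `e`: arcs still enter at `e`, but they leave from
  -- the last vertex `l`.
  redirect : V → V → V → V
  redirect e l x = if x == e then l else x

  redirect-self : ∀ e l → redirect e l e ≡ l
  redirect-self e l rewrite ==-refl e = refl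

  redirect-other : ∀ {e l x} → x ≢ e → redirect e l x ≡ x
  redirect-other {e} {l} {x} h rewrite ==-≢ {x = x} {e} h = refl

  map-redirect : ∀ {e l} xs → e ∉ xs → map (redirect e l) xs ≡ xs
  map-redirect []       h = refl
  map-redirect (x ∷ xs) h = cong₂ _∷_ (redirect-other (λ q → h (here (sym q)))) (map-redirect xs (h ∘ there))

  pairs-fst-∈ : ∀ {x y : V} t xs → (x , y) ∈ pairs t xs → x ∈ t ∷ xs
  pairs-fst-∈ t (z ∷ xs) (here refl) = here refl
  pairs-fst-∈ t (z ∷ xs) (there p) = there (pairs-fst-∈ z xs p)

  chain-restart : ∀ {E : V → V → Bool} e l qs → e ∉ qs → Chain (λ x → E (redirect e l x)) e qs → Chain E l qs
  chain-restart e l [] h c = λ ()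
  chain-restart {E} e l (q ∷ qs) h c = chain-∷ (subst (λ z → E z q ≡ true) (redirect-self e l) (c (here refl)))
    λ {x} {y} p → subst (λ z → E z y ≡ true) (redirect-other λ { refl → h (pairs-fst-∈ q qs p) }) (c (there p))

  last-restart : ∀ e l (qs : List V) → e ∉ qs → lastOf l qs ≡ redirect e l (lastOf e qs)
  last-restart e l [] h = sym (redirect-self e l)
  last-restart e l (q ∷ qs) h = sym (redirect-other λ eq → h (subst (_∈ q ∷ qs) eq (lastOf-∈ q qs)))

  pairs-of-cycle : ∀ {E : V → V → Bool} {s : List (Cyc V)} → (∀ {x y} → (x , y) ∈ allArcs s → E x y ≡ true) →
    ∀ {x xs} → (x , xs) ∈ s → ∀ {u v} → (u , v) ∈ cycArcs (x , xs) → E u v ≡ true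
  pairs-of-cycle {s = c ∷ s} h (here refl) p = h (∈-++⁺ˡ p)
  pairs-of-cycle {s = c ∷ s} h (there q) p = pairs-of-cycle (h ∘ ∈-++⁺ʳ (cycArcs c)) q p

  length-allVerts : ∀ L (cs : List (Cyc V)) → (∀ {c} → c ∈ cs → L ≤ length (proj₂ c)) → length cs * (1 + L) ≤ length (allVerts cs)
  length-allVerts L [] h = z≤n
  length-allVerts L (c ∷ cs) h = ℕₚ.≤-trans (ℕₚ.+-mono-≤ (s≤s (h (here refl))) (length-allVerts L cs (h ∘ there)))
    (ℕₚ.≤-reflexive (sym (Listₚ.length-++ (verts c))))

  -- The classes of the interior cancel along a path.
  chain-balance : ∀ {E : V → V → Bool} {ko ki : V → Bool} → (∀ {x y} → E x y ≡ true → ko x ≡ ki y) →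
    ∀ e ps → Chain E e ps → cnt ko (e ∷ ps) + b2n (ki e) ≡ b2n (ko (lastOf e ps)) + cnt ki (e ∷ ps)
  chain-balance {ko = ko} {ki} pu e [] c = (norm-≡ (b2n (ko e) ∷ b2n (ki e) ∷ [])
      ((ξ 0 ⊕ # 0) ⊕ ξ 1) (ξ 0 ⊕ (ξ 1 ⊕ # 0)) refl)
  chain-balance {ko = ko} {ki} pu e (p ∷ ps) c = (ℕₚ.≤-antisym
      (lin-≤ (b2n (ko p) ∷ sumOf (λ x → b2n (ko x)) ps ∷ b2n (ki p) ∷ b2n (ko (lastOf p ps)) ∷
        sumOf (λ x → b2n (ki x)) ps ∷ b2n (ko e) ∷ b2n (ki e) ∷ [])
        (((ξ 0 ⊕ ξ 1) ⊕ ξ 2 , ξ 3 ⊕ (ξ 2 ⊕ ξ 4)) ∷ (ξ 5 , ξ 2) ∷ [])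
        ((ξ 5 ⊕ (ξ 0 ⊕ ξ 1)) ⊕ ξ 6) (ξ 3 ⊕ (ξ 6 ⊕ (ξ 2 ⊕ ξ 4))) (1 ∷ 1 ∷ 1 ∷ []) (# 0) refl
        (ℕₚ.≤-reflexive (chain-balance pu p ps (c ∘ there)) , ℕₚ.≤-reflexive (cong b2n (pu (c (here refl)))) , tt))
      (lin-≤ (b2n (ko p) ∷ sumOf (λ x → b2n (ko x)) ps ∷ b2n (ki p) ∷ b2n (ko (lastOf p ps)) ∷
        sumOf (λ x → b2n (ki x)) ps ∷ b2n (ko e) ∷ b2n (ki e) ∷ [])
        ((ξ 3 ⊕ (ξ 2 ⊕ ξ 4) , (ξ 0 ⊕ ξ 1) ⊕ ξ 2) ∷ (ξ 2 , ξ 5) ∷ [])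
        (ξ 3 ⊕ (ξ 6 ⊕ (ξ 2 ⊕ ξ 4))) ((ξ 5 ⊕ (ξ 0 ⊕ ξ 1)) ⊕ ξ 6) (1 ∷ 1 ∷ 1 ∷ []) (# 0) refl
        (ℕₚ.≤-reflexive (sym (chain-balance pu p ps (c ∘ there))) ,
         ℕₚ.≤-reflexive (sym (cong b2n (pu (c (here refl))))) , tt)))

-- A Hamilton cycle from robust expansion and short connections

module Closing-up {n : ℕ} {vs : List (Fin n)} {E : Fin n → Fin n → Bool} {ko ki : Fin n → Bool} {d f h g : ℕ}
                (R : Robust vs E ko ki d f h g) (0<g : 0 < g) (irr : ∀ x → E x x ≡ false)
                (C r k : ℕ) (0<C : 0 < C) (0<k : 0 < k) (size-vs : length vs ≤ C * k)
                (4k≤f : 4 · k ≤ f) (2k≤h : 2 · k ≤ h) (slack : g + f + 4 · k ≤ d)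
                (big-k : threshold C r (10 + r + (2 + (C + C)) * (2 + r)) ≤ k)
                (connects : Connects vs E f r) where
  private
    V = Fin n
    module R = Robust R

  σ₀ : ℕ
  σ₀ = 10 + r + (2 + (C + C)) * (2 + r)

  private
    many : ∃ λ M → 4 + C * (2 + r + M * σ₀) ≤ k × (C * k) * (C * k) * (C * C) ^ M < (1 + C * C) ^ M
    many = gadget-count C r σ₀ 0<C k big-k
    M = proj₁ many
    B = C * (2 + r + M * σ₀)
    B≤ : 4 + B ≤ k
    B≤ = proj₁ (proj₂ many)

  module WithFactor {s₀ : List (Cyc V)} (v₀≈ : allVerts s₀ ↭ vs) (e₀ : ∀ {x y} → (x , y) ∈ allArcs s₀ → E x y ≡ true) where
    F : Factor vs ko ki (allArcs s₀)
    F = record { fsts = ↭-trans (allArcs-fst s₀) v₀≈ ; snds = ↭-trans (↭-reflexive (allArcs-snd s₀)) v₀≈ ; apure = λ p → R.pure (e₀ p) }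

    gf<d : g + f < d
    gf<d = lin-≤ (g ∷ f ∷ k ∷ d ∷ [])
          (((ξ 0 ⊕ ξ 1) ⊕ (4 ⊙ ξ 2) , ξ 3) ∷ (# 1 ⊕ # 0 , ξ 2) ∷ [])
          (# 1 ⊕ (ξ 0 ⊕ ξ 1)) (ξ 3) (1 ∷ 1 ∷ 4 ∷ []) (# 3) refl (slack , 0<k , tt)

    big : length vs < g + C * h
    big = lin-≤ (length vs ∷ C ∷ k ∷ g ∷ h ∷ [])
          ((ξ 0 , ξ 1 ⊗ ξ 2) ∷ (# 1 ⊕ # 0 , ξ 3) ∷ (ξ 1 ⊗ ξ 2 , ξ 1 ⊗ ξ 4) ∷ [])
          (# 1 ⊕ ξ 0) (ξ 3 ⊕ (ξ 1 ⊗ ξ 4)) (1 ∷ 1 ∷ 1 ∷ 1 ∷ []) (# 0) refl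
          (size-vs , 0<g , ℕₚ.*-monoʳ-≤ C (twice k h 2k≤h) , tt)
      where
      twice : ∀ k h → 2 · k ≤ h → k ≤ h
      twice k h p = lin-≤ (k ∷ h ∷ []) ((2 ⊙ ξ 0 , ξ 1) ∷ []) (ξ 0) (ξ 1) (2 ∷ 1 ∷ []) (ξ 1 ⊕ # 1) refl (p , tt)

    dense : length vs * length vs ≤ (1 + C * C) * ((4 · k) * (4 · k))
    dense = lin-≤ (length vs ∷ C ∷ k ∷ [])
          ((ξ 0 ⊗ ξ 0 , (ξ 1 ⊗ ξ 2) ⊗ (ξ 1 ⊗ ξ 2)) ∷ [])
          (ξ 0 ⊗ ξ 0) ((# 1 ⊕ (ξ 1 ⊗ ξ 1)) ⊗ ((4 ⊙ ξ 2) ⊗ (4 ⊙ ξ 2))) (1 ∷ 1 ∷ [])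
           (15 ⊙ (ξ 1 ⊗ ξ 1 ⊗ ξ 2 ⊗ ξ 2) ⊕ 16 ⊙ (ξ 2 ⊗ ξ 2)) refl
          (ℕₚ.*-mono-≤ size-vs size-vs , tt)

    0<4k : 0 < 4 · k
    0<4k = lin-≤ (k ∷ []) ((# 1 ⊕ # 0 , ξ 0) ∷ []) (# 1 ⊕ # 0) (4 ⊙ ξ 0) (1 ∷ 4 ∷ []) (# 3) refl (0<k , tt)

    mf≤d : 4 · k + f ≤ d
    mf≤d = lin-≤ (g ∷ f ∷ k ∷ d ∷ [])
          (((ξ 0 ⊕ ξ 1) ⊕ (4 ⊙ ξ 2) , ξ 3) ∷ []) ((4 ⊙ ξ 2) ⊕ ξ 1) (ξ 3) (1 ∷ 1 ∷ []) (ξ 0) refl (slack , tt)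

    module Ro = Rounds R 0<g gf<d irr F e₀ r connects C big (C * C) (4 · k) 0<4k mf≤d dense

    pot : length vs * length vs * (C * C) ^ M < (1 + C * C) ^ M
    pot = ℕₚ.≤-<-trans (ℕₚ.*-monoˡ-≤ ((C * C) ^ M) (ℕₚ.*-mono-≤ size-vs size-vs)) (proj₂ (proj₂ many))

    f<vs : ∀ {v} → v ∈ vs → f < length vs
    f<vs {v} v∈ = lin-≤ (g ∷ f ∷ k ∷ d ∷ cnt (E v) vs ∷ length vs ∷ [])
          (((ξ 0 ⊕ ξ 1) ⊕ (4 ⊙ ξ 2) , ξ 3) ∷ (# 1 ⊕ # 0 , ξ 0) ∷ (ξ 3 , ξ 4) ∷ (ξ 4 , ξ 5) ∷ [])
          (# 1 ⊕ ξ 1) (ξ 5) (1 ∷ 1 ∷ 1 ∷ 1 ∷ 1 ∷ []) (4 ⊙ ξ 2) refl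
          (slack , 0<g , R.deg-out v∈ , cnt≤length (E v) vs , tt)

    module WithRope (P : Ro.Piece []) (szP : Ro.size P ≤ B) (A : Absorber {E = E} Ro.Compatible C (Ro.Piece.e P) (Ro.Piece.ps P)) where
      open Ro.Piece P
      l : V
      l = lastOf e ps
      out : V → V
      out = redirect e l
      rest : List V
      rest = proj₁ (complement (e ∷ ps) vs unique (proj₁ ∘ inside))
      rest≈ : vs ↭ (e ∷ ps) ++ rest
      rest≈ = proj₂ (complement (e ∷ ps) vs unique (proj₁ ∘ inside))
      all-unique : Unique ((e ∷ ps) ++ rest)
      all-unique = Unique-↭ rest≈ R.uniq
      e∉rest : e ∉ rest
      e∉rest q = Unique-disjoint (e ∷ ps) all-unique (here refl) q
      vs′ : List V
      vs′ = e ∷ rest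
      open ↭-Solver
      pv : vs ↭ vs′ ++ ps
      pv = ↭-trans rest≈ (solve 3 (λ a b c → ((a ⊞ b) ⊞ c) ⊜ ((a ⊞ c) ⊞ b)) ↭-refl (e ∷ []) ps rest)
      outs≡ : map out vs′ ≡ l ∷ rest
      outs≡ = cong₂ _∷_ (redirect-self e l) (map-redirect rest e∉rest)
      pw : vs ↭ map out vs′ ++ map proj₁ (pairs e ps)
      pw = ↭-trans rest≈ (↭-trans (↭-reflexive (cong (_++ rest) (sym (pairs-fst e ps))))
        (↭-trans (solve 3 (λ a b c → ((a ⊞ b) ⊞ c) ⊜ ((b ⊞ c) ⊞ a)) ↭-refl (map proj₁ (pairs e ps)) (l ∷ []) rest)
          (↭-reflexive (cong (_++ map proj₁ (pairs e ps)) (sym outs≡)))))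
      ps≤ : length ps ≤ k
      ps≤ = ℕₚ.≤-trans szP (ℕₚ.≤-trans (ℕₚ.m≤n+m B 4) B≤)
      length-pairs : ∀ t (xs : List V) → length (map proj₁ (pairs t xs)) ≡ length xs
      length-pairs t []       = refl
      length-pairs t (x ∷ xs) = cong suc (length-pairs x xs)
      balanced : cnt (λ x → ko (out x)) vs′ ≡ cnt ki vs′
      balanced = ℕₚ.+-cancelʳ-≡ (cnt ki ps) _ _ (begin
        cnt (λ x → ko (out x)) vs′ + cnt ki ps  ≡⟨ cong (_+ cnt ki ps) (trans (sym (sumOf-map (λ x → b2n (ko x)) out vs′)) (cong (cnt ko) outs≡)) ⟩
        b2n (ko l) + cnt ko rest + cnt ki ps    ≡⟨ shuffle ⟩
        b2n (ki e) + cnt ki rest + cnt ki ps    ∎)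
        where
        open ≡-Reasoning
        eo : cnt ko vs ≡ cnt ko (e ∷ ps) + cnt ko rest
        eo = trans (cnt-↭ ko rest≈) (sumOf-++ _ (e ∷ ps) rest)
        ei : cnt ki vs ≡ cnt ki (e ∷ ps) + cnt ki rest
        ei = trans (cnt-↭ ki rest≈) (sumOf-++ _ (e ∷ ps) rest)
        arith : ∀ {a b x y u v w z} → a ≡ x + y → b ≡ u + w + z → a ≡ b → x + u ≡ v + (u + w) → v + y + w ≡ u + z + w
        arith {a} {b} {x} {y} {u} {v} {w} {z} p q s t = (ℕₚ.≤-antisym (lin-≤ (a ∷ x ∷ y ∷ b ∷ u ∷ w ∷ z ∷ v ∷ [])
              ((ξ 1 ⊕ ξ 2 , ξ 0) ∷ (ξ 3 , (ξ 4 ⊕ ξ 5) ⊕ ξ 6) ∷ (ξ 0 , ξ 3) ∷ (ξ 7 ⊕ (ξ 4 ⊕ ξ 5) , ξ 1 ⊕ ξ 4) ∷ [])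
              ((ξ 7 ⊕ ξ 2) ⊕ ξ 5) ((ξ 4 ⊕ ξ 6) ⊕ ξ 5) (1 ∷ 1 ∷ 1 ∷ 1 ∷ 1 ∷ []) (# 0) refl
              (ℕₚ.≤-reflexive (sym p) , ℕₚ.≤-reflexive q , ℕₚ.≤-reflexive s , ℕₚ.≤-reflexive (sym t) , tt))
            (lin-≤ (a ∷ x ∷ y ∷ b ∷ u ∷ w ∷ z ∷ v ∷ [])
              ((ξ 0 , ξ 1 ⊕ ξ 2) ∷ ((ξ 4 ⊕ ξ 5) ⊕ ξ 6 , ξ 3) ∷ (ξ 3 , ξ 0) ∷ (ξ 1 ⊕ ξ 4 , ξ 7 ⊕ (ξ 4 ⊕ ξ 5)) ∷ [])
              ((ξ 4 ⊕ ξ 6) ⊕ ξ 5) ((ξ 7 ⊕ ξ 2) ⊕ ξ 5) (1 ∷ 1 ∷ 1 ∷ 1 ∷ 1 ∷ []) (# 0) refl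
              (ℕₚ.≤-reflexive p , ℕₚ.≤-reflexive (sym q) , ℕₚ.≤-reflexive (sym s) , ℕₚ.≤-reflexive t , tt)))
        shuffle : b2n (ko l) + cnt ko rest + cnt ki ps ≡ b2n (ki e) + cnt ki rest + cnt ki ps
        shuffle = arith {x = cnt ko (e ∷ ps)} {cnt ko rest} {b2n (ki e)} {b2n (ko l)} {cnt ki ps} {cnt ki rest} eo ei R.bal (chain-balance R.pure e ps chain)

      -- The degree parameter is lowered to the least value that the layers admit, so the condition
      -- that it exceeds `g + k + f` holds by reflexivity.
      R′ : Robust vs′ (λ x → E (out x)) (λ x → ko (out x)) ki (1 + (g + k + f)) f k (g + k)
      R′ = contract out k (unbalanced R) pv pw ps≤ (ℕₚ.≤-trans (ℕₚ.≤-reflexive (length-pairs e ps)) ps≤) balanced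
        (lin-≤ (g ∷ f ∷ k ∷ d ∷ [])
              (((ξ 0 ⊕ ξ 1) ⊕ (4 ⊙ ξ 2) , ξ 3) ∷ (# 1 ⊕ # 0 , ξ 2) ∷ [])
              ((# 1 ⊕ ((ξ 0 ⊕ ξ 2) ⊕ ξ 1)) ⊕ ξ 2) (ξ 3) (1 ∷ 1 ∷ 2 ∷ []) (# 1) refl (slack , 0<k , tt)) (
            lin-≤ (k ∷ h ∷ [])
              ((2 ⊙ ξ 0 , ξ 1) ∷ []) (ξ 0 ⊕ ξ 0) (ξ 1) (1 ∷ 1 ∷ []) (# 0) refl (2k≤h , tt))

      0<g′ : 0 < g + k
      0<g′ = ℕₚ.<-≤-trans 0<g (ℕₚ.m≤m+n g k)

      vs′≤ : length vs′ ≤ length vs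
      vs′≤ = ℕₚ.≤-trans (ℕₚ.m≤m+n _ (length ps)) (ℕₚ.≤-reflexive (sym (trans (↭ₚ.↭-length pv) (Listₚ.length-++ vs′))))

      big′ : length vs′ < g + k + C * k
      big′ = ℕₚ.≤-<-trans (ℕₚ.≤-trans vs′≤ size-vs) (ℕₚ.m<n+m (C * k) 0<g′)

      room′ : 2 + C + (k + k) ≤ f
      room′ = lin-≤ (k ∷ f ∷ C ∷ r ∷ proj₁ (gadget-count C r (10 + r + (2 + (C + C)) * (2 + r)) 0<C k big-k) ∷ [])
            ((4 ⊙ ξ 0 , ξ 1) ∷
             (# 4 ⊕ (ξ 2 ⊗ ((# 2 ⊕ ξ 3) ⊕ (ξ 4 ⊗ ((# 10 ⊕ ξ 3) ⊕ ((# 2 ⊕ (ξ 2 ⊕ ξ 2)) ⊗ (# 2 ⊕ ξ 3)))))) , ξ 0) ∷ [])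
            ((# 2 ⊕ ξ 2) ⊕ (ξ 0 ⊕ ξ 0)) (ξ 1) (1 ∷ 1 ∷ 2 ∷ [])
             (4 ⊙ (ξ 2 ⊗ ξ 2 ⊗ ξ 3 ⊗ ξ 4) ⊕ 8 ⊙ (ξ 2 ⊗ ξ 2 ⊗ ξ 4) ⊕ 6 ⊙ (ξ 2 ⊗ ξ 3 ⊗ ξ 4) ⊕ 2 ⊙ (ξ 2 ⊗ ξ 3) ⊕ 28 ⊙ (ξ 2 ⊗ ξ 4) ⊕ 3 ⊙ ξ 2 ⊕ # 6)
             refl
            (4k≤f , B≤ , tt)
        where
        twice : ∀ C r x → C + C ≤ C * (2 + r + x)
        twice C r x = lin-≤ (C ∷ r ∷ x ∷ [])
              [] (ξ 0 ⊕ ξ 0) (ξ 0 ⊗ ((# 2 ⊕ ξ 1) ⊕ ξ 2)) (1 ∷ []) ((ξ 0 ⊗ ξ 1) ⊕ (ξ 0 ⊗ ξ 2)) refl tt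

      module LC = LongCycles R′ 0<g′ ℕₚ.≤-refl C big′ k room′

      -- The cycle through `e` becomes, once the rope is restored, a path from the end `l` of the
      -- rope back to its start. All other cycles are absorbed by the rope, whose ends do not
      -- change.
      assemble : (∃ λ s → allVerts s ↭ vs′ × (∀ {x y} → (x , y) ∈ allArcs s → E (out x) y ≡ true) × (∀ {c} → c ∈ s → k ≤ length (proj₂ c))) →
        HamCycle vs E
      assemble (s , v≈ , arcs , long) = through (∈-map⁻ proj₂ (↭ₚ.∈-resp-↭ (↭-sym (↭-trans (↭-reflexive (allArcs-snd s)) v≈)) (here refl)))
        where
        through : (∃ λ a → a ∈ allArcs s × e ≡ proj₂ a) → HamCycle vs E
        through ((u , _) , m , refl) = spliced (open-at s m)
          where
          spliced : Opening s u e → HamCycle vs E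
          spliced O = join (absorb-all A O.cs few closed)
            where
            module O = Opening O
            qs = O.ps
            all≈ : e ∷ qs ++ allVerts O.cs ↭ e ∷ rest
            all≈ = ↭-trans O.verts≈ v≈
            tail≈ : qs ++ allVerts O.cs ↭ rest
            tail≈ = ↭ₚ.drop-∷ all≈
            e∉ : e ∉ qs ++ allVerts O.cs
            e∉ q = e∉rest (↭ₚ.∈-resp-↭ tail≈ q)
            e∉qs : e ∉ qs
            e∉qs q = e∉ (∈-++⁺ˡ q)
            arc-in : ∀ {x y} → (x , y) ∈ (u , e) ∷ openArcs e qs O.cs → E (out x) y ≡ true
            arc-in q = arcs (↭ₚ.∈-resp-↭ (↭-sym O.arcs≈) q)
            chain-qs : Chain E l qs
            chain-qs = chain-restart e l qs e∉qs λ q → arc-in (there (∈-++⁺ˡ q))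
            back : E (lastOf l qs) e ≡ true
            back = subst (λ z → E z e ≡ true) (trans (cong out (sym O.last≡)) (sym (last-restart e l qs e∉qs))) (arc-in (here refl))
            -- Each cycle has more than `k` vertices and there are at most `C * k` vertices.
            few : length O.cs ≤ C
            few = ℕₚ.≮⇒≥ λ C< → ℕₚ.<⇒≱ (count C (length O.cs) k C<) (ℕₚ.≤-trans (length-allVerts k O.cs (λ q → long (O.sub q)))
              (ℕₚ.≤-trans (ℕₚ.m≤n+m _ (length qs)) (ℕₚ.≤-trans (ℕₚ.≤-reflexive (sym (Listₚ.length-++ qs)))
                (ℕₚ.≤-trans (ℕₚ.n≤1+n _) (ℕₚ.≤-trans (ℕₚ.≤-reflexive (↭ₚ.↭-length all≈)) (ℕₚ.≤-trans vs′≤ size-vs))))))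
              where
              count : ∀ C c k → C < c → C * k < c * (1 + k)
              count C c k p = lin-≤ (C ∷ c ∷ k ∷ [])
                    ((# 1 ⊕ (ξ 2 ⊕ (ξ 0 ⊗ (# 1 ⊕ ξ 2))) , ξ 1 ⊗ (# 1 ⊕ ξ 2)) ∷ [])
                    (# 1 ⊕ (ξ 0 ⊗ ξ 2)) (ξ 1 ⊗ (# 1 ⊕ ξ 2)) (1 ∷ 1 ∷ []) (ξ 0 ⊕ ξ 2) refl
                    (ℕₚ.*-monoˡ-≤ (1 + k) p , tt)
            in-cs : ∀ {x xs y} → (x , xs) ∈ O.cs → y ∈ x ∷ xs → y ∈ allVerts O.cs
            in-cs q p = ∈-concat⁺′ p (∈-map⁺ verts q)
            in-vs : ∀ {y} → y ∈ allVerts O.cs → y ∈ vs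
            in-vs q = ↭ₚ.∈-resp-↭ (↭-sym rest≈) (∈-++⁺ʳ (e ∷ ps) (↭ₚ.∈-resp-↭ tail≈ (∈-++⁺ʳ qs q)))
            arc-cs : ∀ {x xs} → (x , xs) ∈ O.cs → ∀ {y z} → (y , z) ∈ cycArcs (x , xs) → E y z ≡ true
            arc-cs {x} {xs} q {y} {z} p = subst (λ w → E w z ≡ true)
              (redirect-other λ { refl → e∉ (∈-++⁺ʳ qs (in-cs q (src p))) })
              (pairs-of-cycle {E = λ x → E (out x)} {s} arcs (O.sub q) p)
              where
              src : ∀ {y z} → (y , z) ∈ cycArcs (x , xs) → y ∈ x ∷ xs
              src (here refl) = lastOf-∈ x xs
              src (there p)   = pairs-fst-∈ x xs p
            closed : ∀ {x xs} → (x , xs) ∈ O.cs → Chain E x xs × Ro.Compatible (lastOf x xs) x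
            closed {x} {xs} q = (λ p → arc-cs q (there p))
              , in-vs (in-cs q (lastOf-∈ x xs)) , in-vs (in-cs q (here refl)) , R.pure (arc-cs q (here refl))
            join : (∃ λ ps′ → Chain E e ps′ × lastOf e ps′ ≡ lastOf e ps × e ∷ ps′ ↭ (e ∷ ps) ++ allVerts O.cs) → HamCycle vs E
            join (ps′ , ch , la , pe) = e , ps′ ++ qs
              , ↭-trans (↭ₚ.++⁺ʳ qs pe) (↭-trans (solve 3 (λ a b c → ((a ⊞ b) ⊞ c) ⊜ (a ⊞ (c ⊞ b))) ↭-refl (e ∷ ps) (allVerts O.cs) qs)
                  (↭-trans (↭ₚ.++⁺ˡ (e ∷ ps) tail≈) (↭-sym rest≈)))
              , chain-append e ps′ qs ch (subst (λ z → Chain E z qs) (sym la) chain-qs)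
              , subst (λ z → E z e ≡ true) (sym (trans (lastOf-append e ps′ qs) (cong (λ z → lastOf z qs) la))) back

      hamilton : HamCycle vs E
      hamilton = assemble (LC.long-cycles refl)

    hamilton : ∀ {v} → v ∈ vs → HamCycle vs E
    hamilton v∈ = go (Ro.rounds C M v∈ (
        lin-≤ (C ∷ r ∷ proj₁ (gadget-count C r (10 + r + (2 + (C + C)) * (2 + r)) 0<C k big-k) ∷ k ∷ f ∷ [])
          ((# 4 ⊕ (ξ 0 ⊗ ((# 2 ⊕ ξ 1) ⊕ (ξ 2 ⊗ ((# 10 ⊕ ξ 1) ⊕ ((# 2 ⊕ (ξ 0 ⊕ ξ 0)) ⊗ (# 2 ⊕ ξ 1)))))) , ξ 3) ∷
           (4 ⊙ ξ 3 , ξ 4) ∷ [])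
          (2 ⊙ (# 4 ⊕ (ξ 0 ⊗ ((# 2 ⊕ ξ 1) ⊕ (ξ 2 ⊗ ((# 10 ⊕ ξ 1) ⊕ ((# 2 ⊕ (ξ 0 ⊕ ξ 0)) ⊗ (# 2 ⊕ ξ 1)))))))) (ξ 4)
           (1 ∷ 4 ∷ 1 ∷ [])
           (4 ⊙ (ξ 0 ⊗ ξ 0 ⊗ ξ 1 ⊗ ξ 2) ⊕ 8 ⊙ (ξ 0 ⊗ ξ 0 ⊗ ξ 2) ⊕ 6 ⊙ (ξ 0 ⊗ ξ 1 ⊗ ξ 2) ⊕ 2 ⊙ (ξ 0 ⊗ ξ 1) ⊕ 28 ⊙ (ξ 0 ⊗ ξ 2) ⊕ 4 ⊙ ξ 0 ⊕ # 8)
           refl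
          (B≤ , 4k≤f , tt)) pot (f<vs v∈))
      where
      go : Ro.Rope C M → HamCycle vs E
      go (P , sz , A) = WithRope.hamilton P sz A

  opaque
    hamilton : ∀ {v vs₀} → vs ≡ v ∷ vs₀ → HamCycle vs E
    -- The value `0` asks for any 1-factor: this one only supplies the arcs from which gadgets are
    -- built. The cycles to be merged come from a second factor, found after the rope has been
    -- contracted.
    hamilton {v} {vs₀} eq = go (LongCycles.long-cycles R 0<g gf<d C big 0 room eq)
      where
      gf<d : g + f < d
      gf<d = lin-≤ (g ∷ f ∷ k ∷ d ∷ [])
            (((ξ 0 ⊕ ξ 1) ⊕ (4 ⊙ ξ 2) , ξ 3) ∷ (# 1 ⊕ # 0 , ξ 2) ∷ [])
            (# 1 ⊕ (ξ 0 ⊕ ξ 1)) (ξ 3) (1 ∷ 1 ∷ 4 ∷ []) (# 3) refl (slack , 0<k , tt)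
      big : length vs < g + C * h
      big = lin-≤ (length vs ∷ C ∷ k ∷ g ∷ Function.Base.constᵣ k h ∷ [])
            ((ξ 0 , ξ 1 ⊗ ξ 2) ∷ (# 1 ⊕ # 0 , ξ 3) ∷ (ξ 1 ⊗ ξ 2 , ξ 1 ⊗ ξ 4) ∷ [])
            (# 1 ⊕ ξ 0) (ξ 3 ⊕ (ξ 1 ⊗ ξ 4)) (1 ∷ 1 ∷ 1 ∷ 1 ∷ []) (# 0) refl
            (size-vs , 0<g , ℕₚ.*-monoʳ-≤ C (twice k h 2k≤h) , tt)
        where
        twice : ∀ k h → 2 · k ≤ h → k ≤ h
        twice k h p = lin-≤ (k ∷ h ∷ []) ((2 ⊙ ξ 0 , ξ 1) ∷ []) (ξ 0) (ξ 1) (2 ∷ 1 ∷ []) (ξ 1 ⊕ # 1) refl (p , tt)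
      room : 2 + C + 0 ≤ f
      room = lin-≤ (k ∷ f ∷ C ∷ r ∷ proj₁ (gadget-count C r (10 + r + (2 + (C + C)) * (2 + r)) 0<C k big-k) ∷ [])
            ((4 ⊙ ξ 0 , ξ 1) ∷
             (# 4 ⊕ (ξ 2 ⊗ ((# 2 ⊕ ξ 3) ⊕ (ξ 4 ⊗ ((# 10 ⊕ ξ 3) ⊕ ((# 2 ⊕ (ξ 2 ⊕ ξ 2)) ⊗ (# 2 ⊕ ξ 3)))))) , ξ 0) ∷ [])
            ((# 2 ⊕ ξ 2) ⊕ # 0) (ξ 1) (1 ∷ 1 ∷ 4 ∷ [])
             (8 ⊙ (ξ 2 ⊗ ξ 2 ⊗ ξ 3 ⊗ ξ 4) ⊕ 16 ⊙ (ξ 2 ⊗ ξ 2 ⊗ ξ 4) ⊕ 12 ⊙ (ξ 2 ⊗ ξ 3 ⊗ ξ 4) ⊕ 4 ⊙ (ξ 2 ⊗ ξ 3) ⊕ 56 ⊙ (ξ 2 ⊗ ξ 4) ⊕ 7 ⊙ ξ 2 ⊕ # 14)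
             refl
            (4k≤f , B≤ , tt)
        where
        twice : ∀ C r x → C + C ≤ C * (2 + r + x)
        twice C r x = lin-≤ (C ∷ r ∷ x ∷ [])
              [] (ξ 0 ⊕ ξ 0) (ξ 0 ⊗ ((# 2 ⊕ ξ 1) ⊕ ξ 2)) (1 ∷ []) ((ξ 0 ⊗ ξ 1) ⊕ (ξ 0 ⊗ ξ 2)) refl tt
      go : (∃ λ s → allVerts s ↭ vs × (∀ {x y} → (x , y) ∈ allArcs s → E x y ≡ true) × (∀ {c} → c ∈ s → 0 ≤ length (proj₂ c))) → HamCycle vs E
      go (s , v≈ , arcs , _) = WithFactor.hamilton {s} v≈ arcs (subst (v ∈_) (sym eq) (here refl))

-- Oriented graphs

module _ {n : ℕ} (G : OrientedGraph n) where
  private V = Fin n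

  adj : V → V → Bool
  adj x y = does (arc? G x y)

  adj-Arc : ∀ {x y} → adj x y ≡ true → Arc G x y
  adj-Arc {x} {y} h with arc? G x y
  ... | yes a = a

  adj-irrefl : ∀ x → adj x x ≡ false
  adj-irrefl x = dec-false (arc? G x x) (irrefl G x)

  adj-asym : ∀ x y → b2n (adj x y) + b2n (adj y x) ≤ 1
  adj-asym x y with arc? G x y | arc? G y x
  ... | yes a | yes b = ⊥-elim (asym G x y a b)
  ... | yes a | no _  = s≤s z≤n
  ... | no _  | yes b = s≤s z≤n
  ... | no _  | no _  = z≤n

  closed-walk : ∀ {s} x xs → Chain adj x xs → adj (lastOf x xs) s ≡ true → ClosedWalkFrom G s x xs
  closed-walk x []       c e = close (adj-Arc e)
  closed-walk x (y ∷ ys) c e = step (adj-Arc (c (here refl))) (closed-walk y ys (c ∘ there) e)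

  hamilton-cycle : HamCycle (allFin n) adj → HamiltonCycle G
  hamilton-cycle (t , ps , p , c , e) = t ∷ ps , Unique-↭ (↭-sym p) (Uniqueₚ.allFin⁺ n)
    , trans (↭ₚ.↭-length p) (Listₚ.length-tabulate id) , t , ps , refl , closed-walk t ps c e

sumOf-tabulate : ∀ {A : Set} {n} (f : A → ℕ) (g : Fin n → A) → sumOf f (Data.List.Base.tabulate g) ≡ sumOf (λ i → f (g i)) (allFin n)
sumOf-tabulate {n = n} f g = trans (cong (sumOf f) (sym (Listₚ.map-tabulate id g))) (sumOf-map f g (allFin n))

∣tabulate∣ : ∀ {n} (P : Fin n → Bool) → ∣ tabulate P ∣ ≡ cnt P (allFin n)
∣tabulate∣ {zero}  P = refl
∣tabulate∣ {suc n} P with P Fin.zero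
... | true  = cong suc (trans (∣tabulate∣ (P ∘ Fin.suc)) (sym (sumOf-tabulate (λ i → b2n (P i)) Fin.suc)))
... | false = trans (∣tabulate∣ (P ∘ Fin.suc)) (sym (sumOf-tabulate (λ i → b2n (P i)) Fin.suc))

ceil-bound : ∀ n → 3 · n ≤ 8 · ceil[3n-4]/8 n + 4
ceil-bound n = go n (3 * n ∸ 4) (ceil[3n-4]/8 n) (((3 * n ∸ 4) + 7) ℕ.% 8) (m≡m%n+[m/n]*n ((3 * n ∸ 4) + 7) 8) (m%n<n ((3 * n ∸ 4) + 7) 8)
    (ℕₚ.m≤n+m∸n (3 * n) 4)
  where
  go : ∀ n m q x → m + 7 ≡ x + q * 8 → x < 8 → 3 * n ≤ 4 + m → 3 · n ≤ 8 · q + 4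
  go n m q x e l p = lin-≤ (m ∷ x ∷ q ∷ n ∷ [])
        ((ξ 0 ⊕ # 7 , ξ 1 ⊕ (ξ 2 ⊗ # 8)) ∷ (# 1 ⊕ ξ 1 , # 8) ∷ (# 3 ⊗ ξ 3 , # 4 ⊕ ξ 0) ∷ [])
        (3 ⊙ ξ 3) ((8 ⊙ ξ 2) ⊕ # 4) (1 ∷ 1 ∷ 1 ∷ 1 ∷ []) (# 0) refl (ℕₚ.≤-reflexive e , l , p , tt)

-- The case in which every set expands

module _ {n : ℕ} where
  private V = Fin n

  robust-weaken : ∀ {vs : List V} {E ko ki d f h g f′} → f′ ≤ f → Robust vs E ko ki d f h g → Robust vs E ko ki d f′ h g
  robust-weaken {vs} {E} {f = f} {f′ = f′} le R = record
    { uniq = R.uniq ; pure = R.pure ; bal = R.bal ; deg-in = R.deg-in ; deg-out = R.deg-out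
    ; expand = λ c T T⊂ big → let w = wider T in
        [ (λ p → inj₁ (ℕₚ.≤-trans p w)) , (λ p → inj₂ (ℕₚ.<-≤-trans p (ℕₚ.+-monoˡ-≤ _ w))) ]′ (R.expand c T T⊂ big) }
    where
    module R = Robust R
    wider : ∀ T → cnt (λ w → f ℕ.<ᵇ cnt (λ y → E w y ∧ T y) vs) vs ≤ cnt (λ w → f′ ℕ.<ᵇ cnt (λ y → E w y ∧ T y) vs) vs
    wider T = cnt-mono vs λ {w} _ p → <ᵇ-true (ℕₚ.≤-<-trans le (<ᵇ-< {f} {cnt (λ y → E w y ∧ T y) vs} p))

  module Trivial-Connect {vs : List V} {E : V → V → Bool} {d f h g : ℕ} (R : Robust vs E (λ _ → true) (λ _ → true) d f h g)
      (0<g : 0 < g) (gf<d : g + f < d) (J : ℕ) (big : length vs < g + J * h) where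
    -- With the identity as permutation the passage to a predecessor does nothing, and a descent
    -- through the layers of `t` is an ordinary path to `t`.
    diagonal : List (V × V)
    diagonal = map (λ x → x , x) vs

    F : Factor vs (λ _ → true) (λ _ → true) diagonal
    F = record { fsts = ↭-reflexive (trans (sym (Listₚ.map-∘ vs)) (Listₚ.map-id vs))
      ; snds = ↭-reflexive (trans (sym (Listₚ.map-∘ vs)) (Listₚ.map-id vs)) ; apure = λ _ → refl }
    open Layers R F 0<g gf<d

    Link : V → V → ℕ → List V → Set
    Link u t r X = ∃ λ xs → Chain E u (xs ++ t ∷ []) × Unique xs × (∀ {x} → x ∈ xs → x ∈ vs × x ∉ X) × length xs ≤ r

    connect : ∀ j u t X → good t j u ≡ true → length X + j ≤ f → Link u t j X
    connect zero u t X p len = [] , chain-1 p , [] , (λ ()) , z≤n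
    connect (suc j) u t X p len = from (step-good {t} {j} {u} X (ℕₚ.≤-trans (ℕₚ.m≤m+n _ _) len) p)
      where
      from : (∃₂ λ y w → y ∈ vs × y ∉ X × E u y ≡ true × (w , y) ∈ diagonal × good t j w ≡ true) → Link u t (suc j) X
      from (y , w , y∈ , y∉ , e , m , q) with ∈-map⁻ (λ x → x , x) m
      ... | _ , _ , refl = add (connect j y t (y ∷ X) q (ℕₚ.≤-trans (ℕₚ.≤-reflexive (sym (ℕₚ.+-suc _ _))) len))
        where
        add : Link y t j (y ∷ X) → Link u t (suc j) X
        add (xs , c , un , ins , l) = y ∷ xs , chain-∷ e c , Unique-∷ (λ q → proj₂ (ins q) (here refl)) un
          , (λ { (here refl) → y∈ , y∉ ; (there q) → proj₁ (ins q) , λ z → proj₂ (ins q) (there z) }) , s≤s l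

    opaque
      connects : ∀ {f′} → f′ + suc J ≤ f → Connects vs E f′ (suc J)
      connects le {u} {t} u∈ t∈ X len = connect (suc J) u t X (layers {J} big t∈ J ℕₚ.≤-refl u∈ refl)
        (ℕₚ.≤-trans (ℕₚ.+-monoˡ-≤ (suc J) len) le)

module _ {n : ℕ} (G : OrientedGraph n) where
  private
    V = Fin n
    E = adj G

  Nb : ℕ → (V → Bool) → V → Bool
  Nb f T w = f ℕ.<ᵇ cnt (λ y → E w y ∧ T y) (allFin n)

  Violating : ℕ → ℕ → ℕ → (V → Bool) → Set
  Violating f h g T = g ≤ cnt T (allFin n) × cnt (Nb f T) (allFin n) < cnt T (allFin n) + h × cnt (Nb f T) (allFin n) + g ≤ n

  violating? : ∀ f h g T → Dec (Violating f h g T)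
  violating? f h g T = (g ℕₚ.≤? _) ×-dec (_ ℕₚ.<? _) ×-dec (_ ℕₚ.≤? _)

  Nb-cong : ∀ f {T T′ : V → Bool} → (∀ y → T y ≡ T′ y) → ∀ w → Nb f T w ≡ Nb f T′ w
  Nb-cong f h w = cong (f ℕ.<ᵇ_) (cnt-cong (allFin n) λ {y} _ → cong (E w y ∧_) (h y))

  violating-cong : ∀ {f h g} {T T′ : V → Bool} → (∀ y → T y ≡ T′ y) → Violating f h g T → Violating f h g T′
  violating-cong {f} {h} {g} e (a , b , c) rewrite cnt-cong (allFin n) (λ {y} _ → e y) | cnt-cong (allFin n) (λ {w} _ → Nb-cong f e w) = a , b , c

  -- The case distinction of the whole proof is made constructively, by a search through all
  -- subsets.
  decide-violating : ∀ f h g → (∃ λ T → Violating f h g T) ⊎ (∀ T → ¬ Violating f h g T)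
  decide-violating f h g with anySubset? {n} (λ S → violating? f h g (lookup S))
  ... | yes (S , v) = inj₁ (lookup S , v)
  ... | no nv = inj₂ λ T v → nv (tabulate T , violating-cong (λ y → sym (lookup∘tabulate T y)) v)

  outdeg-cnt : ∀ x → outdeg G x ≡ cnt (E x) (allFin n)
  outdeg-cnt x = ∣tabulate∣ (E x)

  indeg-cnt : ∀ x → indeg G x ≡ cnt (λ w → E w x) (allFin n)
  indeg-cnt x = ∣tabulate∣ (λ w → E w x)

  robust-trivial : ∀ {d f h g} → 0 < g → minSemiDegree≥ G d → (∀ T → ¬ Violating f h g T) →
    Robust (allFin n) E (λ _ → true) (λ _ → true) d f h g
  robust-trivial {d} {f} {h} {g} 0<g md nv = record
    { uniq = Uniqueₚ.allFin⁺ n ; pure = λ _ → refl ; bal = refl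
    ; deg-in = λ {t} _ → ℕₚ.≤-trans (proj₂ (md t)) (ℕₚ.≤-reflexive (indeg-cnt t))
    ; deg-out = λ {u} _ → ℕₚ.≤-trans (proj₁ (md u)) (ℕₚ.≤-reflexive (outdeg-cnt u))
    ; expand = ex }
    where
    ex : ∀ c (T : V → Bool) → (∀ {y} → T y ≡ true → true ≡ c) → g ≤ cnt T (allFin n) →
      cnt T (allFin n) + h ≤ cnt (Nb f T) (allFin n) ⊎ cnt (λ _ → inC c true) (allFin n) < cnt (Nb f T) (allFin n) + g
    ex false T T⊂ big = ⊥-elim (ℕₚ.<⇒≱ 0<g (ℕₚ.≤-trans big (ℕₚ.≤-reflexive (cnt-zero (allFin n) λ {y} _ → ¬true⇒false λ p → case (T⊂ p)))))
      where
      case : true ≡ false → ⊥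
      case ()
    ex true T T⊂ big with cnt T (allFin n) + h ℕₚ.≤? cnt (Nb f T) (allFin n)
    ... | yes p = inj₁ p
    ... | no q with n ℕₚ.<? cnt (Nb f T) (allFin n) + g
    ...   | yes p = inj₂ (ℕₚ.≤-<-trans (ℕₚ.≤-reflexive (trans (cnt-true (allFin n)) (Listₚ.length-tabulate id))) p)
    ...   | no q′ = ⊥-elim (nv T (big , ℕₚ.≰⇒> q , ℕₚ.≮⇒≥ q′))

  opaque
    hamilton-robust : ∀ C k g d → 0 < n → 0 < C → 0 < k → n ≤ C * k → threshold C (1 + C) (10 + (1 + C) + (2 + (C + C)) * (2 + (1 + C))) ≤ k →
      0 < g → minSemiDegree≥ G d → g + 8 · k < d → (∀ T → ¬ Violating (8 · k) (8 · k) g T) → HamiltonCycle G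
    -- Connecting paths must avoid `4 · k` given vertices and also their own, so they are drawn from
    -- robustness at level `8 · k`; everything else works with the weaker level `4 · k`.
    hamilton-robust C k g d (s≤s _) 0<C 0<k n≤ th 0<g md slack nv = hamilton-cycle G (Closing-up.hamilton R4 0<g (adj-irrefl G) C (1 + C) k 0<C 0<k
        (ℕₚ.≤-trans (ℕₚ.≤-reflexive (Listₚ.length-tabulate id)) n≤) (lin-≤ (k ∷ [])
              [] (4 ⊙ ξ 0) (4 ⊙ ξ 0) (1 ∷ []) (# 0) refl tt) (lin-≤ (k ∷ [])
              [] (2 ⊙ ξ 0) (8 ⊙ ξ 0) (1 ∷ []) (6 ⊙ ξ 0) refl tt) (lin-≤ (g ∷ k ∷ d ∷ [])
              ((# 1 ⊕ (ξ 0 ⊕ (8 ⊙ ξ 1)) , ξ 2) ∷ [])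
              ((ξ 0 ⊕ (4 ⊙ ξ 1)) ⊕ (4 ⊙ ξ 1)) (ξ 2) (1 ∷ 1 ∷ []) (# 1) refl (slack , tt)) th
        (Trivial-Connect.connects R8 0<g slack C big {4 · k} (lin-≤ (C ∷ k ∷ [])
              ((# 1 ⊕ ξ 0 , ξ 1) ∷ [])
              ((4 ⊙ ξ 1) ⊕ (# 1 ⊕ ξ 0)) (8 ⊙ ξ 1) (1 ∷ 4 ∷ []) (3 ⊙ ξ 0 ⊕ # 3) refl (Cle , tt))) refl)
      where
      R8 : Robust (allFin n) E (λ _ → true) (λ _ → true) d (8 · k) (8 · k) g
      R8 = robust-trivial 0<g md nv
      R4 : Robust (allFin n) E (λ _ → true) (λ _ → true) d (4 · k) (8 · k) g
      R4 = robust-weaken {f = 8 · k} {f′ = 4 · k} (lin-≤ (k ∷ [])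
            [] (4 ⊙ ξ 0) (8 ⊙ ξ 0) (1 ∷ []) (4 ⊙ ξ 0) refl tt) R8
      big : length (allFin n) < g + C * (8 · k)
      big = ℕₚ.≤-<-trans (ℕₚ.≤-trans (ℕₚ.≤-reflexive (Listₚ.length-tabulate id)) n≤)
        (bigger C k g 0<g)
        where
        bigger : ∀ C k g → 0 < g → C * k < g + C * (8 · k)
        bigger C k g p = lin-≤ (g ∷ C ∷ k ∷ [])
              ((# 1 ⊕ # 0 , ξ 0) ∷ [])
              (# 1 ⊕ (ξ 1 ⊗ ξ 2)) (ξ 0 ⊕ (ξ 1 ⊗ (8 ⊙ ξ 2))) (1 ∷ 1 ∷ []) (7 ⊙ (ξ 1 ⊗ ξ 2)) refl (p , tt)
      Cle : 1 + C ≤ k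
      Cle with gadget-count C (1 + C) (10 + (1 + C) + (2 + (C + C)) * (2 + (1 + C))) 0<C k th
      ... | M , room , _ = ℕₚ.≤-trans (small C _ 0<C) room
        where
        small : ∀ C x → 0 < C → 1 + C ≤ 4 + C * (2 + (1 + C) + x)
        small C x p = lin-≤ (C ∷ x ∷ [])
              [] (# 1 ⊕ ξ 0) (# 4 ⊕ (ξ 0 ⊗ ((# 2 ⊕ (# 1 ⊕ ξ 0)) ⊕ ξ 1))) (1 ∷ [])
               ((ξ 0 ⊗ ξ 0) ⊕ (ξ 0 ⊗ ξ 1) ⊕ 2 ⊙ ξ 0 ⊕ # 3) refl tt

-- The extremal structure

-- Products of two inequalities, rearranged so that no subtraction occurs.
cross : ∀ {x y u v} → x ≤ y → u ≤ v → x * v + y * u ≤ x * u + y * v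
cross {x} {y} {u} {v} p q = subst₂ (λ y v → x * v + y * u ≤ x * u + y * v) (ℕₚ.m+[n∸m]≡n p) (ℕₚ.m+[n∸m]≡n q) (go (y ∸ x) (v ∸ u))
  where
  go : ∀ s t → x * (u + t) + (x + s) * u ≤ x * u + (x + s) * (u + t)
  go s t = lin-≤ (x ∷ u ∷ t ∷ s ∷ [])
        [] ((ξ 0 ⊗ (ξ 1 ⊕ ξ 2)) ⊕ ((ξ 0 ⊕ ξ 3) ⊗ ξ 1)) ((ξ 0 ⊗ ξ 1) ⊕ ((ξ 0 ⊕ ξ 3) ⊗ (ξ 1 ⊕ ξ 2))) (1 ∷ [])
         ((ξ 2 ⊗ ξ 3)) refl tt

module _ {n : ℕ} (G : OrientedGraph n) where
  private
    V = Fin n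
    E = adj G
    Vs = allFin n

  size : (V → Bool) → ℕ
  size P = cnt P Vs

  row : V → (V → Bool) → ℕ
  row x Q = cnt (λ y → E x y ∧ Q y) Vs

  col : (V → Bool) → V → ℕ
  col P y = cnt (λ x → E x y ∧ P x) Vs

  edges : (V → Bool) → (V → Bool) → ℕ
  edges P Q = sumOf (λ x → b2n (P x) * row x Q) Vs

  edges-col : ∀ P Q → edges P Q ≡ sumOf (λ y → b2n (Q y) * col P y) Vs
  edges-col P Q = begin
    sumOf (λ x → b2n (P x) * row x Q) Vs                                   ≡⟨ sumOf-cong Vs (λ {x} _ → sumOf-* (b2n (P x)) (λ y → b2n (E x y ∧ Q y)) Vs) ⟨
    sumOf (λ x → sumOf (λ y → b2n (P x) * b2n (E x y ∧ Q y)) Vs) Vs        ≡⟨ sumOf-swap (λ x y → b2n (P x) * b2n (E x y ∧ Q y)) Vs Vs ⟩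
    sumOf (λ y → sumOf (λ x → b2n (P x) * b2n (E x y ∧ Q y)) Vs) Vs        ≡⟨ sumOf-cong Vs (λ {y} _ → sumOf-cong Vs λ {x} _ → flip₃ (P x) (E x y) (Q y)) ⟩
    sumOf (λ y → sumOf (λ x → b2n (Q y) * b2n (E x y ∧ P x)) Vs) Vs        ≡⟨ sumOf-cong Vs (λ {y} _ → sumOf-* (b2n (Q y)) (λ x → b2n (E x y ∧ P x)) Vs) ⟩
    sumOf (λ y → b2n (Q y) * col P y) Vs                                   ∎
    where
    open ≡-Reasoning
    flip₃ : ∀ p e q → b2n p * b2n (e ∧ q) ≡ b2n q * b2n (e ∧ p)
    flip₃ true  true  true  = refl
    flip₃ true  true  false = refl
    flip₃ true  false true  = refl
    flip₃ true  false false = refl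
    flip₃ false true  true  = refl
    flip₃ false true  false = refl
    flip₃ false false true  = refl
    flip₃ false false false = refl

  weighted≥ : ∀ (P : V → Bool) (s : V → ℕ) k → (∀ x → P x ≡ true → k ≤ s x) → k * size P ≤ sumOf (λ x → b2n (P x) * s x) Vs
  weighted≥ P s k h = ℕₚ.≤-trans (ℕₚ.≤-reflexive (sym (sumOf-* k (λ x → b2n (P x)) Vs))) (sumOf-mono Vs λ {x} _ → each (P x) (h x))
    where
    each : ∀ b {m} → (b ≡ true → k ≤ m) → k * b2n b ≤ b2n b * m
    each true  {m} h = ℕₚ.≤-trans (ℕₚ.≤-reflexive (ℕₚ.*-identityʳ k)) (ℕₚ.≤-trans (h refl) (ℕₚ.≤-reflexive (sym (ℕₚ.+-identityʳ m))))
    each false h = ℕₚ.≤-reflexive (ℕₚ.*-zeroʳ k)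

  weighted≤ : ∀ (P : V → Bool) (s : V → ℕ) k → (∀ x → P x ≡ true → s x ≤ k) → sumOf (λ x → b2n (P x) * s x) Vs ≤ k * size P
  weighted≤ P s k h = ℕₚ.≤-trans (sumOf-mono Vs λ {x} _ → each (P x) (h x)) (ℕₚ.≤-reflexive (sumOf-* k (λ x → b2n (P x)) Vs))
    where
    each : ∀ b {m} → (b ≡ true → m ≤ k) → b2n b * m ≤ k * b2n b
    each true  {m} h = ℕₚ.≤-trans (ℕₚ.≤-reflexive (ℕₚ.+-identityʳ m)) (ℕₚ.≤-trans (h refl) (ℕₚ.≤-reflexive (sym (ℕₚ.*-identityʳ k))))
    each false h = z≤n

  edges-≤-row : ∀ P Q k → (∀ x → P x ≡ true → row x Q ≤ k) → edges P Q ≤ k * size P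
  edges-≤-row P Q k = weighted≤ P (λ x → row x Q) k

  -- At most one of the two possible arcs joins `x` and `y`. For `P = Q` this is the bound of one
  -- half on the density inside a set.
  edges-pair : ∀ P Q → edges P Q + edges Q P ≤ size P * size Q
  edges-pair P Q = begin
    edges P Q + edges Q P                                        ≡⟨ cong (edges P Q +_) (edges-col Q P) ⟩
    edges P Q + sumOf (λ x → b2n (P x) * col Q x) Vs             ≡⟨ sumOf-+ _ _ Vs ⟨
    sumOf (λ x → b2n (P x) * row x Q + b2n (P x) * col Q x) Vs   ≤⟨ sumOf-mono Vs (λ {x} _ → ℕₚ.≤-trans (ℕₚ.≤-reflexive (sym (ℕₚ.*-distribˡ-+ (b2n (P x)) _ _))) (ℕₚ.*-monoʳ-≤ (b2n (P x)) (both x))) ⟩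
    sumOf (λ x → b2n (P x) * size Q) Vs                          ≡⟨ sumOf-cong Vs (λ {x} _ → ℕₚ.*-comm (b2n (P x)) (size Q)) ⟩
    sumOf (λ x → size Q * b2n (P x)) Vs                          ≡⟨ sumOf-* (size Q) (λ x → b2n (P x)) Vs ⟩
    size Q * size P                                              ≡⟨ ℕₚ.*-comm (size Q) (size P) ⟩
    size P * size Q                                              ∎
    where
    open ℕₚ.≤-Reasoning
    one : ∀ e e′ q → b2n e + b2n e′ ≤ 1 → b2n (e ∧ q) + b2n (e′ ∧ q) ≤ b2n q
    one e     e′    true  h rewrite Boolₚ.∧-identityʳ e | Boolₚ.∧-identityʳ e′ = h
    one e     e′    false h rewrite Boolₚ.∧-zeroʳ e | Boolₚ.∧-zeroʳ e′ = z≤n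
    both : ∀ x → row x Q + col Q x ≤ size Q
    both x = ℕₚ.≤-trans (ℕₚ.≤-reflexive (sym (sumOf-+ _ _ Vs))) (sumOf-mono Vs λ {y} _ → one (E x y) (E y x) (Q y) (adj-asym G x y))

  edges-self : ∀ P → 2 · edges P P ≤ size P * size P
  edges-self P = lin-≤ (edges P P ∷ size P ∷ [])
        ((ξ 0 ⊕ ξ 0 , ξ 1 ⊗ ξ 1) ∷ []) (2 ⊙ ξ 0) (ξ 1 ⊗ ξ 1) (1 ∷ 1 ∷ []) (# 0) refl (edges-pair P P , tt)

  edges-≤ : ∀ P Q → edges P Q ≤ size P * size Q
  edges-≤ P Q = ℕₚ.≤-trans (ℕₚ.m≤m+n _ _) (edges-pair P Q)

  record Partition (A B C D : V → Bool) : Set where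
    field
      one : ∀ x → b2n (A x) + b2n (B x) + b2n (C x) + b2n (D x) ≡ 1

    cnt-parts : ∀ P → cnt P Vs ≡ cnt (λ x → P x ∧ A x) Vs + cnt (λ x → P x ∧ B x) Vs + cnt (λ x → P x ∧ C x) Vs + cnt (λ x → P x ∧ D x) Vs
    cnt-parts P = trans (sumOf-cong Vs λ {x} _ → each (P x) (one x))
      (trans (sumOf-+ _ _ Vs) (cong (_+ cnt (λ x → P x ∧ D x) Vs) (trans (sumOf-+ _ _ Vs) (cong (_+ cnt (λ x → P x ∧ C x) Vs) (sumOf-+ _ _ Vs)))))
      where
      each : ∀ p {a b c d} → b2n a + b2n b + b2n c + b2n d ≡ 1 → b2n p ≡ b2n (p ∧ a) + b2n (p ∧ b) + b2n (p ∧ c) + b2n (p ∧ d)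
      each true  h = sym h
      each false h = refl

    size-parts : n ≡ size A + size B + size C + size D
    size-parts = trans (sym (trans (cnt-true Vs) (Listₚ.length-tabulate id))) (cnt-parts (λ _ → true))

    rows : ∀ x → cnt (E x) Vs ≡ row x A + row x B + row x C + row x D
    rows x = cnt-parts (E x)

    cols : ∀ y → cnt (λ x → E x y) Vs ≡ col A y + col B y + col C y + col D y
    cols y = cnt-parts (λ x → E x y)

    edges-out : ∀ {δ} P → minSemiDegree≥ G δ → δ * size P ≤ edges P A + edges P B + edges P C + edges P D
    edges-out {δ} P md = ℕₚ.≤-trans (weighted≥ P (λ x → row x A + row x B + row x C + row x D) δ
        (λ x _ → ℕₚ.≤-trans (proj₁ (md x)) (ℕₚ.≤-reflexive (trans (outdeg-cnt G x) (rows x)))))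
      (ℕₚ.≤-reflexive (trans (sumOf-cong Vs λ {x} _ → distrib (b2n (P x)) (row x A) (row x B) (row x C) (row x D))
        (trans (sumOf-+ _ _ Vs) (cong (_+ edges P D) (trans (sumOf-+ _ _ Vs) (cong (_+ edges P C) (sumOf-+ _ _ Vs)))))))
      where
      distrib : ∀ p a b c d → p * (a + b + c + d) ≡ p * a + p * b + p * c + p * d
      distrib p a b c d = (norm-≡ (p ∷ a ∷ b ∷ c ∷ d ∷ [])
          (ξ 0 ⊗ (((ξ 1 ⊕ ξ 2) ⊕ ξ 3) ⊕ ξ 4)) ((((ξ 0 ⊗ ξ 1) ⊕ (ξ 0 ⊗ ξ 2)) ⊕ (ξ 0 ⊗ ξ 3)) ⊕ (ξ 0 ⊗ ξ 4)) refl)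

    edges-in : ∀ {δ} Q → minSemiDegree≥ G δ → δ * size Q ≤ edges A Q + edges B Q + edges C Q + edges D Q
    edges-in {δ} Q md = ℕₚ.≤-trans (weighted≥ Q (λ y → col A y + col B y + col C y + col D y) δ
        (λ x _ → ℕₚ.≤-trans (proj₂ (md x)) (ℕₚ.≤-reflexive (trans (indeg-cnt G x) (cols x)))))
      (ℕₚ.≤-reflexive (trans (sumOf-cong Vs λ {y} _ → distrib (b2n (Q y)) (col A y) (col B y) (col C y) (col D y))
        (trans (sumOf-+ _ _ Vs) (cong₂ _+_ (trans (sumOf-+ _ _ Vs) (cong₂ _+_ (trans (sumOf-+ _ _ Vs)
          (cong₂ _+_ (sym (edges-col A Q)) (sym (edges-col B Q)))) (sym (edges-col C Q)))) (sym (edges-col D Q))))))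
      where
      distrib : ∀ p a b c d → p * (a + b + c + d) ≡ p * a + p * b + p * c + p * d
      distrib p a b c d = (norm-≡ (p ∷ a ∷ b ∷ c ∷ d ∷ [])
          (ξ 0 ⊗ (((ξ 1 ⊕ ξ 2) ⊕ ξ 3) ⊕ ξ 4)) ((((ξ 0 ⊗ ξ 1) ⊕ (ξ 0 ⊗ ξ 2)) ⊕ (ξ 0 ⊗ ξ 3)) ⊕ (ξ 0 ⊗ ξ 4)) refl)

  -- In the ideal structure each part has n/4 vertices, A → B → C → D → A is complete, and arcs have density one
  -- half inside A, inside C and between B and D in either direction.
  record Extremal (z w : ℕ) (A B C D : V → Bool) : Set where
    field
      partition : Partition A B C D
      a≥ : n ≤ 4 · size A + z
      b≥ : n ≤ 4 · size B + z
      c≥ : n ≤ 4 · size C + z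
      d≥ : n ≤ 4 · size D + z
      a≤ : 4 · size A ≤ n + z
      b≤ : 4 · size B ≤ n + z
      c≤ : 4 · size C ≤ n + z
      d≤ : 4 · size D ≤ n + z
      ab : size A * size B ≤ edges A B + w * n
      bc : size B * size C ≤ edges B C + w * n
      cd : size C * size D ≤ edges C D + w * n
      da : size D * size A ≤ edges D A + w * n
      aa : n * n ≤ 32 · edges A A + w * n
      cc : n * n ≤ 32 · edges C C + w * n
      db : n * n ≤ 32 · edges D B + w * n
      bd : n * n ≤ 32 · edges B D + w * n

  extremal-swap : ∀ {z w A B C D} → Extremal z w A B C D → Extremal z w C D A B
  extremal-swap {A = A} {B} {C} {D} X = record
    { partition = record { one = λ x → rot (b2n (A x)) (b2n (B x)) (b2n (C x)) (b2n (D x)) (Partition.one partition x) }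
    ; a≥ = c≥ ; b≥ = d≥ ; c≥ = a≥ ; d≥ = b≥ ; a≤ = c≤ ; b≤ = d≤ ; c≤ = a≤ ; d≤ = b≤
    ; ab = cd ; bc = da ; cd = ab ; da = bc ; aa = cc ; cc = aa ; db = bd ; bd = db }
    where
    open Extremal X
    rot : ∀ a b c d → a + b + c + d ≡ 1 → c + d + a + b ≡ 1
    rot a b c d h = (ℕₚ.≤-antisym (lin-≤ (a ∷ b ∷ c ∷ d ∷ [])
          ((((ξ 0 ⊕ ξ 1) ⊕ ξ 2) ⊕ ξ 3 , # 1) ∷ [])
          (((ξ 2 ⊕ ξ 3) ⊕ ξ 0) ⊕ ξ 1) (# 1) (1 ∷ 1 ∷ []) (# 0) refl (ℕₚ.≤-reflexive h , tt))
        (lin-≤ (a ∷ b ∷ c ∷ d ∷ [])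
          ((# 1 , ((ξ 0 ⊕ ξ 1) ⊕ ξ 2) ⊕ ξ 3) ∷ [])
          (# 1) (((ξ 2 ⊕ ξ 3) ⊕ ξ 0) ⊕ ξ 1) (1 ∷ 1 ∷ []) (# 0) refl (ℕₚ.≤-reflexive (sym h) , tt)))

cancel-half : ∀ {a x y} → 0 < a → a * x ≤ a * y → x ≤ y
cancel-half {suc a} {x} {y} _ h = ℕₚ.*-cancelˡ-≤ (suc a) h

-- The average outdegree in a part of size `a`: at most `a / 2` inside, at most `b` into the second
-- part, and at most `f` stray arcs.
out-bound : ∀ {δ a b f eAA eAB eAC eAD} → 0 < a → δ * a ≤ eAA + eAB + eAC + eAD → 2 · eAA ≤ a * a → eAB ≤ a * b → eAC + eAD ≤ f * a →
  2 · δ ≤ a + 2 · b + 2 · f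
out-bound {δ} {a} {b} {f} {eAA} {eAB} {eAC} {eAD} 0<a h1 h2 h3 h4 = cancel-half 0<a (
    lin-≤ (δ ∷ a ∷ eAA ∷ eAB ∷ eAC ∷ eAD ∷ b ∷ f ∷ [])
      ((ξ 0 ⊗ ξ 1 , ((ξ 2 ⊕ ξ 3) ⊕ ξ 4) ⊕ ξ 5) ∷ (2 ⊙ ξ 2 , ξ 1 ⊗ ξ 1) ∷ (ξ 3 , ξ 1 ⊗ ξ 6) ∷
       (ξ 4 ⊕ ξ 5 , ξ 7 ⊗ ξ 1) ∷ [])
      (ξ 1 ⊗ (2 ⊙ ξ 0)) (ξ 1 ⊗ ((ξ 1 ⊕ (2 ⊙ ξ 6)) ⊕ (2 ⊙ ξ 7))) (1 ∷ 2 ∷ 1 ∷ 2 ∷ 2 ∷ []) (# 0) refl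
      (h1 , h2 , h3 , h4 , tt))

-- The substitute when `A` is empty: the outdegrees of `D` are counted instead, and nothing can go
-- to `A`.
out-bound₀ : ∀ {δ b d f eDA eDB eDC eDD} → 0 < d → δ * d ≤ eDA + eDB + eDC + eDD → eDA ≤ d * 0 → eDB ≤ d * b → eDC + eDD ≤ f * d →
  2 · δ ≤ 2 · b + 2 · f
out-bound₀ {δ} {b} {d} {f} {eDA} {eDB} {eDC} {eDD} 0<d h1 h2 h3 h4 = cancel-half 0<d (
    lin-≤ (δ ∷ d ∷ eDA ∷ eDB ∷ eDC ∷ eDD ∷ b ∷ f ∷ [])
      ((ξ 0 ⊗ ξ 1 , ((ξ 2 ⊕ ξ 3) ⊕ ξ 4) ⊕ ξ 5) ∷ (ξ 2 , ξ 1 ⊗ # 0) ∷ (ξ 3 , ξ 1 ⊗ ξ 6) ∷ (ξ 4 ⊕ ξ 5 , ξ 7 ⊗ ξ 1) ∷ [])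
      (ξ 1 ⊗ (2 ⊙ ξ 0)) (ξ 1 ⊗ ((2 ⊙ ξ 6) ⊕ (2 ⊙ ξ 7))) (1 ∷ 2 ∷ 2 ∷ 2 ∷ 2 ∷ []) (# 0) refl (h1 , h2 , h3 , h4 , tt))

-- The mirror image for indegrees in `C`. The stray arcs are bounded only in total, by `g * g`, so
-- `C` needs at least `g` vertices for their average to be at most `g`.
in-bound : ∀ {δ b c g eAC eBC eCC eDC} → 0 < c → g ≤ c → δ * c ≤ eAC + eBC + eCC + eDC → 2 · eCC ≤ c * c → eBC ≤ b * c → eAC + eDC ≤ g * g →
  2 · δ ≤ c + 2 · b + 2 · g
in-bound {δ} {b} {c} {g} {eAC} {eBC} {eCC} {eDC} 0<c g≤c h1 h2 h3 h4 = cancel-half 0<c (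
    lin-≤ (δ ∷ c ∷ eAC ∷ eBC ∷ eCC ∷ eDC ∷ b ∷ g ∷ [])
      ((ξ 0 ⊗ ξ 1 , ((ξ 2 ⊕ ξ 3) ⊕ ξ 4) ⊕ ξ 5) ∷ (2 ⊙ ξ 4 , ξ 1 ⊗ ξ 1) ∷ (ξ 3 , ξ 6 ⊗ ξ 1) ∷
       (ξ 2 ⊕ ξ 5 , ξ 7 ⊗ ξ 7) ∷ (ξ 7 ⊗ ξ 7 , ξ 7 ⊗ ξ 1) ∷ [])
      (ξ 1 ⊗ (2 ⊙ ξ 0)) (ξ 1 ⊗ ((ξ 1 ⊕ (2 ⊙ ξ 6)) ⊕ (2 ⊙ ξ 7))) (1 ∷ 2 ∷ 1 ∷ 2 ∷ 2 ∷ 2 ∷ []) (# 0) refl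
      (h1 , h2 , h3 , h4 , ℕₚ.*-monoʳ-≤ g g≤c , tt))

-- The substitute when `C` is tiny: up to stray arcs, the vertices of `D` receive arcs only from `B`
-- and `C`.
in-bound₀ : ∀ {δ b c d g eAD eBD eCD eDD} → g ≤ d → 0 < d → δ * d ≤ eAD + eBD + eCD + eDD → eBD ≤ b * d → eCD ≤ c * d → eAD + eDD ≤ g * g →
  δ ≤ b + c + g
in-bound₀ {δ} {b} {c} {d} {g} {eAD} {eBD} {eCD} {eDD} g≤d 0<d h1 h2 h3 h4 = cancel-half 0<d (
    lin-≤ (δ ∷ d ∷ eAD ∷ eBD ∷ eCD ∷ eDD ∷ b ∷ c ∷ g ∷ [])
      ((ξ 0 ⊗ ξ 1 , ((ξ 2 ⊕ ξ 3) ⊕ ξ 4) ⊕ ξ 5) ∷ (ξ 3 , ξ 6 ⊗ ξ 1) ∷ (ξ 4 , ξ 7 ⊗ ξ 1) ∷ (ξ 2 ⊕ ξ 5 , ξ 8 ⊗ ξ 8) ∷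
       (ξ 8 ⊗ ξ 8 , ξ 8 ⊗ ξ 1) ∷ [])
      (ξ 1 ⊗ ξ 0) (ξ 1 ⊗ ((ξ 6 ⊕ ξ 7) ⊕ ξ 8)) (1 ∷ 1 ∷ 1 ∷ 1 ∷ 1 ∷ 1 ∷ []) (# 0) refl
      (h1 , h2 , h3 , h4 , ℕₚ.*-monoʳ-≤ g g≤d , tt))

-- Since `D` is almost free of inner arcs, in- and outdegrees of its vertices together fit into the
-- `n - d` other vertices, each pair being used once.
sparse-bound : ∀ {δ n a b c d f eDA eAD eDB eBD eDC eCD eDD} → 0 < d → n ≡ a + b + c + d →
  δ * d ≤ eDA + eDB + eDC + eDD → δ * d ≤ eAD + eBD + eCD + eDD → eDA + eAD ≤ d * a → eDB + eBD ≤ d * b → eDC + eCD ≤ d * c →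
  eDD ≤ f * d → 2 · δ + d ≤ n + 2 · f
sparse-bound {δ} {n} {a} {b} {c} {d} {f} {eDA} {eAD} {eDB} {eBD} {eDC} {eCD} {eDD} 0<d e h1 h2 h3 h4 h5 h6 = cancel-half 0<d (
    lin-≤ (d ∷ n ∷ a ∷ b ∷ c ∷ δ ∷ eDA ∷ eDB ∷ eDC ∷ eDD ∷ eAD ∷ eBD ∷ eCD ∷ f ∷ [])
      ((ξ 0 ⊗ (((ξ 2 ⊕ ξ 3) ⊕ ξ 4) ⊕ ξ 0) , ξ 0 ⊗ ξ 1) ∷ (ξ 5 ⊗ ξ 0 , ((ξ 6 ⊕ ξ 7) ⊕ ξ 8) ⊕ ξ 9) ∷
       (ξ 5 ⊗ ξ 0 , ((ξ 10 ⊕ ξ 11) ⊕ ξ 12) ⊕ ξ 9) ∷ (ξ 6 ⊕ ξ 10 , ξ 0 ⊗ ξ 2) ∷ (ξ 7 ⊕ ξ 11 , ξ 0 ⊗ ξ 3) ∷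
       (ξ 8 ⊕ ξ 12 , ξ 0 ⊗ ξ 4) ∷ (ξ 9 , ξ 13 ⊗ ξ 0) ∷ [])
      (ξ 0 ⊗ ((2 ⊙ ξ 5) ⊕ ξ 0)) (ξ 0 ⊗ (ξ 1 ⊕ (2 ⊙ ξ 13))) (1 ∷ 1 ∷ 1 ∷ 1 ∷ 1 ∷ 1 ∷ 1 ∷ 2 ∷ []) (# 0) refl
      (ℕₚ.≤-reflexive (sym (cong (d *_) e)) , h1 , h2 , h3 , h4 , h5 , h6 , tt))

private
  record Sizes (n a b c d z : ℕ) : Set where
    field
      a≥ : n ≤ 4 · a + z
      b≥ : n ≤ 4 · b + z
      c≥ : n ≤ 4 · c + z
      d≥ : n ≤ 4 · d + z
      a≤ : 4 · a ≤ n + z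
      b≤ : 4 · b ≤ n + z
      c≤ : 4 · c ≤ n + z
      d≤ : 4 · d ≤ n + z

  -- With 2δ about 3n/4 the inequalities read a + 2b ≥ 3n/4, c + 2b ≥ 3n/4, d ≤ n/4 and b ≤ d up to
  -- errors. Inserting the first two and b ≤ d into a + b + c + d = n yields b ≥ n/4, and then all
  -- four sizes are n/4.
  sizes : ∀ {n δ f g a b c d} → 3 · n ≤ 8 · δ + 4 → n ≡ a + b + c + d → f ≤ g → 4 ≤ g → b < d + f →
    2 · δ ≤ a + 2 · b + 2 · f → 2 · δ ≤ c + 2 · b + 3 · g → 2 · δ + d ≤ n + 2 · f → Sizes n a b c d (200 · g)
  sizes {n} {δ} {f} {g} {a} {b} {c} {d} h0 e h1 h2 h3 s1 s2 s3 = record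
    { a≥ = (lin-≤ (n ∷ δ ∷ a ∷ b ∷ c ∷ d ∷ f ∷ g ∷ [])
          ((3 ⊙ ξ 0 , (8 ⊙ ξ 1) ⊕ # 4) ∷ (ξ 6 , ξ 7) ∷ (# 4 , ξ 7) ∷ (# 1 ⊕ ξ 3 , ξ 5 ⊕ ξ 6) ∷
           (2 ⊙ ξ 1 , (ξ 2 ⊕ (2 ⊙ ξ 3)) ⊕ (2 ⊙ ξ 6)) ∷ ((2 ⊙ ξ 1) ⊕ ξ 5 , ξ 0 ⊕ (2 ⊙ ξ 6)) ∷ [])
          (ξ 0) ((4 ⊙ ξ 2) ⊕ (200 ⊙ ξ 7)) (1 ∷ 3 ∷ 32 ∷ 168 ∷ 8 ∷ 4 ∷ 8 ∷ []) (# 668) refl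
          (h0 , h1 , h2 , h3 , s1 , s3 , tt)) ; b≥ = lin-≤ (n ∷ δ ∷ a ∷ b ∷ c ∷ d ∷ f ∷ g ∷ [])
          ((3 ⊙ ξ 0 , (8 ⊙ ξ 1) ⊕ # 4) ∷ (((ξ 2 ⊕ ξ 3) ⊕ ξ 4) ⊕ ξ 5 , ξ 0) ∷ (ξ 6 , ξ 7) ∷ (# 4 , ξ 7) ∷
           (# 1 ⊕ ξ 3 , ξ 5 ⊕ ξ 6) ∷ (2 ⊙ ξ 1 , (ξ 2 ⊕ (2 ⊙ ξ 3)) ⊕ (2 ⊙ ξ 6)) ∷
           (2 ⊙ ξ 1 , (ξ 4 ⊕ (2 ⊙ ξ 3)) ⊕ (3 ⊙ ξ 7)) ∷ [])
          (ξ 0) ((4 ⊙ ξ 3) ⊕ (200 ⊙ ξ 7)) (1 ∷ 1 ∷ 2 ∷ 6 ∷ 188 ∷ 2 ∷ 2 ∷ 2 ∷ []) (# 750) refl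
          (h0 , ℕₚ.≤-reflexive (sym e) , h1 , h2 , h3 , s1 , s2 , tt)
    ; c≥ = (lin-≤ (n ∷ δ ∷ a ∷ b ∷ c ∷ d ∷ f ∷ g ∷ [])
          ((3 ⊙ ξ 0 , (8 ⊙ ξ 1) ⊕ # 4) ∷ (ξ 6 , ξ 7) ∷ (# 4 , ξ 7) ∷ (# 1 ⊕ ξ 3 , ξ 5 ⊕ ξ 6) ∷
           (2 ⊙ ξ 1 , (ξ 4 ⊕ (2 ⊙ ξ 3)) ⊕ (3 ⊙ ξ 7)) ∷ ((2 ⊙ ξ 1) ⊕ ξ 5 , ξ 0 ⊕ (2 ⊙ ξ 6)) ∷ [])
          (ξ 0) ((4 ⊙ ξ 4) ⊕ (200 ⊙ ξ 7)) (1 ∷ 3 ∷ 24 ∷ 164 ∷ 8 ∷ 4 ∷ 8 ∷ []) (# 652) refl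
          (h0 , h1 , h2 , h3 , s2 , s3 , tt)) ; d≥ = lin-≤ (n ∷ δ ∷ a ∷ b ∷ c ∷ d ∷ f ∷ g ∷ [])
          ((3 ⊙ ξ 0 , (8 ⊙ ξ 1) ⊕ # 4) ∷ (((ξ 2 ⊕ ξ 3) ⊕ ξ 4) ⊕ ξ 5 , ξ 0) ∷ (ξ 6 , ξ 7) ∷ (# 4 , ξ 7) ∷
           (# 1 ⊕ ξ 3 , ξ 5 ⊕ ξ 6) ∷ (2 ⊙ ξ 1 , (ξ 2 ⊕ (2 ⊙ ξ 3)) ⊕ (2 ⊙ ξ 6)) ∷
           (2 ⊙ ξ 1 , (ξ 4 ⊕ (2 ⊙ ξ 3)) ⊕ (3 ⊙ ξ 7)) ∷ [])
          (ξ 0) ((4 ⊙ ξ 5) ⊕ (200 ⊙ ξ 7)) (1 ∷ 1 ∷ 2 ∷ 10 ∷ 184 ∷ 6 ∷ 2 ∷ 2 ∷ []) (# 738) refl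
          (h0 , ℕₚ.≤-reflexive (sym e) , h1 , h2 , h3 , s1 , s2 , tt)
    ; a≤ = (lin-≤ (n ∷ δ ∷ a ∷ b ∷ c ∷ d ∷ f ∷ g ∷ [])
          ((3 ⊙ ξ 0 , (8 ⊙ ξ 1) ⊕ # 4) ∷ (((ξ 2 ⊕ ξ 3) ⊕ ξ 4) ⊕ ξ 5 , ξ 0) ∷ (ξ 6 , ξ 7) ∷ (# 4 , ξ 7) ∷
           (# 1 ⊕ ξ 3 , ξ 5 ⊕ ξ 6) ∷ (2 ⊙ ξ 1 , (ξ 4 ⊕ (2 ⊙ ξ 3)) ⊕ (3 ⊙ ξ 7)) ∷ [])
          (4 ⊙ ξ 2) (ξ 0 ⊕ (200 ⊙ ξ 7)) (1 ∷ 1 ∷ 4 ∷ 4 ∷ 184 ∷ 4 ∷ 4 ∷ []) (# 736) refl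
          (h0 , ℕₚ.≤-reflexive (sym e) , h1 , h2 , h3 , s2 , tt)) ; b≤ = lin-≤ (n ∷ δ ∷ a ∷ b ∷ c ∷ d ∷ f ∷ g ∷ [])
          ((3 ⊙ ξ 0 , (8 ⊙ ξ 1) ⊕ # 4) ∷ (ξ 6 , ξ 7) ∷ (# 4 , ξ 7) ∷ (# 1 ⊕ ξ 3 , ξ 5 ⊕ ξ 6) ∷
           ((2 ⊙ ξ 1) ⊕ ξ 5 , ξ 0 ⊕ (2 ⊙ ξ 6)) ∷ [])
          (4 ⊙ ξ 3) (ξ 0 ⊕ (200 ⊙ ξ 7)) (1 ∷ 1 ∷ 12 ∷ 188 ∷ 4 ∷ 4 ∷ []) (# 752) refl (h0 , h1 , h2 , h3 , s3 , tt)
    ; c≤ = (lin-≤ (n ∷ δ ∷ a ∷ b ∷ c ∷ d ∷ f ∷ g ∷ [])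
          ((3 ⊙ ξ 0 , (8 ⊙ ξ 1) ⊕ # 4) ∷ (((ξ 2 ⊕ ξ 3) ⊕ ξ 4) ⊕ ξ 5 , ξ 0) ∷ (ξ 6 , ξ 7) ∷ (# 4 , ξ 7) ∷
           (# 1 ⊕ ξ 3 , ξ 5 ⊕ ξ 6) ∷ (2 ⊙ ξ 1 , (ξ 2 ⊕ (2 ⊙ ξ 3)) ⊕ (2 ⊙ ξ 6)) ∷ [])
          (4 ⊙ ξ 4) (ξ 0 ⊕ (200 ⊙ ξ 7)) (1 ∷ 1 ∷ 4 ∷ 12 ∷ 188 ∷ 4 ∷ 4 ∷ []) (# 752) refl
          (h0 , ℕₚ.≤-reflexive (sym e) , h1 , h2 , h3 , s1 , tt)) ; d≤ = (lin-≤ (n ∷ δ ∷ a ∷ b ∷ c ∷ d ∷ f ∷ g ∷ [])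
          ((3 ⊙ ξ 0 , (8 ⊙ ξ 1) ⊕ # 4) ∷ (ξ 6 , ξ 7) ∷ (# 4 , ξ 7) ∷ ((2 ⊙ ξ 1) ⊕ ξ 5 , ξ 0 ⊕ (2 ⊙ ξ 6)) ∷ [])
          (4 ⊙ ξ 5) (ξ 0 ⊕ (200 ⊙ ξ 7)) (1 ∷ 1 ∷ 8 ∷ 192 ∷ 4 ∷ []) (# 764) refl (h0 , h1 , h2 , s3 , tt)) }

  -- A class x whose only substantial neighbourhood besides itself is y is joined to y completely and to itself
  -- with density one half; the defect q stands for the stray arcs.
  full : ∀ {n δ x y exx exy q g} → 3 · n ≤ 8 · δ + 4 → 4 ≤ g → x ≤ n → 4 · x ≤ n + 200 · g → 4 · y ≤ n + 200 · g →
    δ * x ≤ exx + exy + q → 2 · exx ≤ x * x → q ≤ g * n → x * y ≤ exy + 2000 · g * n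
  full {n} {δ} {x} {y} {exx} {exy} {q} {g} h0 h4 x≤n hx hy h1 h2 h3 = lin-≤ (δ ∷ x ∷ exx ∷ exy ∷ q ∷ g ∷ n ∷ y ∷ [])
        ((ξ 0 ⊗ ξ 1 , (ξ 2 ⊕ ξ 3) ⊕ ξ 4) ∷ (2 ⊙ ξ 2 , ξ 1 ⊗ ξ 1) ∷ (ξ 4 , ξ 5 ⊗ ξ 6) ∷
         (ξ 1 ⊗ (3 ⊙ ξ 6) , ξ 1 ⊗ ((8 ⊙ ξ 0) ⊕ # 4)) ∷ (ξ 1 ⊗ (4 ⊙ ξ 1) , ξ 1 ⊗ (ξ 6 ⊕ (200 ⊙ ξ 5))) ∷
         (ξ 1 ⊗ (4 ⊙ ξ 7) , ξ 1 ⊗ (ξ 6 ⊕ (200 ⊙ ξ 5))) ∷ (ξ 5 ⊗ ξ 1 , ξ 5 ⊗ ξ 6) ∷ (# 4 ⊗ ξ 1 , ξ 5 ⊗ ξ 6) ∷ [])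
        (ξ 1 ⊗ ξ 7) (ξ 3 ⊕ ((2000 ⊙ ξ 5) ⊗ ξ 6)) (8 ∷ 8 ∷ 4 ∷ 8 ∷ 1 ∷ 1 ∷ 2 ∷ 600 ∷ 1 ∷ [])
         (15391 ⊙ (ξ 5 ⊗ ξ 6) ⊕ # 7) refl
        (h1 , h2 , h3 , ℕₚ.*-monoʳ-≤ x h0 , ℕₚ.*-monoʳ-≤ x hx , ℕₚ.*-monoʳ-≤ x hy , ℕₚ.*-monoʳ-≤ g x≤n ,
         ℕₚ.*-mono-≤ h4 x≤n , tt)

  half : ∀ {n δ x y exx exy q g} → 3 · n ≤ 8 · δ + 4 → 4 ≤ g → x ≤ n → n ≤ 4 · x + 200 · g → 4 · y ≤ n + 200 · g →
    δ * x ≤ exx + exy + q → exy ≤ x * y → q ≤ g * n → n * n ≤ 32 · exx + 2000 · g * n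
  half {n} {δ} {x} {y} {exx} {exy} {q} {g} h0 h4 x≤n hx hy h1 h2 h3 = lin-≤ (δ ∷ x ∷ exx ∷ exy ∷ q ∷ y ∷ g ∷ n ∷ [])
        ((ξ 0 ⊗ ξ 1 , (ξ 2 ⊕ ξ 3) ⊕ ξ 4) ∷ (ξ 3 , ξ 1 ⊗ ξ 5) ∷ (ξ 4 , ξ 6 ⊗ ξ 7) ∷
         (ξ 1 ⊗ (3 ⊙ ξ 7) , ξ 1 ⊗ ((8 ⊙ ξ 0) ⊕ # 4)) ∷ (ξ 1 ⊗ (4 ⊙ ξ 5) , ξ 1 ⊗ (ξ 7 ⊕ (200 ⊙ ξ 6))) ∷
         (ξ 7 ⊗ ξ 7 , ξ 7 ⊗ ((4 ⊙ ξ 1) ⊕ (200 ⊙ ξ 6))) ∷ (ξ 6 ⊗ ξ 1 , ξ 6 ⊗ ξ 7) ∷ (# 4 ⊗ ξ 1 , ξ 6 ⊗ ξ 7) ∷ [])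
        (ξ 7 ⊗ ξ 7) ((32 ⊙ ξ 2) ⊕ ((2000 ⊙ ξ 6) ⊗ ξ 7)) (1 ∷ 32 ∷ 32 ∷ 32 ∷ 4 ∷ 8 ∷ 1 ∷ 1600 ∷ 4 ∷ [])
         (164 ⊙ (ξ 6 ⊗ ξ 7)) refl
        (h1 , h2 , h3 , ℕₚ.*-monoʳ-≤ x h0 , ℕₚ.*-monoʳ-≤ x hy , ℕₚ.*-monoʳ-≤ n hx , ℕₚ.*-monoʳ-≤ g x≤n ,
         ℕₚ.*-mono-≤ h4 x≤n , tt)

  -- In- and outdegrees of `D` are added because the two directions between `D` and `B` share the
  -- `d * b` pairs. What is left has to fill `C → D` and `D → A` almost completely.
  fullD : ∀ {n δ a b c d eDA eCD eDB eBD q g} → 3 · n ≤ 8 · δ + 4 → 4 ≤ g → n ≡ a + b + c + d → d ≤ n → n ≤ 4 · d + 200 · g →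
    2 · (δ * d) ≤ eDA + eCD + eDB + eBD + q → eDB + eBD ≤ d * b → eCD ≤ c * d → q ≤ 3 · (g * n) → d * a ≤ eDA + 2000 · g * n
  fullD {n} {δ} {a} {b} {c} {d} {eDA} {eCD} {eDB} {eBD} {q} {g} h0 h4 e d≤n hd h1 h2 h3 h5 =
      lin-≤ (δ ∷ d ∷ eDA ∷ eCD ∷ eDB ∷ eBD ∷ q ∷ b ∷ c ∷ g ∷ n ∷ a ∷ [])
        ((2 ⊙ (ξ 0 ⊗ ξ 1) , (((ξ 2 ⊕ ξ 3) ⊕ ξ 4) ⊕ ξ 5) ⊕ ξ 6) ∷ (ξ 4 ⊕ ξ 5 , ξ 1 ⊗ ξ 7) ∷ (ξ 3 , ξ 8 ⊗ ξ 1) ∷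
         (ξ 6 , 3 ⊙ (ξ 9 ⊗ ξ 10)) ∷ (ξ 1 ⊗ (3 ⊙ ξ 10) , ξ 1 ⊗ ((8 ⊙ ξ 0) ⊕ # 4)) ∷
         (ξ 1 ⊗ (((ξ 11 ⊕ ξ 7) ⊕ ξ 8) ⊕ ξ 1) , ξ 1 ⊗ ξ 10) ∷ (ξ 1 ⊗ ξ 10 , ξ 1 ⊗ ((4 ⊙ ξ 1) ⊕ (200 ⊙ ξ 9))) ∷
         (ξ 9 ⊗ ξ 1 , ξ 9 ⊗ ξ 10) ∷ (# 4 ⊗ ξ 1 , ξ 9 ⊗ ξ 10) ∷ [])
        (ξ 1 ⊗ ξ 11) (ξ 2 ⊕ ((2000 ⊙ ξ 9) ⊗ ξ 10)) (4 ∷ 4 ∷ 4 ∷ 4 ∷ 4 ∷ 1 ∷ 4 ∷ 1 ∷ 200 ∷ 1 ∷ [])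
         (7787 ⊙ (ξ 9 ⊗ ξ 10) ⊕ # 3) refl
        (h1 , h2 , h3 , h5 , ℕₚ.*-monoʳ-≤ d h0 , ℕₚ.≤-reflexive (sym (cong (d *_) e)) , ℕₚ.*-monoʳ-≤ d hd ,
         ℕₚ.*-monoʳ-≤ g d≤n , ℕₚ.*-mono-≤ h4 d≤n , tt)

two-degrees : ∀ {n δ} (G : OrientedGraph n) → minSemiDegree≥ G δ → Fin n → 2 · δ ≤ n
two-degrees {n} {δ} G md x = lin-≤ (δ ∷ outdeg G x ∷ indeg G x ∷ cnt (λ y → does (arc? G x y)) (allFin n) ∷
      cnt (λ w → does (arc? G w x)) (allFin n) ∷ cnt (λ z → true) (allFin n) ∷ n ∷ [])
      ((ξ 0 , ξ 1) ∷ (ξ 0 , ξ 2) ∷ (ξ 1 , ξ 3) ∷ (ξ 2 , ξ 4) ∷ (ξ 3 ⊕ ξ 4 , ξ 5) ∷ (ξ 5 , ξ 6) ∷ [])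
      (2 ⊙ ξ 0) (ξ 6) (1 ∷ 1 ∷ 1 ∷ 1 ∷ 1 ∷ 1 ∷ 1 ∷ []) (# 0) refl
      (proj₁ (md x) , proj₂ (md x) , ℕₚ.≤-reflexive (outdeg-cnt G x) , ℕₚ.≤-reflexive (indeg-cnt G x) , both ,
       ℕₚ.≤-reflexive all , tt)
  where
  all : cnt (λ _ → true) (allFin n) ≡ n
  all = trans (cnt-true (allFin n)) (Listₚ.length-tabulate id)
  both : cnt (adj G x) (allFin n) + cnt (λ w → adj G w x) (allFin n) ≤ cnt (λ _ → true) (allFin n)
  both = ℕₚ.≤-trans (ℕₚ.≤-reflexive (sym (sumOf-+ (λ y → b2n (adj G x y)) (λ y → b2n (adj G y x)) (allFin n)))) (sumOf-mono (allFin n) λ {y} _ → adj-asym G x y)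

-- From a set that does not expand to the extremal structure

module FromViolation {n : ℕ} (G : OrientedGraph n) {δ f g : ℕ} (md : minSemiDegree≥ G δ) (δ≥ : 3 · n ≤ 8 · δ + 4)
    (0<n : 0 < n) (4≤g : 4 ≤ g) (f≤g : f ≤ g) (fn≤ : f * n ≤ g * g) (g≤n : g ≤ n)
    (T : Fin n → Bool) (viol : Violating G f f (2 · g) T) where
  private
    V = Fin n
    E = adj G
    Vs = allFin n
    N : V → Bool
    N = Nb G f T

  -- The cells of `N` and `T`. A vertex outside `N`, that is in `A` or `D`, sends at most `f` arcs
  -- into `T`, the union of `C` and `D`.
  A B C D : V → Bool
  A x = not (N x) ∧ not (T x)
  B x = N x ∧ not (T x)
  C x = N x ∧ T x
  D x = not (N x) ∧ T x

  private
    part : Partition G A B C D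
    part = record { one = λ x → one (N x) (T x) }
      where
      one : ∀ p q → b2n (not p ∧ not q) + b2n (p ∧ not q) + b2n (p ∧ q) + b2n (not p ∧ q) ≡ 1
      one true  true  = refl
      one true  false = refl
      one false true  = refl
      one false false = refl
    open Partition part

    a b c d : ℕ
    a = size G A
    b = size G B
    c = size G C
    d = size G D

    stray : ∀ P → (∀ x → P x ≡ true → N x ≡ false) → edges G P C + edges G P D ≤ f * size G P
    stray P h = ℕₚ.≤-trans (ℕₚ.≤-reflexive (trans (sym (sumOf-+ _ _ Vs)) (sumOf-cong Vs λ {x} _ → sym (ℕₚ.*-distribˡ-+ (b2n (P x)) _ _))))
      (weighted≤ G P (λ x → row G x C + row G x D) f λ x p →
        ℕₚ.≤-trans (ℕₚ.≤-reflexive (trans (sym (sumOf-+ _ _ Vs)) (sumOf-cong Vs λ {y} _ → both (E x y) (N y) (T y)))) (<ᵇ-false {f} (h x p)))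
      where
      both : ∀ e p q → b2n (e ∧ (p ∧ q)) + b2n (e ∧ (not p ∧ q)) ≡ b2n (e ∧ q)
      both false p     q     = refl
      both true  true  true  = refl
      both true  true  false = refl
      both true  false q     = refl

    strayA : edges G A C + edges G A D ≤ f * a
    strayA = stray A λ x p → not-true (proj₁ (∧-split p))
    strayD : edges G D C + edges G D D ≤ f * d
    strayD = stray D λ x p → not-true (proj₁ (∧-split p))

    b+c : cnt (Nb G f T) (allFin n) ≡ b + c
    b+c = trans (sumOf-cong Vs λ {x} _ → two (N x) (T x)) (sumOf-+ _ _ Vs)
      where
      two : ∀ p q → b2n p ≡ b2n (p ∧ not q) + b2n (p ∧ q)
      two true true = refl
      two true false = refl
      two false q = refl

    c+d : cnt T (allFin n) ≡ c + d
    c+d = trans (sumOf-cong Vs λ {x} _ → two (N x) (T x)) (sumOf-+ _ _ Vs)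
      where
      two : ∀ p q → b2n q ≡ b2n (p ∧ q) + b2n (not p ∧ q)
      two true true = refl
      two true false = refl
      two false true = refl
      two false false = refl

    n≡ : n ≡ a + b + c + d
    n≡ = size-parts

    b<d+f : b < d + f
    b<d+f = lin-≤ (cnt (Nb G f T) (allFin n) ∷ b ∷ c ∷ cnt T (allFin n) ∷ d ∷ f ∷ [])
          ((ξ 1 ⊕ ξ 2 , ξ 0) ∷ (ξ 3 , ξ 2 ⊕ ξ 4) ∷ (# 1 ⊕ ξ 0 , ξ 3 ⊕ ξ 5) ∷ [])
          (# 1 ⊕ ξ 1) (ξ 4 ⊕ ξ 5) (1 ∷ 1 ∷ 1 ∷ 1 ∷ []) (# 0) refl
          (ℕₚ.≤-reflexive (sym b+c) , ℕₚ.≤-reflexive c+d , proj₁ (proj₂ viol) , tt)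

    2g≤c+d : 2 · g ≤ c + d
    2g≤c+d = ℕₚ.≤-trans (proj₁ viol) (ℕₚ.≤-reflexive c+d)

    2g≤a+d : 2 · g ≤ a + d
    2g≤a+d = lin-≤ (cnt (Nb G f T) (allFin n) ∷ b ∷ c ∷ n ∷ a ∷ d ∷ g ∷ [])
          ((ξ 1 ⊕ ξ 2 , ξ 0) ∷ (ξ 3 , ((ξ 4 ⊕ ξ 1) ⊕ ξ 2) ⊕ ξ 5) ∷ (ξ 0 ⊕ (2 ⊙ ξ 6) , ξ 3) ∷ [])
          (2 ⊙ ξ 6) (ξ 4 ⊕ ξ 5) (1 ∷ 1 ∷ 1 ∷ 1 ∷ []) (# 0) refl
          (ℕₚ.≤-reflexive (sym b+c) , ℕₚ.≤-reflexive n≡ , proj₂ (proj₂ viol) , tt)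

    0<g : 0 < g
    0<g = ℕₚ.≤-trans (s≤s z≤n) 4≤g

    a≤n : a ≤ n
    a≤n = lin-≤ (n ∷ a ∷ b ∷ c ∷ d ∷ [])
          ((((ξ 1 ⊕ ξ 2) ⊕ ξ 3) ⊕ ξ 4 , ξ 0) ∷ [])
          (ξ 1) (ξ 0) (1 ∷ 1 ∷ []) (ξ 2 ⊕ ξ 3 ⊕ ξ 4) refl (ℕₚ.≤-reflexive (sym n≡) , tt)
    c≤n : c ≤ n
    c≤n = lin-≤ (n ∷ a ∷ b ∷ c ∷ d ∷ [])
          ((((ξ 1 ⊕ ξ 2) ⊕ ξ 3) ⊕ ξ 4 , ξ 0) ∷ [])
          (ξ 3) (ξ 0) (1 ∷ 1 ∷ []) (ξ 1 ⊕ ξ 2 ⊕ ξ 4) refl (ℕₚ.≤-reflexive (sym n≡) , tt)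
    d≤n : d ≤ n
    d≤n = lin-≤ (n ∷ a ∷ b ∷ c ∷ d ∷ [])
          ((((ξ 1 ⊕ ξ 2) ⊕ ξ 3) ⊕ ξ 4 , ξ 0) ∷ [])
          (ξ 4) (ξ 0) (1 ∷ 1 ∷ []) (ξ 1 ⊕ ξ 2 ⊕ ξ 3) refl (ℕₚ.≤-reflexive (sym n≡) , tt)

    a+d≤n : a + d ≤ n
    a+d≤n = lin-≤ (n ∷ a ∷ b ∷ c ∷ d ∷ [])
          ((((ξ 1 ⊕ ξ 2) ⊕ ξ 3) ⊕ ξ 4 , ξ 0) ∷ [])
          (ξ 1 ⊕ ξ 4) (ξ 0) (1 ∷ 1 ∷ []) (ξ 2 ⊕ ξ 3) refl (ℕₚ.≤-reflexive (sym n≡) , tt)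

    fa+fd : f * a + f * d ≤ g * g
    fa+fd = ℕₚ.≤-trans (ℕₚ.≤-trans (ℕₚ.≤-reflexive (sym (ℕₚ.*-distribˡ-+ f a d))) (ℕₚ.*-monoʳ-≤ f a+d≤n)) fn≤

    gg≤gn : g * g ≤ g * n
    gg≤gn = ℕₚ.*-monoʳ-≤ g g≤n

    s1 : 2 · δ ≤ a + 2 · b + 2 · f
    s1 = [ empty , (λ 0<a → out-bound {eAA = edges G A A} {edges G A B} {edges G A C} {edges G A D} 0<a (edges-out A md) (edges-self G A) (edges-≤ G A B) strayA) ]′ (ℕₚ.≤-<-connex a 0)
      where
      empty : a ≤ 0 → 2 · δ ≤ a + 2 · b + 2 · f
      empty a≤0 = ℕₚ.≤-trans (out-bound₀ {b = b} {d = d} {f = f} {eDA = edges G D A} {edges G D B} {edges G D C} {edges G D D} (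
          lin-≤ (g ∷ a ∷ d ∷ [])
            ((2 ⊙ ξ 0 , ξ 1 ⊕ ξ 2) ∷ (ξ 1 , # 0) ∷ (# 1 ⊕ # 0 , ξ 0) ∷ [])
            (# 1 ⊕ # 0) (ξ 2) (1 ∷ 1 ∷ 1 ∷ 2 ∷ []) (# 1) refl (2g≤a+d , a≤0 , 0<g , tt)) (edges-out D md)
        (ℕₚ.≤-trans (edges-≤ G D A) (ℕₚ.*-monoʳ-≤ d a≤0)) (edges-≤ G D B) strayD) (ℕₚ.+-monoˡ-≤ (2 · f) (ℕₚ.m≤n+m (2 · b) a))

    s2 : 2 · δ ≤ c + 2 · b + 3 · g
    s2 = [ large , small ]′ (ℕₚ.≤-<-connex g c)
      where
      weaken : ∀ {c b} → 2 · δ ≤ c + 2 · b + 2 · g → 2 · δ ≤ c + 2 · b + 3 · g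
      weaken {c} {b} h = lin-≤ (δ ∷ c ∷ b ∷ g ∷ [])
            ((2 ⊙ ξ 0 , (ξ 1 ⊕ (2 ⊙ ξ 2)) ⊕ (2 ⊙ ξ 3)) ∷ [])
            (2 ⊙ ξ 0) ((ξ 1 ⊕ (2 ⊙ ξ 2)) ⊕ (3 ⊙ ξ 3)) (1 ∷ 1 ∷ []) (ξ 3) refl (h , tt)
      large : g ≤ c → 2 · δ ≤ c + 2 · b + 3 · g
      large g≤c = weaken {c} {b} (in-bound {eAC = edges G A C} {edges G B C} {edges G C C} {edges G D C} (ℕₚ.<-≤-trans 0<g g≤c) g≤c (edges-in C md) (edges-self G C) (edges-≤ G B C)
        (lin-≤ (edges G A C ∷ edges G A D ∷ f ∷ a ∷ edges G D C ∷ edges G D D ∷ d ∷ g ∷ [])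
              ((ξ 0 ⊕ ξ 1 , ξ 2 ⊗ ξ 3) ∷ (ξ 4 ⊕ ξ 5 , ξ 2 ⊗ ξ 6) ∷ ((ξ 2 ⊗ ξ 3) ⊕ (ξ 2 ⊗ ξ 6) , ξ 7 ⊗ ξ 7) ∷ [])
              (ξ 0 ⊕ ξ 4) (ξ 7 ⊗ ξ 7) (1 ∷ 1 ∷ 1 ∷ 1 ∷ []) (ξ 1 ⊕ ξ 5) refl (strayA , strayD , fa+fd , tt)))
      -- Since `T` has at least `2 · g` vertices, a small `C` leaves more than `g` of them for `D`.
      small : c < g → 2 · δ ≤ c + 2 · b + 3 · g
      small c<g = lin-≤ (δ ∷ b ∷ c ∷ g ∷ []) ((ξ 0 , (ξ 1 ⊕ ξ 2) ⊕ ξ 3) ∷ (# 1 ⊕ ξ 2 , ξ 3) ∷ [])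
          (2 ⊙ ξ 0) ((ξ 2 ⊕ (2 ⊙ ξ 1)) ⊕ (3 ⊙ ξ 3)) (1 ∷ 2 ∷ 1 ∷ []) (# 1) refl
          (in-bound₀ {δ} {b} {c} {d} {g} {eAD = edges G A D} {edges G B D} {edges G C D} {edges G D D} g≤d
            (ℕₚ.<-≤-trans 0<g g≤d) (edges-in D md) (edges-≤ G B D) (edges-≤ G C D) strayAD , c<g , tt)
        where
        g≤d : g ≤ d
        g≤d = lin-≤ (g ∷ c ∷ d ∷ [])
              ((2 ⊙ ξ 0 , ξ 1 ⊕ ξ 2) ∷ (# 1 ⊕ ξ 1 , ξ 0) ∷ [])
              (ξ 0) (ξ 2) (1 ∷ 1 ∷ 1 ∷ []) (# 1) refl (2g≤c+d , c<g , tt)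
        strayAD : edges G A D + edges G D D ≤ g * g
        strayAD = lin-≤ (edges G A C ∷ edges G A D ∷ f ∷ a ∷ edges G D C ∷ edges G D D ∷ d ∷ g ∷ [])
              ((ξ 0 ⊕ ξ 1 , ξ 2 ⊗ ξ 3) ∷ (ξ 4 ⊕ ξ 5 , ξ 2 ⊗ ξ 6) ∷ ((ξ 2 ⊗ ξ 3) ⊕ (ξ 2 ⊗ ξ 6) , ξ 7 ⊗ ξ 7) ∷ [])
              (ξ 1 ⊕ ξ 5) (ξ 7 ⊗ ξ 7) (1 ∷ 1 ∷ 1 ∷ 1 ∷ []) (ξ 0 ⊕ ξ 4) refl (strayA , strayD , fa+fd , tt)

    s3 : 2 · δ + d ≤ n + 2 · f
    s3 = [ empty , (λ 0<d → sparse-bound {eDA = edges G D A} {edges G A D} {edges G D B} {edges G B D} {edges G D C} {edges G C D} {edges G D D} 0<d n≡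
        (edges-out D md) (edges-in D md) (edges-pair G D A) (edges-pair G D B) (edges-pair G D C)
        (ℕₚ.≤-trans (ℕₚ.m≤n+m _ (edges G D C)) strayD)) ]′ (ℕₚ.≤-<-connex d 0)
      where
      empty : d ≤ 0 → 2 · δ + d ≤ n + 2 · f
      empty d≤0 = lin-≤ (δ ∷ n ∷ d ∷ f ∷ [])
            ((2 ⊙ ξ 0 , ξ 1) ∷ (ξ 2 , # 0) ∷ [])
            ((2 ⊙ ξ 0) ⊕ ξ 2) (ξ 1 ⊕ (2 ⊙ ξ 3)) (1 ∷ 1 ∷ 1 ∷ []) (2 ⊙ ξ 3) refl
            (two-degrees G md (Fin.fromℕ< 0<n) , d≤0 , tt)

    sz : Sizes n a b c d (200 · g)
    sz = sizes δ≥ n≡ f≤g 4≤g b<d+f s1 s2 s3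
    open Sizes sz

  opaque
    extremal : Extremal G (200 · g) (2000 · g) A B C D
    extremal = record
      { partition = part ; a≥ = a≥ ; b≥ = b≥ ; c≥ = c≥ ; d≥ = d≥ ; a≤ = a≤ ; b≤ = b≤ ; c≤ = c≤ ; d≤ = d≤
      ; ab = full δ≥ 4≤g a≤n a≤ b≤ outA (edges-self G A) (lin-≤ (edges G A C ∷ edges G A D ∷ f ∷ a ∷ d ∷ g ∷ n ∷ [])
            ((ξ 0 ⊕ ξ 1 , ξ 2 ⊗ ξ 3) ∷ ((ξ 2 ⊗ ξ 3) ⊕ (ξ 2 ⊗ ξ 4) , ξ 5 ⊗ ξ 5) ∷ (ξ 5 ⊗ ξ 5 , ξ 5 ⊗ ξ 6) ∷ [])
            (ξ 0 ⊕ ξ 1) (ξ 5 ⊗ ξ 6) (1 ∷ 1 ∷ 1 ∷ 1 ∷ []) ((ξ 2 ⊗ ξ 4)) refl (strayA , fa+fd , gg≤gn , tt))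
      ; bc = ℕₚ.≤-trans (ℕₚ.≤-reflexive (ℕₚ.*-comm b c)) (full δ≥ 4≤g c≤n c≤ b≤ inC′ (edges-self G C) (
          lin-≤ (edges G A C ∷ edges G A D ∷ f ∷ a ∷ edges G D C ∷ edges G D D ∷ d ∷ g ∷ n ∷ [])
            ((ξ 0 ⊕ ξ 1 , ξ 2 ⊗ ξ 3) ∷ (ξ 4 ⊕ ξ 5 , ξ 2 ⊗ ξ 6) ∷ ((ξ 2 ⊗ ξ 3) ⊕ (ξ 2 ⊗ ξ 6) , ξ 7 ⊗ ξ 7) ∷
             (ξ 7 ⊗ ξ 7 , ξ 7 ⊗ ξ 8) ∷ [])
            (ξ 0 ⊕ ξ 4) (ξ 7 ⊗ ξ 8) (1 ∷ 1 ∷ 1 ∷ 1 ∷ 1 ∷ []) (ξ 1 ⊕ ξ 5) refl (strayA , strayD , fa+fd , gg≤gn , tt)))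
      -- The count for `D → A` with the roles of `A` and `C` exchanged.
      ; cd = ℕₚ.≤-trans (ℕₚ.≤-reflexive (ℕₚ.*-comm c d)) (fullD {a = c} {b} {a} {d} {edges G C D} {edges G D A} {edges G D B} {edges G B D} {q} δ≥ 4≤g n≡′ d≤n d≥
          (lin-≤ (δ ∷ d ∷ edges G D A ∷ edges G C D ∷ edges G D B ∷ edges G B D ∷
                sumOf (λ x → b2n (D x) * row G x C) (Data.List.Base.tabulate id) ∷ edges G D D ∷ edges G A D ∷ [])
                ((2 ⊙ (ξ 0 ⊗ ξ 1) , (((ξ 2 ⊕ ξ 3) ⊕ ξ 4) ⊕ ξ 5) ⊕ ((ξ 6 ⊕ ξ 7) ⊕ (ξ 8 ⊕ ξ 7))) ∷ [])
                (2 ⊙ (ξ 0 ⊗ ξ 1)) ((((ξ 3 ⊕ ξ 2) ⊕ ξ 4) ⊕ ξ 5) ⊕ ((ξ 6 ⊕ ξ 7) ⊕ (ξ 8 ⊕ ξ 7))) (1 ∷ 1 ∷ []) (# 0) refl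
                (bothD , tt)) (edges-pair G D B) (ℕₚ.≤-trans (edges-≤ G D A) (ℕₚ.≤-reflexive (ℕₚ.*-comm d a))) strayD′)
      ; da = fullD {a = a} {b} {c} {d} {edges G D A} {edges G C D} {edges G D B} {edges G B D} {q} δ≥ 4≤g n≡ d≤n d≥ bothD (edges-pair G D B) (edges-≤ G C D) strayD′
      ; aa = half δ≥ 4≤g a≤n a≥ b≤ outA (edges-≤ G A B) (lin-≤ (edges G A C ∷ edges G A D ∷ f ∷ a ∷ d ∷ g ∷ n ∷ [])
            ((ξ 0 ⊕ ξ 1 , ξ 2 ⊗ ξ 3) ∷ ((ξ 2 ⊗ ξ 3) ⊕ (ξ 2 ⊗ ξ 4) , ξ 5 ⊗ ξ 5) ∷ (ξ 5 ⊗ ξ 5 , ξ 5 ⊗ ξ 6) ∷ [])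
            (ξ 0 ⊕ ξ 1) (ξ 5 ⊗ ξ 6) (1 ∷ 1 ∷ 1 ∷ 1 ∷ []) ((ξ 2 ⊗ ξ 4)) refl (strayA , fa+fd , gg≤gn , tt))
      ; cc = half δ≥ 4≤g c≤n c≥ b≤ inC′ (ℕₚ.≤-trans (edges-≤ G B C) (ℕₚ.≤-reflexive (ℕₚ.*-comm b c))) (
          lin-≤ (edges G A C ∷ edges G A D ∷ f ∷ a ∷ edges G D C ∷ edges G D D ∷ d ∷ g ∷ n ∷ [])
            ((ξ 0 ⊕ ξ 1 , ξ 2 ⊗ ξ 3) ∷ (ξ 4 ⊕ ξ 5 , ξ 2 ⊗ ξ 6) ∷ ((ξ 2 ⊗ ξ 3) ⊕ (ξ 2 ⊗ ξ 6) , ξ 7 ⊗ ξ 7) ∷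
             (ξ 7 ⊗ ξ 7 , ξ 7 ⊗ ξ 8) ∷ [])
            (ξ 0 ⊕ ξ 4) (ξ 7 ⊗ ξ 8) (1 ∷ 1 ∷ 1 ∷ 1 ∷ 1 ∷ []) (ξ 1 ⊕ ξ 5) refl (strayA , strayD , fa+fd , gg≤gn , tt))
      ; db = half {x = d} {a} {edges G D B} {edges G D A} {q = edges G D C + edges G D D} δ≥ 4≤g d≤n d≥ a≤ (
          lin-≤ (δ ∷ size G D ∷ edges G D A ∷ edges G D B ∷ edges G D C ∷ edges G D D ∷ [])
            ((ξ 0 ⊗ ξ 1 , ((ξ 2 ⊕ ξ 3) ⊕ ξ 4) ⊕ ξ 5) ∷ [])
            (ξ 0 ⊗ ξ 1) ((ξ 3 ⊕ ξ 2) ⊕ (ξ 4 ⊕ ξ 5)) (1 ∷ 1 ∷ []) (# 0) refl (edges-out D md , tt)) (edges-≤ G D A) (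
          lin-≤ (edges G D C ∷ edges G D D ∷ f ∷ d ∷ a ∷ g ∷ n ∷ [])
            ((ξ 0 ⊕ ξ 1 , ξ 2 ⊗ ξ 3) ∷ ((ξ 2 ⊗ ξ 4) ⊕ (ξ 2 ⊗ ξ 3) , ξ 5 ⊗ ξ 5) ∷ (ξ 5 ⊗ ξ 5 , ξ 5 ⊗ ξ 6) ∷ [])
            (ξ 0 ⊕ ξ 1) (ξ 5 ⊗ ξ 6) (1 ∷ 1 ∷ 1 ∷ 1 ∷ []) ((ξ 2 ⊗ ξ 4)) refl (strayD , fa+fd , gg≤gn , tt))
      ; bd = half {x = d} {c} {edges G B D} {edges G C D} {q = edges G A D + edges G D D} δ≥ 4≤g d≤n d≥ c≤ (
          lin-≤ (δ ∷ size G D ∷ edges G A D ∷ edges G B D ∷ edges G C D ∷ edges G D D ∷ [])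
            ((ξ 0 ⊗ ξ 1 , ((ξ 2 ⊕ ξ 3) ⊕ ξ 4) ⊕ ξ 5) ∷ [])
            (ξ 0 ⊗ ξ 1) ((ξ 3 ⊕ ξ 4) ⊕ (ξ 2 ⊕ ξ 5)) (1 ∷ 1 ∷ []) (# 0) refl (edges-in D md , tt)) (ℕₚ.≤-trans (edges-≤ G C D) (ℕₚ.≤-reflexive (ℕₚ.*-comm c d))) (
          lin-≤ (edges G A C ∷ edges G A D ∷ f ∷ a ∷ edges G D C ∷ edges G D D ∷ d ∷ g ∷ n ∷ [])
            ((ξ 0 ⊕ ξ 1 , ξ 2 ⊗ ξ 3) ∷ (ξ 4 ⊕ ξ 5 , ξ 2 ⊗ ξ 6) ∷ ((ξ 2 ⊗ ξ 3) ⊕ (ξ 2 ⊗ ξ 6) , ξ 7 ⊗ ξ 7) ∷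
             (ξ 7 ⊗ ξ 7 , ξ 7 ⊗ ξ 8) ∷ [])
            (ξ 1 ⊕ ξ 5) (ξ 7 ⊗ ξ 8) (1 ∷ 1 ∷ 1 ∷ 1 ∷ 1 ∷ []) (ξ 0 ⊕ ξ 4) refl (strayA , strayD , fa+fd , gg≤gn , tt)) }
      where
      n≡′ : n ≡ c + b + a + d
      n≡′ = (ℕₚ.≤-antisym (lin-≤ (n ∷ a ∷ b ∷ c ∷ d ∷ [])
            ((ξ 0 , ((ξ 1 ⊕ ξ 2) ⊕ ξ 3) ⊕ ξ 4) ∷ [])
            (ξ 0) (((ξ 3 ⊕ ξ 2) ⊕ ξ 1) ⊕ ξ 4) (1 ∷ 1 ∷ []) (# 0) refl (ℕₚ.≤-reflexive n≡ , tt))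
          (lin-≤ (n ∷ a ∷ b ∷ c ∷ d ∷ [])
            ((((ξ 1 ⊕ ξ 2) ⊕ ξ 3) ⊕ ξ 4 , ξ 0) ∷ [])
            (((ξ 3 ⊕ ξ 2) ⊕ ξ 1) ⊕ ξ 4) (ξ 0) (1 ∷ 1 ∷ []) (# 0) refl (ℕₚ.≤-reflexive (sym n≡) , tt)))
      outA : δ * a ≤ edges G A A + edges G A B + (edges G A C + edges G A D)
      outA = lin-≤ (δ ∷ size G A ∷ edges G A A ∷ edges G A B ∷ edges G A C ∷ edges G A D ∷ [])
            ((ξ 0 ⊗ ξ 1 , ((ξ 2 ⊕ ξ 3) ⊕ ξ 4) ⊕ ξ 5) ∷ [])
            (ξ 0 ⊗ ξ 1) ((ξ 2 ⊕ ξ 3) ⊕ (ξ 4 ⊕ ξ 5)) (1 ∷ 1 ∷ []) (# 0) refl (edges-out A md , tt)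
      inC′ : δ * c ≤ edges G C C + edges G B C + (edges G A C + edges G D C)
      inC′ = lin-≤ (δ ∷ size G C ∷ edges G A C ∷ edges G B C ∷ edges G C C ∷ edges G D C ∷ [])
            ((ξ 0 ⊗ ξ 1 , ((ξ 2 ⊕ ξ 3) ⊕ ξ 4) ⊕ ξ 5) ∷ [])
            (ξ 0 ⊗ ξ 1) ((ξ 4 ⊕ ξ 3) ⊕ (ξ 2 ⊕ ξ 5)) (1 ∷ 1 ∷ []) (# 0) refl (edges-in C md , tt)
      q : ℕ
      q = edges G D C + edges G D D + (edges G A D + edges G D D)
      bothD : 2 · (δ * d) ≤ edges G D A + edges G C D + edges G D B + edges G B D + q
      bothD =
          lin-≤ (δ ∷ size G D ∷ edges G D A ∷ edges G D B ∷ edges G D C ∷ edges G D D ∷ edges G A D ∷ edges G B D ∷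
            edges G C D ∷ [])
            ((ξ 0 ⊗ ξ 1 , ((ξ 2 ⊕ ξ 3) ⊕ ξ 4) ⊕ ξ 5) ∷ (ξ 0 ⊗ ξ 1 , ((ξ 6 ⊕ ξ 7) ⊕ ξ 8) ⊕ ξ 5) ∷ [])
            (2 ⊙ (ξ 0 ⊗ ξ 1)) ((((ξ 2 ⊕ ξ 8) ⊕ ξ 3) ⊕ ξ 7) ⊕ ((ξ 4 ⊕ ξ 5) ⊕ (ξ 6 ⊕ ξ 5))) (1 ∷ 1 ∷ 1 ∷ []) (# 0) refl
            (edges-out D md , edges-in D md , tt)
      strayD′ : q ≤ 3 · (g * n)
      strayD′ = lin-≤ (edges G A C ∷ edges G A D ∷ f ∷ a ∷ edges G D C ∷ edges G D D ∷ d ∷ g ∷ n ∷ [])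
            ((ξ 0 ⊕ ξ 1 , ξ 2 ⊗ ξ 3) ∷ (ξ 4 ⊕ ξ 5 , ξ 2 ⊗ ξ 6) ∷ ((ξ 2 ⊗ ξ 3) ⊕ (ξ 2 ⊗ ξ 6) , ξ 7 ⊗ ξ 7) ∷
             (ξ 7 ⊗ ξ 7 , ξ 7 ⊗ ξ 8) ∷ [])
            ((ξ 4 ⊕ ξ 5) ⊕ (ξ 1 ⊕ ξ 5)) (3 ⊙ (ξ 7 ⊗ ξ 8)) (1 ∷ 2 ∷ 2 ∷ 2 ∷ 2 ∷ [])
             ((ξ 7 ⊗ ξ 8) ⊕ 2 ⊙ ξ 0 ⊕ ξ 1 ⊕ ξ 4) refl
            (strayA , strayD , fa+fd , gg≤gn , tt)

-- Reassigning exceptional vertices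

module _ {n : ℕ} where
  private
    V = Fin n
    Vs = allFin n

  cnt-mem-exact : ∀ (S : List V) → Unique S → cnt (λ x → mem x S) Vs ≡ length S
  cnt-mem-exact S u with complement S Vs u (λ _ → ∈-allFin _)
  ... | rest , p = trans (cnt-sub {xs = S} {rest} (λ x → mem x S) p) (trans (cong₂ _+_
      (trans (cnt-cong S (λ q → ∈⇒mem q)) (cnt-true S))
      (cnt-zero rest λ q → ∉⇒mem λ r → Unique-disjoint S (Unique-↭ p (Uniqueₚ.allFin⁺ n)) r q)) (ℕₚ.+-identityʳ _))

  take-⊆ : ∀ {A : Set} m (xs : List A) {x} → x ∈ take m xs → x ∈ xs
  take-⊆ (suc m) (x ∷ xs) (here e)  = here e
  take-⊆ (suc m) (x ∷ xs) (there p) = there (take-⊆ m xs p)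

  filterᵇ-∈ : ∀ (P : V → Bool) xs {x} → x ∈ filterᵇ P xs → P x ≡ true
  filterᵇ-∈ P (y ∷ ys) p with P y in eq
  filterᵇ-∈ P (y ∷ ys) (here refl) | true = eq
  filterᵇ-∈ P (y ∷ ys) (there p)   | true = filterᵇ-∈ P ys p
  ... | false = filterᵇ-∈ P ys p

  filterᵇ-unique : ∀ (P : V → Bool) xs → Unique xs → Unique (filterᵇ P xs)
  filterᵇ-unique P []       u = []
  filterᵇ-unique P (x ∷ xs) (x∉ ∷ u) with P x
  ... | true  = All.tabulate (λ {y} q → All.lookup x∉ (sub xs q)) ∷ filterᵇ-unique P xs u
    where
    sub : ∀ ys {y} → y ∈ filterᵇ P ys → y ∈ ys
    sub (z ∷ ys) q with P z
    sub (z ∷ ys) (here e)  | true = here e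
    sub (z ∷ ys) (there q) | true = there (sub ys q)
    ... | false = there (sub ys q)
  ... | false = filterᵇ-unique P xs u

  Between : (V → Bool) → (V → Bool) → ℕ → Set
  Between P Q m = ∃ λ R → (∀ {x} → P x ≡ true → R x ≡ true) × (∀ {x} → R x ≡ true → Q x ≡ true) × cnt R Vs ≡ m

  between : ∀ (P Q : V → Bool) m → (∀ {x} → P x ≡ true → Q x ≡ true) → cnt P Vs ≤ m → m ≤ cnt Q Vs → Between P Q m
  between P Q m P⊂Q lo hi = R , (λ p → ∨-left p) , R⊂Q , trans cnt-R (ℕₚ.m+[n∸m]≡n lo)
    where
    D : V → Bool
    D x = Q x ∧ not (P x)
    S : List V
    S = take (m ∸ cnt P Vs) (filterᵇ D Vs)
    uS : Unique S
    uS = Uniqueₚ.take⁺ (m ∸ cnt P Vs) (filterᵇ-unique D Vs (Uniqueₚ.allFin⁺ n))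
    S⊂D : ∀ {x} → x ∈ S → D x ≡ true
    S⊂D q = filterᵇ-∈ D Vs (take-⊆ (m ∸ cnt P Vs) (filterᵇ D Vs) q)
    R : V → Bool
    R x = P x ∨ mem x S
    ∨-left : ∀ {a b} → a ≡ true → a ∨ b ≡ true
    ∨-left refl = refl
    R⊂Q : ∀ {x} → R x ≡ true → Q x ≡ true
    R⊂Q {x} h with P x in eq
    ... | true  = P⊂Q eq
    ... | false = proj₁ (∧-split (S⊂D (mem⇒∈ S h)))
    split : ∀ a b → (b ≡ true → a ≡ false) → b2n (a ∨ b) ≡ b2n a + b2n b
    split true  true  h = ⊥-elim (false≢true (h refl) refl)
    split true  false h = refl
    split false b     h = refl
    D-size : cnt Q Vs ≡ cnt P Vs + cnt D Vs
    D-size = trans (cnt-split Q P Vs) (cong (_+ cnt D Vs) (sumOf-cong Vs λ {x} _ → cong b2n (absorb (P x) (Q x) P⊂Q)))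
      where
      absorb : ∀ a b → (a ≡ true → b ≡ true) → b ∧ a ≡ a
      absorb true  b h rewrite h refl = refl
      absorb false b h = Boolₚ.∧-zeroʳ b
    len : length S ≡ m ∸ cnt P Vs
    len = trans (Listₚ.length-take (m ∸ cnt P Vs) (filterᵇ D Vs)) (ℕₚ.m≤n⇒m⊓n≡m
      (ℕₚ.≤-trans (ℕₚ.m≤n+o⇒m∸n≤o m (cnt P Vs) (ℕₚ.≤-trans hi (ℕₚ.≤-reflexive D-size))) (ℕₚ.≤-reflexive (sym (length-filter D Vs)))))
    cnt-R : cnt R Vs ≡ cnt P Vs + (m ∸ cnt P Vs)
    cnt-R = trans (sumOf-cong Vs λ {x} _ → split (P x) (mem x S) λ q → not-true (proj₂ (∧-split {Q x} (S⊂D (mem⇒∈ S q)))))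
      (trans (sumOf-+ (λ x → b2n (P x)) (λ x → b2n (mem x S)) Vs) (cong (cnt P Vs +_) (trans (cnt-mem-exact S uS) len)))

module _ {n : ℕ} (G : OrientedGraph n) where
  private
    V = Fin n
    Vs = allFin n

  -- Every vertex counted on the left falls short of `q` by at least `q - τ`, and the total
  -- shortfall is at most `m`.
  low-count : ∀ (P : V → Bool) (s : V → ℕ) q τ m → (∀ x → s x ≤ q) → size G P * q ≤ sumOf (λ x → b2n (P x) * s x) Vs + m →
    cnt (λ x → P x ∧ (s x ℕ.<ᵇ τ)) Vs * q ≤ cnt (λ x → P x ∧ (s x ℕ.<ᵇ τ)) Vs * τ + m
  low-count P s q τ m s≤ h = ℕₚ.+-cancelˡ-≤ (sumOf (λ x → b2n (P x) * s x) Vs) _ _ (begin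
      S + l * q                                                  ≡⟨ cong (S +_) (trans (ℕₚ.*-comm l q) (sym (sumOf-* q _ Vs))) ⟩
      S + sumOf (λ x → q * b2n (L x)) Vs                         ≡⟨ sumOf-+ _ _ Vs ⟨
      sumOf (λ x → b2n (P x) * s x + q * b2n (L x)) Vs           ≤⟨ sumOf-mono Vs (λ {x} _ → each (P x) (s≤ x)) ⟩
      sumOf (λ x → q * b2n (P x) + τ * b2n (L x)) Vs             ≡⟨ sumOf-+ _ _ Vs ⟩
      sumOf (λ x → q * b2n (P x)) Vs + sumOf (λ x → τ * b2n (L x)) Vs ≡⟨ cong₂ _+_ (trans (sumOf-* q _ Vs) (ℕₚ.*-comm q _)) (trans (sumOf-* τ _ Vs) (ℕₚ.*-comm τ _)) ⟩
      size G P * q + l * τ                                       ≤⟨ ℕₚ.+-monoˡ-≤ (l * τ) h ⟩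
      S + m + l * τ                                              ≡⟨ trans (ℕₚ.+-assoc S m _) (cong (S +_) (ℕₚ.+-comm m _)) ⟩
      S + (l * τ + m)                                            ∎)
    where
    open ℕₚ.≤-Reasoning
    L : V → Bool
    L x = P x ∧ (s x ℕ.<ᵇ τ)
    l = cnt L Vs
    S = sumOf (λ x → b2n (P x) * s x) Vs
    each : ∀ p {k} → k ≤ q → b2n p * k + q * b2n (p ∧ (k ℕ.<ᵇ τ)) ≤ q * b2n p + τ * b2n (p ∧ (k ℕ.<ᵇ τ))
    each false {k} le = lin-≤ (k ∷ q ∷ τ ∷ [])
          [] ((# 0 ⊗ ξ 0) ⊕ (ξ 1 ⊗ # 0)) ((ξ 1 ⊗ # 0) ⊕ (ξ 2 ⊗ # 0)) (1 ∷ []) (# 0) refl tt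
    each true {k} le with k ℕ.<ᵇ τ in eq
    ... | true  = lin-≤ (k ∷ τ ∷ q ∷ [])
          ((ξ 0 , ξ 1) ∷ [])
          ((ξ 0 ⊕ # 0) ⊕ (ξ 2 ⊗ # 1)) ((ξ 2 ⊗ # 1) ⊕ (ξ 1 ⊗ # 1)) (1 ∷ 1 ∷ []) (# 0) refl
          (ℕₚ.<⇒≤ (<ᵇ-< {k} {τ} eq) , tt)
    ... | false = lin-≤ (k ∷ q ∷ τ ∷ [])
          ((ξ 0 , ξ 1) ∷ []) ((ξ 0 ⊕ # 0) ⊕ (ξ 1 ⊗ # 0)) ((ξ 1 ⊗ # 1) ⊕ (ξ 2 ⊗ # 0)) (1 ∷ 1 ∷ []) (# 0) refl (le , tt)

  row≤ : ∀ x Q → row G x Q ≤ size G Q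
  row≤ x Q = cnt-mono Vs λ {y} _ p → proj₂ (∧-split {adj G x y} p)

  col≤ : ∀ y P → col G P y ≤ size G P
  col≤ y P = cnt-mono Vs λ {x} _ p → proj₂ (∧-split {adj G x y} p)

  row-mono : ∀ x {Q R : V → Bool} → (∀ y → Q y ≡ true → R y ≡ true) → row G x Q ≤ row G x R
  row-mono x {Q} {R} h = cnt-mono Vs λ {y} _ p → let (a , b) = ∧-split {adj G x y} p in ∧-join a (h y b)

  col-mono : ∀ y {Q R : V → Bool} → (∀ x → Q x ≡ true → R x ≡ true) → col G Q y ≤ col G R y
  col-mono y {Q} {R} h = cnt-mono Vs λ {x} _ p → let (a , b) = ∧-split {adj G x y} p in ∧-join a (h x b)

  low-rows : ∀ P Q {τ m} → size G P * size G Q ≤ edges G P Q + m →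
    cnt (λ x → P x ∧ (row G x Q ℕ.<ᵇ τ)) Vs * size G Q ≤ cnt (λ x → P x ∧ (row G x Q ℕ.<ᵇ τ)) Vs * τ + m
  low-rows P Q {τ} {m} = low-count P (λ x → row G x Q) (size G Q) τ m (λ x → row≤ x Q)

  low-cols : ∀ P Q {τ m} → size G P * size G Q ≤ edges G P Q + m →
    cnt (λ y → Q y ∧ (col G P y ℕ.<ᵇ τ)) Vs * size G P ≤ cnt (λ y → Q y ∧ (col G P y ℕ.<ᵇ τ)) Vs * τ + m
  low-cols P Q {τ} {m} h = low-count Q (λ y → col G P y) (size G P) τ m (λ y → col≤ y P)
    (ℕₚ.≤-trans (ℕₚ.≤-reflexive (ℕₚ.*-comm (size G Q) (size G P))) (ℕₚ.≤-trans h (ℕₚ.≤-reflexive (cong (_+ m) (edges-col G P Q)))))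

-- The scales of the extremal case: g ≪ y ≪ γ ≪ n.
record Scales (n δ f g y γ : ℕ) : Set where
  field
    δ≥  : 3 · n ≤ 8 · δ + 4
    4≤g : 4 ≤ g
    -- At most `2000 · g * n` arcs are missing between consecutive parts, so this leaves at most `y`
    -- vertices that miss `y` arcs or more.
    yy  : 2 · (2000 · g * n) ≤ y * y
    fy  : 4 · f ≤ y
    0<f : 0 < f
    gy  : 200000 · g ≤ y
    yγ  : 1000 · y ≤ γ
    γn  : 400 · γ ≤ n

-- A bad vertex misses nearly n/4 of the at most `2000 · g * n` missing arcs; this gives slightly
-- more than `8000 · g`, rounded up.
few-bad : ∀ {n q l g γ} → 0 < n → n ≤ 4 · q + 200 · g → 400 · γ ≤ n → 200000000 · g ≤ γ → l * q ≤ l * γ + 2000 · g * n → l ≤ 10000 · g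
few-bad {n} {q} {l} {g} {γ} 0<n hq hγ hg h = cancel-half 0<n (lin-≤ (l ∷ q ∷ γ ∷ g ∷ n ∷ [])
      ((ξ 0 ⊗ ξ 1 , (ξ 0 ⊗ ξ 2) ⊕ ((2000 ⊙ ξ 3) ⊗ ξ 4)) ∷ (ξ 0 ⊗ ξ 4 , ξ 0 ⊗ ((4 ⊙ ξ 1) ⊕ (200 ⊙ ξ 3))) ∷
       (ξ 0 ⊗ (400 ⊙ ξ 2) , ξ 0 ⊗ ξ 4) ∷ (ξ 0 ⊗ (200000000 ⊙ ξ 3) , ξ 0 ⊗ ξ 2) ∷ [])
      (ξ 4 ⊗ ξ 0) (ξ 4 ⊗ (10000 ⊙ ξ 3)) (395999999 ∷ 1600000000 ∷ 400000000 ∷ 4000001 ∷ 400 ∷ [])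
       (759999990000 ⊙ (ξ 3 ⊗ ξ 4) ⊕ # 395999998) refl
      (h , ℕₚ.*-monoʳ-≤ l hq , ℕₚ.*-monoʳ-≤ l hγ , ℕₚ.*-monoʳ-≤ l hg , tt))

module Classes {n : ℕ} (G : OrientedGraph n) (γ : ℕ) (A B C D : Fin n → Bool) where
  private
    V = Fin n
    Vs = allFin n

  -- Tails and heads of the two relations: A and D send to A and B, while B and C send to C and D.
  -- These are the eight pairs of parts with density one or one half.
  X₀ Y₀ X₀ᶜ Y₀ᶜ : V → Bool
  X₀ x = A x ∨ D x
  Y₀ x = A x ∨ B x
  X₀ᶜ x = C x ∨ B x
  Y₀ᶜ x = C x ∨ D x

  -- A vertex with `rowT` has too few arcs into `Y₀` to be a tail of the first relation, one with
  -- `rowF` too few for the second. All other vertices could be tails in either, and this freedom is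
  -- what balancing uses; likewise for heads.
  rowT rowF colT colF X₁ Y₁ : V → Bool
  rowT x = row G x Y₀ ℕ.<ᵇ γ
  rowF x = row G x Y₀ᶜ ℕ.<ᵇ γ
  colT y = col G X₀ y ℕ.<ᵇ γ
  colF y = col G X₀ᶜ y ℕ.<ᵇ γ
  X₁ x = (X₀ x ∧ not (rowT x)) ∨ rowF x
  Y₁ y = (Y₀ y ∧ not (colT y)) ∨ colF y

  module Facts (P : Partition G A B C D) {δ} (md : minSemiDegree≥ G δ) (2γ≤δ : 2 · γ ≤ δ) where
    open Partition P

    row-two : ∀ x → cnt (adj G x) Vs ≡ row G x Y₀ + row G x Y₀ᶜ
    row-two x = trans (sumOf-cong Vs λ {y} _ → each (adj G x y) {A y} {B y} {C y} {D y} (one y)) (sumOf-+ _ _ Vs)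
      where
      each : ∀ e {a b c d} → b2n a + b2n b + b2n c + b2n d ≡ 1 → b2n e ≡ b2n (e ∧ (a ∨ b)) + b2n (e ∧ (c ∨ d))
      each false h = refl
      each true {true}  {false} {false} {false} h = refl
      each true {false} {true}  {false} {false} h = refl
      each true {false} {false} {true}  {false} h = refl
      each true {false} {false} {false} {true}  h = refl

    col-two : ∀ y → cnt (λ x → adj G x y) Vs ≡ col G X₀ y + col G X₀ᶜ y
    col-two y = trans (sumOf-cong Vs λ {x} _ → each (adj G x y) {A x} {B x} {C x} {D x} (one x)) (sumOf-+ _ _ Vs)
      where
      each : ∀ e {a b c d} → b2n a + b2n b + b2n c + b2n d ≡ 1 → b2n e ≡ b2n (e ∧ (a ∨ d)) + b2n (e ∧ (c ∨ b))
      each false h = refl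
      each true {true}  {false} {false} {false} h = refl
      each true {false} {true}  {false} {false} h = refl
      each true {false} {false} {true}  {false} h = refl
      each true {false} {false} {false} {true}  h = refl

    row-not-both : ∀ x → rowT x ≡ true → rowF x ≡ true → ⊥
    row-not-both x p q =
        lin-⊥ (δ ∷ outdeg G x ∷ cnt (λ y → does (arc? G x y)) (allFin n) ∷ row G x Y₀ ∷ row G x Y₀ᶜ ∷ γ ∷ [])
          ((ξ 0 , ξ 1) ∷ (ξ 1 , ξ 2) ∷ (ξ 2 , ξ 3 ⊕ ξ 4) ∷ (# 1 ⊕ ξ 3 , ξ 5) ∷ (# 1 ⊕ ξ 4 , ξ 5) ∷ (2 ⊙ ξ 5 , ξ 0) ∷
           [])
          (1 ∷ 1 ∷ 1 ∷ 1 ∷ 1 ∷ 1 ∷ []) (# 1) refl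
          (proj₁ (md x) , ℕₚ.≤-reflexive (outdeg-cnt G x) , ℕₚ.≤-reflexive (row-two x) , <ᵇ-< {row G x Y₀} {γ} p ,
           <ᵇ-< {row G x Y₀ᶜ} {γ} q , 2γ≤δ , tt)

    col-not-both : ∀ y → colT y ≡ true → colF y ≡ true → ⊥
    col-not-both y p q =
        lin-⊥ (δ ∷ indeg G y ∷ cnt (λ w → does (arc? G w y)) (allFin n) ∷ col G X₀ y ∷ col G X₀ᶜ y ∷ γ ∷ [])
          ((ξ 0 , ξ 1) ∷ (ξ 1 , ξ 2) ∷ (ξ 2 , ξ 3 ⊕ ξ 4) ∷ (# 1 ⊕ ξ 3 , ξ 5) ∷ (# 1 ⊕ ξ 4 , ξ 5) ∷ (2 ⊙ ξ 5 , ξ 0) ∷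
           [])
          (1 ∷ 1 ∷ 1 ∷ 1 ∷ 1 ∷ 1 ∷ []) (# 1) refl
          (proj₂ (md y) , ℕₚ.≤-reflexive (indeg-cnt G y) , ℕₚ.≤-reflexive (col-two y) , <ᵇ-< {col G X₀ y} {γ} p ,
           <ᵇ-< {col G X₀ᶜ y} {γ} q , 2γ≤δ , tt)

-- An excess is left only if `X` is as small and `Y` as large as possible. The field `tight` is the
-- gain from that: every vertex then has few crossing arcs, so they cannot be concentrated on a few
-- vertices.
record Choice {n : ℕ} (G : OrientedGraph n) (γ β : ℕ) (A B C D : Fin n → Bool) : Set where
  open Classes G γ A B C D
  field
    X Y     : Fin n → Bool
    excess  : ℕ
    rowX    : ∀ {x} → X x ≡ true → γ ≤ row G x Y₀
    rowX′   : ∀ {x} → X x ≡ false → γ ≤ row G x Y₀ᶜ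
    colY    : ∀ {y} → Y y ≡ true → γ ≤ col G X₀ y
    colY′   : ∀ {y} → Y y ≡ false → γ ≤ col G X₀ᶜ y
    devX    : cnt (λ x → X x xor X₀ x) (allFin n) ≤ β
    devY    : cnt (λ y → Y y xor Y₀ y) (allFin n) ≤ β
    balance : size G X ≡ size G Y + excess
    excess≤ : excess ≤ β
    tight   : excess ≡ 0 ⊎ (∀ {x} → X x ≡ true → row G x Y₀ᶜ < γ) × (∀ {y} → Y y ≡ false → col G X₀ y < γ)

module Choosing {n : ℕ} (G : OrientedGraph n) {δ f g y γ : ℕ} (md : minSemiDegree≥ G δ) (0<n : 0 < n) (Sc : Scales n δ f g y γ)
    {A B C D : Fin n → Bool} (Ex : Extremal G (200 · g) (2000 · g) A B C D) where
  private
    V = Fin n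
    Vs = allFin n
  open Scales Sc
  open Extremal Ex
  open Classes G γ A B C D
  open Partition partition
  private
    2γ≤δ : 2 · γ ≤ δ
    2γ≤δ = lin-≤ (n ∷ δ ∷ γ ∷ y ∷ g ∷ [])
          ((3 ⊙ ξ 0 , (8 ⊙ ξ 1) ⊕ # 4) ∷ (400 ⊙ ξ 2 , ξ 0) ∷ [])
          (2 ⊙ ξ 2) (ξ 1) (600 ∷ 1 ∷ 3 ∷ []) (592 ⊙ ξ 1 ⊕ # 595) refl (δ≥ , γn , tt)
  open Facts partition md 2γ≤δ
  private
    gγ : 200000000 · g ≤ γ
    gγ = lin-≤ (g ∷ y ∷ γ ∷ [])
          ((200000 ⊙ ξ 0 , ξ 1) ∷ (1000 ⊙ ξ 1 , ξ 2) ∷ [])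
          (200000000 ⊙ ξ 0) (ξ 2) (1 ∷ 1000 ∷ 1 ∷ []) (# 0) refl (gy , yγ , tt)

    bad : (V → Bool) → (V → ℕ) → ℕ
    bad P s = cnt (λ x → P x ∧ (s x ℕ.<ᵇ γ)) Vs

    few-rows : ∀ P Q → n ≤ 4 · size G Q + 200 · g → size G P * size G Q ≤ edges G P Q + 2000 · g * n → bad P (λ x → row G x Q) ≤ 10000 · g
    few-rows P Q hq h = few-bad 0<n hq γn gγ (low-rows G P Q h)

    few-cols : ∀ P Q → n ≤ 4 · size G P + 200 · g → size G P * size G Q ≤ edges G P Q + 2000 · g * n → bad Q (λ y → col G P y) ≤ 10000 · g
    few-cols P Q hq h = few-bad 0<n hq γn gγ (low-cols G P Q h)

    shrink : ∀ {a b} → a ≤ b → (b ℕ.<ᵇ γ) ≡ true → (a ℕ.<ᵇ γ) ≡ true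
    shrink {a} {b} le h = <ᵇ-true (ℕₚ.≤-<-trans le (<ᵇ-< {b} {γ} h))

    ∨-l : ∀ {a b} → a ≡ true → a ∨ b ≡ true
    ∨-l refl = refl
    ∨-r : ∀ {a b} → b ≡ true → a ∨ b ≡ true
    ∨-r {a} refl = Boolₚ.∨-zeroʳ a

    -- A vertex changes sides only if it lacks arcs to the next part, or from the previous one for
    -- heads. So each change is charged to one of four counts of bad vertices.
    four : ∀ {p q r s a b c d : Bool} {lo hi : Bool} → b2n a + b2n b + b2n c + b2n d ≡ 1 →
      (a ≡ true → lo ≡ true → p ≡ true) → (d ≡ true → lo ≡ true → q ≡ true) →
      (b ≡ true → hi ≡ true → r ≡ true) → (c ≡ true → hi ≡ true → s ≡ true) →
      b2n (((a ∨ d) ∧ not lo ∨ hi) xor (a ∨ d)) ≤ b2n p + b2n q + b2n r + b2n s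
    four {p} {q} {r} {s} {true}  {false} {false} {false} {true}  {hi}    _ f₁ f₂ f₃ f₄ rewrite f₁ refl refl = ℕₚ.≤-trans (b2n≤1 _) (s≤s z≤n)
    four {p} {q} {r} {s} {true}  {false} {false} {false} {false} {hi}    _ f₁ f₂ f₃ f₄ = z≤n
    four {p} {q} {r} {s} {false} {true}  {false} {false} {lo}    {true}  _ f₁ f₂ f₃ f₄ rewrite f₃ refl refl =
        lin-≤ (b2n p ∷ b2n q ∷ b2n s ∷ [])
          [] (# 1) (((ξ 0 ⊕ ξ 1) ⊕ # 1) ⊕ ξ 2) (1 ∷ []) (ξ 0 ⊕ ξ 1 ⊕ ξ 2) refl tt
    four {p} {q} {r} {s} {false} {true}  {false} {false} {lo}    {false} _ f₁ f₂ f₃ f₄ = z≤n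
    four {p} {q} {r} {s} {false} {false} {true}  {false} {lo}    {true}  _ f₁ f₂ f₃ f₄ rewrite f₄ refl refl =
        lin-≤ (b2n p ∷ b2n q ∷ b2n r ∷ [])
          [] (# 1) (((ξ 0 ⊕ ξ 1) ⊕ ξ 2) ⊕ # 1) (1 ∷ []) (ξ 0 ⊕ ξ 1 ⊕ ξ 2) refl tt
    four {p} {q} {r} {s} {false} {false} {true}  {false} {lo}    {false} _ f₁ f₂ f₃ f₄ = z≤n
    four {p} {q} {r} {s} {false} {false} {false} {true}  {true}  {hi}    _ f₁ f₂ f₃ f₄ rewrite f₂ refl refl = ℕₚ.≤-trans (b2n≤1 _) (
        lin-≤ (b2n p ∷ b2n r ∷ b2n s ∷ [])
          [] (# 1) (((ξ 0 ⊕ # 1) ⊕ ξ 1) ⊕ ξ 2) (1 ∷ []) (ξ 0 ⊕ ξ 1 ⊕ ξ 2) refl tt)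
    four {p} {q} {r} {s} {false} {false} {false} {true}  {false} {hi}    _ f₁ f₂ f₃ f₄ = z≤n

    sum4 : ∀ (P Q R S T : V → Bool) {k} → (∀ x → b2n (T x) ≤ b2n (P x) + b2n (Q x) + b2n (R x) + b2n (S x)) →
      cnt P Vs ≤ k → cnt Q Vs ≤ k → cnt R Vs ≤ k → cnt S Vs ≤ k → cnt T Vs ≤ 4 · k
    sum4 P Q R S T {k} h p q r s = ℕₚ.≤-trans (sumOf-mono Vs λ {x} _ → h x) (ℕₚ.≤-trans (ℕₚ.≤-reflexive (trans (sumOf-+ (λ x → b2n (P x) + b2n (Q x) + b2n (R x)) (b2n ∘ S) Vs)
      (cong (_+ cnt S Vs) (trans (sumOf-+ (λ x → b2n (P x) + b2n (Q x)) (b2n ∘ R) Vs) (cong (_+ cnt R Vs) (sumOf-+ (b2n ∘ P) (b2n ∘ Q) Vs)))))) (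
          lin-≤ (cnt P Vs ∷ k ∷ cnt Q Vs ∷ cnt R Vs ∷ cnt S Vs ∷ [])
            ((ξ 0 , ξ 1) ∷ (ξ 2 , ξ 1) ∷ (ξ 3 , ξ 1) ∷ (ξ 4 , ξ 1) ∷ [])
            (((ξ 0 ⊕ ξ 2) ⊕ ξ 3) ⊕ ξ 4) (4 ⊙ ξ 1) (1 ∷ 1 ∷ 1 ∷ 1 ∷ 1 ∷ []) (# 0) refl (p , q , r , s , tt)))

    dev-X₁ : cnt (λ x → X₁ x xor X₀ x) Vs ≤ 4 · (10000 · g)
    dev-X₁ = sum4 (λ x → A x ∧ (row G x B ℕ.<ᵇ γ)) (λ x → D x ∧ (row G x A ℕ.<ᵇ γ)) (λ x → B x ∧ (row G x C ℕ.<ᵇ γ)) (λ x → C x ∧ (row G x D ℕ.<ᵇ γ)) _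
      (λ x → four {a = A x} {B x} {C x} {D x} (one x)
        (λ p q → ∧-join p (shrink {row G x B} {row G x Y₀} (row-mono G x λ y → ∨-r {A y}) q)) (λ p q → ∧-join p (shrink {row G x A} {row G x Y₀} (row-mono G x λ y → ∨-l) q))
        (λ p q → ∧-join p (shrink {row G x C} {row G x Y₀ᶜ} (row-mono G x λ y → ∨-l) q)) (λ p q → ∧-join p (shrink {row G x D} {row G x Y₀ᶜ} (row-mono G x λ y → ∨-r {C y}) q)))
      (few-rows A B b≥ ab) (few-rows D A a≥ da) (few-rows B C c≥ bc) (few-rows C D d≥ cd)

    dev-Y₁ : cnt (λ y → Y₁ y xor Y₀ y) Vs ≤ 4 · (10000 · g)
    dev-Y₁ = sum4 (λ x → A x ∧ (col G D x ℕ.<ᵇ γ)) (λ x → B x ∧ (col G A x ℕ.<ᵇ γ)) (λ x → D x ∧ (col G C x ℕ.<ᵇ γ)) (λ x → C x ∧ (col G B x ℕ.<ᵇ γ)) _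
      (λ y → four {a = A y} {D y} {C y} {B y} (reorder (b2n (A y)) (b2n (B y)) (b2n (C y)) (b2n (D y)) (one y))
        (λ p q → ∧-join p (shrink {col G D y} {col G X₀ y} (col-mono G y λ x → ∨-r {A x}) q)) (λ p q → ∧-join p (shrink {col G A y} {col G X₀ y} (col-mono G y λ x → ∨-l) q))
        (λ p q → ∧-join p (shrink {col G C y} {col G X₀ᶜ y} (col-mono G y λ x → ∨-l) q)) (λ p q → ∧-join p (shrink {col G B y} {col G X₀ᶜ y} (col-mono G y λ x → ∨-r {C x}) q)))
      (few-cols D A d≥ da) (few-cols A B a≥ ab) (few-cols C D c≥ cd) (few-cols B C b≥ bc)
      where
      reorder : ∀ a b c d → a + b + c + d ≡ 1 → a + d + c + b ≡ 1
      reorder a b c d h = (ℕₚ.≤-antisym (lin-≤ (a ∷ b ∷ c ∷ d ∷ [])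
            ((((ξ 0 ⊕ ξ 1) ⊕ ξ 2) ⊕ ξ 3 , # 1) ∷ [])
            (((ξ 0 ⊕ ξ 3) ⊕ ξ 2) ⊕ ξ 1) (# 1) (1 ∷ 1 ∷ []) (# 0) refl (ℕₚ.≤-reflexive h , tt))
          (lin-≤ (a ∷ b ∷ c ∷ d ∷ [])
            ((# 1 , ((ξ 0 ⊕ ξ 1) ⊕ ξ 2) ⊕ ξ 3) ∷ [])
            (# 1) (((ξ 0 ⊕ ξ 3) ⊕ ξ 2) ⊕ ξ 1) (1 ∷ 1 ∷ []) (# 0) refl (ℕₚ.≤-reflexive (sym h) , tt)))

    size-∨ : ∀ (P Q : V → Bool) → (∀ x → P x ≡ true → Q x ≡ true → ⊥) → cnt (λ x → P x ∨ Q x) Vs ≡ size G P + size G Q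
    size-∨ P Q dis = trans (sumOf-cong Vs λ {x} _ → each (P x) (Q x) (dis x)) (sumOf-+ _ _ Vs)
      where
      each : ∀ a b → (a ≡ true → b ≡ true → ⊥) → b2n (a ∨ b) ≡ b2n a + b2n b
      each true true h = ⊥-elim (h refl refl)
      each true false h = refl
      each false b h = refl

    X₀-size : size G X₀ ≡ size G A + size G D
    X₀-size = size-∨ A D λ x p q → clash p q (one x)
      where
      clash : ∀ {a b c d} → a ≡ true → d ≡ true → b2n a + b2n b + b2n c + b2n d ≡ 1 → ⊥
      clash {b = b} {c} refl refl e = lin-⊥ (b2n b ∷ b2n c ∷ [])
            ((((# 1 ⊕ ξ 0) ⊕ ξ 1) ⊕ # 1 , # 1) ∷ []) (1 ∷ []) (ξ 0 ⊕ ξ 1) refl (ℕₚ.≤-reflexive e , tt)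

    Y₀-size : size G Y₀ ≡ size G A + size G B
    Y₀-size = size-∨ A B λ x p q → clash p q (one x)
      where
      clash : ∀ {a b c d} → a ≡ true → b ≡ true → b2n a + b2n b + b2n c + b2n d ≡ 1 → ⊥
      clash {c = c} {d} refl refl e = lin-⊥ (b2n c ∷ b2n d ∷ [])
            ((((# 1 ⊕ # 1) ⊕ ξ 0) ⊕ ξ 1 , # 1) ∷ []) (1 ∷ []) (ξ 0 ⊕ ξ 1) refl (ℕₚ.≤-reflexive e , tt)

    xor-bound : ∀ (P Q : V → Bool) → cnt P Vs ≤ cnt Q Vs + cnt (λ x → P x xor Q x) Vs
    xor-bound P Q = ℕₚ.≤-trans (sumOf-mono Vs λ {x} _ → each (P x) (Q x)) (ℕₚ.≤-reflexive (sumOf-+ _ _ Vs))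
      where
      each : ∀ p q → b2n p ≤ b2n q + b2n (p xor q)
      each true  true  = s≤s z≤n
      each true  false = s≤s z≤n
      each false q     = z≤n

    xor-bound′ : ∀ (P Q : V → Bool) → cnt Q Vs ≤ cnt P Vs + cnt (λ x → P x xor Q x) Vs
    xor-bound′ P Q = ℕₚ.≤-trans (sumOf-mono Vs λ {x} _ → each (P x) (Q x)) (ℕₚ.≤-reflexive (sumOf-+ _ _ Vs))
      where
      each : ∀ p q → b2n q ≤ b2n p + b2n (p xor q)
      each true  true  = s≤s z≤n
      each true  false = z≤n
      each false true  = s≤s z≤n
      each false false = z≤n

    xor-triangle : ∀ (P Q R : V → Bool) → (∀ {x} → P x ≡ true → Q x ≡ true) →
      cnt (λ x → P x xor R x) Vs + cnt P Vs ≤ cnt (λ x → Q x xor R x) Vs + cnt Q Vs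
      × cnt (λ x → Q x xor R x) Vs + cnt P Vs ≤ cnt (λ x → P x xor R x) Vs + cnt Q Vs
    xor-triangle P Q R h =
      ℕₚ.≤-trans (ℕₚ.≤-reflexive (sym (sumOf-+ _ _ Vs))) (ℕₚ.≤-trans (sumOf-mono Vs λ {x} _ → each (P x) (Q x) (R x) h) (ℕₚ.≤-reflexive (sumOf-+ _ _ Vs))) ,
      ℕₚ.≤-trans (ℕₚ.≤-reflexive (sym (sumOf-+ _ _ Vs))) (ℕₚ.≤-trans (sumOf-mono Vs λ {x} _ → each′ (P x) (Q x) (R x) h) (ℕₚ.≤-reflexive (sumOf-+ _ _ Vs)))
      where
      each : ∀ p q r → (p ≡ true → q ≡ true) → b2n (p xor r) + b2n p ≤ b2n (q xor r) + b2n q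
      each true  q r h rewrite h refl = ℕₚ.≤-refl
      each false true  true  h = s≤s z≤n
      each false true  false h = z≤n
      each false false r h = ℕₚ.≤-refl
      each′ : ∀ p q r → (p ≡ true → q ≡ true) → b2n (q xor r) + b2n p ≤ b2n (p xor r) + b2n q
      each′ true  q r h rewrite h refl = ℕₚ.≤-refl
      each′ false true  true  h = z≤n
      each′ false true  false h = s≤s z≤n
      each′ false false r h = ℕₚ.≤-refl

    x₁ y₁ : ℕ
    x₁ = cnt X₁ Vs
    y₁ = cnt Y₁ Vs

    -- `X₀` and `Y₀` differ in size by that of `D` minus that of `B`, at most `100 · g`;
    -- reassignment adds at most `40000 · g` on either side.
    x₁≤ : x₁ ≤ y₁ + 80100 · g
    x₁≤ = lin-≤ (cnt (Classes.X₁ G γ A B C D) Vs ∷ cnt (Classes.X₀ G γ A B C D) Vs ∷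
          cnt (λ x → Classes.X₁ G γ A B C D x xor Classes.X₀ G γ A B C D x) Vs ∷ cnt (Classes.Y₀ G γ A B C D) Vs ∷
          cnt (Classes.Y₁ G γ A B C D) Vs ∷ cnt (λ x → Classes.Y₁ G γ A B C D x xor Classes.Y₀ G γ A B C D x) Vs ∷
          g ∷ size G A ∷ size G D ∷ size G B ∷ n ∷ [])
          ((ξ 0 , ξ 1 ⊕ ξ 2) ∷ (ξ 3 , ξ 4 ⊕ ξ 5) ∷ (ξ 2 , 4 ⊙ (10000 ⊙ ξ 6)) ∷ (ξ 5 , 4 ⊙ (10000 ⊙ ξ 6)) ∷
           (ξ 1 , ξ 7 ⊕ ξ 8) ∷ (ξ 7 ⊕ ξ 9 , ξ 3) ∷ (4 ⊙ ξ 8 , ξ 10 ⊕ (200 ⊙ ξ 6)) ∷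
           (ξ 10 , (4 ⊙ ξ 9) ⊕ (200 ⊙ ξ 6)) ∷ [])
          (ξ 0) (ξ 4 ⊕ (80100 ⊙ ξ 6)) (4 ∷ 4 ∷ 4 ∷ 4 ∷ 4 ∷ 4 ∷ 4 ∷ 1 ∷ 1 ∷ []) (# 3) refl
          (xor-bound X₁ X₀ , xor-bound′ Y₁ Y₀ , dev-X₁ , dev-Y₁ , ℕₚ.≤-reflexive X₀-size ,
           ℕₚ.≤-reflexive (sym Y₀-size) , d≤ , b≥ , tt)

    Xmin⊂X₁ : ∀ {x} → rowF x ≡ true → X₁ x ≡ true
    Xmin⊂X₁ {x} p = ∨-r {X₀ x ∧ not (rowT x)} p

    X₁⊂ : ∀ {x} → X₁ x ≡ true → rowT x ≡ false
    X₁⊂ {x} p = ¬true⇒false λ t → case (X₀ x) (rowT x) (rowF x) p t (row-not-both x t)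
      where
      case : ∀ a b c → (a ∧ not b) ∨ c ≡ true → b ≡ true → (c ≡ true → ⊥) → ⊥
      case true  true  c p q r = r p
      case false true  c p q r = r p

    Y₁⊂Ymax : ∀ {y} → Y₁ y ≡ true → not (colT y) ≡ true
    Y₁⊂Ymax {y} p = case (Y₀ y) (colT y) (colF y) p (col-not-both y)
      where
      case : ∀ a b c → (a ∧ not b) ∨ c ≡ true → (b ≡ true → c ≡ true → ⊥) → not b ≡ true
      case a     false c p q = refl
      case true  true  c p q = ⊥-elim (q refl p)
      case false true  c p q = ⊥-elim (q refl p)

    ¬Y₁ : ∀ {y} → Y₁ y ≡ false → colF y ≡ false
    ¬Y₁ {y} p = ¬true⇒false λ t → false≢true p (∨-r {Y₀ y ∧ not (colT y)} t)

    choice : ∀ X Y e → (∀ {x} → rowF x ≡ true → X x ≡ true) → (∀ {x} → X x ≡ true → X₁ x ≡ true) →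
      (∀ {y} → Y₁ y ≡ true → Y y ≡ true) → (∀ {y} → Y y ≡ true → not (colT y) ≡ true) →
      cnt X Vs ≡ cnt Y Vs + e → e ≡ 0 ⊎ ((∀ {x} → X x ≡ true → rowF x ≡ true) × (∀ {y} → not (colT y) ≡ true → Y y ≡ true)) →
      Choice G γ (200000 · g) A B C D
    choice X Y e lo hi lo′ hi′ bal tight = record
      { X = X ; Y = Y ; excess = e
      ; rowX = λ {x} p → <ᵇ-false {row G x Y₀} {γ} (X₁⊂ (hi p))
      ; rowX′ = λ {x} p → <ᵇ-false {row G x Y₀ᶜ} {γ} (¬true⇒false λ t → false≢true p (lo t))
      ; colY = λ {y} p → <ᵇ-false {col G X₀ y} {γ} (not-true (hi′ p))
      ; colY′ = λ {y} p → <ᵇ-false {col G X₀ᶜ y} {γ} (¬Y₁ (¬true⇒false λ t → false≢true p (lo′ t)))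
      ; devX = lin-≤ (cnt (λ x → X x xor Classes.X₀ G γ A B C D x) Vs ∷ cnt X Vs ∷
            cnt (λ x → Classes.X₁ G γ A B C D x xor Classes.X₀ G γ A B C D x) Vs ∷ cnt (Classes.X₁ G γ A B C D) Vs ∷
            g ∷ y₁ ∷ cnt Y Vs ∷ e ∷ [])
            ((ξ 0 ⊕ ξ 1 , ξ 2 ⊕ ξ 3) ∷ (ξ 2 , 4 ⊙ (10000 ⊙ ξ 4)) ∷ (ξ 3 , ξ 5 ⊕ (80100 ⊙ ξ 4)) ∷ (ξ 6 ⊕ ξ 7 , ξ 1) ∷
             (ξ 5 , ξ 6) ∷ [])
            (ξ 0) (200000 ⊙ ξ 4) (1 ∷ 1 ∷ 1 ∷ 1 ∷ 1 ∷ 1 ∷ []) (79900 ⊙ ξ 4 ⊕ ξ 7) refl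
            (proj₁ (xor-triangle X X₁ X₀ hi) , dev-X₁ , x₁≤ , ℕₚ.≤-reflexive (sym bal) , yle , tt)
      ; devY = lin-≤ (cnt (λ x → Y x xor Classes.Y₀ G γ A B C D x) Vs ∷ cnt (Classes.Y₁ G γ A B C D) Vs ∷
            cnt (λ x → Classes.Y₁ G γ A B C D x xor Classes.Y₀ G γ A B C D x) Vs ∷ cnt Y Vs ∷ g ∷ x₁ ∷ cnt X Vs ∷
            e ∷ [])
            ((ξ 0 ⊕ ξ 1 , ξ 2 ⊕ ξ 3) ∷ (ξ 2 , 4 ⊙ (10000 ⊙ ξ 4)) ∷ (ξ 5 , ξ 1 ⊕ (80100 ⊙ ξ 4)) ∷ (ξ 3 ⊕ ξ 7 , ξ 6) ∷
             (ξ 6 , ξ 5) ∷ [])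
            (ξ 0) (200000 ⊙ ξ 4) (1 ∷ 1 ∷ 1 ∷ 1 ∷ 1 ∷ 1 ∷ []) (79900 ⊙ ξ 4 ⊕ ξ 7) refl
            (proj₂ (xor-triangle Y₁ Y Y₀ lo′) , dev-Y₁ , x₁≤ , ℕₚ.≤-reflexive (sym bal) , xle , tt)
      ; balance = bal
      ; excess≤ = lin-≤ (cnt X Vs ∷ cnt Y Vs ∷ e ∷ x₁ ∷ y₁ ∷ g ∷ [])
            ((ξ 1 ⊕ ξ 2 , ξ 0) ∷ (ξ 3 , ξ 4 ⊕ (80100 ⊙ ξ 5)) ∷ (ξ 4 , ξ 1) ∷ (ξ 0 , ξ 3) ∷ [])
            (ξ 2) (200000 ⊙ ξ 5) (1 ∷ 1 ∷ 1 ∷ 1 ∷ 1 ∷ []) (119900 ⊙ ξ 5) refl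
            (ℕₚ.≤-reflexive (sym bal) , x₁≤ , yle , xle , tt)
      ; tight = [ inj₁ , (λ (s , t) → inj₂ ((λ {x} p → <ᵇ-< {row G x Y₀ᶜ} {γ} (s p)) , λ {y} p →
          <ᵇ-< {col G X₀ y} {γ} (trans (sym (Boolₚ.not-involutive (colT y))) (cong not (¬true⇒false λ u → false≢true p (t u)))))) ]′ tight }
      where
      yle : y₁ ≤ cnt Y Vs
      yle = cnt-mono Vs λ _ → lo′
      xle : cnt X Vs ≤ x₁
      xle = cnt-mono Vs λ _ → hi

    xm ym : ℕ
    xm = cnt rowF Vs
    ym = cnt (λ y → not (colT y)) Vs

  opaque
    -- `X₁` is lowered towards the set `rowF` of forced tails. If that does not reach balance, `Y₁`
    -- is raised towards the complement of `colT`; if this fails too, both extremes are taken and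
    -- the difference is the excess.
    choose : y₁ ≤ x₁ → Choice G γ (200000 · g) A B C D
    choose le = [ (λ xm≤y₁ → shrinkX (between rowF X₁ y₁ Xmin⊂X₁ xm≤y₁ le)) , (λ y₁<xm → growY (ℕₚ.≤-<-connex xm ym) (ℕₚ.<⇒≤ y₁<xm)) ]′ (ℕₚ.≤-<-connex xm y₁)
      where
      shrinkX : Between rowF X₁ y₁ → Choice G γ (200000 · g) A B C D
      shrinkX (R , lo , hi , e) = choice R Y₁ 0 lo hi id Y₁⊂Ymax (trans e (sym (ℕₚ.+-identityʳ y₁))) (inj₁ refl)
      exact : Between Y₁ (λ y → not (colT y)) xm → Choice G γ (200000 · g) A B C D
      exact (R , lo , hi , e) = choice rowF R 0 id Xmin⊂X₁ lo hi (trans (sym e) (sym (ℕₚ.+-identityʳ _))) (inj₁ refl)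
      growY : xm ≤ ym ⊎ ym < xm → y₁ ≤ xm → Choice G γ (200000 · g) A B C D
      growY (inj₁ le′) y₁≤ = exact (between Y₁ (λ y → not (colT y)) xm Y₁⊂Ymax y₁≤ le′)
      growY (inj₂ lt) y₁≤ = choice rowF (λ y → not (colT y)) (xm ∸ ym) id Xmin⊂X₁ Y₁⊂Ymax id
        (sym (ℕₚ.m+[n∸m]≡n (ℕₚ.<⇒≤ lt))) (inj₂ (id , id))

-- Disjoint crossing arcs

module _ {n : ℕ} (G : OrientedGraph n) where
  private
    V = Fin n
    Vs = allFin n
    E = adj G

  edges-mono : ∀ {P P′ Q Q′ : V → Bool} → (∀ x → P x ≡ true → P′ x ≡ true) → (∀ y → Q y ≡ true → Q′ y ≡ true) → edges G P Q ≤ edges G P′ Q′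
  edges-mono h k = sumOf-mono Vs λ {x} _ → ℕₚ.*-mono-≤ (b2n-⇒ (h x)) (row-mono G x k)

  edges-+ʳ : ∀ (P Q R S : V → Bool) → (∀ y → b2n (S y) ≡ b2n (Q y) + b2n (R y)) → edges G P S ≡ edges G P Q + edges G P R
  edges-+ʳ P Q R S h = trans (sumOf-cong Vs λ {x} _ → trans (cong (b2n (P x) *_) (trans (sumOf-cong Vs λ {y} _ → each (E x y) {S y} {Q y} {R y} (h y)) (sumOf-+ _ _ Vs)))
      (ℕₚ.*-distribˡ-+ (b2n (P x)) _ _)) (sumOf-+ _ _ Vs)
    where
    each : ∀ e {s q r} → b2n s ≡ b2n q + b2n r → b2n (e ∧ s) ≡ b2n (e ∧ q) + b2n (e ∧ r)
    each true  h = h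
    each false h = refl

  edges-+ˡ : ∀ (P Q R S : V → Bool) → (∀ x → b2n (P x) ≡ b2n (Q x) + b2n (R x)) → edges G P S ≡ edges G Q S + edges G R S
  edges-+ˡ P Q R S h = trans (sumOf-cong Vs λ {x} _ → trans (cong (_* row G x S) (h x)) (ℕₚ.*-distribʳ-+ (row G x S) (b2n (Q x)) (b2n (R x)))) (sumOf-+ _ _ Vs)

  -- Counting the missing loops too improves the bound by a term linear in the size of `P`, which
  -- the sharp degree condition requires.
  edges-irrefl : ∀ P → 2 · edges G P P + size G P ≤ size G P * size G P
  edges-irrefl P = begin
    2 · edges G P P + size G P                                                        ≡⟨ cong (_+ size G P) (trans (·-def 2 _) (cong (edges G P P +_) (trans (ℕₚ.+-identityʳ _) (edges-col G P P)))) ⟩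
    edges G P P + sumOf (λ x → b2n (P x) * col G P x) Vs + size G P                   ≡⟨ cong (_+ size G P) (sumOf-+ _ _ Vs) ⟨
    sumOf (λ x → b2n (P x) * row G x P + b2n (P x) * col G P x) Vs + size G P         ≡⟨ sumOf-+ _ _ Vs ⟨
    sumOf (λ x → b2n (P x) * row G x P + b2n (P x) * col G P x + b2n (P x)) Vs        ≤⟨ sumOf-mono Vs (λ {x} _ → each x (P x) refl) ⟩
    sumOf (λ x → size G P * b2n (P x)) Vs                                             ≡⟨ sumOf-* (size G P) (λ x → b2n (P x)) Vs ⟩
    size G P * size G P                                                               ∎
    where
    open ℕₚ.≤-Reasoning
    point : ∀ x y q → b2n (E x y ∧ q) + b2n (E y x ∧ q) + b2n ((y == x) ∧ q) ≤ b2n q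
    point x y true with y Finₚ.≟ x
    ... | yes refl rewrite adj-irrefl G y = s≤s z≤n
    ... | no _ rewrite Boolₚ.∧-identityʳ (E x y) | Boolₚ.∧-identityʳ (E y x) | ℕₚ.+-identityʳ (b2n (E x y) + b2n (E y x)) = adj-asym G x y
    point x y false rewrite Boolₚ.∧-zeroʳ (E x y) | Boolₚ.∧-zeroʳ (E y x) | Boolₚ.∧-zeroʳ (y == x) = z≤n
    three : ∀ x → P x ≡ true → row G x P + col G P x + 1 ≤ size G P
    three x p = ℕₚ.≤-trans (ℕₚ.+-monoʳ-≤ _ (cnt-pos {P = λ y → (y == x) ∧ P y} Vs (∈-allFin x) (∧-join (==-refl x) p)))
      (ℕₚ.≤-trans (ℕₚ.≤-reflexive (trans (cong (_+ cnt (λ y → (y == x) ∧ P y) Vs) (sym (sumOf-+ _ _ Vs))) (sym (sumOf-+ _ _ Vs))))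
        (sumOf-mono Vs λ {y} _ → point x y (P y)))
    each : ∀ x b → P x ≡ b → b2n b * row G x P + b2n b * col G P x + b2n b ≤ size G P * b2n b
    each x false e = z≤n
    each x true  e = lin-≤ (row G x P ∷ col G P x ∷ size G P ∷ [])
          (((ξ 0 ⊕ ξ 1) ⊕ # 1 , ξ 2) ∷ [])
          (((# 1 ⊗ ξ 0) ⊕ (# 1 ⊗ ξ 1)) ⊕ # 1) (ξ 2 ⊗ # 1) (1 ∷ 1 ∷ []) (# 0) refl (three x e , tt)

  edges-∃ : ∀ P Q → 0 < edges G P Q → ∃₂ λ x y → P x ≡ true × Q y ≡ true × E x y ≡ true
  edges-∃ P Q h with ∃-sumOf-< {f = λ _ → 0} {g = λ x → b2n (P x) * row G x Q} Vs (ℕₚ.≤-<-trans (ℕₚ.≤-reflexive (trans (sumOf-const 0 Vs) (ℕₚ.*-zeroʳ (length Vs)))) h)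
  ... | x , _ , q with P x in eq
  ...   | true with cnt-∃ {P = λ y → E x y ∧ Q y} Vs (ℕₚ.<-≤-trans q (ℕₚ.≤-reflexive (ℕₚ.+-identityʳ _)))
  ...     | y , _ , r = x , y , eq , proj₂ (∧-split {E x y} r) , proj₁ (∧-split {E x y} r)

-- Passes from the size of a part to `n`. The difference `v - u` may be negative, in which case
-- nothing is claimed; when it is positive, `n` may be replaced by `5 · a`.
scale : ∀ {n a c u v} → n ≤ 5 · a → a * v ≤ 2 · c + a * u → n * v ≤ 10 · c + n * u
scale {n} {a} {c} {u} {v} h k = [ (λ v≤u → ℕₚ.≤-trans (ℕₚ.*-monoʳ-≤ n v≤u) (ℕₚ.m≤n+m _ _)) , large ]′ (ℕₚ.≤-<-connex v u)
  where
  large : u < v → n * v ≤ 10 · c + n * u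
  large u<v = lin-≤ (n ∷ v ∷ a ∷ u ∷ c ∷ [])
        (((ξ 0 ⊗ ξ 1) ⊕ ((5 ⊙ ξ 2) ⊗ ξ 3) , (ξ 0 ⊗ ξ 3) ⊕ ((5 ⊙ ξ 2) ⊗ ξ 1)) ∷
         (ξ 2 ⊗ ξ 1 , (2 ⊙ ξ 4) ⊕ (ξ 2 ⊗ ξ 3)) ∷ [])
        (ξ 0 ⊗ ξ 1) ((10 ⊙ ξ 4) ⊕ (ξ 0 ⊗ ξ 3)) (1 ∷ 1 ∷ 5 ∷ []) (# 0) refl (cross h (ℕₚ.<⇒≤ u<v) , k , tt)

-- The degree count for `A′` without error terms, and by reversal for `C′`: whatever exceeds a/2 + b
-- must cross. The extra 1 comes from the missing loops.
out-surplus : ∀ {δ a b c eAA eAB eX} → δ * a ≤ eAA + eAB + eX → 2 · eAA + a ≤ a * a → eAB ≤ a * b → eX ≤ c → a * (2 · δ + 1) ≤ 2 · c + a * (a + 2 · b)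
out-surplus {δ} {a} {b} {c} {eAA} {eAB} {eX} h1 h2 h3 h4 = lin-≤ (δ ∷ a ∷ eAA ∷ eAB ∷ eX ∷ b ∷ c ∷ [])
      ((ξ 0 ⊗ ξ 1 , (ξ 2 ⊕ ξ 3) ⊕ ξ 4) ∷ ((2 ⊙ ξ 2) ⊕ ξ 1 , ξ 1 ⊗ ξ 1) ∷ (ξ 3 , ξ 1 ⊗ ξ 5) ∷ (ξ 4 , ξ 6) ∷ [])
      (ξ 1 ⊗ ((2 ⊙ ξ 0) ⊕ # 1)) ((2 ⊙ ξ 6) ⊕ (ξ 1 ⊗ (ξ 1 ⊕ (2 ⊙ ξ 5)))) (1 ∷ 2 ∷ 1 ∷ 2 ∷ 2 ∷ []) (# 0) refl
      (h1 , h2 , h3 , h4 , tt)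

-- The same for `D′`, with both degrees added: here it is the arcs inside the part that cross.
inner-surplus : ∀ {δ a b c d e eDA eAD eDB eBD eDC eCD eDD} → δ * d ≤ eDA + eDB + eDC + eDD → δ * d ≤ eAD + eBD + eCD + eDD →
  eDA + eAD ≤ d * a → eDB + eBD ≤ d * b → eDC + eCD ≤ d * c → eDD ≤ e → d * (2 · δ) ≤ 2 · e + d * (a + b + c)
inner-surplus {δ} {a} {b} {c} {d} {e} {eDA} {eAD} {eDB} {eBD} {eDC} {eCD} {eDD} h1 h2 h3 h4 h5 h6 =
    lin-≤ (δ ∷ d ∷ eDA ∷ eDB ∷ eDC ∷ eDD ∷ eAD ∷ eBD ∷ eCD ∷ a ∷ b ∷ c ∷ e ∷ [])
      ((ξ 0 ⊗ ξ 1 , ((ξ 2 ⊕ ξ 3) ⊕ ξ 4) ⊕ ξ 5) ∷ (ξ 0 ⊗ ξ 1 , ((ξ 6 ⊕ ξ 7) ⊕ ξ 8) ⊕ ξ 5) ∷ (ξ 2 ⊕ ξ 6 , ξ 1 ⊗ ξ 9) ∷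
       (ξ 3 ⊕ ξ 7 , ξ 1 ⊗ ξ 10) ∷ (ξ 4 ⊕ ξ 8 , ξ 1 ⊗ ξ 11) ∷ (ξ 5 , ξ 12) ∷ [])
      (ξ 1 ⊗ (2 ⊙ ξ 0)) ((2 ⊙ ξ 12) ⊕ (ξ 1 ⊗ ((ξ 9 ⊕ ξ 10) ⊕ ξ 11))) (1 ∷ 1 ∷ 1 ∷ 1 ∷ 1 ∷ 1 ∷ 2 ∷ []) (# 0) refl
      (h1 , h2 , h3 , h4 , h5 , h6 , tt)

-- Summing the three surpluses with weights 1, 1, 2 leaves exactly the excess: this is where 3n - 4 is used.
total-surplus : ∀ {n δ a b c d e r} → 3 · n ≤ 8 · δ + 4 → n ≡ a + b + c + d → d ≡ b + e → 0 < e →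
  n * (2 · δ + 1) ≤ 10 · r + n * (a + 2 · b) → n * (2 · δ + 1) ≤ 10 · r + n * (c + 2 · b) → n * (2 · δ) ≤ 10 · r + n * (a + b + c) → n * e ≤ 40 · r
total-surplus {n} {δ} {a} {b} {c} {d} {e} {r} h0 h1 h2 h3 s1 s2 s3 = lin-≤ (n ∷ δ ∷ a ∷ b ∷ c ∷ d ∷ e ∷ r ∷ [])
      ((ξ 0 ⊗ (3 ⊙ ξ 0) , ξ 0 ⊗ ((8 ⊙ ξ 1) ⊕ # 4)) ∷ (ξ 0 ⊗ (((ξ 2 ⊕ ξ 3) ⊕ ξ 4) ⊕ ξ 5) , ξ 0 ⊗ ξ 0) ∷
       (ξ 0 ⊗ (ξ 3 ⊕ ξ 6) , ξ 0 ⊗ ξ 5) ∷ (ξ 0 ⊗ # 1 , ξ 0 ⊗ ξ 6) ∷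
       (ξ 0 ⊗ ((2 ⊙ ξ 1) ⊕ # 1) , (10 ⊙ ξ 7) ⊕ (ξ 0 ⊗ (ξ 2 ⊕ (2 ⊙ ξ 3)))) ∷
       (ξ 0 ⊗ ((2 ⊙ ξ 1) ⊕ # 1) , (10 ⊙ ξ 7) ⊕ (ξ 0 ⊗ (ξ 4 ⊕ (2 ⊙ ξ 3)))) ∷
       (ξ 0 ⊗ (2 ⊙ ξ 1) , (10 ⊙ ξ 7) ⊕ (ξ 0 ⊗ ((ξ 2 ⊕ ξ 3) ⊕ ξ 4))) ∷ [])
      (ξ 0 ⊗ ξ 6) (40 ⊙ ξ 7) (1 ∷ 1 ∷ 3 ∷ 3 ∷ 2 ∷ 1 ∷ 1 ∷ 2 ∷ []) (# 0) refl
      (ℕₚ.*-monoʳ-≤ n h0 , ℕₚ.≤-reflexive (sym (cong (n *_) h1)) , ℕₚ.≤-reflexive (sym (cong (n *_) h2)) ,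
       ℕₚ.*-monoʳ-≤ n h3 , s1 , s2 , s3 , tt)

Arcs : ∀ {n} → OrientedGraph n → (X Y : Fin n → Bool) → ℕ → Set
Arcs {n} G X Y e = ∃ λ (M : List (Fin n × Fin n)) → length M ≡ e × Unique (map proj₁ M ++ map proj₂ M) ×
  (∀ {p q} → (p , q) ∈ M → X p ≡ true × Y q ≡ false × adj G p q ≡ true)

module Crossing {n : ℕ} (G : OrientedGraph n) {δ f g y γ : ℕ} (md : minSemiDegree≥ G δ) (0<n : 0 < n) (Sc : Scales n δ f g y γ)
    {A B C D : Fin n → Bool} (Ex : Extremal G (200 · g) (2000 · g) A B C D) (Ch : Choice G γ (200000 · g) A B C D) where
  private
    V = Fin n
    Vs = allFin n
  open Scales Sc
  open Extremal Ex
  open Classes G γ A B C D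
  open Choice Ch

  A′ B′ C′ D′ Yᶜ : V → Bool
  A′ x = X x ∧ Y x
  B′ x = not (X x) ∧ Y x
  C′ x = not (X x) ∧ not (Y x)
  D′ x = X x ∧ not (Y x)
  Yᶜ x = not (Y x)

  part′ : Partition G A′ B′ C′ D′
  part′ = record { one = λ x → each (X x) (Y x) }
    where
    each : ∀ p q → b2n (p ∧ q) + b2n (not p ∧ q) + b2n (not p ∧ not q) + b2n (p ∧ not q) ≡ 1
    each true  true  = refl
    each true  false = refl
    each false true  = refl
    each false false = refl

  private
    open Partition part′
    a b c d r : ℕ
    a = size G A′
    b = size G B′
    c = size G C′
    d = size G D′
    r = edges G X Yᶜ

    devX′ : sumOf (λ x → b2n (X x xor X₀ x)) Vs ≤ 200000 · g
    devX′ = devX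
    devY′ : sumOf (λ x → b2n (Y x xor Y₀ x)) Vs ≤ 200000 · g
    devY′ = devY

    core : ∀ (P P′ : V → Bool) → (∀ x → P x ≡ true → (X x xor X₀ x) ≡ false → (Y x xor Y₀ x) ≡ false → P′ x ≡ true) →
      size G P ≤ size G P′ + 400000 · g
    core P P′ h = ℕₚ.≤-trans (sumOf-mono Vs λ {x} _ → each (P x) (P′ x) (X x xor X₀ x) (Y x xor Y₀ x) (h x))
      (ℕₚ.≤-trans (ℕₚ.≤-reflexive (trans (sumOf-+ (λ x → b2n (P′ x)) (λ x → b2n (X x xor X₀ x) + b2n (Y x xor Y₀ x)) Vs) (cong (size G P′ +_) (sumOf-+ (λ x → b2n (X x xor X₀ x)) (λ x → b2n (Y x xor Y₀ x)) Vs)))) (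
          lin-≤ (sumOf (λ x → b2n (Choice.X Ch x xor X₀ x)) Vs ∷ g ∷ sumOf (λ x → b2n (Choice.Y Ch x xor Y₀ x)) Vs ∷
            size G P′ ∷ [])
            ((ξ 0 , 200000 ⊙ ξ 1) ∷ (ξ 2 , 200000 ⊙ ξ 1) ∷ [])
            (ξ 3 ⊕ (ξ 0 ⊕ ξ 2)) (ξ 3 ⊕ (400000 ⊙ ξ 1)) (1 ∷ 1 ∷ 1 ∷ []) (# 0) refl (devX′ , devY′ , tt)))
      where
      each : ∀ p p′ u v → (p ≡ true → u ≡ false → v ≡ false → p′ ≡ true) → b2n p ≤ b2n p′ + (b2n u + b2n v)
      each false p′ u v h = z≤n
      each true true u v h = s≤s z≤n
      each true false true v h = s≤s z≤n
      each true false false true h = s≤s z≤n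
      each true false false false h with h refl refl refl
      ... | ()

    big-part : ∀ P P′ → n ≤ 4 · size G P + 200 · g → size G P ≤ size G P′ + 400000 · g → n ≤ 5 · size G P′
    big-part P P′ h k = lin-≤ (n ∷ size G P ∷ g ∷ size G P′ ∷ γ ∷ y ∷ [])
          ((ξ 0 , (4 ⊙ ξ 1) ⊕ (200 ⊙ ξ 2)) ∷ (ξ 1 , ξ 3 ⊕ (400000 ⊙ ξ 2)) ∷ (400 ⊙ ξ 4 , ξ 0) ∷ (1000 ⊙ ξ 5 , ξ 4) ∷
           (200000 ⊙ ξ 2 , ξ 5) ∷ [])
          (ξ 0) (5 ⊙ ξ 3) (399991999 ∷ 400000000 ∷ 1600000000 ∷ 8001 ∷ 3200400 ∷ 3200400000 ∷ [])
           (399959995 ⊙ ξ 3 ⊕ # 399991998) refl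
          (h , k , γn , yγ , gy , tt)

    xor-true : ∀ {p q} → q ≡ true → (p xor q) ≡ false → p ≡ true
    xor-true {true}  refl _ = refl
    xor-true {false} refl ()

    xor-false : ∀ {p q} → q ≡ false → (p xor q) ≡ false → p ≡ false
    xor-false {true}  refl ()
    xor-false {false} refl _ = refl

    oneA : ∀ {a b c d} → b2n a + b2n b + b2n c + b2n d ≡ 1 → a ≡ true → a ∨ d ≡ true × a ∨ b ≡ true
    oneA _ refl = refl , refl
    oneC : ∀ {a b c d} → b2n a + b2n b + b2n c + b2n d ≡ 1 → c ≡ true → a ∨ d ≡ false × a ∨ b ≡ false
    oneC {false} {false} {true} {false} _ refl = refl , refl
    oneC {true} {b} {true} {d} e refl = ⊥-elim (lin-⊥ (b2n b ∷ b2n d ∷ [])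
          ((((# 1 ⊕ ξ 0) ⊕ # 1) ⊕ ξ 1 , # 1) ∷ []) (1 ∷ []) (ξ 0 ⊕ ξ 1) refl (ℕₚ.≤-reflexive e , tt))
    oneC {false} {true} {true} {d} e refl = ⊥-elim (lin-⊥ (b2n d ∷ [])
          ((((# 0 ⊕ # 1) ⊕ # 1) ⊕ ξ 0 , # 1) ∷ []) (1 ∷ []) (ξ 0) refl (ℕₚ.≤-reflexive e , tt))
    oneC {false} {false} {true} {true} () refl
    oneD : ∀ {a b c d} → b2n a + b2n b + b2n c + b2n d ≡ 1 → d ≡ true → a ∨ d ≡ true × a ∨ b ≡ false
    oneD {a} {false} {c} {true} e refl = Boolₚ.∨-zeroʳ a , ¬true⇒false (λ p → two p e)
      where
      two : a ∨ false ≡ true → b2n a + 0 + b2n c + 1 ≡ 1 → ⊥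
      two p e rewrite trans (sym (Boolₚ.∨-identityʳ a)) p = ⊥-elim (lin-⊥ (b2n c ∷ [])
            ((((# 1 ⊕ # 0) ⊕ ξ 0) ⊕ # 1 , # 1) ∷ []) (1 ∷ []) (ξ 0) refl (ℕₚ.≤-reflexive e , tt))
    oneD {a} {true} {c} {true} e refl = ⊥-elim (lin-⊥ (b2n a ∷ b2n c ∷ [])
          ((((ξ 0 ⊕ # 1) ⊕ ξ 1) ⊕ # 1 , # 1) ∷ []) (1 ∷ []) (ξ 0 ⊕ ξ 1) refl (ℕₚ.≤-reflexive e , tt))

    part-one : ∀ x → b2n (A x) + b2n (B x) + b2n (C x) + b2n (D x) ≡ 1
    part-one = Partition.one partition

    n≤5a : n ≤ 5 · a
    n≤5a = big-part A A′ a≥ (core A A′ λ x p u v → let (s , t) = oneA {A x} {B x} {C x} {D x} (part-one x) p in ∧-join (xor-true {X x} s u) (xor-true {Y x} t v))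
    n≤5c : n ≤ 5 · c
    n≤5c = big-part C C′ c≥ (core C C′ λ x p u v → let (s , t) = oneC {A x} {B x} {C x} {D x} (part-one x) p in ∧-join (cong not (xor-false {X x} s u)) (cong not (xor-false {Y x} t v)))
    n≤5d : n ≤ 5 · d
    n≤5d = big-part D D′ d≥ (core D D′ λ x p u v → let (s , t) = oneD {A x} {B x} {C x} {D x} (part-one x) p in ∧-join (xor-true {X x} s u) (cong not (xor-false {Y x} t v)))

    X-split : ∀ x → b2n (X x) ≡ b2n (A′ x) + b2n (D′ x)
    X-split x = b2n-split (X x) (Y x)
    Y-split : ∀ x → b2n (Y x) ≡ b2n (A′ x) + b2n (B′ x)
    Y-split x = each (X x) (Y x)
      where
      each : ∀ p q → b2n q ≡ b2n (p ∧ q) + b2n (not p ∧ q)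
      each true  true  = refl
      each true  false = refl
      each false q     = refl
    Yᶜ-split : ∀ x → b2n (Yᶜ x) ≡ b2n (C′ x) + b2n (D′ x)
    Yᶜ-split x = each (X x) (Y x)
      where
      each : ∀ p q → b2n (not q) ≡ b2n (not p ∧ not q) + b2n (p ∧ not q)
      each true  q     = refl
      each false true  = refl
      each false false = refl

    d≡ : d ≡ b + excess
    d≡ = ℕₚ.+-cancelˡ-≡ a _ _ (trans (trans (sym (sumOf-+ _ _ Vs)) (sumOf-cong Vs λ {x} _ → sym (X-split x)))
      (trans balance (trans (cong (_+ excess) (trans (sumOf-cong Vs λ {x} _ → Y-split x) (sumOf-+ _ _ Vs))) (ℕₚ.+-assoc a b excess))))

    crA : edges G A′ C′ + edges G A′ D′ ≤ r
    crA = ℕₚ.≤-trans (ℕₚ.≤-reflexive (sym (edges-+ʳ G A′ C′ D′ Yᶜ Yᶜ-split))) (edges-mono G {A′} {X} {Yᶜ} {Yᶜ} (λ x p → proj₁ (∧-split p)) (λ _ → id))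
    crC : edges G A′ C′ + edges G D′ C′ ≤ r
    crC = ℕₚ.≤-trans (ℕₚ.≤-reflexive (sym (edges-+ˡ G X A′ D′ C′ X-split))) (edges-mono G {X} {X} {C′} {Yᶜ} (λ _ → id) (λ x p → proj₂ (∧-split {not (X x)} p)))
    crD : edges G D′ D′ ≤ r
    crD = edges-mono G {D′} {X} {D′} {Yᶜ} (λ x p → proj₁ (∧-split p)) (λ x p → proj₂ (∧-split {X x} p))

    crossing-many : 0 < excess → n * excess ≤ 40 · r
    crossing-many 0<e = total-surplus {δ = δ} δ≥ size-parts d≡ 0<e
      (scale {n} {a} {r} {a + 2 · b} {2 · δ + 1} n≤5a (out-surplus {δ} {a} {b} {eAA = edges G A′ A′} {edges G A′ B′} {edges G A′ C′ + edges G A′ D′} out-A (edges-irrefl G A′) (edges-≤ G A′ B′) crA))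
      (scale {n} {c} {r} {c + 2 · b} {2 · δ + 1} n≤5c (out-surplus {δ} {c} {b} {eAA = edges G C′ C′} {edges G B′ C′} {edges G A′ C′ + edges G D′ C′} in-C (edges-irrefl G C′)
        (ℕₚ.≤-trans (edges-≤ G B′ C′) (ℕₚ.≤-reflexive (ℕₚ.*-comm b c))) crC))
      (scale {n} {d} {r} {a + b + c} {2 · δ} n≤5d (inner-surplus {δ} {a} {b} {c} {d} {eDA = edges G D′ A′} {edges G A′ D′} {edges G D′ B′} {edges G B′ D′} {edges G D′ C′} {edges G C′ D′} {edges G D′ D′}
        (edges-out D′ md) (edges-in D′ md) (edges-pair G D′ A′) (edges-pair G D′ B′) (edges-pair G D′ C′) crD))
      where
      out-A : δ * a ≤ edges G A′ A′ + edges G A′ B′ + (edges G A′ C′ + edges G A′ D′)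
      out-A = ℕₚ.≤-trans (edges-out A′ md) (ℕₚ.≤-reflexive (ℕₚ.+-assoc (edges G A′ A′ + edges G A′ B′) _ _))
      in-C : δ * c ≤ edges G C′ C′ + edges G B′ C′ + (edges G A′ C′ + edges G D′ C′)
      in-C = ℕₚ.≤-trans (edges-in C′ md) (ℕₚ.≤-reflexive (arr (edges G A′ C′) (edges G B′ C′) (edges G C′ C′) (edges G D′ C′)))
        where
        arr : ∀ a b c d → a + b + c + d ≡ c + b + (a + d)
        arr a b c d = (norm-≡ (a ∷ b ∷ c ∷ d ∷ []) (((ξ 0 ⊕ ξ 1) ⊕ ξ 2) ⊕ ξ 3) ((ξ 2 ⊕ ξ 1) ⊕ (ξ 0 ⊕ ξ 3)) refl)

    -- In the tight case a vertex has fewer than `γ` arcs on the wrong side of the original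
    -- partition, and the reassigned classes differ from the original ones in at most `200000 · g`
    -- vertices.
    τ : ℕ
    τ = γ + 200000 · g

    module Tight (tx : ∀ {x} → X x ≡ true → row G x Y₀ᶜ < γ) (ty : ∀ {y} → Y y ≡ false → col G X₀ y < γ) where
      row-τ : ∀ x → X x ≡ true → row G x Yᶜ ≤ τ
      row-τ x p = ℕₚ.≤-trans (cnt-cover {Q = λ y → adj G x y ∧ Y₀ᶜ y} {λ y → Y y xor Y₀ y} Vs λ {y} _ q →
          let (e , u) = ∧-split {adj G x y} q in [ (λ v → inj₁ (∧-join e v)) , inj₂ ]′ (each {A y} {B y} {C y} {D y} (part-one y) (Y y) u))
        (ℕₚ.+-mono-≤ (ℕₚ.<⇒≤ (tx p)) devY)
        where
        each : ∀ {a b c d} → b2n a + b2n b + b2n c + b2n d ≡ 1 → ∀ y → not y ≡ true → (c ∨ d) ≡ true ⊎ (y xor (a ∨ b)) ≡ true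
        each {true}  {false} {false} {false} _ false _ = inj₂ refl
        each {false} {true}  {false} {false} _ false _ = inj₂ refl
        each {false} {false} {true}  {false} _ false _ = inj₁ refl
        each {false} {false} {false} {true}  _ false _ = inj₁ refl

      col-τ : ∀ y → Yᶜ y ≡ true → col G X y ≤ τ
      col-τ y p = ℕₚ.≤-trans (cnt-cover {Q = λ x → adj G x y ∧ X₀ x} {λ x → X x xor X₀ x} Vs λ {x} _ q →
          let (e , u) = ∧-split {adj G x y} q in [ (λ v → inj₁ (∧-join e v)) , inj₂ ]′ (each (X x) (X₀ x) u))
        (ℕₚ.+-mono-≤ (ℕₚ.<⇒≤ (ty (not-true p))) devX)
        where
        each : ∀ x z → x ≡ true → z ≡ true ⊎ (x xor z) ≡ true
        each true true  _ = inj₁ refl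
        each true false _ = inj₂ refl

      module Avoid (F : List V) where
        X∩ X∖ Y∩ Y∖ : V → Bool
        X∩ x = X x ∧ mem x F
        X∖ x = X x ∧ not (mem x F)
        Y∩ x = Yᶜ x ∧ mem x F
        Y∖ x = Yᶜ x ∧ not (mem x F)

        sz : ∀ (P : V → Bool) → size G (λ x → P x ∧ mem x F) ≤ length F
        sz P = ℕₚ.≤-trans (cnt-mono Vs λ {x} _ p → proj₂ (∧-split {P x} p)) (cnt-mem F Vs (Uniqueₚ.allFin⁺ n))

        e₁ : edges G X∩ Yᶜ ≤ τ * length F
        e₁ = ℕₚ.≤-trans (edges-≤-row G X∩ Yᶜ τ λ x p → row-τ x (proj₁ (∧-split p))) (ℕₚ.*-monoʳ-≤ τ (sz X))

        e₂ : edges G X Y∩ ≤ τ * length F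
        e₂ = ℕₚ.≤-trans (ℕₚ.≤-reflexive (edges-col G X Y∩)) (ℕₚ.≤-trans (weighted≤ G Y∩ (col G X) τ λ y p → col-τ y (proj₁ (∧-split p))) (ℕₚ.*-monoʳ-≤ τ (sz Yᶜ)))

        bound : r ≤ 2 · (τ * length F) + edges G X∖ Y∖
        bound = lin-≤ (edges G (Choice.X Ch) Yᶜ ∷ edges G X∩ Yᶜ ∷ edges G X∖ Yᶜ ∷ edges G X∖ Y∩ ∷ edges G X∖ Y∖ ∷
              edges G (Choice.X Ch) Y∩ ∷ γ ∷ g ∷ length F ∷ [])
              ((ξ 0 , ξ 1 ⊕ ξ 2) ∷ (ξ 2 , ξ 3 ⊕ ξ 4) ∷ (ξ 3 , ξ 5) ∷ (ξ 1 , (ξ 6 ⊕ (200000 ⊙ ξ 7)) ⊗ ξ 8) ∷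
               (ξ 5 , (ξ 6 ⊕ (200000 ⊙ ξ 7)) ⊗ ξ 8) ∷ [])
              (ξ 0) ((2 ⊙ ((ξ 6 ⊕ (200000 ⊙ ξ 7)) ⊗ ξ 8)) ⊕ ξ 4) (1 ∷ 1 ∷ 1 ∷ 1 ∷ 1 ∷ 1 ∷ []) (# 0) refl
              (ℕₚ.≤-reflexive (edges-+ˡ G X X∩ X∖ Yᶜ (λ x → b2n-split (X x) (mem x F))) ,
               ℕₚ.≤-reflexive (edges-+ʳ G X∖ Y∩ Y∖ Yᶜ (λ y → b2n-split (Yᶜ y) (mem y F))) ,
               edges-mono G {X∖} {X} {Y∩} {Y∩} (λ x p → proj₁ (∧-split p)) (λ _ → id) , e₁ , e₂ , tt)

      -- The `2 i` ends of the arcs chosen so far meet at most `4 τ i` crossing arcs. There are at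
      -- least `n * excess / 40` of them and `n > 160 τ`, so a free one exists while `i < excess`.
      grow : 0 < excess → ∀ i → i ≤ excess → Arcs G X Y i
      grow 0<e zero    le = [] , refl , [] , λ ()
      grow 0<e (suc i) le = add (grow 0<e i (ℕₚ.<⇒≤ le))
        where
        add : Arcs G X Y i → Arcs G X Y (suc i)
        add (M , len , u , h) = new (edges-∃ G (Avoid.X∖ F) (Avoid.Y∖ F) free)
          where
          F : List V
          F = map proj₁ M ++ map proj₂ M
          lenF : length F ≡ i + i
          lenF = trans (Listₚ.length-++ (map proj₁ M)) (cong₂ _+_ (trans (Listₚ.length-map proj₁ M) len) (trans (Listₚ.length-map proj₂ M) len))
          exceed : ∀ {n e i r t k ε} → n * e ≤ 40 · r → r ≤ 2 · (t * k) + ε → k ≡ i + i → suc i ≤ e → 160 · t < n → 0 < ε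
          exceed {n} {e} {i} {r} {t} {k} {ε} p q s l m = ℕₚ.≰⇒> λ z → (lin-⊥ (n ∷ e ∷ r ∷ t ∷ k ∷ ε ∷ i ∷ [])
                ((ξ 0 ⊗ ξ 1 , 40 ⊙ ξ 2) ∷ (ξ 2 , (2 ⊙ (ξ 3 ⊗ ξ 4)) ⊕ ξ 5) ∷ (ξ 5 , # 0) ∷
                 (ξ 3 ⊗ ξ 4 , ξ 3 ⊗ (ξ 6 ⊕ ξ 6)) ∷ (ξ 3 ⊗ (# 1 ⊕ ξ 6) , ξ 3 ⊗ ξ 1) ∷
                 (ξ 1 ⊕ ((160 ⊙ ξ 3) ⊗ ξ 1) , ξ 0 ⊗ ξ 1) ∷ (# 1 ⊕ ξ 6 , ξ 1) ∷ [])
                (1 ∷ 40 ∷ 40 ∷ 80 ∷ 160 ∷ 1 ∷ 1 ∷ []) (160 ⊙ ξ 3 ⊕ ξ 6) refl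
                (p , q , z , ℕₚ.≤-reflexive (cong (t *_) s) , ℕₚ.*-monoʳ-≤ t l , ℕₚ.*-monoˡ-≤ e m , l , tt))
          free : 0 < edges G (Avoid.X∖ F) (Avoid.Y∖ F)
          free = exceed {n} {r = r} {τ} (crossing-many 0<e) (Avoid.bound F) lenF le (lin-≤ (γ ∷ n ∷ y ∷ g ∷ [])
                ((400 ⊙ ξ 0 , ξ 1) ∷ (1000 ⊙ ξ 2 , ξ 0) ∷ (200000 ⊙ ξ 3 , ξ 2) ∷ (# 4 , ξ 3) ∷ [])
                (# 1 ⊕ (160 ⊙ (ξ 0 ⊕ (200000 ⊙ ξ 3)))) (ξ 1) (1 ∷ 1 ∷ 240 ∷ 240000 ∷ 47968000000 ∷ [])
                 (# 191871999999) refl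
                (γn , yγ , gy , 4≤g , tt))
          new : (∃₂ λ x y → Avoid.X∖ F x ≡ true × Avoid.Y∖ F y ≡ true × adj G x y ≡ true) → Arcs G X Y (suc i)
          new (x , y , p , q , e) = (x , y) ∷ M , cong suc len
            , Unique-↭ (↭-sym (↭-prep x (↭ₚ.shift y (map proj₁ M) (map proj₂ M)))) (Unique-∷ x∉ (Unique-∷ y∉ u))
            , λ { (here refl) → proj₁ (∧-split p) , not-true (proj₁ (∧-split q)) , e ; (there m) → h m }
            where
            y∉ : y ∉ F
            y∉ = mem⇒∉ (not-true (proj₂ (∧-split {Yᶜ y} q)))
            -- Tail and head may both lie in the intersection of `X` and the complement of `Y`; they
            -- differ because there are no loops.
            x∉ : x ∉ y ∷ F
            x∉ (here refl) = false≢true (adj-irrefl G y) e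
            x∉ (there m) = mem⇒∉ (not-true (proj₂ (∧-split {X x} p))) m

  opaque
    crossing-arcs : Arcs G X Y excess
    crossing-arcs = [ none , (λ (tx , ty) → some tx ty (ℕₚ.≤-<-connex excess 0)) ]′ tight
      where
      none : ∀ {e} → e ≡ 0 → Arcs G X Y e
      none refl = [] , refl , [] , λ ()
      some : (∀ {x} → X x ≡ true → row G x Y₀ᶜ < γ) → (∀ {y} → Y y ≡ false → col G X₀ y < γ) → excess ≤ 0 ⊎ 0 < excess → Arcs G X Y excess
      some tx ty (inj₁ z) = none (ℕₚ.n≤0⇒n≡0 z)
      some tx ty (inj₂ p) = Tight.grow tx ty p excess ℕₚ.≤-refl

-- Expansion in the extremal case

record Bipartite {n : ℕ} (G : OrientedGraph n) (g : ℕ) (P₁ P₂ Q₁ Q₂ : Fin n → Bool) : Set where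
  field
    p₁≥ : n ≤ 4 · size G P₁ + 200 · g
    p₂≥ : n ≤ 4 · size G P₂ + 200 · g
    q₁≤ : 4 · size G Q₁ ≤ n + 200 · g
    q₂≤ : 4 · size G Q₂ ≤ n + 200 · g
    full₁ : size G P₁ * size G Q₁ ≤ edges G P₁ Q₁ + 2000 · g * n
    full₂ : size G P₂ * size G Q₂ ≤ edges G P₂ Q₂ + 2000 · g * n
    half₁ : n * n ≤ 32 · edges G P₁ Q₂ + 2000 · g * n
    half₂ : n * n ≤ 32 · edges G P₂ Q₁ + 2000 · g * n

bipartite-swap : ∀ {n g P₁ P₂ Q₁ Q₂} {G : OrientedGraph n} → Bipartite G g P₁ P₂ Q₁ Q₂ → Bipartite G g P₂ P₁ Q₂ Q₁
bipartite-swap R = record { p₁≥ = p₂≥ ; p₂≥ = p₁≥ ; q₁≤ = q₂≤ ; q₂≤ = q₁≤ ; full₁ = full₂ ; full₂ = full₁ ; half₁ = half₂ ; half₂ = half₁ }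
  where open Bipartite R

-- Each of the `l` vertices misses at least `t - (1 + f)` arcs, which is at least `y / 2`, and only
-- `m ≤ y² / 2` arcs are missing.
few-low : ∀ {l t f m y} → y ≤ t → 0 < f → 4 · f ≤ y → 2 · m ≤ y * y → l * t ≤ l * (1 + f) + m → l ≤ y
few-low {l} {t} {f} {m} {y} h0 h1 h2 h3 h4 = ℕₚ.≮⇒≥ λ lt →
    (lin-⊥ (l ∷ const y t ∷ Function.Base.constᵣ y t ∷ f ∷ m ∷ [])
      ((ξ 0 ⊗ ξ 1 , ξ 0 ⊗ ξ 2) ∷ (ξ 0 ⊗ (4 ⊙ ξ 3) , ξ 0 ⊗ ξ 1) ∷ (ξ 0 ⊗ # 1 , ξ 0 ⊗ ξ 3) ∷ (2 ⊙ ξ 4 , ξ 1 ⊗ ξ 1) ∷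
       (ξ 0 ⊗ ξ 2 , (ξ 0 ⊗ (# 1 ⊕ ξ 3)) ⊕ ξ 4) ∷ (ξ 1 ⊕ (ξ 1 ⊗ ξ 1) , ξ 0 ⊗ ξ 1) ∷ (4 ⊙ ξ 3 , ξ 1) ∷
       (# 1 ⊕ # 0 , ξ 3) ∷ [])
      (2 ∷ 1 ∷ 2 ∷ 1 ∷ 2 ∷ 1 ∷ 1 ∷ 4 ∷ []) (# 3) refl
      (ℕₚ.*-monoʳ-≤ l h0 , ℕₚ.*-monoʳ-≤ l h2 , ℕₚ.*-monoʳ-≤ l h1 , h3 , h4 , ℕₚ.*-monoˡ-≤ y lt , h2 , h1 , tt))

-- Unreached vertices send at most `f + s` arcs each, so nearly all of the n²/32 arcs leave from the
-- `k` reached ones, which have at most about n/4 each. This gives about n/8 reached vertices, and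
-- n/10 after the errors.
half-growth : ∀ {n q p e k f s g y} → 0 < n → 4 · q ≤ n + 200 · g → p ≤ n → k ≤ n → n * n ≤ 32 · e + 2000 · g * n → e ≤ q * k + (f + s) * p →
  4 · f ≤ y → s ≤ 9 · y → 200000 · g ≤ y → 400000 · y ≤ n → n ≤ 10 · k
half-growth {n} {q} {p} {e} {k} {f} {s} {g} {y} 0<n h1 h2 h3 h4 h5 h6 h7 h8 h9 = cancel-half 0<n (
    lin-≤ (n ∷ e ∷ g ∷ q ∷ k ∷ f ∷ s ∷ p ∷ y ∷ [])
      ((ξ 0 ⊗ ξ 0 , (32 ⊙ ξ 1) ⊕ ((2000 ⊙ ξ 2) ⊗ ξ 0)) ∷ (ξ 1 , (ξ 3 ⊗ ξ 4) ⊕ ((ξ 5 ⊕ ξ 6) ⊗ ξ 7)) ∷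
       ((4 ⊙ ξ 3) ⊗ ξ 4 , (ξ 0 ⊕ (200 ⊙ ξ 2)) ⊗ ξ 4) ∷ (ξ 2 ⊗ ξ 4 , ξ 2 ⊗ ξ 0) ∷
       ((ξ 5 ⊕ ξ 6) ⊗ ξ 7 , (ξ 5 ⊕ ξ 6) ⊗ ξ 0) ∷ ((4 ⊙ ξ 5) ⊗ ξ 0 , ξ 8 ⊗ ξ 0) ∷ (ξ 6 ⊗ ξ 0 , (9 ⊙ ξ 8) ⊗ ξ 0) ∷
       ((200000 ⊙ ξ 2) ⊗ ξ 0 , ξ 8 ⊗ ξ 0) ∷ ((400000 ⊙ ξ 8) ⊗ ξ 0 , ξ 0 ⊗ ξ 0) ∷ [])
      (ξ 0 ⊗ ξ 0) (ξ 0 ⊗ (10 ⊙ ξ 4))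
       (199851991 ∷ 200000000 ∷ 6400000000 ∷ 1600000000 ∷ 320000000000 ∷ 6400000000 ∷ 1600000000 ∷ 6400000000 ∷ 3600000 ∷ 148009 ∷ [])
       (398519910 ⊙ (ξ 0 ⊗ ξ 4) ⊕ # 199851990) refl
      (h4 , h5 , ℕₚ.*-monoˡ-≤ k h1 , ℕₚ.*-monoʳ-≤ g h3 , ℕₚ.*-monoʳ-≤ (f + s) h2 , ℕₚ.*-monoˡ-≤ n h6 ,
       ℕₚ.*-monoˡ-≤ n h7 , ℕₚ.*-monoˡ-≤ n h8 , ℕₚ.*-monoˡ-≤ n h9 , tt))

module BipartiteExpansion {n : ℕ} (G : OrientedGraph n) {δ f g y γ : ℕ} (0<n : 0 < n) (Sc : Scales n δ f g y γ)
    (T : Fin n → Bool) where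
  private
    V = Fin n
    Vs = allFin n
  open Scales Sc

  reached : (V → Bool) → V → Bool
  reached P w = P w ∧ (f ℕ.<ᵇ row G w T)

  size≤n : ∀ P → size G P ≤ n
  size≤n P = ℕₚ.≤-trans (cnt≤length P Vs) (ℕₚ.≤-reflexive (Listₚ.length-tabulate id))

  module _ (P Q : V → Bool) where
    p q t : ℕ
    p = size G P
    q = size G Q
    t = size G (λ y → Q y ∧ T y)
    Qᵗ Qⁿ : V → Bool
    Qᵗ y = Q y ∧ T y
    Qⁿ y = Q y ∧ not (T y)
    u : ℕ
    u = size G Qⁿ
    q≡ : q ≡ t + u
    q≡ = cnt-split Q T Vs

    reached-full : size G P * size G Q ≤ edges G P Q + 2000 · g * n → y ≤ size G (λ y → Q y ∧ T y) → size G P ≤ cnt (reached P) Vs + y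
    reached-full miss y≤t = ℕₚ.≤-trans (ℕₚ.≤-reflexive (cnt-split P (λ w → f ℕ.<ᵇ row G w T) Vs))
        (ℕₚ.+-monoʳ-≤ _ (ℕₚ.≤-trans (cnt-mono Vs λ {w} _ h → let (a , b) = ∧-split {P w} h in
          ∧-join a (<ᵇ-true (s≤s (ℕₚ.≤-trans (row-mono G w {Qᵗ} {T} λ y z → proj₂ (∧-split {Q y} z)) (<ᵇ-false {f} {row G w T} (not-true b))))))
          (few-low y≤t 0<f fy yy (low-rows G P Qᵗ miss′))))
      where
      miss′ : p * t ≤ edges G P Qᵗ + 2000 · g * n
      miss′ = lin-≤ (size G P ∷ size G Q ∷ edges G P Q ∷ g ∷ n ∷ edges G P Qᵗ ∷ edges G P Qⁿ ∷ size G Qⁿ ∷ t ∷ [])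
            ((ξ 0 ⊗ ξ 1 , ξ 2 ⊕ ((2000 ⊙ ξ 3) ⊗ ξ 4)) ∷ (ξ 2 , ξ 5 ⊕ ξ 6) ∷ (ξ 6 , ξ 0 ⊗ ξ 7) ∷
             (ξ 0 ⊗ (ξ 8 ⊕ ξ 7) , ξ 0 ⊗ ξ 1) ∷ [])
            (ξ 0 ⊗ ξ 8) (ξ 5 ⊕ ((2000 ⊙ ξ 3) ⊗ ξ 4)) (1 ∷ 1 ∷ 1 ∷ 1 ∷ 1 ∷ []) (# 0) refl
            (miss , ℕₚ.≤-reflexive (edges-+ʳ G P Qᵗ Qⁿ Q (λ y → b2n-split (Q y) (T y))) , edges-≤ G P Qⁿ ,
             ℕₚ.≤-reflexive (sym (cong (p *_) q≡)) , tt)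

    reached-half : n * n ≤ 32 · edges G P Q + 2000 · g * n → 4 · size G Q ≤ n + 200 · g → size G Q ≤ size G (λ y → Q y ∧ T y) + 9 · y → n ≤ 10 · cnt (reached P) Vs
    reached-half den hq near = half-growth 0<n hq (size≤n P) (size≤n (reached P)) den bound fy u≤ gy (
        lin-≤ (y ∷ γ ∷ n ∷ [])
          ((1000 ⊙ ξ 0 , ξ 1) ∷ (400 ⊙ ξ 1 , ξ 2) ∷ [])
          (400000 ⊙ ξ 0) (ξ 2) (1 ∷ 400 ∷ 1 ∷ []) (# 0) refl (yγ , γn , tt))
      where
      u≤ : u ≤ 9 · y
      u≤ = lin-≤ (q ∷ t ∷ u ∷ y ∷ [])
            ((ξ 1 ⊕ ξ 2 , ξ 0) ∷ (ξ 0 , ξ 1 ⊕ (9 ⊙ ξ 3)) ∷ [])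
            (ξ 2) (9 ⊙ ξ 3) (1 ∷ 1 ∷ 1 ∷ []) (# 0) refl (ℕₚ.≤-reflexive (sym q≡) , near , tt)
      row-bound : ∀ w → row G w Q ≤ row G w T + u
      row-bound w = ℕₚ.≤-trans (cnt-cover {Q = λ y → adj G w y ∧ T y} {Qⁿ} Vs λ {y} _ h → let (a , b) = ∧-split {adj G w y} h in
        [ (λ z → inj₁ (∧-join a z)) , (λ z → inj₂ (∧-join b (cong not z))) ]′ (true-or-false (T y))) ℕₚ.≤-refl
      bound : edges G P Q ≤ q * cnt (reached P) Vs + (f + u) * p
      bound = ℕₚ.≤-trans (sumOf-mono Vs λ {w} _ → each (P w) (f ℕ.<ᵇ row G w T) refl (row≤ G w Q) (row-bound w))
        (ℕₚ.≤-reflexive (trans (sumOf-+ (λ w → q * b2n (reached P w)) (λ w → (f + u) * b2n (P w)) Vs)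
          (cong₂ _+_ (sumOf-* q (λ w → b2n (reached P w)) Vs) (sumOf-* (f + u) (λ w → b2n (P w)) Vs))))
        where
        each : ∀ a b {r s} → (f ℕ.<ᵇ s) ≡ b → r ≤ q → r ≤ s + u → b2n a * r ≤ q * b2n (a ∧ b) + (f + u) * b2n a
        each false b {r} e h k = z≤n
        each true true {r} e h k = lin-≤ (r ∷ q ∷ f ∷ u ∷ [])
              ((ξ 0 , ξ 1) ∷ [])
              (# 1 ⊗ ξ 0) ((ξ 1 ⊗ # 1) ⊕ ((ξ 2 ⊕ ξ 3) ⊗ # 1)) (1 ∷ 1 ∷ []) (ξ 2 ⊕ ξ 3) refl (h , tt)
        each true false {r} {s} e h k = lin-≤ (r ∷ s ∷ u ∷ f ∷ q ∷ [])
              ((ξ 0 , ξ 1 ⊕ ξ 2) ∷ (ξ 1 , ξ 3) ∷ [])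
              (# 1 ⊗ ξ 0) ((ξ 4 ⊗ # 0) ⊕ ((ξ 3 ⊕ ξ 2) ⊗ # 1)) (1 ∷ 1 ∷ 1 ∷ []) (# 0) refl
              (k , <ᵇ-false {f} {s} e , tt)

  module _ {P₁ P₂ Q₁ Q₂ : V → Bool} where
    -- Almost all of `T` lies in `Q₁`. The complete pair `P₁`, `Q₁` reaches about n/4 vertices,
    -- which is enough unless `T` nearly exhausts `Q₁`; in that event the half-dense pair `P₂`, `Q₁`
    -- adds another n/10.
    one-sided : Bipartite G g P₁ P₂ Q₁ Q₂ → ∀ s → s ≤ size G (λ y → Q₁ y ∧ T y) + y + 200000 · g → 10 · y ≤ s →
      s + y + 4 · (200000 · g) ≤ cnt (reached P₁) Vs + cnt (reached P₂) Vs
    one-sided R s h k = [ small , large ]′ (ℕₚ.≤-<-connex (size G Q₁) (t₁ + 9 · y))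
      where
      open Bipartite R
      t₁ : ℕ
      t₁ = size G (λ y → Q₁ y ∧ T y)
      N₁ N₂ : ℕ
      N₁ = cnt (reached P₁) Vs
      N₂ = cnt (reached P₂) Vs
      near₁ : size G P₁ ≤ N₁ + y
      near₁ = reached-full P₁ Q₁ full₁ (lin-≤ (s ∷ size G (λ y₁ → Q₁ y₁ ∧ T y₁) ∷ y ∷ g ∷ [])
            ((ξ 0 , (ξ 1 ⊕ ξ 2) ⊕ (200000 ⊙ ξ 3)) ∷ (10 ⊙ ξ 2 , ξ 0) ∷ (200000 ⊙ ξ 3 , ξ 2) ∷ [])
            (ξ 2) (ξ 1) (8 ∷ 1 ∷ 1 ∷ 1 ∷ []) (7 ⊙ ξ 1 ⊕ # 7) refl (h , k , gy , tt))
      t₁≤ : t₁ ≤ size G Q₁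
      t₁≤ = cnt-mono Vs λ _ p → proj₁ (∧-split p)
      small : size G Q₁ ≤ t₁ + 9 · y → s + y + 4 · (200000 · g) ≤ N₁ + N₂
      small near =
          lin-≤ (n ∷ cnt (reached P₂) Vs ∷ size G P₁ ∷ N₁ ∷ y ∷ s ∷ size G (λ y₁ → Q₁ y₁ ∧ T y₁) ∷ g ∷ size G Q₁ ∷
            f ∷ γ ∷ [])
            ((ξ 0 , 10 ⊙ ξ 1) ∷ (ξ 2 , ξ 3 ⊕ ξ 4) ∷ (ξ 5 , (ξ 6 ⊕ ξ 4) ⊕ (200000 ⊙ ξ 7)) ∷ (ξ 6 , ξ 8) ∷
             (4 ⊙ ξ 8 , ξ 0 ⊕ (200 ⊙ ξ 7)) ∷ (ξ 0 , (4 ⊙ ξ 2) ⊕ (200 ⊙ ξ 7)) ∷ (200000 ⊙ ξ 7 , ξ 4) ∷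
             (1000 ⊙ ξ 4 , ξ 10) ∷ (400 ⊙ ξ 10 , ξ 0) ∷ [])
            ((ξ 5 ⊕ ξ 4) ⊕ (4 ⊙ (200000 ⊙ ξ 7))) (ξ 3 ⊕ ξ 1)
             (7999919980 ∷ 799991998 ∷ 4800560020 ∷ 7999919980 ∷ 7999919980 ∷ 1999979995 ∷ 1200140005 ∷ 40002800020 ∷ 60803200 ∷ 152008 ∷ [])
             (3199359960 ⊙ ξ 3 ⊕ # 7999919979) refl
            (reached-half P₂ Q₁ half₂ q₁≤ near , near₁ , h , t₁≤ , q₁≤ , p₁≥ , gy , yγ , γn , tt)
      large : t₁ + 9 · y < size G Q₁ → s + y + 4 · (200000 · g) ≤ N₁ + N₂
      large far = lin-≤ (size G P₁ ∷ N₁ ∷ y ∷ s ∷ size G (λ y₁ → Q₁ y₁ ∧ T y₁) ∷ g ∷ size G Q₁ ∷ n ∷ f ∷ N₂ ∷ [])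
            ((ξ 0 , ξ 1 ⊕ ξ 2) ∷ (ξ 3 , (ξ 4 ⊕ ξ 2) ⊕ (200000 ⊙ ξ 5)) ∷ (# 1 ⊕ (ξ 4 ⊕ (9 ⊙ ξ 2)) , ξ 6) ∷
             (4 ⊙ ξ 6 , ξ 7 ⊕ (200 ⊙ ξ 5)) ∷ (ξ 7 , (4 ⊙ ξ 0) ⊕ (200 ⊙ ξ 5)) ∷ (200000 ⊙ ξ 5 , ξ 2) ∷ [])
            ((ξ 3 ⊕ ξ 2) ⊕ (4 ⊙ (200000 ⊙ ξ 5))) (ξ 1 ⊕ ξ 9) (4 ∷ 4 ∷ 4 ∷ 4 ∷ 1 ∷ 1 ∷ 24 ∷ [])
             (799600 ⊙ ξ 5 ⊕ 4 ⊙ ξ 9 ⊕ # 7) refl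
            (near₁ , h , far , q₁≤ , p₁≥ , gy , tt)

  opaque
    -- If `T` meets both `Q₁` and `Q₂` in at least `y` vertices, the two complete pairs reach all
    -- but `y` vertices of each side. Otherwise `T` is one-sided.
    bipartite-expansion : ∀ {P₁ P₂ Q₁ Q₂ : V → Bool} → Bipartite G g P₁ P₂ Q₁ Q₂ →
      size G T ≤ size G (λ y → Q₁ y ∧ T y) + size G (λ y → Q₂ y ∧ T y) + 200000 · g → 10 · y ≤ size G T →
      size G T + y + 4 · (200000 · g) ≤ cnt (reached P₁) Vs + cnt (reached P₂) Vs
        ⊎ size G P₁ + size G P₂ + 4 · (200000 · g) < cnt (reached P₁) Vs + cnt (reached P₂) Vs + 10 · y
    bipartite-expansion {P₁} {P₂} {Q₁} {Q₂} R cover big = cases (ℕₚ.≤-<-connex y t₁) (ℕₚ.≤-<-connex y t₂)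
      where
      open Bipartite R
      t₁ t₂ N₁ N₂ : ℕ
      t₁ = size G (λ y → Q₁ y ∧ T y)
      t₂ = size G (λ y → Q₂ y ∧ T y)
      N₁ = cnt (reached P₁) Vs
      N₂ = cnt (reached P₂) Vs
      Goal : Set
      Goal = size G T + y + 4 · (200000 · g) ≤ N₁ + N₂ ⊎ size G P₁ + size G P₂ + 4 · (200000 · g) < N₁ + N₂ + 10 · y
      0<y : 0 < y
      0<y = lin-≤ (f ∷ y ∷ [])
            ((4 ⊙ ξ 0 , ξ 1) ∷ (# 1 ⊕ # 0 , ξ 0) ∷ []) (# 1 ⊕ # 0) (ξ 1) (1 ∷ 1 ∷ 4 ∷ []) (# 3) refl (fy , 0<f , tt)
      cases : y ≤ t₁ ⊎ t₁ < y → y ≤ t₂ ⊎ t₂ < y → Goal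
      cases (inj₁ h₁) (inj₁ h₂) = inj₂ (
          lin-≤ (size G P₁ ∷ cnt (reached P₁) Vs ∷ y ∷ size G P₂ ∷ cnt (reached P₂) Vs ∷ g ∷ [])
            ((ξ 0 , ξ 1 ⊕ ξ 2) ∷ (ξ 3 , ξ 4 ⊕ ξ 2) ∷ (200000 ⊙ ξ 5 , ξ 2) ∷ (# 1 ⊕ # 0 , ξ 2) ∷ [])
            (# 1 ⊕ ((ξ 0 ⊕ ξ 3) ⊕ (4 ⊙ (200000 ⊙ ξ 5)))) ((ξ 1 ⊕ ξ 4) ⊕ (10 ⊙ ξ 2)) (1 ∷ 1 ∷ 1 ∷ 4 ∷ 4 ∷ []) (# 3)
             refl
            (reached-full P₁ Q₁ full₁ h₁ , reached-full P₂ Q₂ full₂ h₂ , gy , 0<y , tt))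
      cases _ (inj₂ h₂) = inj₁ (one-sided R (size G T) (
          lin-≤ (size G T ∷ size G (λ y₁ → Q₁ y₁ ∧ T y₁) ∷ size G (λ y₁ → Q₂ y₁ ∧ T y₁) ∷ g ∷ y ∷ [])
            ((ξ 0 , (ξ 1 ⊕ ξ 2) ⊕ (200000 ⊙ ξ 3)) ∷ (# 1 ⊕ ξ 2 , ξ 4) ∷ [])
            (ξ 0) ((ξ 1 ⊕ ξ 4) ⊕ (200000 ⊙ ξ 3)) (1 ∷ 1 ∷ 1 ∷ []) (# 1) refl (cover , h₂ , tt)) big)
      cases (inj₂ h₁) (inj₁ _) = inj₁ (ℕₚ.≤-trans (one-sided (bipartite-swap R) (size G T) (
          lin-≤ (size G T ∷ size G (λ y₁ → Q₁ y₁ ∧ T y₁) ∷ size G (λ y₁ → Q₂ y₁ ∧ T y₁) ∷ g ∷ y ∷ [])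
            ((ξ 0 , (ξ 1 ⊕ ξ 2) ⊕ (200000 ⊙ ξ 3)) ∷ (# 1 ⊕ ξ 1 , ξ 4) ∷ [])
            (ξ 0) ((ξ 2 ⊕ ξ 4) ⊕ (200000 ⊙ ξ 3)) (1 ∷ 1 ∷ 1 ∷ []) (# 1) refl (cover , h₁ , tt)) big) (ℕₚ.≤-reflexive (ℕₚ.+-comm N₂ N₁)))

-- Expansion and connections in the extremal structure

data Quarter : Set where
  qa qb qc qd : Quarter

next : Quarter → Quarter
next qa = qb
next qb = qc
next qc = qd
next qd = qa

-- Counted from zero, as at least one step is made; a return to the same part is a full turn with
-- `k = 3`.
steps : ℕ → Quarter → Quarter
steps zero    i = next i
steps (suc k) i = steps k (next i)

distance : ∀ i j → ∃ λ k → k ≤ 3 × steps k i ≡ j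
distance qa qa = 3 , ℕₚ.≤-refl , refl
distance qa qb = 0 , z≤n , refl
distance qa qc = 1 , s≤s z≤n , refl
distance qa qd = 2 , s≤s (s≤s z≤n) , refl
distance qb qb = 3 , ℕₚ.≤-refl , refl
distance qb qc = 0 , z≤n , refl
distance qb qd = 1 , s≤s z≤n , refl
distance qb qa = 2 , s≤s (s≤s z≤n) , refl
distance qc qc = 3 , ℕₚ.≤-refl , refl
distance qc qd = 0 , z≤n , refl
distance qc qa = 1 , s≤s z≤n , refl
distance qc qb = 2 , s≤s (s≤s z≤n) , refl
distance qd qd = 3 , ℕₚ.≤-refl , refl
distance qd qa = 0 , z≤n , refl
distance qd qb = 1 , s≤s z≤n , refl
distance qd qc = 2 , s≤s (s≤s z≤n) , refl

out-class in-class : Quarter → Bool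
out-class qa = true
out-class qb = false
out-class qc = false
out-class qd = true
in-class qa = true
in-class qb = true
in-class qc = false
in-class qd = false

class-next : ∀ i → out-class i ≡ in-class (next i)
class-next qa = refl
class-next qb = refl
class-next qc = refl
class-next qd = refl

few-missing : ∀ {l q q′ m y} → q ≡ y + q′ → 2 · m ≤ y * y → 0 < y → l * q ≤ l * q′ + m → l ≤ y
few-missing {l} {q} {q′} {m} {y} e h 0<y k = ℕₚ.≮⇒≥ λ lt → (lin-⊥ (l ∷ q ∷ q′ ∷ m ∷ y ∷ [])
      ((ξ 0 ⊗ ξ 1 , (ξ 0 ⊗ ξ 2) ⊕ ξ 3) ∷ (2 ⊙ ξ 3 , ξ 4 ⊗ ξ 4) ∷ (ξ 0 ⊗ (ξ 4 ⊕ ξ 2) , ξ 0 ⊗ ξ 1) ∷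
       (ξ 4 ⊕ (ξ 4 ⊗ ξ 4) , ξ 0 ⊗ ξ 4) ∷ (# 1 ⊕ # 0 , ξ 4) ∷ [])
      (2 ∷ 1 ∷ 2 ∷ 2 ∷ 2 ∷ []) ((ξ 4 ⊗ ξ 4) ⊕ # 1) refl
      (k , h , ℕₚ.≤-reflexive (sym (cong (l *_) e)) , ℕₚ.*-monoˡ-≤ y lt , 0<y , tt))

module Base {n : ℕ} (G : OrientedGraph n) {δ f g y γ : ℕ} (md : minSemiDegree≥ G δ) (0<n : 0 < n) (Sc : Scales n δ f g y γ)
    {A B C D : Fin n → Bool} (Ex : Extremal G (200 · g) (2000 · g) A B C D) (Ch : Choice G γ (200000 · g) A B C D) where
  private
    V = Fin n
    Vs = allFin n
  open Scales Sc
  open Extremal Ex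
  open Classes G γ A B C D
  open Choice Ch
  open BipartiteExpansion G 0<n Sc using (reached; bipartite-expansion)

  -- Crossing arcs are left out. The few that are needed for balance come back by contraction.
  E₀ : V → V → Bool
  E₀ x y = adj G x y ∧ inC (X x) (Y y)

  private
    β : ℕ
    β = 200000 · g

    dX dY : V → Bool
    dX x = X x xor X₀ x
    dY y = Y y xor Y₀ y

    devX′ : cnt dX Vs ≤ β
    devX′ = devX
    devY′ : cnt dY Vs ≤ β
    devY′ = devY

    part-one : ∀ x → b2n (A x) + b2n (B x) + b2n (C x) + b2n (D x) ≡ 1
    part-one = Partition.one partition

    0<y : 0 < y
    0<y = lin-≤ (f ∷ y ∷ [])
          ((4 ⊙ ξ 0 , ξ 1) ∷ (# 1 ⊕ # 0 , ξ 0) ∷ []) (# 1 ⊕ # 0) (ξ 1) (1 ∷ 1 ∷ 4 ∷ []) (# 3) refl (fy , 0<f , tt)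

    xor-cases : ∀ p q → p ≡ q ⊎ (p xor q) ≡ true
    xor-cases true  true  = inj₁ refl
    xor-cases true  false = inj₂ refl
    xor-cases false true  = inj₂ refl
    xor-cases false false = inj₁ refl

    neither : ∀ {a b c d} → b2n a + b2n b + b2n c + b2n d ≡ 1 → a ∨ d ≡ false → c ∨ b ≡ true
    neither {false} {true}  {c} {false} _ _ = Boolₚ.∨-zeroʳ c
    neither {false} {false} {true} {false} _ _ = refl

    neither′ : ∀ {a b c d} → b2n a + b2n b + b2n c + b2n d ≡ 1 → a ∨ b ≡ false → c ∨ d ≡ true
    neither′ {false} {false} {true}  {d} _ _ = refl
    neither′ {false} {false} {false} {true} _ _ = refl

  pure₀ : ∀ {x y} → E₀ x y ≡ true → X x ≡ Y y
  pure₀ {x} {y} h = sym (inC-≡ (X x) (proj₂ (∧-split {adj G x y} h)))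

  private
    class-out : ∀ u → ∃ λ Q → γ ≤ row G u Q × (∀ y → Q y ≡ true → Y₀ y ≡ X u)
    class-out u = [ (λ e → Y₀ , rowX e , λ y q → trans q (sym e)) , (λ e → Y₀ᶜ , rowX′ e , λ y q → trans (¬true⇒false (excl {A y} {B y} {C y} {D y} (part-one y) q)) (sym e)) ]′ (true-or-false (X u))
      where
      excl : ∀ {a b c d} → b2n a + b2n b + b2n c + b2n d ≡ 1 → c ∨ d ≡ true → a ∨ b ≡ true → ⊥
      excl {true}  {b} {true}  {d} e p q = lin-⊥ (b2n b ∷ b2n d ∷ [])
            ((((# 1 ⊕ ξ 0) ⊕ # 1) ⊕ ξ 1 , # 1) ∷ []) (1 ∷ []) (ξ 0 ⊕ ξ 1) refl (ℕₚ.≤-reflexive e , tt)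
      excl {true}  {b} {false} {true} e p q = lin-⊥ (b2n b ∷ [])
            ((((# 1 ⊕ ξ 0) ⊕ # 0) ⊕ # 1 , # 1) ∷ []) (1 ∷ []) (ξ 0) refl (ℕₚ.≤-reflexive e , tt)
      excl {false} {true} {true}  {d} e p q = lin-⊥ (b2n d ∷ [])
            ((((# 0 ⊕ # 1) ⊕ # 1) ⊕ ξ 0 , # 1) ∷ []) (1 ∷ []) (ξ 0) refl (ℕₚ.≤-reflexive e , tt)
      excl {false} {true} {false} {true} () p q

    class-in : ∀ t → ∃ λ P → γ ≤ col G P t × (∀ x → P x ≡ true → X₀ x ≡ Y t)
    class-in t = [ (λ e → X₀ , colY e , λ y q → trans q (sym e)) , (λ e → X₀ᶜ , colY′ e , λ y q → trans (¬true⇒false (excl {A y} {B y} {C y} {D y} (part-one y) q)) (sym e)) ]′ (true-or-false (Y t))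
      where
      excl : ∀ {a b c d} → b2n a + b2n b + b2n c + b2n d ≡ 1 → c ∨ b ≡ true → a ∨ d ≡ true → ⊥
      excl {true}  {b} {true}  {d} e p q = lin-⊥ (b2n b ∷ b2n d ∷ [])
            ((((# 1 ⊕ ξ 0) ⊕ # 1) ⊕ ξ 1 , # 1) ∷ []) (1 ∷ []) (ξ 0 ⊕ ξ 1) refl (ℕₚ.≤-reflexive e , tt)
      excl {true}  {true} {false} {d} e p q = lin-⊥ (b2n d ∷ [])
            ((((# 1 ⊕ # 1) ⊕ # 0) ⊕ ξ 0 , # 1) ∷ []) (1 ∷ []) (ξ 0) refl (ℕₚ.≤-reflexive e , tt)
      excl {false} {b} {true}  {true} e p q = two b e
        where
        two : ∀ b → b2n b + 1 + 1 ≡ 1 → ⊥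
        two true ()
        two false ()
      excl {false} {true} {false} {true} () p q

  out-degree₀ : ∀ u → γ ≤ cnt (E₀ u) Vs + β
  out-degree₀ u with class-out u
  ... | Q , h , cl = ℕₚ.≤-trans h (ℕₚ.≤-trans (cnt-cover {Q = E₀ u} {dY} Vs λ {y} _ p → let (e , q) = ∧-split {adj G u y} p in
      [ (λ eq → inj₁ (∧-join e (subst (λ z → inC (X u) z ≡ true) (sym (trans eq (cl y q))) (inC-refl (X u))))) , inj₂ ]′ (xor-cases (Y y) (Y₀ y)))
      (ℕₚ.+-monoʳ-≤ _ devY′))

  in-degree₀ : ∀ t → γ ≤ cnt (λ w → E₀ w t) Vs + β
  in-degree₀ t with class-in t
  ... | P , h , cl = ℕₚ.≤-trans h (ℕₚ.≤-trans (cnt-cover {Q = λ w → E₀ w t} {dX} Vs λ {x} _ p → let (e , q) = ∧-split {adj G x t} p in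
      [ (λ eq → inj₁ (∧-join e (subst (λ z → inC (X x) z ≡ true) (trans eq (cl x q)) (inC-refl (X x))))) , inj₂ ]′ (xor-cases (X x) (X₀ x)))
      (ℕₚ.+-monoʳ-≤ _ devX′))

  private
    module Expand (c : Bool) (P₁ P₂ Q₁ Q₂ : V → Bool) (R : Bipartite G g P₁ P₂ Q₁ Q₂)
        (apart : ∀ w → P₁ w ≡ true → P₂ w ≡ true → ⊥)
        (outs : ∀ w → P₁ w ∨ P₂ w ≡ true → X₀ w ≡ c) (outs′ : ∀ w → X₀ w ≡ c → P₁ w ∨ P₂ w ≡ true)
        (ins : ∀ y → Y₀ y ≡ c → Q₁ y ∨ Q₂ y ≡ true)
        (T : V → Bool) (T⊂ : ∀ {y} → T y ≡ true → Y y ≡ c) (big : 10 · y ≤ cnt T Vs) where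
      nb : V → Bool
      nb w = f ℕ.<ᵇ cnt (λ y → E₀ w y ∧ T y) Vs
      N : ℕ
      N = cnt nb Vs
      ∨-cases : ∀ {a b} → a ∨ b ≡ true → a ≡ true ⊎ b ≡ true
      ∨-cases {true}  _ = inj₁ refl
      ∨-cases {false} h = inj₂ h
      cover : size G T ≤ size G (λ y → Q₁ y ∧ T y) + size G (λ y → Q₂ y ∧ T y) + β
      cover = ℕₚ.≤-trans (cnt-cover {Q = λ y → (Q₁ y ∨ Q₂ y) ∧ T y} {dY} Vs λ {y} _ p →
          [ (λ e → inj₁ (∧-join (ins y (trans (sym e) (T⊂ p))) p)) , inj₂ ]′ (xor-cases (Y y) (Y₀ y)))
        (ℕₚ.+-mono-≤ (cnt-cover {Q = λ y → Q₁ y ∧ T y} {λ y → Q₂ y ∧ T y} Vs λ {y} _ p → let (q , t) = ∧-split {Q₁ y ∨ Q₂ y} p in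
          [ (λ r → inj₁ (∧-join r t)) , (λ r → inj₂ (∧-join r t)) ]′ (∨-cases q)) devY′)
      same-row : ∀ w → X w ≡ c → cnt (λ y → E₀ w y ∧ T y) Vs ≡ row G w T
      same-row w e = cnt-cong Vs λ {y} _ → each (adj G w y) (T y) (λ t → subst₂ (λ a b → inC a b ≡ true) (sym e) (sym (T⊂ t)) (inC-refl c))
        where
        each : ∀ a t {i} → (t ≡ true → i ≡ true) → (a ∧ i) ∧ t ≡ a ∧ t
        each false t h = refl
        each true true h rewrite h refl = refl
        each true false {i} h = Boolₚ.∧-zeroʳ i
      hit : cnt (reached T P₁) Vs + cnt (reached T P₂) Vs ≤ N + β
      hit = ℕₚ.≤-trans (ℕₚ.≤-reflexive (sym (sumOf-+ (λ w → b2n (reached T P₁ w)) (λ w → b2n (reached T P₂ w)) Vs)))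
        (ℕₚ.≤-trans (sumOf-mono Vs λ {w} _ → each w (P₁ w) (P₂ w) refl refl)
        (ℕₚ.≤-trans (ℕₚ.≤-reflexive (sumOf-+ (λ w → b2n (nb w)) (λ w → b2n (dX w)) Vs)) (ℕₚ.+-monoʳ-≤ N devX′)))
        where
        one : ∀ w → P₁ w ∨ P₂ w ≡ true → b2n (f ℕ.<ᵇ row G w T) ≤ b2n (nb w) + b2n (dX w)
        one w p = b2n-⇒+ {f ℕ.<ᵇ row G w T} {nb w} {dX w} λ q →
          [ (λ e → inj₁ (trans (cong (f ℕ.<ᵇ_) (same-row w (trans e (outs w p)))) q)) , inj₂ ]′ (xor-cases (X w) (X₀ w))
        each : ∀ w p q → P₁ w ≡ p → P₂ w ≡ q → b2n (p ∧ (f ℕ.<ᵇ row G w T)) + b2n (q ∧ (f ℕ.<ᵇ row G w T)) ≤ b2n (nb w) + b2n (dX w)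
        each w true true e₁ e₂ = ⊥-elim (apart w e₁ e₂)
        each w true false e₁ e₂ = ℕₚ.≤-trans (ℕₚ.≤-reflexive (ℕₚ.+-identityʳ _)) (one w (cong (_∨ P₂ w) e₁))
        each w false true e₁ e₂ = one w (trans (cong (P₁ w ∨_) e₂) (Boolₚ.∨-zeroʳ (P₁ w)))
        each w false false e₁ e₂ = z≤n
      class-size : cnt (λ w → inC c (X w)) Vs ≤ size G P₁ + size G P₂ + β
      class-size = ℕₚ.≤-trans (cnt-cover {Q = λ w → P₁ w ∨ P₂ w} {dX} Vs λ {w} _ p →
          [ (λ e → inj₁ (outs′ w (trans (sym e) (inC-≡ c p)))) , inj₂ ]′ (xor-cases (X w) (X₀ w)))
        (ℕₚ.+-mono-≤ (cnt-cover {Q = P₁} {P₂} Vs λ _ → ∨-cases) devX′)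
      grown : cnt T Vs + y + 4 · β ≤ cnt (reached T P₁) Vs + cnt (reached T P₂) Vs → cnt T Vs + y ≤ N
      grown h = lin-≤ (cnt T Vs ∷ y ∷ g ∷ cnt (reached T P₁) Vs ∷ cnt (reached T P₂) Vs ∷ N ∷ [])
            (((ξ 0 ⊕ ξ 1) ⊕ (4 ⊙ (200000 ⊙ ξ 2)) , ξ 3 ⊕ ξ 4) ∷ (ξ 3 ⊕ ξ 4 , ξ 5 ⊕ (200000 ⊙ ξ 2)) ∷ [])
            (ξ 0 ⊕ ξ 1) (ξ 5) (1 ∷ 1 ∷ 1 ∷ []) (600000 ⊙ ξ 2) refl (h , hit , tt)
      filled : size G P₁ + size G P₂ + 4 · β < cnt (reached T P₁) Vs + cnt (reached T P₂) Vs + 10 · y → cnt (λ w → inC c (X w)) Vs < N + 10 · y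
      filled h = lin-≤ (size G P₁ ∷ size G P₂ ∷ g ∷ cnt (reached T P₁) Vs ∷ cnt (reached T P₂) Vs ∷ y ∷ N ∷
            cnt (λ w → inC c (Choice.X Ch w)) Vs ∷ [])
            ((# 1 ⊕ ((ξ 0 ⊕ ξ 1) ⊕ (4 ⊙ (200000 ⊙ ξ 2))) , (ξ 3 ⊕ ξ 4) ⊕ (10 ⊙ ξ 5)) ∷
             (ξ 3 ⊕ ξ 4 , ξ 6 ⊕ (200000 ⊙ ξ 2)) ∷ (ξ 7 , (ξ 0 ⊕ ξ 1) ⊕ (200000 ⊙ ξ 2)) ∷ [])
            (# 1 ⊕ ξ 7) (ξ 6 ⊕ (10 ⊙ ξ 5)) (1 ∷ 1 ∷ 1 ∷ 1 ∷ []) (400000 ⊙ ξ 2) refl (h , hit , class-size , tt)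
      result : cnt T Vs + y ≤ N ⊎ cnt (λ w → inC c (X w)) Vs < N + 10 · y
      result = [ (λ h → inj₁ (grown h)) , (λ h → inj₂ (filled h)) ]′ (bipartite-expansion T R cover big)

    clash : ∀ {p q a b} → p ≡ true → q ≡ true → b2n p + b2n q + a + b ≡ 1 → ⊥
    clash {a = a} {b} refl refl e = lin-⊥ (a ∷ b ∷ [])
          ((((# 1 ⊕ # 1) ⊕ ξ 0) ⊕ ξ 1 , # 1) ∷ []) (1 ∷ []) (ξ 0 ⊕ ξ 1) refl (ℕₚ.≤-reflexive e , tt)

  expand₀ : ∀ c (T : V → Bool) → (∀ {y} → T y ≡ true → Y y ≡ c) → 10 · y ≤ cnt T Vs →
    let N = cnt (λ w → f ℕ.<ᵇ cnt (λ y → E₀ w y ∧ T y) Vs) Vs in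
    cnt T Vs + y ≤ N ⊎ cnt (λ w → inC c (X w)) Vs < N + 10 · y
  expand₀ true T T⊂ big = Expand.result true A D B A
    (record { p₁≥ = a≥ ; p₂≥ = d≥ ; q₁≤ = b≤ ; q₂≤ = a≤ ; full₁ = ab ; full₂ = da ; half₁ = aa ; half₂ = db })
    (λ w p q → clash {A w} {D w} {b2n (B w)} {b2n (C w)} p q (arr (b2n (A w)) (b2n (B w)) (b2n (C w)) (b2n (D w)) (part-one w)))
    (λ w p → p) (λ w p → p) (λ y p → trans (Boolₚ.∨-comm (B y) (A y)) p) T T⊂ big
    where
    arr : ∀ a b c d → a + b + c + d ≡ 1 → a + d + b + c ≡ 1
    arr a b c d h = (ℕₚ.≤-antisym (lin-≤ (a ∷ b ∷ c ∷ d ∷ [])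
          ((((ξ 0 ⊕ ξ 1) ⊕ ξ 2) ⊕ ξ 3 , # 1) ∷ [])
          (((ξ 0 ⊕ ξ 3) ⊕ ξ 1) ⊕ ξ 2) (# 1) (1 ∷ 1 ∷ []) (# 0) refl (ℕₚ.≤-reflexive h , tt))
        (lin-≤ (a ∷ b ∷ c ∷ d ∷ [])
          ((# 1 , ((ξ 0 ⊕ ξ 1) ⊕ ξ 2) ⊕ ξ 3) ∷ [])
          (# 1) (((ξ 0 ⊕ ξ 3) ⊕ ξ 1) ⊕ ξ 2) (1 ∷ 1 ∷ []) (# 0) refl (ℕₚ.≤-reflexive (sym h) , tt)))
  expand₀ false T T⊂ big = Expand.result false C B D C
    (record { p₁≥ = c≥ ; p₂≥ = b≥ ; q₁≤ = d≤ ; q₂≤ = c≤ ; full₁ = cd ; full₂ = bc ; half₁ = cc ; half₂ = bd })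
    (λ w p q → clash {C w} {B w} {b2n (A w)} {b2n (D w)} p q (arr (b2n (A w)) (b2n (B w)) (b2n (C w)) (b2n (D w)) (part-one w)))
    (λ w p → flip {A w} {B w} {C w} {D w} (part-one w) p) (λ w p → neither {A w} {B w} {C w} {D w} (part-one w) p)
    (λ y p → trans (Boolₚ.∨-comm (D y) (C y)) (neither′ {A y} {B y} {C y} {D y} (part-one y) p)) T T⊂ big
    where
    arr : ∀ a b c d → a + b + c + d ≡ 1 → c + b + a + d ≡ 1
    arr a b c d h = (ℕₚ.≤-antisym (lin-≤ (a ∷ b ∷ c ∷ d ∷ [])
          ((((ξ 0 ⊕ ξ 1) ⊕ ξ 2) ⊕ ξ 3 , # 1) ∷ [])
          (((ξ 2 ⊕ ξ 1) ⊕ ξ 0) ⊕ ξ 3) (# 1) (1 ∷ 1 ∷ []) (# 0) refl (ℕₚ.≤-reflexive h , tt))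
        (lin-≤ (a ∷ b ∷ c ∷ d ∷ [])
          ((# 1 , ((ξ 0 ⊕ ξ 1) ⊕ ξ 2) ⊕ ξ 3) ∷ [])
          (# 1) (((ξ 2 ⊕ ξ 1) ⊕ ξ 0) ⊕ ξ 3) (1 ∷ 1 ∷ []) (# 0) refl (ℕₚ.≤-reflexive (sym h) , tt)))
    flip : ∀ {a b c d} → b2n a + b2n b + b2n c + b2n d ≡ 1 → c ∨ b ≡ true → a ∨ d ≡ false
    flip {false} {b} {c} {false} _ _ = refl
    flip {true} {true} {c} {d} e p = ⊥-elim (lin-⊥ (b2n c ∷ b2n d ∷ [])
          ((((# 1 ⊕ # 1) ⊕ ξ 0) ⊕ ξ 1 , # 1) ∷ []) (1 ∷ []) (ξ 0 ⊕ ξ 1) refl (ℕₚ.≤-reflexive e , tt))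
    flip {true} {false} {true} {d} e p = ⊥-elim (lin-⊥ (b2n d ∷ [])
          ((((# 1 ⊕ # 0) ⊕ # 1) ⊕ ξ 0 , # 1) ∷ []) (1 ∷ []) (ξ 0) refl (ℕₚ.≤-reflexive e , tt))
    flip {false} {true} {c} {true} e p = ⊥-elim (lin-⊥ (b2n c ∷ [])
          ((((# 0 ⊕ # 1) ⊕ ξ 0) ⊕ # 1 , # 1) ∷ []) (1 ∷ []) (ξ 0) refl (ℕₚ.≤-reflexive e , tt))
    flip {false} {false} {true} {true} () p

  opaque
    pre-robust : ∀ {d} → d + β ≤ γ → PreRobust Vs E₀ X Y d f y (10 · y)
    pre-robust h = record
      { uniq = Uniqueₚ.allFin⁺ n ; pure = pure₀
      ; deg-in = λ {t} _ → ℕₚ.+-cancelʳ-≤ β _ _ (ℕₚ.≤-trans h (in-degree₀ t))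
      ; deg-out = λ {u} _ → ℕₚ.+-cancelʳ-≤ β _ _ (ℕₚ.≤-trans h (out-degree₀ u))
      ; expand = expand₀ }

  Part : Quarter → V → Bool
  Part qa = A
  Part qb = B
  Part qc = C
  Part qd = D

  -- The vertices of a part that kept both classes and send arcs to all but at most `y` vertices of
  -- the next part. Connecting paths run inside the cores, where the next vertex can be found
  -- greedily.
  Core : Quarter → V → Bool
  Core i x = Part i x ∧ (not (dX x ∨ dY x) ∧ not ((row G x (Part (next i)) + y) ℕ.<ᵇ size G (Part (next i))))

  private
    dense : ∀ i → size G (Part i) * size G (Part (next i)) ≤ edges G (Part i) (Part (next i)) + 2000 · g * n
    dense qa = ab
    dense qb = bc
    dense qc = cd
    dense qd = da
    part≥ : ∀ i → n ≤ 4 · size G (Part i) + 200 · g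
    part≥ qa = a≥
    part≥ qb = b≥
    part≥ qc = c≥
    part≥ qd = d≥

    core-Part : ∀ {i x} → Core i x ≡ true → Part i x ≡ true
    core-Part {i} {x} h = proj₁ (∧-split {Part i x} h)

    unmoved : ∀ {i x} → Core i x ≡ true → X x ≡ X₀ x × Y x ≡ Y₀ x
    unmoved {i} {x} h = go (not-true (proj₁ (∧-split {not (dX x ∨ dY x)} (proj₂ (∧-split {Part i x} h))))) (xor-cases (X x) (X₀ x)) (xor-cases (Y x) (Y₀ x))
      where
      go : ∀ {P Q : Set} → dX x ∨ dY x ≡ false → P ⊎ dX x ≡ true → Q ⊎ dY x ≡ true → P × Q
      go e (inj₁ p) (inj₁ q) = p , q
      go e (inj₂ p) _        = ⊥-elim (false≢true e (cong (_∨ dY x) p))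
      go e (inj₁ p) (inj₂ q) = ⊥-elim (false≢true e (trans (cong (dX x ∨_) q) (Boolₚ.∨-zeroʳ (dX x))))

    core-full : ∀ {i x} → Core i x ≡ true → size G (Part (next i)) ≤ row G x (Part (next i)) + y
    core-full {i} {x} h = <ᵇ-false (not-true (proj₂ (∧-split {not (dX x ∨ dY x)} (proj₂ (∧-split {Part i x} h)))))

    part-class : ∀ i {x} → Part i x ≡ true → X₀ x ≡ out-class i × Y₀ x ≡ in-class i
    part-class i {x} p = go i p (part-one x)
      where
      go : ∀ i → Part i x ≡ true → b2n (A x) + b2n (B x) + b2n (C x) + b2n (D x) ≡ 1 → A x ∨ D x ≡ out-class i × A x ∨ B x ≡ in-class i
      go qa p e rewrite p = refl , refl
      go qb p e rewrite p with A x | C x | D x | e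
      ... | false | false | false | _ = refl , refl
      ... | false | false | true | ()
      ... | false | true | _ | ()
      ... | true | _ | _ | ()
      go qc p e rewrite p with A x | B x | D x | e
      ... | false | false | false | _ = refl , refl
      ... | false | false | true | ()
      ... | false | true | _ | ()
      ... | true | false | _ | ()
      ... | true | true | _ | ()
      go qd p e rewrite p with A x | B x | C x | e
      ... | false | false | false | _ = refl , refl
      ... | false | false | true | ()
      ... | false | true | false | ()
      ... | false | true | true | ()
      ... | true | false | false | ()
      ... | true | true | false | ()
      ... | true | false | true | ()
      ... | true | true | true | ()

    core-out : ∀ {i x} → Core i x ≡ true → X x ≡ out-class i
    core-out {i} {x} h = trans (proj₁ (unmoved {i} h)) (proj₁ (part-class i (core-Part {i} h)))
    core-in : ∀ {i x} → Core i x ≡ true → Y x ≡ in-class i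
    core-in {i} {x} h = trans (proj₂ (unmoved {i} h)) (proj₂ (part-class i (core-Part {i} h)))

    core-cover : ∀ i (P : V → Bool) → (∀ x → P x ≡ true → Part i x ≡ true) → cnt P Vs ≤ cnt (λ x → Core i x ∧ P x) Vs + 3 · y
    core-cover i P P⊂ = ℕₚ.≤-trans (sumOf-mono Vs λ {x} _ → each (P x) (Part i x) (dX x) (dY x) ((row G x (Part (next i)) + y) ℕ.<ᵇ q) (P⊂ x))
      (ℕₚ.≤-trans (ℕₚ.≤-reflexive (trans (sumOf-+ (λ x → b2n (Core i x ∧ P x)) _ Vs) (cong (cnt (λ x → Core i x ∧ P x) Vs +_)
          (trans (sumOf-+ (λ x → b2n (dX x)) _ Vs) (cong (cnt dX Vs +_) (sumOf-+ (λ x → b2n (dY x)) (λ x → b2n (L x)) Vs))))))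
        (ℕₚ.+-monoʳ-≤ (cnt (λ x → Core i x ∧ P x) Vs) three))
      where
      q : ℕ
      q = size G (Part (next i))
      L : V → Bool
      L x = Part i x ∧ ((row G x (Part (next i)) + y) ℕ.<ᵇ q)
      q≥y : y ≤ q
      q≥y = lin-≤ (n ∷ size G (Part (next i)) ∷ g ∷ γ ∷ y ∷ [])
            ((ξ 0 , (4 ⊙ ξ 1) ⊕ (200 ⊙ ξ 2)) ∷ (400 ⊙ ξ 3 , ξ 0) ∷ (1000 ⊙ ξ 4 , ξ 3) ∷ (200000 ⊙ ξ 2 , ξ 4) ∷ [])
            (ξ 4) (ξ 1) (399999999 ∷ 1000 ∷ 1000 ∷ 400000 ∷ 1 ∷ []) (399995999 ⊙ ξ 1 ⊕ # 399999998) refl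
            (part≥ (next i) , γn , yγ , gy , tt)
      few : cnt L Vs ≤ y
      few = ℕₚ.≤-trans (cnt-mono Vs λ {x} _ p → let (a , b) = ∧-split {Part i x} p in
          ∧-join a (<ᵇ-true (ℕₚ.+-cancelʳ-< y _ _ (ℕₚ.<-≤-trans (<ᵇ-< {row G x (Part (next i)) + y} {q} b) (ℕₚ.≤-reflexive (sym (ℕₚ.m∸n+n≡m q≥y)))))))
        (few-missing (sym (ℕₚ.m+[n∸m]≡n q≥y)) yy 0<y (low-rows G (Part i) (Part (next i)) (dense i)))
      three : cnt dX Vs + (cnt dY Vs + cnt L Vs) ≤ 3 · y
      three = lin-≤ (cnt dX Vs ∷ g ∷ cnt dY Vs ∷ cnt L Vs ∷ y ∷ [])
            ((ξ 0 , 200000 ⊙ ξ 1) ∷ (ξ 2 , 200000 ⊙ ξ 1) ∷ (ξ 3 , ξ 4) ∷ (200000 ⊙ ξ 1 , ξ 4) ∷ [])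
            (ξ 0 ⊕ (ξ 2 ⊕ ξ 3)) (3 ⊙ ξ 4) (1 ∷ 1 ∷ 1 ∷ 1 ∷ 2 ∷ []) (# 0) refl (devX′ , devY′ , few , gy , tt)
      each : ∀ p a u v l → (p ≡ true → a ≡ true) → b2n p ≤ b2n ((a ∧ (not (u ∨ v) ∧ not l)) ∧ p) + (b2n u + (b2n v + b2n (a ∧ l)))
      each false a u v l h = z≤n
      each true a u v l h rewrite h refl = rest u v l
        where
        rest : ∀ u v l → 1 ≤ b2n ((not (u ∨ v) ∧ not l) ∧ true) + (b2n u + (b2n v + b2n l))
        rest true  v     l     = ℕₚ.≤-trans (s≤s z≤n) (ℕₚ.m≤n+m _ 0)
        rest false true  l     = s≤s z≤n
        rest false false true  = s≤s z≤n
        rest false false false = s≤s z≤n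

    forward : ∀ {i x} → Core i x ≡ true → (S : V → Bool) → (∀ z → S z ≡ true → Part (next i) z ≡ true) → (F : List V) → length F + y < cnt S Vs →
      ∃ λ z → S z ≡ true × adj G x z ≡ true × z ∉ F
    forward {i} {x} cx S S⊂ F h with pick (λ z → adj G x z ∧ S z) F Vs (Uniqueₚ.allFin⁺ n) enough
      where
      Q R : V → Bool
      Q = Part (next i)
      R z = Q z ∧ not (S z)
      split-Q : size G (Part (next i)) ≡ cnt S Vs + cnt R Vs
      split-Q = trans (cnt-split Q S Vs) (cong (_+ cnt R Vs) (cnt-cong Vs λ {z} _ → absorb (Q z) (S z) (S⊂ z)))
        where
        absorb : ∀ a b → (b ≡ true → a ≡ true) → a ∧ b ≡ b
        absorb a true  h rewrite h refl = refl
        absorb a false h = Boolₚ.∧-zeroʳ a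
      row-Q : row G x (Part (next i)) ≤ row G x S + cnt R Vs
      row-Q = cnt-cover {Q = λ z → adj G x z ∧ S z} {R} Vs λ {z} _ p → let (a , b) = ∧-split {adj G x z} p in
        [ (λ s → inj₁ (∧-join a s)) , (λ s → inj₂ (∧-join b (cong not s))) ]′ (true-or-false (S z))
      enough : length F < row G x S
      enough =
          lin-≤ (size G (Part (next i)) ∷ row G x (Part (next i)) ∷ y ∷ cnt S Vs ∷ cnt R Vs ∷ row G x S ∷ length F ∷
            [])
            ((ξ 0 , ξ 1 ⊕ ξ 2) ∷ (ξ 3 ⊕ ξ 4 , ξ 0) ∷ (ξ 1 , ξ 5 ⊕ ξ 4) ∷ (# 1 ⊕ (ξ 6 ⊕ ξ 2) , ξ 3) ∷ [])
            (# 1 ⊕ ξ 6) (ξ 5) (1 ∷ 1 ∷ 1 ∷ 1 ∷ 1 ∷ []) (# 0) refl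
            (core-full {i} cx , ℕₚ.≤-reflexive (sym split-Q) , row-Q , h , tt)
    ... | z , _ , p , z∉ = z , proj₂ (∧-split {adj G x z} p) , proj₁ (∧-split {adj G x z} p) , z∉

    core-arc : ∀ {i x z} → Core i x ≡ true → Core (next i) z ≡ true → adj G x z ≡ true → E₀ x z ≡ true
    core-arc {i} {x} {z} p q e = ∧-join e (subst₂ (λ a b → inC a b ≡ true) (sym (core-out {i} p)) (sym (trans (core-in {next i} q) (sym (class-next i)))) (inC-refl (out-class i)))

    Link : V → V → List V → ℕ → Set
    Link x t F r = ∃ λ xs → Chain E₀ x (xs ++ t ∷ []) × Unique xs × (∀ {z} → z ∈ xs → z ∈ Vs × z ∉ F) × length xs ≤ r

    prepend : ∀ {x z t F r} → E₀ x z ≡ true → z ∉ F → Link z t (z ∷ F) r → Link x t F (suc r)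
    prepend {z = z} e z∉ (xs , c , u , ins , l) = z ∷ xs , chain-∷ e c , Unique-∷ (λ q → proj₂ (ins q) (here refl)) u
      , (λ { (here refl) → ∈-allFin _ , z∉ ; (there q) → proj₁ (ins q) , λ w → proj₂ (ins q) (there w) }) , s≤s l

    -- The walk goes round the four parts in cyclic order. Its last vertex is picked among the core
    -- vertices that send an arc to `t`, so that no further connection is needed.
    reach : ∀ k i j {x t} → steps k i ≡ j → Core i x ≡ true → Y t ≡ out-class j → 5 · y ≤ cnt (λ s → Core j s ∧ adj G s t) Vs →
      (F : List V) → length F + k ≤ 3 · y → Link x t F (suc k)
    reach zero i _ {x} {t} refl cx yt big F len = finish (forward {i} cx (λ s → Core (next i) s ∧ adj G s t) (λ z p → core-Part {next i} (proj₁ (∧-split p))) F (room big len))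
      where
      room : ∀ {c} → 5 · y ≤ c → length F + 0 ≤ 3 · y → length F + y < c
      room {c} p q = lin-≤ (y ∷ c ∷ length F ∷ [])
            ((5 ⊙ ξ 0 , ξ 1) ∷ (ξ 2 ⊕ # 0 , 3 ⊙ ξ 0) ∷ (# 1 ⊕ # 0 , ξ 0) ∷ [])
            (# 1 ⊕ (ξ 2 ⊕ ξ 0)) (ξ 1) (1 ∷ 1 ∷ 1 ∷ 1 ∷ []) (# 0) refl (p , q , 0<y , tt)
      finish : (∃ λ z → Core (next i) z ∧ adj G z t ≡ true × adj G x z ≡ true × z ∉ F) → Link x t F 1
      finish (z , p , e , z∉) = let (cz , zt) = ∧-split {Core (next i) z} p in
        prepend (core-arc {i} cx cz e) z∉ ([] , chain-1 (∧-join zt (subst₂ (λ a b → inC a b ≡ true) (sym (core-out {next i} cz)) (sym yt) (inC-refl (out-class (next i))))) , [] , (λ ()) , z≤n)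
    reach (suc k) i j {x} {t} eq cx yt big F len = go (forward {i} cx (λ z → Core (next i) z ∧ Part (next i) z) (λ z p → proj₂ (∧-split {Core (next i) z} p)) F
        (lin-≤ (cnt (Part (next i)) Vs ∷ cnt (λ x₁ → Core (next i) x₁ ∧ Part (next i) x₁) Vs ∷ y ∷ n ∷ g ∷ length F ∷ k ∷ γ ∷
              [])
              ((ξ 0 , ξ 1 ⊕ (3 ⊙ ξ 2)) ∷ (ξ 3 , (4 ⊙ ξ 0) ⊕ (200 ⊙ ξ 4)) ∷ (ξ 5 ⊕ (# 1 ⊕ ξ 6) , 3 ⊙ ξ 2) ∷
               (400 ⊙ ξ 7 , ξ 3) ∷ (1000 ⊙ ξ 2 , ξ 7) ∷ (200000 ⊙ ξ 4 , ξ 2) ∷ [])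
              (# 1 ⊕ (ξ 5 ⊕ ξ 2)) (ξ 1) (12000 ∷ 12000 ∷ 3000 ∷ 399983999 ∷ 3000 ∷ 1200000 ∷ 3 ∷ [])
               (399971999 ⊙ ξ 5 ⊕ 399983999 ⊙ ξ 6 ⊕ # 399983998) refl
              (core-cover (next i) (Part (next i)) (λ _ → id) , part≥ (next i) , len , γn , yγ , gy , tt)))
      where
      go : (∃ λ z → Core (next i) z ∧ Part (next i) z ≡ true × adj G x z ≡ true × z ∉ F) → Link x t F (suc (suc k))
      go (z , p , e , z∉) = let cz = proj₁ (∧-split {Core (next i) z} p) in
        prepend (core-arc {i} cx cz e) z∉ (reach k (next i) j eq cz yt big (z ∷ F) (ℕₚ.≤-trans (ℕₚ.≤-reflexive (sym (ℕₚ.+-suc (length F) k))) len))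

    half-of : ∀ {a b s} → γ ≤ s → s ≤ a + b → 8 · y ≤ a ⊎ 8 · y ≤ b
    half-of {a} {b} {s} h k = [ inj₁ , (λ lt → inj₂ (lin-≤ (γ ∷ s ∷ a ∷ b ∷ y ∷ [])
          ((ξ 0 , ξ 1) ∷ (ξ 1 , ξ 2 ⊕ ξ 3) ∷ (# 1 ⊕ ξ 2 , 8 ⊙ ξ 4) ∷ (1000 ⊙ ξ 4 , ξ 0) ∷ [])
          (8 ⊙ ξ 4) (ξ 3) (124 ∷ 1 ∷ 1 ∷ 1 ∷ 1 ∷ []) (123 ⊙ ξ 3 ⊕ # 124) refl (h , k , lt , yγ , tt))) ]′ (ℕₚ.≤-<-connex (8 · y) a)

    row-∨ : ∀ u (P Q : V → Bool) → row G u (λ z → P z ∨ Q z) ≤ row G u P + row G u Q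
    row-∨ u P Q = cnt-cover {Q = λ z → adj G u z ∧ P z} {λ z → adj G u z ∧ Q z} Vs λ {z} _ p → let (a , b) = ∧-split {adj G u z} p in
      [ (λ s → inj₁ (∧-join a s)) , (λ s → inj₂ (∧-join a s)) ]′ (∨-cases b)
      where
      ∨-cases : ∀ {a b} → a ∨ b ≡ true → a ≡ true ⊎ b ≡ true
      ∨-cases {true}  _ = inj₁ refl
      ∨-cases {false} h = inj₂ h

    col-∨ : ∀ u (P Q : V → Bool) → col G (λ z → P z ∨ Q z) u ≤ col G P u + col G Q u
    col-∨ u P Q = cnt-cover {Q = λ z → adj G z u ∧ P z} {λ z → adj G z u ∧ Q z} Vs λ {z} _ p → let (a , b) = ∧-split {adj G z u} p in
      [ (λ s → inj₁ (∧-join a s)) , (λ s → inj₂ (∧-join a s)) ]′ (∨-cases b)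
      where
      ∨-cases : ∀ {a b} → a ∨ b ≡ true → a ≡ true ⊎ b ≡ true
      ∨-cases {true}  _ = inj₁ refl
      ∨-cases {false} h = inj₂ h

    -- Among the at least `γ` arcs of `u` in its relation, `8 · y` go to the same part; at most
    -- `3 · y` vertices of a part lie outside its core, and `5 · y` remain.
    Exit : V → Set
    Exit u = ∃ λ i → X u ≡ in-class i × 5 · y ≤ cnt (λ z → Core i z ∧ adj G u z) Vs

    Entry : V → Set
    Entry t = ∃ λ j → Y t ≡ out-class j × 5 · y ≤ cnt (λ z → Core j z ∧ adj G z t) Vs

    deduct : ∀ {a b c} → 8 · y ≤ a → a ≤ b + 3 · y → b ≤ c → 5 · y ≤ c
    deduct {a} {b} {c} p q r = lin-≤ (y ∷ a ∷ b ∷ c ∷ [])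
          ((8 ⊙ ξ 0 , ξ 1) ∷ (ξ 1 , ξ 2 ⊕ (3 ⊙ ξ 0)) ∷ (ξ 2 , ξ 3) ∷ [])
          (5 ⊙ ξ 0) (ξ 3) (1 ∷ 1 ∷ 1 ∷ 1 ∷ []) (# 0) refl (p , q , r , tt)

    exit-at : ∀ u i → 8 · y ≤ row G u (Part i) → 5 · y ≤ cnt (λ z → Core i z ∧ adj G u z) Vs
    exit-at u i h = deduct h
      (core-cover i (λ z → adj G u z ∧ Part i z) (λ z p → proj₂ (∧-split {adj G u z} p)))
      (cnt-mono {P = λ z → Core i z ∧ (adj G u z ∧ Part i z)} {λ z → Core i z ∧ adj G u z} Vs (λ {z} _ p →
        let (a , b) = ∧-split {Core i z} p in ∧-join a (proj₁ (∧-split {adj G u z} b))))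

    entry-at : ∀ t j → 8 · y ≤ col G (Part j) t → 5 · y ≤ cnt (λ z → Core j z ∧ adj G z t) Vs
    entry-at t j h = deduct h
      (core-cover j (λ z → adj G z t ∧ Part j z) (λ z p → proj₂ (∧-split {adj G z t} p)))
      (cnt-mono {P = λ z → Core j z ∧ (adj G z t ∧ Part j z)} {λ z → Core j z ∧ adj G z t} Vs (λ {z} _ p →
        let (a , b) = ∧-split {Core j z} p in ∧-join a (proj₁ (∧-split {adj G z t} b))))

    exit : ∀ u → Exit u
    exit u = [ (λ e → [ (λ h → qa , e , exit-at u qa h) , (λ h → qb , e , exit-at u qb h) ]′ (half-of (rowX e) (row-∨ u A B)))
             , (λ e → [ (λ h → qc , e , exit-at u qc h) , (λ h → qd , e , exit-at u qd h) ]′ (half-of (rowX′ e) (row-∨ u C D))) ]′ (true-or-false (X u))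

    entry : ∀ t → Entry t
    entry t = [ (λ e → [ (λ h → qa , e , entry-at t qa h) , (λ h → qd , e , entry-at t qd h) ]′ (half-of (colY e) (col-∨ t A D)))
              , (λ e → [ (λ h → qc , e , entry-at t qc h) , (λ h → qb , e , entry-at t qb h) ]′ (half-of (colY′ e) (col-∨ t C B))) ]′ (true-or-false (Y t))

  opaque
    -- Five inner vertices suffice: one core vertex after `u`, then at most four steps to a core
    -- vertex before `t`.
    connects₀ : ∀ {φ} → φ + 4 ≤ 3 · y → Connects Vs E₀ φ 5
    connects₀ {φ} small {u} {t} _ _ F len = start (exit u) (entry t)
      where
      start : Exit u → Entry t → Link u t F 5
      start (i , xu , out) (j , yt , inn) = first (pick (λ z → Core i z ∧ adj G u z) F Vs (Uniqueₚ.allFin⁺ n) (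
          lin-≤ (y ∷ cnt (λ z → Core i z ∧ does (arc? G u z)) Vs ∷ length F ∷ φ ∷ [])
            ((5 ⊙ ξ 0 , ξ 1) ∷ (ξ 2 , ξ 3) ∷ (ξ 3 ⊕ # 4 , 3 ⊙ ξ 0) ∷ [])
            (# 1 ⊕ ξ 2) (ξ 1) (3 ∷ 3 ∷ 3 ∷ 5 ∷ []) (2 ⊙ ξ 3 ⊕ # 19) refl (out , len , small , tt))) (distance i j)
        where
        first : (∃ λ z → z ∈ Vs × Core i z ∧ adj G u z ≡ true × z ∉ F) → (∃ λ k → k ≤ 3 × steps k i ≡ j) → Link u t F 5
        first (z , _ , p , z∉) (k , k≤3 , eq) = widen (prepend (∧-join (proj₂ (∧-split {Core i z} p)) (subst₂ (λ a b → inC a b ≡ true) (sym xu) (sym (core-in {i} (proj₁ (∧-split {Core i z} p)))) (inC-refl (in-class i))))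
            z∉ (reach k i j eq (proj₁ (∧-split {Core i z} p)) yt inn (z ∷ F) (lin-≤ (length F ∷ φ ∷ y ∷ k ∷ [])
                  ((ξ 0 , ξ 1) ∷ (ξ 1 ⊕ # 4 , 3 ⊙ ξ 2) ∷ (ξ 3 , # 3) ∷ [])
                  ((# 1 ⊕ ξ 0) ⊕ ξ 3) (3 ⊙ ξ 2) (1 ∷ 1 ∷ 1 ∷ 1 ∷ []) (# 0) refl (len , small , k≤3 , tt))))
          where
          widen : Link u t F (suc (suc k)) → Link u t F 5
          widen (xs , c , un , ins , l) = xs , c , un , ins , ℕₚ.≤-trans l (s≤s (s≤s k≤3))

-- Contracting the crossing arcs

module _ {n : ℕ} where
  private V = Fin n

  -- The contraction of each arc `p → q` of `M` to `p`: arcs still enter at `p`, but they leave from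
  -- `q`.
  along : List (V × V) → V → V
  along []            x = x
  along ((p , q) ∷ M) x = if x == p then q else along M x

  along-cases : ∀ M x → along M x ≡ x ⊎ (x , along M x) ∈ M
  along-cases []            x = inj₁ refl
  along-cases ((p , q) ∷ M) x with x Finₚ.≟ p
  ... | yes refl = inj₂ (here refl)
  ... | no _     = [ inj₁ , (λ h → inj₂ (there h)) ]′ (along-cases M x)

  along-fixed : ∀ M {x} → x ∉ map proj₁ M → along M x ≡ x
  along-fixed []            h = refl
  along-fixed ((p , q) ∷ M) {x} h rewrite ==-≢ {x = x} {p} (λ e → h (here e)) = along-fixed M (h ∘ there)

  along-map : ∀ M xs → (∀ {x} → x ∈ xs → x ∉ map proj₁ M) → map (along M) xs ≡ xs
  along-map M []       h = refl
  along-map M (x ∷ xs) h = cong₂ _∷_ (along-fixed M (h (here refl))) (along-map M xs (h ∘ there))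

  along-sources : ∀ M → Unique (map proj₁ M) → map (along M) (map proj₁ M) ≡ map proj₂ M
  along-sources []            u = refl
  along-sources ((p , q) ∷ M) (p∉ ∷ u) rewrite ==-refl p = cong (q ∷_)
    (trans (rest (map proj₁ M) (λ {x} m → λ e → All.lookup p∉ m (sym e))) (along-sources M u))
    where
    rest : ∀ xs → (∀ {x} → x ∈ xs → x ≢ p) → map (along ((p , q) ∷ M)) xs ≡ map (along M) xs
    rest []       h = refl
    rest (x ∷ xs) h = cong₂ _∷_ (cong (λ b → if b then q else along M x) (==-≢ (h (here refl)))) (rest xs (h ∘ there))

  lift-chain : ∀ {E : V → V → Bool} (out : V → V) u xs t → (∀ {x} → x ∈ xs → out x ≡ x) → Chain E (out u) (xs ++ t ∷ []) → Chain (λ x → E (out x)) u (xs ++ t ∷ [])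
  lift-chain out u []       t h c = chain-1 (c (here refl))
  lift-chain {E} out u (x ∷ xs) t h c = chain-∷ (c (here refl)) (lift-chain {E} out x xs t (h ∘ there)
    (subst (λ z → Chain E z (xs ++ t ∷ [])) (sym (h (here refl))) (c ∘ there)))

module ExtremalCase {n : ℕ} (G : OrientedGraph n) {δ f g y γ : ℕ} (md : minSemiDegree≥ G δ) (0<n : 0 < n) (Sc : Scales n δ f g y γ)
    (C k : ℕ) (0<C : 0 < C) (0<k : 0 < k) (n≤ : n ≤ C * k) (f≡ : f ≡ 4 · k) (growth≥ : 200000 · g + 2 · k ≤ y)
    (big-k : threshold C 5 (10 + 5 + (2 + (C + C)) * (2 + 5)) ≤ k) where
  private
    V = Fin n
    Vs = allFin n
    β : ℕ
    β = 200000 · g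
  open Scales Sc

  module WithChoice {A B C′ D : V → Bool} (Ex : Extremal G (200 · g) (2000 · g) A B C′ D) (Ch : Choice G γ (200000 · g) A B C′ D)
      (M : List (V × V)) (lenM : length M ≡ Choice.excess Ch) (uM : Unique (map proj₁ M ++ map proj₂ M))
      (arcs : ∀ {p q} → (p , q) ∈ M → Choice.X Ch p ≡ true × Choice.Y Ch q ≡ false × adj G p q ≡ true) where
    open Choice Ch using (X; Y; excess; excess≤; balance)
    open Base G md 0<n Sc Ex Ch using (E₀; pre-robust; connects₀)
    out : V → V
    out = along M
    S Tg rest vs : List V
    S = map proj₁ M
    Tg = map proj₂ M
    rest = proj₁ (complement (S ++ Tg) Vs uM (λ _ → ∈-allFin _))
    vs = S ++ rest
    all≈ : Vs ↭ (S ++ Tg) ++ rest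
    all≈ = proj₂ (complement (S ++ Tg) Vs uM (λ _ → ∈-allFin _))
    all-unique : Unique ((S ++ Tg) ++ rest)
    all-unique = Unique-↭ all≈ (Uniqueₚ.allFin⁺ n)
    open ↭-Solver
    pv : Vs ↭ vs ++ Tg
    pv = ↭-trans all≈ (solve 3 (λ a b c → ((a ⊞ b) ⊞ c) ⊜ ((a ⊞ c) ⊞ b)) ↭-refl S Tg rest)
    outs≡ : map out vs ≡ Tg ++ rest
    outs≡ = trans (Listₚ.map-++ out S rest) (cong₂ _++_ (along-sources M (Unique-++⁻ˡ S uM))
      (along-map M rest λ q r → Unique-disjoint (S ++ Tg) all-unique (∈-++⁺ˡ r) q))
    pw : Vs ↭ map out vs ++ S
    pw = ↭-trans all≈ (↭-trans (solve 3 (λ a b c → ((a ⊞ b) ⊞ c) ⊜ ((b ⊞ c) ⊞ a)) ↭-refl S Tg rest) (↭-reflexive (cong (_++ S) (sym outs≡))))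
    lenS : length S ≤ β
    lenS = ℕₚ.≤-trans (ℕₚ.≤-reflexive (trans (Listₚ.length-map proj₁ M) lenM)) excess≤
    lenT : length Tg ≤ β
    lenT = ℕₚ.≤-trans (ℕₚ.≤-reflexive (trans (Listₚ.length-map proj₂ M) lenM)) excess≤
    X-S : cnt X S ≡ excess
    X-S = trans (cnt-cong {P = X} {λ _ → true} S all-true) (trans (cnt-true S) (trans (Listₚ.length-map proj₁ M) lenM))
      where
      all-true : ∀ {x} → x ∈ S → X x ≡ true
      all-true q with ∈-map⁻ proj₁ q
      ... | _ , m , refl = proj₁ (arcs m)
    Y-T : cnt Y Tg ≡ 0
    Y-T = cnt-zero Tg all-false
      where
      all-false : ∀ {x} → x ∈ Tg → Y x ≡ false
      all-false q with ∈-map⁻ proj₂ q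
      ... | _ , m , refl = proj₁ (proj₂ (arcs m))
    -- The sources, all in `X`, no longer act as tails, which lowers the number of tails in `X` by
    -- the excess. The targets no longer act as heads, but none of them lies in `Y`.
    balanced : cnt (λ x → X (out x)) vs ≡ cnt Y vs
    balanced = arith {xt = cnt X Tg} {cnt X rest} {cnt Y S} {cnt Y Tg} {cnt Y rest} (trans (sym (sumOf-map (λ x → b2n (X x)) out vs)) (trans (cong (cnt X) outs≡) (sumOf-++ _ Tg rest))) (sumOf-++ _ S rest)
      (trans (cnt-↭ X all≈) (trans (sumOf-++ _ (S ++ Tg) rest) (cong (_+ cnt X rest) (sumOf-++ _ S Tg))))
      (trans (cnt-↭ Y all≈) (trans (sumOf-++ _ (S ++ Tg) rest) (cong (_+ cnt Y rest) (sumOf-++ _ S Tg)))) balance X-S Y-T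
      where
      arith : ∀ {u v x w xs xt xr ys yt yr e} → u ≡ xt + xr → v ≡ ys + yr → x ≡ xs + xt + xr → w ≡ ys + yt + yr → x ≡ w + e → xs ≡ e → yt ≡ 0 → u ≡ v
      arith {u} {v} {x} {w} {xs} {xt} {xr} {ys} {yt} {yr} {e} p q r s t a b = (ℕₚ.≤-antisym
          (lin-≤ (u ∷ xt ∷ xr ∷ v ∷ ys ∷ yr ∷ x ∷ xs ∷ w ∷ yt ∷ e ∷ [])
            ((ξ 0 , ξ 1 ⊕ ξ 2) ∷ (ξ 4 ⊕ ξ 5 , ξ 3) ∷ ((ξ 7 ⊕ ξ 1) ⊕ ξ 2 , ξ 6) ∷ (ξ 8 , (ξ 4 ⊕ ξ 9) ⊕ ξ 5) ∷
             (ξ 6 , ξ 8 ⊕ ξ 10) ∷ (ξ 10 , ξ 7) ∷ (ξ 9 , # 0) ∷ [])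
            (ξ 0) (ξ 3) (1 ∷ 1 ∷ 1 ∷ 1 ∷ 1 ∷ 1 ∷ 1 ∷ 1 ∷ []) (# 0) refl
            (ℕₚ.≤-reflexive p , ℕₚ.≤-reflexive (sym q) , ℕₚ.≤-reflexive (sym r) , ℕₚ.≤-reflexive s ,
             ℕₚ.≤-reflexive t , ℕₚ.≤-reflexive (sym a) , ℕₚ.≤-reflexive b , tt))
          (lin-≤ (u ∷ xt ∷ xr ∷ v ∷ ys ∷ yr ∷ x ∷ xs ∷ w ∷ yt ∷ e ∷ [])
            ((ξ 1 ⊕ ξ 2 , ξ 0) ∷ (ξ 3 , ξ 4 ⊕ ξ 5) ∷ (ξ 6 , (ξ 7 ⊕ ξ 1) ⊕ ξ 2) ∷ ((ξ 4 ⊕ ξ 9) ⊕ ξ 5 , ξ 8) ∷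
             (ξ 8 ⊕ ξ 10 , ξ 6) ∷ (ξ 7 , ξ 10) ∷ [])
            (ξ 3) (ξ 0) (1 ∷ 1 ∷ 1 ∷ 1 ∷ 1 ∷ 1 ∷ 1 ∷ []) (ξ 9) refl
            (ℕₚ.≤-reflexive (sym p) , ℕₚ.≤-reflexive q , ℕₚ.≤-reflexive r , ℕₚ.≤-reflexive (sym s) ,
             ℕₚ.≤-reflexive (sym t) , ℕₚ.≤-reflexive a , tt)))

    R : Robust vs (λ x → E₀ (out x)) (λ x → X (out x)) Y (10 · y + β + f + 4 · k) f (2 · k) (10 · y + β)
    R = contract out β (pre-robust {10 · y + β + f + 4 · k + β} (lin-≤ (g ∷ y ∷ f ∷ γ ∷ k ∷ [])
          ((200000 ⊙ ξ 0 , ξ 1) ∷ (4 ⊙ ξ 2 , ξ 1) ∷ (1000 ⊙ ξ 1 , ξ 3) ∷ (4 ⊙ ξ 4 , ξ 2) ∷ [])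
          ((((((10 ⊙ ξ 1) ⊕ (200000 ⊙ ξ 0)) ⊕ ξ 2) ⊕ (4 ⊙ ξ 4)) ⊕ (200000 ⊙ ξ 0)) ⊕ (200000 ⊙ ξ 0)) (ξ 3)
           (2000 ∷ 6000 ∷ 1000 ∷ 27 ∷ 2000 ∷ []) (1973 ⊙ ξ 3 ⊕ # 1999) refl
          (gy , fy , yγ , ℕₚ.≤-reflexive (sym f≡) , tt))) pv pw lenT lenS balanced ℕₚ.≤-refl (lin-≤ (g ∷ k ∷ y ∷ [])
          (((200000 ⊙ ξ 0) ⊕ (2 ⊙ ξ 1) , ξ 2) ∷ [])
          ((2 ⊙ ξ 1) ⊕ (200000 ⊙ ξ 0)) (ξ 2) (1 ∷ 1 ∷ []) (# 0) refl (growth≥ , tt))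

    -- A loop at a contracted arc would be an arc from `out x` to `x`, opposite to the arc of `M`
    -- from `x` to `out x`.
    irr : ∀ x → E₀ (out x) x ≡ false
    irr x = ¬true⇒false λ h → [ (λ e → false≢true (adj-irrefl G x) (subst (λ z → adj G z x ≡ true) e (proj₁ (∧-split h))))
      , (λ m → asym′ (proj₁ (∧-split h)) (proj₂ (proj₂ (arcs m)))) ]′ (along-cases M x)
      where
      asym′ : ∀ {x y} → adj G x y ≡ true → adj G y x ≡ true → ⊥
      asym′ {x} {y} p q = lin-⊥ (b2n (does (arc? G x y)) ∷ b2n (does (arc? G y x)) ∷ [])
            ((ξ 0 ⊕ ξ 1 , # 1) ∷ (# 1 , ξ 0) ∷ (# 1 , ξ 1) ∷ [])
            (1 ∷ 1 ∷ 1 ∷ []) (# 0) refl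
            (adj-asym G x y , ℕₚ.≤-reflexive (sym (cong b2n p)) , ℕₚ.≤-reflexive (sym (cong b2n q)) , tt)

    -- Inner vertices avoid both ends of every contracted arc, so the path reads the same before and
    -- after contraction.
    connects : Connects vs (λ x → E₀ (out x)) f 5
    connects {u} {t} u∈ t∈ F len = go (connects₀ {f + (β + β)} (lin-≤ (g ∷ y ∷ f ∷ k ∷ [])
          ((200000 ⊙ ξ 0 , ξ 1) ∷ (4 ⊙ ξ 2 , ξ 1) ∷ (# 4 , ξ 0) ∷ [])
          ((ξ 2 ⊕ ((200000 ⊙ ξ 0) ⊕ (200000 ⊙ ξ 0))) ⊕ # 4) (3 ⊙ ξ 1) (4 ∷ 11 ∷ 1 ∷ 600000 ∷ []) (# 2399987) refl
          (gy , fy , 4≤g , tt)) (∈-allFin (out u)) (∈-allFin t) (F ++ (S ++ Tg))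
        (ℕₚ.≤-trans (ℕₚ.≤-reflexive (trans (Listₚ.length-++ F) (cong (length F +_) (Listₚ.length-++ S)))) (ℕₚ.+-mono-≤ len (ℕₚ.+-mono-≤ lenS lenT))))
      where
      go : (∃ λ xs → Chain E₀ (out u) (xs ++ t ∷ []) × Unique xs × (∀ {x} → x ∈ xs → x ∈ Vs × x ∉ F ++ (S ++ Tg)) × length xs ≤ 5) →
        ∃ λ xs → Chain (λ x → E₀ (out x)) u (xs ++ t ∷ []) × Unique xs × (∀ {x} → x ∈ xs → x ∈ vs × x ∉ F) × length xs ≤ 5
      go (xs , c , un , ins , l) = xs , lift-chain {E = E₀} out u xs t (λ q → along-fixed M λ r → proj₂ (ins q) (∈-++⁺ʳ F (∈-++⁺ˡ r))) c , un
        , (λ {x} q → in-vs (∈-++⁻ vs (↭ₚ.∈-resp-↭ pv (∈-allFin x))) (λ r → proj₂ (ins q) (∈-++⁺ʳ F (∈-++⁺ʳ S r))) , λ r → proj₂ (ins q) (∈-++⁺ˡ r)) , l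
        where
        in-vs : ∀ {x} → x ∈ vs ⊎ x ∈ Tg → x ∉ Tg → x ∈ vs
        in-vs (inj₁ p) _ = p
        in-vs (inj₂ p) h = ⊥-elim (h p)

    len-vs : length vs + length Tg ≡ n
    len-vs = trans (sym (Listₚ.length-++ vs)) (trans (sym (↭ₚ.↭-length pv)) (Listₚ.length-tabulate id))

    contracted : HamCycle vs (λ x → E₀ (out x))
    contracted = start vs refl
      where
      start : ∀ ws → vs ≡ ws → HamCycle vs (λ x → E₀ (out x))
      start (v ∷ ws) e = Closing-up.hamilton R (lin-≤ (f ∷ y ∷ g ∷ [])
            ((4 ⊙ ξ 0 , ξ 1) ∷ (# 1 ⊕ # 0 , ξ 0) ∷ [])
            (# 1 ⊕ # 0) ((10 ⊙ ξ 1) ⊕ (200000 ⊙ ξ 2)) (1 ∷ 10 ∷ 40 ∷ []) (200000 ⊙ ξ 2 ⊕ # 39) refl (fy , 0<f , tt)) irr C 5 k 0<C 0<k (ℕₚ.≤-trans (ℕₚ.≤-trans (ℕₚ.m≤m+n _ (length Tg)) (ℕₚ.≤-reflexive len-vs)) n≤)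
        (ℕₚ.≤-reflexive (sym f≡)) ℕₚ.≤-refl ℕₚ.≤-refl big-k connects e
      start [] e = ⊥-elim (lin-⊥ (length vs ∷ length Tg ∷ n ∷ g ∷ y ∷ γ ∷ [])
            ((ξ 2 , ξ 0 ⊕ ξ 1) ∷ (ξ 0 , # 0) ∷ (ξ 1 , 200000 ⊙ ξ 3) ∷ (200000 ⊙ ξ 3 , ξ 4) ∷ (1000 ⊙ ξ 4 , ξ 5) ∷
             (400 ⊙ ξ 5 , ξ 2) ∷ (# 1 ⊕ # 0 , ξ 2) ∷ [])
            (400000 ∷ 400000 ∷ 400000 ∷ 400000 ∷ 400 ∷ 1 ∷ 399999 ∷ []) (# 399998) refl
            (ℕₚ.≤-reflexive (sym len-vs) , ℕₚ.≤-reflexive (cong length e) , lenT , gy , yγ , γn , 0<n , tt))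

    -- Each contracted source p is expanded back to the arc p → out p.
    insert : List V → List V
    insert [] = []
    insert (x ∷ xs) = if mem x S then x ∷ out x ∷ insert xs else x ∷ insert xs

    start-arc : ∀ x → mem x S ≡ true → adj G x (out x) ≡ true
    start-arc x m = [ (λ e → ⊥-elim (clash e)) , (λ h → proj₂ (proj₂ (arcs h))) ]′ (along-cases M x)
      where
      clash : out x ≡ x → ⊥
      clash e = Unique-disjoint S uM (mem⇒∈ S m) (subst (_∈ Tg) e (subst (out x ∈_) (along-sources M (Unique-++⁻ˡ S uM)) (∈-map⁺ out (mem⇒∈ S m))))

    not-start : ∀ x → mem x S ≡ false → out x ≡ x
    not-start x m = along-fixed M (mem⇒∉ m)

    blocks : V → List V → List V
    blocks x xs = if mem x S then out x ∷ insert xs else insert xs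

    insert-∷ : ∀ x xs → insert (x ∷ xs) ≡ x ∷ blocks x xs
    insert-∷ x xs with mem x S
    ... | true  = refl
    ... | false = refl

    insert-chain : ∀ x xs → Chain (λ x → E₀ (out x)) x xs → Chain (adj G) x (blocks x xs) × lastOf x (blocks x xs) ≡ out (lastOf x xs)
    insert-chain x xs c = [ two , one ]′ (true-or-false (mem x S))
      where
      tail : ∀ z xs → (∀ {y ys} → xs ≡ y ∷ ys → adj G z y ≡ true × Chain (adj G) y (blocks y ys) × lastOf y (blocks y ys) ≡ out (lastOf y ys)) →
        out x ≡ z → Chain (adj G) z (insert xs) × lastOf z (insert xs) ≡ out (lastOf x xs)
      tail z []       h e = (λ ()) , sym e
      tail z (y ∷ ys) h e rewrite insert-∷ y ys = let (a , b , l) = h refl in chain-∷ a b , l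
      rec : ∀ z → out x ≡ z → ∀ {y ys} → xs ≡ y ∷ ys → adj G z y ≡ true × Chain (adj G) y (blocks y ys) × lastOf y (blocks y ys) ≡ out (lastOf y ys)
      rec z e {y} {ys} refl = subst (λ w → adj G w y ≡ true) e (proj₁ (∧-split (c (here refl)))) , insert-chain y ys (c ∘ there)
      two : mem x S ≡ true → Chain (adj G) x (blocks x xs) × lastOf x (blocks x xs) ≡ out (lastOf x xs)
      two m rewrite m = let (a , l) = tail (out x) xs (rec (out x) refl) refl in chain-∷ (start-arc x m) a , l
      one : mem x S ≡ false → Chain (adj G) x (blocks x xs) × lastOf x (blocks x xs) ≡ out (lastOf x xs)
      one m rewrite m = tail x xs (rec x (not-start x m)) (not-start x m)

    insert-↭ : ∀ xs → insert xs ↭ xs ++ map out (filterᵇ (λ x → mem x S) xs)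
    insert-↭ [] = ↭-refl
    insert-↭ (x ∷ xs) with mem x S
    ... | true  = ↭-prep x (↭-trans (↭-prep (out x) (insert-↭ xs)) (↭-sym (↭ₚ.shift (out x) xs _)))
    ... | false = ↭-prep x (insert-↭ xs)

    filter-all : ∀ xs ys → (∀ {x} → x ∈ xs → mem x S ≡ true) → (∀ {x} → x ∈ ys → mem x S ≡ false) → filterᵇ (λ x → mem x S) (xs ++ ys) ≡ xs
    filter-all [] [] h k = refl
    filter-all [] (y ∷ ys) h k rewrite k (here refl) = filter-all [] ys h (k ∘ there)
    filter-all (x ∷ xs) ys h k rewrite h (here refl) = cong (x ∷_) (filter-all xs ys (h ∘ there) k)

    expanded : HamCycle vs (λ x → E₀ (out x)) → HamCycle Vs (adj G)
    expanded (t , ps , p , c , e) = t , blocks t ps , perm , proj₁ (insert-chain t ps c)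
        , subst (λ z → adj G z t ≡ true) (sym (proj₂ (insert-chain t ps c))) (proj₁ (∧-split e))
      where
      perm : t ∷ blocks t ps ↭ Vs
      perm = ↭-trans (↭-reflexive (sym (insert-∷ t ps))) (↭-trans (insert-↭ (t ∷ ps)) (↭-trans
        (↭ₚ.++⁺ p (↭ₚ.map⁺ out (↭ₚ.filter-↭ (λ x → Boolₚ.T? (mem x S)) p)))
        (↭-trans (↭-reflexive (cong (vs ++_) (trans (cong (map out) (filter-all S rest (λ q → ∈⇒mem {xs = S} q) λ q → ∉⇒mem {xs = S} λ r → Unique-disjoint (S ++ Tg) all-unique (∈-++⁺ˡ r) q))
          (along-sources M (Unique-++⁻ˡ S uM))))) (↭-sym pv))))

  opaque
    from-choice : ∀ {A B C′ D : V → Bool} → Extremal G (200 · g) (2000 · g) A B C′ D → Choice G γ (200000 · g) A B C′ D → HamiltonCycle G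
    from-choice {A} {B} {C′} {D} Ex Ch = go (Crossing.crossing-arcs G md 0<n Sc Ex Ch)
      where
      go : Arcs G (Choice.X Ch) (Choice.Y Ch) (Choice.excess Ch) → HamiltonCycle G
      go (M , len , u , h) = hamilton-cycle G (WithChoice.expanded Ex Ch M len u h (WithChoice.contracted Ex Ch M len u h))

    -- If `X₁` is smaller than `Y₁`, exchanging A with C and B with D turns both into their
    -- complements and reverses the inequality.
    from-extremal : ∀ {A B C′ D : V → Bool} → Extremal G (200 · g) (2000 · g) A B C′ D → HamiltonCycle G
    from-extremal {A} {B} {C′} {D} Ex = [ (λ le → from-choice Ex (Choosing.choose G md 0<n Sc Ex le)) , (λ lt → from-choice (extremal-swap G Ex)
        (Choosing.choose G md 0<n Sc (extremal-swap G Ex) (flip lt))) ]′ (ℕₚ.≤-<-connex (cnt K.Y₁ Vs) (cnt K.X₁ Vs))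
      where
      module K = Classes G γ A B C′ D
      module K′ = Classes G γ C′ D A B
      2γ≤δ : 2 · γ ≤ δ
      2γ≤δ = lin-≤ (n ∷ δ ∷ γ ∷ y ∷ g ∷ [])
            ((3 ⊙ ξ 0 , (8 ⊙ ξ 1) ⊕ # 4) ∷ (400 ⊙ ξ 2 , ξ 0) ∷ [])
            (2 ⊙ ξ 2) (ξ 1) (600 ∷ 1 ∷ 3 ∷ []) (592 ⊙ ξ 1 ⊕ # 595) refl (δ≥ , γn , tt)
      module Fa = K.Facts (Extremal.partition Ex) md 2γ≤δ
      negate : ∀ {a b c d} u v → b2n a + b2n b + b2n c + b2n d ≡ 1 → (u ≡ true → v ≡ true → ⊥) → ((c ∨ b) ∧ not v) ∨ u ≡ not (((a ∨ d) ∧ not u) ∨ v)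
      negate true true e h = ⊥-elim (h refl refl)
      negate {true}  {b}     {c}     {d}     true false e h = Boolₚ.∨-zeroʳ ((c ∨ b) ∧ true)
      negate {false} {b}     {c}     {d}     true false e h = trans (Boolₚ.∨-zeroʳ ((c ∨ b) ∧ true)) (sym (cong (λ z → not (z ∨ false)) (Boolₚ.∧-zeroʳ d)))
      negate {a} {b} {c} {d} false true e h = trans (cong (_∨ false) (Boolₚ.∧-zeroʳ (c ∨ b))) (sym (cong not (Boolₚ.∨-zeroʳ ((a ∨ d) ∧ true))))
      negate {true}  {false} {false} {false} false false e h = refl
      negate {false} {true}  {false} {false} false false e h = refl
      negate {false} {false} {true}  {false} false false e h = refl
      negate {false} {false} {false} {true}  false false e h = refl
      negX : ∀ x → K′.X₁ x ≡ not (K.X₁ x)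
      negX x = negate {A x} {B x} {C′ x} {D x} (K.rowT x) (K.rowF x) (Partition.one (Extremal.partition Ex) x) (Fa.row-not-both x)
      negY : ∀ x → K′.Y₁ x ≡ not (K.Y₁ x)
      negY x = negate {A x} {D x} {C′ x} {B x} (K.colT x) (K.colF x) (arr (b2n (A x)) (b2n (B x)) (b2n (C′ x)) (b2n (D x)) (Partition.one (Extremal.partition Ex) x)) (Fa.col-not-both x)
        where
        arr : ∀ a b c d → a + b + c + d ≡ 1 → a + d + c + b ≡ 1
        arr a b c d h = (ℕₚ.≤-antisym (lin-≤ (a ∷ b ∷ c ∷ d ∷ [])
              ((((ξ 0 ⊕ ξ 1) ⊕ ξ 2) ⊕ ξ 3 , # 1) ∷ [])
              (((ξ 0 ⊕ ξ 3) ⊕ ξ 2) ⊕ ξ 1) (# 1) (1 ∷ 1 ∷ []) (# 0) refl (ℕₚ.≤-reflexive h , tt))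
            (lin-≤ (a ∷ b ∷ c ∷ d ∷ [])
              ((# 1 , ((ξ 0 ⊕ ξ 1) ⊕ ξ 2) ⊕ ξ 3) ∷ [])
              (# 1) (((ξ 0 ⊕ ξ 3) ⊕ ξ 2) ⊕ ξ 1) (1 ∷ 1 ∷ []) (# 0) refl (ℕₚ.≤-reflexive (sym h) , tt)))
      flip : cnt K.X₁ Vs < cnt K.Y₁ Vs → cnt K′.Y₁ Vs ≤ cnt K′.X₁ Vs
      flip lt = arith (trans (cong (cnt K.X₁ Vs +_) (cnt-cong Vs λ {x} _ → negX x)) (cnt-not K.X₁ Vs)) (trans (cong (cnt K.Y₁ Vs +_) (cnt-cong Vs λ {x} _ → negY x)) (cnt-not K.Y₁ Vs)) lt
        where
        arith : ∀ {a b a′ b′ m} → a + a′ ≡ m → b + b′ ≡ m → a < b → b′ ≤ a′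
        arith {a} {b} {a′} {b′} {m} p q r = lin-≤ (a ∷ a′ ∷ m ∷ b ∷ b′ ∷ [])
              ((ξ 2 , ξ 0 ⊕ ξ 1) ∷ (ξ 3 ⊕ ξ 4 , ξ 2) ∷ (# 1 ⊕ ξ 0 , ξ 3) ∷ [])
              (ξ 4) (ξ 1) (1 ∷ 1 ∷ 1 ∷ 1 ∷ []) (# 1) refl (ℕₚ.≤-reflexive (sym p) , ℕₚ.≤-reflexive q , r , tt)

-- All scales are multiples of k = n / scale: the robustness threshold 8 k, the size g = 10¹⁶ k of the sets that
-- must expand, and y = 21·10²⁴ k, γ = 21·10²⁷ k for the extremal case.
opaque
  scale-of-k : ℕ
  scale-of-k = 10000000000000000000000000000000

  scale-def : ∀ x → scale-of-k * x ≡ 10000000000000000000000000000000 · x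
  scale-def x = sym (·-def 10000000000000000000000000000000 x)

  0<scale : 0 < scale-of-k
  0<scale = s≤s z≤n

-- The constant `C` in `n ≤ C * k`; it exceeds the ratio by one to make up for the remainder of the
-- division.
rounds-bound : ℕ
rounds-bound = suc scale-of-k

threshold₁ threshold₂ : ℕ
threshold₁ = threshold rounds-bound 5 (10 + 5 + (2 + (rounds-bound + rounds-bound)) * (2 + 5))
threshold₂ = threshold rounds-bound (1 + rounds-bound) (10 + (1 + rounds-bound) + (2 + (rounds-bound + rounds-bound)) * (2 + (1 + rounds-bound)))

-- The two cases combined

module Main {n : ℕ} (G : OrientedGraph n) {δ : ℕ} (md : minSemiDegree≥ G δ) (δ≥ : 3 · n ≤ 8 · δ + 4) (k : ℕ) (0<k : 0 < k)
    (k≤ : 10000000000000000000000000000000 · k ≤ n) (n≤ : n ≤ 10000000000000000000000000000001 · k)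
    (n≤C : n ≤ rounds-bound * k) (th₁ : threshold₁ ≤ k) (th₂ : threshold₂ ≤ k) where

  -- With n about 10³¹ k, the condition 8 k n ≤ g² asks for g just below 10¹⁶ k, and 4000 g n ≤ y²
  -- for y slightly above 2·10²⁵ k. Then γ = 1000 y still satisfies 400 γ = 8.4·10³⁰ k ≤ n.
  g y γ : ℕ
  g = 10000000000000000 · k
  y = 21000000000000000000000000 · k
  γ = 21000000000000000000000000000 · k

  private
    0<n : 0 < n
    0<n = lin-≤ (k ∷ n ∷ [])
          ((10000000000000000000000000000000 ⊙ ξ 0 , ξ 1) ∷ (# 1 ⊕ # 0 , ξ 0) ∷ [])
          (# 1 ⊕ # 0) (ξ 1) (1 ∷ 1 ∷ 10000000000000000000000000000000 ∷ []) (# 9999999999999999999999999999999) refl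
          (k≤ , 0<k , tt)
    kn≤ : k * n ≤ k * (10000000000000000000000000000001 · k)
    kn≤ = ℕₚ.*-monoʳ-≤ k n≤

  scales : Scales n δ (4 · k) g y γ
  scales = record
    { δ≥ = δ≥
    ; 4≤g = lin-≤ (k ∷ [])
          ((# 1 ⊕ # 0 , ξ 0) ∷ [])
          (# 4) (10000000000000000 ⊙ ξ 0) (1 ∷ 10000000000000000 ∷ []) (# 9999999999999996) refl (0<k , tt)
    ; yy = lin-≤ (k ∷ n ∷ [])
          ((ξ 0 ⊗ ξ 1 , ξ 0 ⊗ (10000000000000000000000000000001 ⊙ ξ 0)) ∷ [])
          (2 ⊙ ((2000 ⊙ (10000000000000000 ⊙ ξ 0)) ⊗ ξ 1))
           ((21000000000000000000000000 ⊙ ξ 0) ⊗ (21000000000000000000000000 ⊙ ξ 0)) (1 ∷ 40000000000000000000 ∷ [])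
           (40999999999999999999999999999960000000000000000000 ⊙ (ξ 0 ⊗ ξ 0)) refl
          (kn≤ , tt)
    ; fy = lin-≤ (k ∷ [])
          [] (4 ⊙ (4 ⊙ ξ 0)) (21000000000000000000000000 ⊙ ξ 0) (1 ∷ []) (20999999999999999999999984 ⊙ ξ 0) refl tt
    ; 0<f = lin-≤ (k ∷ []) ((# 1 ⊕ # 0 , ξ 0) ∷ []) (# 1 ⊕ # 0) (4 ⊙ ξ 0) (1 ∷ 4 ∷ []) (# 3) refl (0<k , tt)
    ; gy = lin-≤ (k ∷ [])
          [] (200000 ⊙ (10000000000000000 ⊙ ξ 0)) (21000000000000000000000000 ⊙ ξ 0) (1 ∷ [])
           (20998000000000000000000000 ⊙ ξ 0) refl tt
    ; yγ = lin-≤ (k ∷ [])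
          [] (1000 ⊙ (21000000000000000000000000 ⊙ ξ 0)) (21000000000000000000000000000 ⊙ ξ 0) (1 ∷ []) (# 0) refl tt
    ; γn = (lin-≤ (k ∷ n ∷ [])
          ((# 1 ⊕ # 0 , ξ 0) ∷ (10000000000000000000000000000000 ⊙ ξ 0 , ξ 1) ∷ [])
          (400 ⊙ (21000000000000000000000000000 ⊙ ξ 0)) (ξ 1) (1 ∷ 1600000000000000000000000000000 ∷ 1 ∷ [])
           (# 1600000000000000000000000000000) refl
          (0<k , k≤ , tt)) }

  private
    sparse : (∃ λ T → Violating G (8 · k) (8 · k) (2 · g) T) → HamiltonCycle G
    sparse (T , v) = ExtremalCase.from-extremal G md 0<n scales rounds-bound k (s≤s z≤n) 0<k n≤C refl (lin-≤ (k ∷ [])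
          [] ((200000 ⊙ (10000000000000000 ⊙ ξ 0)) ⊕ (2 ⊙ ξ 0)) (21000000000000000000000000 ⊙ ξ 0) (1 ∷ [])
           (20997999999999999999999998 ⊙ ξ 0) refl tt) th₁
      (FromViolation.extremal G {δ} {8 · k} {g} md δ≥ 0<n (Scales.4≤g scales) (lin-≤ (k ∷ [])
            [] (8 ⊙ ξ 0) (10000000000000000 ⊙ ξ 0) (1 ∷ []) (9999999999999992 ⊙ ξ 0) refl tt) (lin-≤ (k ∷ n ∷ [])
            ((ξ 0 ⊗ ξ 1 , ξ 0 ⊗ (10000000000000000000000000000001 ⊙ ξ 0)) ∷ [])
            ((8 ⊙ ξ 0) ⊗ ξ 1) ((10000000000000000 ⊙ ξ 0) ⊗ (10000000000000000 ⊙ ξ 0)) (1 ∷ 8 ∷ [])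
             (19999999999999999999999999999992 ⊙ (ξ 0 ⊗ ξ 0)) refl
            (kn≤ , tt)) (lin-≤ (k ∷ n ∷ [])
            ((10000000000000000000000000000000 ⊙ ξ 0 , ξ 1) ∷ [])
            (10000000000000000 ⊙ ξ 0) (ξ 1) (1000000000000000 ∷ 1 ∷ []) (999999999999999 ⊙ ξ 1 ⊕ # 999999999999999)
             refl
            (k≤ , tt)) T v)

    robust : (∀ T → ¬ Violating G (8 · k) (8 · k) (2 · g) T) → HamiltonCycle G
    robust = hamilton-robust G rounds-bound k (2 · g) δ 0<n (s≤s z≤n) 0<k n≤C th₂ (lin-≤ (k ∷ [])
          ((# 1 ⊕ # 0 , ξ 0) ∷ [])
          (# 1 ⊕ # 0) (2 ⊙ (10000000000000000 ⊙ ξ 0)) (1 ∷ 20000000000000000 ∷ []) (# 19999999999999999) refl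
          (0<k , tt)) md (lin-≤ (n ∷ δ ∷ k ∷ [])
          ((3 ⊙ ξ 0 , (8 ⊙ ξ 1) ⊕ # 4) ∷ (10000000000000000000000000000000 ⊙ ξ 2 , ξ 0) ∷ (# 1 ⊕ # 0 , ξ 2) ∷ [])
          (# 1 ⊕ ((2 ⊙ (10000000000000000 ⊙ ξ 2)) ⊕ (8 ⊙ ξ 2))) (ξ 1)
           (8 ∷ 1 ∷ 3 ∷ 29999999999999839999999999999936 ∷ []) (# 29999999999999839999999999999931) refl
          (δ≥ , k≤ , 0<k , tt))

  opaque
    hamiltonian : HamiltonCycle G
    hamiltonian = [ sparse , robust ]′ (decide-violating G (8 · k) (8 · k) (2 · g))

size-bounds : ∀ {n N k x a b} → n ≡ x + k * N → x < N → 1 + (N + (a + b)) ≤ k → (∀ z → N * z ≡ 10000000000000000000000000000000 · z) →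
  0 < k × 10000000000000000000000000000000 · k ≤ n × n ≤ 10000000000000000000000000000001 · k × n ≤ suc N * k × a ≤ k × b ≤ k
size-bounds {n} {N} {k} {x} {a} {b} e l h d =
  ℕₚ.≤-trans (s≤s z≤n) h , (lin-≤ (n ∷ x ∷ k ∷ N ∷ [])
        ((ξ 1 ⊕ (ξ 2 ⊗ ξ 3) , ξ 0) ∷ (10000000000000000000000000000000 ⊙ ξ 2 , ξ 3 ⊗ ξ 2) ∷ [])
        (10000000000000000000000000000000 ⊙ ξ 2) (ξ 0) (1 ∷ 1 ∷ 1 ∷ []) (ξ 1) refl
        (ℕₚ.≤-reflexive (sym e) , ℕₚ.≤-reflexive (sym (d k)) , tt)) , (lin-≤ (n ∷ x ∷ k ∷ N ∷ a ∷ b ∷ [])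
        ((ξ 0 , ξ 1 ⊕ (ξ 2 ⊗ ξ 3)) ∷ (ξ 3 ⊗ ξ 2 , 10000000000000000000000000000000 ⊙ ξ 2) ∷ (# 1 ⊕ ξ 1 , ξ 3) ∷
         (# 1 ⊕ (ξ 3 ⊕ (ξ 4 ⊕ ξ 5)) , ξ 2) ∷ [])
        (ξ 0) (10000000000000000000000000000001 ⊙ ξ 2) (1 ∷ 1 ∷ 1 ∷ 1 ∷ 1 ∷ []) (ξ 4 ⊕ ξ 5 ⊕ # 2) refl
        (ℕₚ.≤-reflexive e , ℕₚ.≤-reflexive (d k) , l , h , tt)) , (lin-≤ (n ∷ x ∷ k ∷ N ∷ a ∷ b ∷ [])
        ((ξ 0 , ξ 1 ⊕ (ξ 2 ⊗ ξ 3)) ∷ (# 1 ⊕ ξ 1 , ξ 3) ∷ (# 1 ⊕ (ξ 3 ⊕ (ξ 4 ⊕ ξ 5)) , ξ 2) ∷ [])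
        (ξ 0) ((# 1 ⊕ ξ 3) ⊗ ξ 2) (1 ∷ 1 ∷ 1 ∷ 1 ∷ []) (ξ 4 ⊕ ξ 5 ⊕ # 2) refl (ℕₚ.≤-reflexive e , l , h , tt)) ,
      (lin-≤ (N ∷ a ∷ b ∷ k ∷ [])
        ((# 1 ⊕ (ξ 0 ⊕ (ξ 1 ⊕ ξ 2)) , ξ 3) ∷ []) (ξ 1) (ξ 3) (1 ∷ 1 ∷ []) (ξ 0 ⊕ ξ 2 ⊕ # 1) refl (h , tt)) ,
      (lin-≤ (N ∷ a ∷ b ∷ k ∷ [])
        ((# 1 ⊕ (ξ 0 ⊕ (ξ 1 ⊕ ξ 2)) , ξ 3) ∷ []) (ξ 2) (ξ 3) (1 ∷ 1 ∷ []) (ξ 0 ⊕ ξ 1 ⊕ # 1) refl (h , tt))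

-- The quotient `k` then exceeds `scale-of-k`, so the remainder of the division is below `k`, and it
-- exceeds both thresholds.
large-enough : ℕ
large-enough = scale-of-k * (1 + (scale-of-k + (threshold₁ + threshold₂)))

hamilton-large : ∀ n → large-enough ≤ n → (G : OrientedGraph n) → minSemiDegree≥ G (ceil[3n-4]/8 n) → HamiltonCycle G
hamilton-large n le G md = go (split-by n scale-of-k 0<scale)
  where
  go : (∃₂ λ s x → n ≡ x + s * scale-of-k × x < scale-of-k) → HamiltonCycle G
  go (k , x , e , l) = finish (size-bounds {n} {scale-of-k} {k} {x} {threshold₁} {threshold₂} e l (quotient-large n scale-of-k k x _ e l le) scale-def)
    where
    finish : 0 < k × 10000000000000000000000000000000 · k ≤ n × n ≤ 10000000000000000000000000000001 · k × n ≤ rounds-bound * k × threshold₁ ≤ k × threshold₂ ≤ k → HamiltonCycle G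
    finish (0<k , k≤ , n≤ , n≤C , t₁ , t₂) = Main.hamiltonian G md (ceil-bound n) k 0<k k≤ n≤ n≤C t₁ t₂

theorem1p1 : Σ ℕ λ n₀ → (n : ℕ) → n ≥ n₀ → (G : OrientedGraph n) →
    minSemiDegree≥ G (ceil[3n-4]/8 n) → HamiltonCycle G
theorem1p1 = large-enough , hamilton-large
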